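{- For all integers $2\le i\le n$, the number of connected top-cycle-free chord diagrams $C$ with $n$ chords and $t_1(C)=i$, and likewise the number of planar bridgeless rooted combinatorial maps with $n$ edges and $\deg^-_{DFS,1}=i$, is $$\frac{2(2i-1)!\,(4n-2i-3)!}{(i-2)!\,i!\,(n-i)!\,(3n-i-1)!}=\frac{i-1}{(4n-2i-1)(2n-i-1)}\binom{2i-1}{i}\binom{4n-2i-1}{n-i}.$$
   Context: Chord diagrams. A chord diagram of size $n$ is a perfect matching of $\{1,\dots,2n\}$; chords are ordered pairs $(a,b)$ with $a<b$, $a$ the source and $b$ the sink; the root is the chord containing $1$. A subset of chords is a subdiagram, viewed as a diagram by order-preserving relabelling of endpoints. Chords $c_1=(a_1,b_1)$, $c_2=(a_2,b_2)$ with $a_1<a_2$ cross if $a_2<b_1<b_2$, and then $c_2$ is a right neighbor of $c_1$. A diagram is connected if its intersection graph (chords as vertices, crossings as edges) is connected. A chord is terminal if it has no right neighbors. The standard order of chords is the order of their sources. Intersection order on a connected diagram: starting with label 1, label the root with the next available label, remove it, and then label the resulting connected components recursively, one after another, in the standard order of their roots. $t_1(C)$ is the index in the intersection order of the first terminal chord of $C$. For $m\ge3$ the top cycle diagram of size $m$ is $T_m=\{(2j-1,2j+2):1\le j\le m-1\}\cup\{(2,2m-1)\}$; a diagram is top-cycle-free if no subdiagram of it equals (after relabelling) some $T_m$, $m\ge3$. Maps. A rooted combinatorial map is a transitive permutation representation of the group $\langle\sigma,\alpha\mid\alpha^2=1\rangle$ on a finite set of half-edges, with a distinguished fixed point of $\alpha$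 (the root), considered up to root-preserving isomorphism; here the root is the only fixed point of $\alpha$. It is represented by a connected graph whose vertices are the cycles of $\sigma$ (which give the cyclic order of half-edges around each vertex), whose edges are the 2-cycles of $\alpha$, together with one dangling root half-edge attached to the root vertex. In the count of $n$ edges the dangling root half-edge is counted as an edge. The map is bridgeless if its underlying graph (the dangling root not being counted as a bridge) has no bridge, and planar if its Euler characteristic (vertices minus edges plus faces, the dangling root not being counted as an edge here) is $2$. The rightmost depth-first search enters the root vertex along the dangling root and, at each vertex, explores the not yet traversed half-edges in their cyclic order beginning from the half-edge by which the vertex was first entered, backtracking when a traversed edge leads to an already visited vertex or when no half-edges remain. Each edge is oriented in the direction in which it is first traversed, the dangling root being oriented into the root vertex. $\deg^-_{DFS,1}$ is the indegree of the root vertex under this orientation, the dangling root included. -}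

module Defs where

open import Data.Bool using (if_then_else_; _∨_)
open import Data.Fin using (Fin; toℕ; _<_)
open import Data.Fin.Permutation using (Permutation; Permutation′; _⟨$⟩ʳ_; _⟨$⟩ˡ_; inverseˡ; inverseʳ; flip; _∘ₚ_)
import Data.Fin.Permutation as Perm
import Data.Fin.Properties as Fin
import Data.Integer as ℤ
open import Data.Integer using (+_)
open import Data.List using (List; []; _∷_; [_]; length; map; filter; concat; concatMap; partition; takeWhile; allFin; iterate)
open import Data.List.Membership.Propositional using (_∈_)
import Data.List.Membership.DecPropositional as DecMembership
open import Data.List.Relation.Unary.All using (All; all?)
open import Data.List.Relation.Unary.Any using (any?)
open import Data.Nat as ℕ using (ℕ; zero; suc; _+_; _*_; _∸_; _!; NonZero)
open import Data.Nat.Combinatorics using (_C_)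
import Data.Nat.Properties as ℕ
open import Data.Product using (Σ-syntax; _×_; _,_; proj₁)
open import Data.Product.Properties using (≡-dec)
open import Data.Rational.Unnormalised as ℚᵘ using (ℚᵘ)
open import Data.Sum using (_⊎_)
open import Function using (Inverse; _⇔_)
open import Level using (0ℓ)
open import Relation.Binary using (Setoid)
import Relation.Binary.Construct.On as On
open import Relation.Binary.Construct.Closure.Equivalence using (EqClosure)
open import Relation.Binary.PropositionalEquality
  using (_≡_; _≢_; refl; sym; trans; cong; setoid; _→-setoid_; module ≡-Reasoning)
open import Relation.Nullary using (¬_; Dec; does; ¬?)
open import Relation.Nullary.Decidable using (_×-dec_; _⊎-dec_)

HasCardinality : Setoid 0ℓ 0ℓ → ℕ → Set
HasCardinality S k = Inverse S (setoid (Fin k))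

------------------------------------------------------------------------
-- Chord diagrams

-- A perfect matching, given by its fixed-point-free involution.  The
-- point x : Fin (2 * n) stands for the number suc (toℕ x).
record ChordDiagram (n : ℕ) : Set where
  field
    partner    : Fin (2 * n) → Fin (2 * n)
    involutive : ∀ x → partner (partner x) ≡ x
    matched    : ∀ x → partner x ≢ x

open ChordDiagram public using (partner)

-- (source , sink)
Chord : ℕ → Set
Chord m = Fin m × Fin m

module _ {m : ℕ} where

  RightNeighbor : Chord m → Chord m → Set
  RightNeighbor (a₁ , b₁) (a₂ , b₂) = a₁ < a₂ × a₂ < b₁ × b₁ < b₂

  rightNeighbor? : ∀ c d → Dec (RightNeighbor c d)
  rightNeighbor? (a₁ , b₁) (a₂ , b₂) =
    (a₁ Fin.<? a₂) ×-dec (a₂ Fin.<? b₁) ×-dec (b₁ Fin.<? b₂)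

  Crosses : Chord m → Chord m → Set
  Crosses c d = RightNeighbor c d ⊎ RightNeighbor d c

  crosses? : ∀ c d → Dec (Crosses c d)
  crosses? c d = rightNeighbor? c d ⊎-dec rightNeighbor? d c

  open DecMembership (≡-dec (Fin._≟_ {m}) (Fin._≟_ {m})) using (_∈?_)

  -- The connected components of a set of chords listed in standard
  -- order; each component is again listed in standard order, and the
  -- components come in the standard order of their roots.  The component
  -- of c is c together with every component of the later chords
  -- containing a chord that crosses c.
  components : List (Chord m) → List (List (Chord m))
  components []       = []
  components (c ∷ cs) =
    let (touching , others) = partition (any? (crosses? c)) (components cs)
    in (c ∷ filter (_∈? concat touching) cs) ∷ others

  -- The chords of a connected set (listed in standard order) in
  -- intersection order.  The first argument only ensures termination;
  -- any value ≥ length of the list gives the same result.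
  intersectionOrder : ℕ → List (Chord m) → List (Chord m)
  intersectionOrder zero    _        = []
  intersectionOrder (suc k) []       = []
  intersectionOrder (suc k) (c ∷ cs) =
    c ∷ concatMap (intersectionOrder k) (components cs)

-- In standard order.
chords : ∀ {n} → ChordDiagram n → List (Chord (2 * n))
chords {n} D = map (λ a → a , partner D a)
                   (filter (λ a → a Fin.<? partner D a) (allFin (2 * n)))

module _ {n : ℕ} (D : ChordDiagram n) where

  Connected : Set
  Connected = ∀ {c d} → c ∈ chords D → d ∈ chords D → EqClosure Adjacent c d
    where
    Adjacent : Chord (2 * n) → Chord (2 * n) → Set
    Adjacent c d = c ∈ chords D × d ∈ chords D × Crosses c d

  Terminal : Chord (2 * n) → Set
  Terminal c = All (λ d → ¬ RightNeighbor c d) (chords D)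

  terminal? : ∀ c → Dec (Terminal c)
  terminal? c = all? (λ d → ¬? (rightNeighbor? c d)) (chords D)

  -- The 1-based position of the first terminal chord.
  t₁ : ℕ
  t₁ = suc (length (takeWhile (λ c → ¬? (terminal? c))
                              (intersectionOrder n (chords D))))

  -- Endpoints numbered 1, …, 2n.
  HasChord : ℕ → ℕ → Set
  HasChord a b = Σ[ x ∈ Fin (2 * n) ]
    x < partner D x × a ≡ suc (toℕ x) × b ≡ suc (toℕ (partner D x))

-- D is, up to order-preserving relabelling, a set of chords of E; the
-- embedding sends the endpoints of D to those of the chosen chords.
_IsSubdiagramOf_ : ∀ {m n} → ChordDiagram m → ChordDiagram n → Set
_IsSubdiagramOf_ {m} {n} D E = Σ[ f ∈ (Fin (2 * m) → Fin (2 * n)) ]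
  (∀ x y → x < y → f x < f y) × (∀ x → partner E (f x) ≡ f (partner D x))

data TopCycle (m : ℕ) : ℕ → ℕ → Set where
  short : ∀ j → 1 ℕ.≤ j → j ℕ.≤ m ∸ 1 → TopCycle m (2 * j ∸ 1) (2 * j + 2)
  long  : TopCycle m 2 (2 * m ∸ 1)

TopCycleFree : ∀ {n} → ChordDiagram n → Set
TopCycleFree E = ∀ m → 3 ℕ.≤ m → (D : ChordDiagram m) → D IsSubdiagramOf E →
                 ¬ (∀ a b → HasChord D a b ⇔ TopCycle m a b)

chordDiagrams : ℕ → Setoid 0ℓ 0ℓ
chordDiagrams n = On.setoid (Fin (2 * n) →-setoid Fin (2 * n)) (partner {n})

connectedTopCycleFreeDiagrams : ℕ → ℕ → Setoid 0ℓ 0ℓ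
connectedTopCycleFreeDiagrams n i =
  On.setoid {B = Σ[ D ∈ ChordDiagram n ] Connected D × TopCycleFree D × t₁ D ≡ i}
            (chordDiagrams n) proj₁

------------------------------------------------------------------------
-- Rooted maps

-- The orbit x , π x , π² x , … of x under a permutation π.  The list is
-- complete, since cycles have at most m elements, but has repetitions.
orbit : ∀ {m} → (Fin m → Fin m) → Fin m → List (Fin m)
orbit {m} π x = iterate π x m

-- Every cycle is counted by its least element.
numCycles : ∀ {m} → (Fin m → Fin m) → ℕ
numCycles {m} π =
  length (filter (λ x → all? (x Fin.≤?_) (orbit π x)) (allFin m))

record RootedMap : Set where
  field
    size : ℕ

  HalfEdge : Set
  HalfEdge = Fin size

  field
    rotation     : Permutation′ size
    α            : HalfEdge → HalfEdge
    α-involutive : ∀ h → α (α h) ≡ h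
    root         : HalfEdge
    α-fixed      : ∀ h → α h ≡ h ⇔ h ≡ root

  σ : HalfEdge → HalfEdge
  σ h = rotation ⟨$⟩ʳ h

  field
    transitive : ∀ g h → EqClosure (λ x y → σ x ≡ y ⊎ α x ≡ y) g h

  -- The dangling root is counted.
  numEdges : ℕ
  numEdges = numCycles α

  numVertices : ℕ
  numVertices = numCycles σ

  -- The dangling root, being a fixed point of α, does not affect the
  -- number of faces.
  numFaces : ℕ
  numFaces = numCycles (λ h → σ (α h))

  Planar : Set
  Planar = + numVertices ℤ.- + (numEdges ∸ 1) ℤ.+ + numFaces ≡ + 2

  -- Connectedness of the graph left after deleting the edge {e , α e};
  -- the half-edges e and α e remain, attached to their vertices only.
  ConnectedWithout : HalfEdge → Set
  ConnectedWithout e = ∀ g h → EqClosure Step g h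
    where
    Step : HalfEdge → HalfEdge → Set
    Step x y = σ x ≡ y ⊎ (x ≢ e × x ≢ α e × α x ≡ y)

  Bridge : HalfEdge → Set
  Bridge e = e ≢ root × ¬ ConnectedWithout e

  Bridgeless : Set
  Bridgeless = ∀ e → ¬ Bridge e

  open DecMembership (Fin._≟_ {size}) using (_∈?_)

  -- explore k e h S continues the search at a vertex first entered by the
  -- half-edge e, with h the next half-edge to be tried.  S lists the sinks
  -- of the edges oriented so far: the edge of h has been traversed iff h or
  -- α h is in S, and a vertex has been visited iff one of its half-edges is
  -- in S.  The first argument only ensures termination; as every half-edge
  -- is tried at most once, the value size is large enough.
  explore : ℕ → HalfEdge → HalfEdge → List HalfEdge → List HalfEdge
  explore zero    e h S = S
  explore (suc k) e h S =
    if does (h Fin.≟ e) then S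
    else if does (h ∈? S) ∨ does (α h ∈? S) then explore k e (σ h) S
    else if does (any? (_∈? orbit σ (α h)) S) then explore k e (σ h) (α h ∷ S)
    else explore k e (σ h) (explore k (α h) (σ (α h)) (α h ∷ S))

  dfsSinks : List HalfEdge
  dfsSinks = explore size root (σ root) [ root ]

  rootIndegree : ℕ
  rootIndegree = length (filter (_∈? orbit σ root) dfsSinks)

record _≅_ (M N : RootedMap) : Set where
  private
    module M = RootedMap M
    module N = RootedMap N
  field
    iso    : Permutation M.size N.size
    σ-hom  : ∀ h → iso ⟨$⟩ʳ M.σ h ≡ N.σ (iso ⟨$⟩ʳ h)
    α-hom  : ∀ h → iso ⟨$⟩ʳ M.α h ≡ N.α (iso ⟨$⟩ʳ h)
    root↦  : iso ⟨$⟩ʳ M.root ≡ N.root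

rootedMaps : Setoid 0ℓ 0ℓ
rootedMaps = record
  { Carrier       = RootedMap
  ; _≈_           = _≅_
  ; isEquivalence = record { refl = ≅-refl ; sym = ≅-sym ; trans = ≅-trans }
  }
  where
  open _≅_

  ≅-refl : ∀ {M} → M ≅ M
  ≅-refl = record
    { iso = Perm.id ; σ-hom = λ _ → refl ; α-hom = λ _ → refl ; root↦ = refl }

  ≅-sym : ∀ {M N} → M ≅ N → N ≅ M
  ≅-sym {M} {N} p = record
    { iso   = flip (iso p)
    ; σ-hom = λ h → back (M.σ) (N.σ) (σ-hom p) h
    ; α-hom = λ h → back (M.α) (N.α) (α-hom p) h
    ; root↦ = trans (cong (iso p ⟨$⟩ˡ_) (sym (root↦ p))) (inverseˡ (iso p))
    }
    where
    module M = RootedMap M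
    module N = RootedMap N
    back : ∀ f g → (∀ h → iso p ⟨$⟩ʳ f h ≡ g (iso p ⟨$⟩ʳ h)) →
           ∀ h → iso p ⟨$⟩ˡ g h ≡ f (iso p ⟨$⟩ˡ h)
    back f g hom h = begin
      iso p ⟨$⟩ˡ g h                                 ≡⟨ cong (λ x → iso p ⟨$⟩ˡ g x) (inverseʳ (iso p)) ⟨
      iso p ⟨$⟩ˡ g (iso p ⟨$⟩ʳ (iso p ⟨$⟩ˡ h))       ≡⟨ cong (iso p ⟨$⟩ˡ_) (hom _) ⟨
      iso p ⟨$⟩ˡ (iso p ⟨$⟩ʳ f (iso p ⟨$⟩ˡ h))       ≡⟨ inverseˡ (iso p) ⟩
      f (iso p ⟨$⟩ˡ h)                               ∎
      where open ≡-Reasoning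

  ≅-trans : ∀ {L M N} → L ≅ M → M ≅ N → L ≅ N
  ≅-trans p q = record
    { iso   = iso p ∘ₚ iso q
    ; σ-hom = λ h → trans (cong (iso q ⟨$⟩ʳ_) (σ-hom p h)) (σ-hom q _)
    ; α-hom = λ h → trans (cong (iso q ⟨$⟩ʳ_) (α-hom p h)) (α-hom q _)
    ; root↦ = trans (cong (iso q ⟨$⟩ʳ_) (root↦ p)) (root↦ q)
    }

planarBridgelessMaps : ℕ → ℕ → Setoid 0ℓ 0ℓ
planarBridgelessMaps n i =
  On.setoid {B = Σ[ M ∈ RootedMap ] let open RootedMap M in
                 Planar × Bridgeless × numEdges ≡ n × rootIndegree ≡ i}
            rootedMaps proj₁

------------------------------------------------------------------------
-- The two formulas.  All truncated subtractions are exact for 2 ≤ i ≤ n.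

factorialFormula : ℕ → ℕ → ℚᵘ
factorialFormula n i =
  (+ (2 * (2 * i ∸ 1) ! * (4 * n ∸ 2 * i ∸ 3) !))
    ℚᵘ./ ((i ∸ 2) ! * i ! * (n ∸ i) ! * (3 * n ∸ i ∸ 1) !)
  where
  instance
    nonZero : NonZero ((i ∸ 2) ! * i ! * (n ∸ i) ! * (3 * n ∸ i ∸ 1) !)
    nonZero = ℕ.m*n≢0 _ _ {{ℕ.m*n≢0 _ _ {{ℕ.m*n≢0 _ _ {{(i ∸ 2) ℕ.!≢0}} {{i ℕ.!≢0}}}} {{(n ∸ i) ℕ.!≢0}}}}
                          {{(3 * n ∸ i ∸ 1) ℕ.!≢0}}

denominator≢0 : ∀ n i → 2 ℕ.≤ i → i ℕ.≤ n →
                NonZero ((4 * n ∸ 2 * i ∸ 1) * (2 * n ∸ i ∸ 1))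
denominator≢0 n i 2≤i i≤n =
  ℕ.m*n≢0 _ _ {{ℕ.>-nonZero (gap (2 * i) (4 * n) 2i+1<4n)}}
              {{ℕ.>-nonZero (gap i (2 * n) i+1<2n)}}
  where
  open ℕ.≤-Reasoning

  gap : ∀ a b → 2 + a ℕ.≤ b → 0 ℕ.< b ∸ a ∸ 1
  gap a b 2+a≤b = begin-strict
    0            <⟨ ℕ.n<1+n 0 ⟩
    1            ≡⟨ cong (_∸ 1) (ℕ.m+n∸n≡m 2 a) ⟨
    2 + a ∸ a ∸ 1 ≤⟨ ℕ.∸-monoˡ-≤ 1 (ℕ.∸-monoˡ-≤ a 2+a≤b) ⟩
    b ∸ a ∸ 1    ∎

  i+1<2n : 2 + i ℕ.≤ 2 * n
  i+1<2n = begin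
    2 + i       ≤⟨ ℕ.+-mono-≤ (ℕ.≤-trans 2≤i i≤n) i≤n ⟩
    n + n       ≡⟨ cong (λ x → n + x) (ℕ.+-identityʳ n) ⟨
    2 * n       ∎

  2i+1<4n : 2 + 2 * i ℕ.≤ 4 * n
  2i+1<4n = begin
    2 + 2 * i       ≤⟨ ℕ.+-mono-≤ (ℕ.≤-trans (ℕ.m≤m+n 2 i) i+1<2n) (ℕ.*-monoʳ-≤ 2 i≤n) ⟩
    2 * n + 2 * n   ≡⟨ ℕ.*-distribʳ-+ n 2 2 ⟨
    4 * n           ∎

binomialFormula : ∀ n i → 2 ℕ.≤ i → i ℕ.≤ n → ℚᵘ
binomialFormula n i 2≤i i≤n =
  ((+ (i ∸ 1)) ℚᵘ./ ((4 * n ∸ 2 * i ∸ 1) * (2 * n ∸ i ∸ 1)))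
    ℚᵘ.* ((+ ((2 * i ∸ 1) C i)) ℚᵘ./ 1)
    ℚᵘ.* ((+ ((4 * n ∸ 2 * i ∸ 1) C (n ∸ i))) ℚᵘ./ 1)
  where
  instance
    nonZero : NonZero ((4 * n ∸ 2 * i ∸ 1) * (2 * n ∸ i ∸ 1))
    nonZero = denominator≢0 n i 2≤i i≤n

{-# OPTIONS --safe #-}
module Submission where

-- Both families are coded by the binary trees in which a node with subtrees t₁
-- and t₂ carries one of weight t₁ places, where the weight of a leaf is 1 and
-- that of a node with place j is j + 1 + weight t₂ (places are counted from 0).
--
-- Maps.  The rightmost search visits the half-edges in the order of a walk
-- around its spanning tree, so that a planar map becomes a word with two
-- noncrossing matchings.  Removing the first edge of the word splits it into
-- the words of two smaller bridgeless maps, the second one being inserted in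
-- front of a sink at the root vertex of the first, and weight counts these sinks.
--
-- Diagrams.  Removing the root chord of a connected diagram leaves a first
-- component t₁, and the root together with the other components forms t₂, all
-- of which, but for the first point, lies in one gap of t₁.  The gaps where no
-- top cycle arises are the slots, of which there are weight t₁.  The first
-- terminal chord is reached along the first components, so t₁(C) is the depth
-- of the leftmost leaf.
--
-- Counting.  By the kernel method the depth is distributed like the weight.  The
-- generating function of the weight solves a quadratic functional equation, whose
-- solution is rational in the series B = 1 + z B⁴ and c = 1 + z v B² c².

-- Depth and weight differ on single trees, already with three leaves; only their distributions
-- agree, and no bijection between them is built. The kernel of the equation for the depth is x - 1
-- - z v x W(x), where W(x) is the series of the weight, and its root U turns out to be W(v) / v
-- itself, so the unknown specialisation at x = 1 becomes W(v). The equation for W(v) still contains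
-- the second unknown W(1). A solution is guessed and then verified coefficient by coefficient: the
-- lower coefficients of W(v) and W(1) give the next one of W(v), a polynomial in v, whose value at
-- v = 1 is the next one of W(1). Maps count up to isomorphism, diagrams do not, so maps need a
-- normal form. The walk of the search provides it, since it is determined by the rooted map.
-- Planarity is given by Euler's formula only; it becomes a noncrossing condition because the number
-- of cycles of a matching composed with the cyclic shift is maximal exactly for noncrossing
-- matchings. For diagrams the crucial point is that every gap of a connected diagram that is not a
-- slot is really blocked: chords chosen greedily with farthest sinks supply the top cycle.

open import Defs
open import Data.Integer using (+_)
open import Data.Nat using (ℕ; _≤_)
open import Data.Product using (Σ-syntax; _×_)
open import Data.Rational.Unnormalised using (_/_; _≃_)

open import Algebra.Bundles using (CommutativeRing; RawRing)
open import Data.Bool using (Bool; true; false; if_then_else_; _∨_)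
open import Data.Empty using (⊥; ⊥-elim)
open import Data.Fin using (Fin; toℕ; fromℕ; inject₁; fromℕ<) renaming (zero to fzero; suc to fsuc)
open import Data.List using (List; []; _∷_; [_]; length; map; filter; concat; concatMap; partition; takeWhile; allFin; iterate; _++_; lookup; tabulate)
open import Data.Maybe using (Maybe; just; nothing)
open import Data.Nat using (ℕ; zero; suc; _+_; _*_; _∸_; _!; _≤_; _<_; z≤n; s≤s; NonZero; _≤?_; _<?_)
open import Data.Product using (_×_; _,_; proj₁; proj₂)
open import Data.Sum using (_⊎_; inj₁; inj₂; [_,_]′)
open import Function using (_∘_; id; _⇔_; case_of_; Equivalence; mk⇔)
open import Relation.Binary.PropositionalEquality using (_≡_; _≢_; refl; sym; trans; cong; cong₂; subst; subst₂; setoid; module ≡-Reasoning)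
open import Relation.Nullary using (¬_; Dec; yes; no; does; ¬?; contradiction)
open import Relation.Binary using (tri<; tri≈; tri>; Setoid)
open import Relation.Unary using (Decidable)
import Data.Nat.Properties
import Data.Fin.Properties
module ℕP = Data.Nat.Properties
module FinP = Data.Fin.Properties
import Algebra.Properties.Ring
import Algebra.Solver.Ring
import Algebra.Solver.Ring.NaturalCoefficients.Default
open import Algebra.Solver.Ring.AlmostCommutativeRing using (fromCommutativeRing; _-Raw-AlmostCommutative⟶_)
import Algebra.Properties.Semiring.Mult
import Algebra.Properties.Semiring.Mult.TCOptimised
import Relation.Binary.Reasoning.Setoid
open import Level using (0ℓ)
open import Data.List.Properties using (map-tabulate; length-++; filter-accept; filter-reject; length-map; ++-assoc; length-tabulate; filter-notAll; partition-defn; length-filter; ++-identityʳ)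
open import Data.Nat.Solver using (module +-*-Solver)
open import Data.List.Membership.Propositional using (_∈_; _∉_; find; lose)
open import Data.List.Membership.Propositional.Properties using (∈-map⁺; ∈-map⁻; ∈-filter⁺; ∈-filter⁻; ∈-allFin; ∈-lookup; ∈-++⁺ˡ; ∈-++⁺ʳ; ∈-++⁻; ∈-concatMap⁺; ∈-concatMap⁻; ∈-concat⁺′; ∈-concat⁻′)
open import Data.List.Relation.Unary.Any using (Any; here; there; index; any?)
open import Data.List.Relation.Unary.Any.Properties using (lookup-index; map⁺; map⁻)
open import Data.List.Relation.Unary.All using (All; []; _∷_; all?)
import Data.List.Relation.Unary.All as All
open import Data.List.Relation.Unary.AllPairs using (AllPairs; []; _∷_)
import Data.List.Relation.Unary.AllPairs as AllPairs
import Data.List.Relation.Unary.AllPairs.Properties as AllPairsP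
import Data.List.Relation.Unary.All.Properties as AllP
open import Data.List.Relation.Unary.Unique.Propositional using (Unique)
import Data.List.Relation.Unary.Unique.Propositional.Properties as Unique
open import Data.Integer as ℤ using (ℤ; +_)
import Data.Integer.Properties as ℤP
import Data.Nat.Induction as NatInd
open import Induction.WellFounded using (Acc; acc)
import Relation.Binary
open import Data.Fin.Permutation using (_⟨$⟩ʳ_; _⟨$⟩ˡ_; inverseˡ; inverseʳ; ↔⇒≡; permutation)
open import Relation.Binary.Construct.Closure.Equivalence as Eq using (EqClosure)
open import Relation.Nullary.Decidable using (does-⇔; _×-dec_; dec-true; dec-false; _⊎-dec_)
import Data.List.Membership.DecPropositional as DecMembership
import Data.List.Relation.Unary.Any as Any
open import Relation.Binary.Construct.Closure.ReflexiveTransitive using (ε; _◅_; _◅◅_)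
open import Relation.Binary.Construct.Closure.Symmetric using (fwd; bwd)
import Data.Maybe
import Data.Fin.Permutation as Perm
open import Data.Product.Properties using (≡-dec)
open import Relation.Unary.Properties using (∁?)
import Data.Nat as ℕ
open import Data.Nat.DivMod using (m/n*n≡m)
open import Data.Nat.Combinatorics using (nCk≡n!/k![n-k]!; k![n∸k]!∣n!) renaming (_C_ to _choosing_)
open import Data.Rational.Unnormalised as ℚᵘ using (ℚᵘ; _/_; _≃_; *≡*)
open ℕP using (≤-trans; <-trans; ≤-refl; <⇒≱; <⇒≢; <-irrefl; <-asym; ≤-<-trans; <-≤-trans; <⇒≤; ≤-pred; ≤-reflexive; <-≤-connex; m≤n⇒m<n∨m≡n; <-cmp; m≤m+n; ≮⇒≥; n<1+n; ≤∧≢⇒<; ≤-antisym; m≤n+m; ≤⇒≯; ≰⇒>; >⇒≢; m≤n⇒m≤1+n; +-suc; m+[n∸m]≡n; suc-injective; +-monoʳ-<; +-cancelˡ-<; n≤1+n; m<m+n; m+n∸m≡n; m∸n+n≡m; +-mono-≤-<; +-monoˡ-<; +-monoʳ-≤; +-monoˡ-≤; +-cancelʳ-<; +-mono-<)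
open FinP using (toℕ-injective; toℕ<n; toℕ-fromℕ<; toℕ-fromℕ; injective⇒≤; toℕ-inject₁)

-- Power series

-- Ring solver with integer coefficients; (a , b) stands for a - b.  The
-- coefficients are kept reduced because the solver compares normal forms
-- definitionally.
module ℤSolver (R : CommutativeRing 0ℓ 0ℓ) where
  private
    module R = CommutativeRing R
    module RP = Algebra.Properties.Ring R.ring
    module NS = Algebra.Solver.Ring.NaturalCoefficients.Default R.commutativeSemiring
    open Algebra.Properties.Semiring.Mult R.semiring using (×-homo-+; ×1-homo-*) renaming (_×_ to _×ᵣ_)
    open R using (_≈_; 1#; 0#) renaming (_+_ to _⊕_; _*_ to _⊗_; -_ to ⊖_)
    open Relation.Binary.Reasoning.Setoid R.setoid

    pairs : RawRing 0ℓ 0ℓ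
    pairs = record
      { Carrier = ℕ × ℕ
      ; _≈_     = _≡_
      ; _+_     = λ (a , b) (c , d) → a + c , b + d
      ; _*_     = λ (a , b) (c , d) → a * c + b * d , a * d + b * c
      ; -_ = λ (a , b) → b , a
      ; 0# = 0 , 0
      ; 1# = 1 , 0
      }

    reduce : ℕ × ℕ → ℕ × ℕ
    reduce (suc a , suc b) = reduce (a , b)
    reduce (zero  , b)     = zero , b
    reduce (a     , zero)  = a , zero

    reduced : RawRing 0ℓ 0ℓ
    reduced = record
      { Carrier = ℕ × ℕ
      ; _≈_     = _≡_
      ; _+_     = λ p q → reduce (RawRing._+_ pairs p q)
      ; _*_     = λ p q → reduce (RawRing._*_ pairs p q)
      ; -_ = λ p → reduce (RawRing.-_ pairs p)
      ; 0# = 0 , 0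
      ; 1# = 1 , 0
      }

    ι : ℕ → R.Carrier
    ι n = n ×ᵣ 1#

    value : ℕ × ℕ → R.Carrier
    value (a , b) = ι a ⊕ (⊖ ι b)

    +-hom : ∀ p q → value (RawRing._+_ pairs p q) ≈ value p ⊕ value q
    +-hom (a , b) (c , d) = begin
      ι (a + c) ⊕ (⊖ ι (b + d)) ≈⟨ R.+-cong (×-homo-+ 1# a c) (R.-‿cong (×-homo-+ 1# b d)) ⟩
      (ι a ⊕ ι c) ⊕ (⊖ (ι b ⊕ ι d)) ≈⟨ R.+-congˡ (RP.-‿+-comm (ι b) (ι d)) ⟨
      (ι a ⊕ ι c) ⊕ ((⊖ ι b) ⊕ (⊖ ι d)) ≈⟨ NS.solve 4 (λ x y z w → (x NS.:+ y) NS.:+ (z NS.:+ w) NS.:= (x NS.:+ z) NS.:+ (y NS.:+ w)) R.refl (ι a) (ι c) (⊖ ι b) (⊖ ι d) ⟩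
      value (a , b) ⊕ value (c , d) ∎

    *-hom : ∀ p q → value (RawRing._*_ pairs p q) ≈ value p ⊗ value q
    *-hom (a , b) (c , d) = begin
      ι (a * c + b * d) ⊕ (⊖ ι (a * d + b * c))
        ≈⟨ R.+-cong (expand a c b d) (R.-‿cong (expand a d b c)) ⟩
      (A ⊗ C ⊕ B ⊗ D) ⊕ (⊖ (A ⊗ D ⊕ B ⊗ C))
        ≈⟨ R.+-cong (R.+-congˡ neg-neg) (RP.-‿+-comm (A ⊗ D) (B ⊗ C)) ⟨
      (A ⊗ C ⊕ (⊖ B) ⊗ (⊖ D)) ⊕ ((⊖ (A ⊗ D)) ⊕ (⊖ (B ⊗ C)))
        ≈⟨ R.+-congˡ (R.+-cong (RP.-‿distribʳ-* A D) (RP.-‿distribˡ-* B C)) ⟩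
      (A ⊗ C ⊕ (⊖ B) ⊗ (⊖ D)) ⊕ (A ⊗ (⊖ D) ⊕ (⊖ B) ⊗ C)
        ≈⟨ NS.solve 4 (λ x y z w → (x NS.:* z NS.:+ y NS.:* w) NS.:+ (x NS.:* w NS.:+ y NS.:* z) NS.:= (x NS.:+ y) NS.:* (z NS.:+ w)) R.refl A (⊖ B) C (⊖ D) ⟩
      value (a , b) ⊗ value (c , d) ∎
      where
      A = ι a
      B = ι b
      C = ι c
      D = ι d
      neg-neg : (⊖ B) ⊗ (⊖ D) ≈ B ⊗ D
      neg-neg = R.trans (R.sym (RP.-‿distribˡ-* B (⊖ D))) (R.trans (R.-‿cong (R.sym (RP.-‿distribʳ-* B D))) (RP.-‿involutive (B ⊗ D)))
      expand : ∀ a c b d → ι (a * c + b * d) ≈ ι a ⊗ ι c ⊕ ι b ⊗ ι d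
      expand a c b d = R.trans (×-homo-+ 1# (a * c) (b * d)) (R.+-cong (×1-homo-* a c) (×1-homo-* b d))

    -hom : ∀ p → value (RawRing.-_ pairs p) ≈ ⊖ value p
    -hom (a , b) = begin
      ι b ⊕ (⊖ ι a) ≈⟨ R.+-comm _ _ ⟩
      (⊖ ι a) ⊕ ι b ≈⟨ R.+-congˡ (RP.-‿involutive (ι b)) ⟨
      (⊖ ι a) ⊕ (⊖ (⊖ ι b)) ≈⟨ RP.-‿+-comm (ι a) (⊖ ι b) ⟩
      ⊖ (ι a ⊕ (⊖ ι b)) ∎

    equal? : ∀ p q → Maybe (value p ≈ value q)
    equal? (a , b) (c , d) with a + d ℕP.≟ c + b
    ... | no  _ = nothing
    ... | yes e = just (begin
      ι a ⊕ (⊖ ι b) ≈⟨ shift (ι a) (ι d) (⊖ ι b) (⊖ ι d) (R.-‿inverseʳ (ι d)) ⟨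
      (ι a ⊕ ι d) ⊕ ((⊖ ι b) ⊕ (⊖ ι d)) ≈⟨ R.+-congʳ (×-homo-+ 1# a d) ⟨
      ι (a + d) ⊕ ((⊖ ι b) ⊕ (⊖ ι d)) ≡⟨ cong (λ n → ι n ⊕ ((⊖ ι b) ⊕ (⊖ ι d))) e ⟩
      ι (c + b) ⊕ ((⊖ ι b) ⊕ (⊖ ι d)) ≈⟨ R.+-cong (×-homo-+ 1# c b) (R.+-comm (⊖ ι b) (⊖ ι d)) ⟩
      (ι c ⊕ ι b) ⊕ ((⊖ ι d) ⊕ (⊖ ι b)) ≈⟨ shift (ι c) (ι b) (⊖ ι d) (⊖ ι b) (R.-‿inverseʳ (ι b)) ⟩
      ι c ⊕ (⊖ ι d) ∎)
      where
      shift : ∀ x y u v → y ⊕ v ≈ 0# → (x ⊕ y) ⊕ (u ⊕ v) ≈ x ⊕ u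
      shift x y u v e = begin
        (x ⊕ y) ⊕ (u ⊕ v) ≈⟨ NS.solve 4 (λ x y u v → (x NS.:+ y) NS.:+ (u NS.:+ v) NS.:= (x NS.:+ u) NS.:+ (y NS.:+ v)) R.refl x y u v ⟩
        (x ⊕ u) ⊕ (y ⊕ v) ≈⟨ R.+-congˡ e ⟩
        (x ⊕ u) ⊕ 0# ≈⟨ R.+-identityʳ _ ⟩
        x ⊕ u ∎

    open Algebra.Properties.Semiring.Mult.TCOptimised R.semiring using (×ᵤ≈×) renaming (_×_ to _×ₒ_)

    -- The same value, in a form that reduces to 0# and 1# on those constants.
    value′ : ℕ × ℕ → R.Carrier
    value′ (a , zero)  = a ×ₒ 1#
    value′ (a , suc b) = value (a , suc b)

    value-value′ : ∀ p → value′ p ≈ value p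
    value-value′ (a , zero)  = R.trans (R.sym (×ᵤ≈× a 1#)) (R.sym (R.trans (R.+-congˡ RP.-0#≈0#) (R.+-identityʳ _)))
    value-value′ (a , suc b) = R.refl

    value-reduce : ∀ p → value (reduce p) ≈ value p
    value-reduce (zero  , b)     = R.refl
    value-reduce (suc a , zero)  = R.refl
    value-reduce (suc a , suc b) = R.trans (value-reduce (a , b)) (R.sym (begin
      (1# ⊕ ι a) ⊕ (⊖ (1# ⊕ ι b)) ≈⟨ R.+-congˡ (RP.-‿+-comm 1# (ι b)) ⟨
      (1# ⊕ ι a) ⊕ ((⊖ 1#) ⊕ (⊖ ι b)) ≈⟨ NS.solve 4 (λ x y u v → (x NS.:+ y) NS.:+ (u NS.:+ v) NS.:= (x NS.:+ u) NS.:+ (y NS.:+ v)) R.refl 1# (ι a) (⊖ 1#) (⊖ ι b) ⟩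
      (1# ⊕ (⊖ 1#)) ⊕ (ι a ⊕ (⊖ ι b)) ≈⟨ R.+-congʳ (R.-‿inverseʳ 1#) ⟩
      0# ⊕ (ι a ⊕ (⊖ ι b)) ≈⟨ R.+-identityˡ _ ⟩
      ι a ⊕ (⊖ ι b) ∎))

    value′-reduce : ∀ p → value′ (reduce p) ≈ value p
    value′-reduce p = R.trans (value-value′ (reduce p)) (value-reduce p)

    morphism : reduced -Raw-AlmostCommutative⟶ fromCommutativeRing R
    morphism = record
      { ⟦_⟧    = value′
      ; +-homo = λ p q → R.trans (value′-reduce (RawRing._+_ pairs p q)) (R.trans (+-hom p q) (R.sym (R.+-cong (value-value′ p) (value-value′ q))))
      ; *-homo = λ p q → R.trans (value′-reduce (RawRing._*_ pairs p q)) (R.trans (*-hom p q) (R.sym (R.*-cong (value-value′ p) (value-value′ q))))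
      ; -‿homo = λ p → R.trans (value′-reduce (RawRing.-_ pairs p)) (R.trans (-hom p) (R.-‿cong (R.sym (value-value′ p))))
      ; 0-homo = R.refl
      ; 1-homo = R.refl
      }

    equal?′ : ∀ p q → Maybe (value′ p ≈ value′ q)
    equal?′ p q with equal? p q
    ... | nothing = nothing
    ... | just e  = just (R.trans (value-value′ p) (R.trans e (R.sym (value-value′ q))))

  open Algebra.Solver.Ring reduced (fromCommutativeRing R) morphism equal?′ public
    using (solve; con; _:+_; _:*_; _:-_; :-_; _:=_; Polynomial)

  :0 :1 :2 : ∀ {n} → Polynomial n
  :0 = con (0 , 0)
  :1 = con (1 , 0)
  :2 = con (2 , 0)

module PowerSeries (R : CommutativeRing 0ℓ 0ℓ) where
  private
    module R = CommutativeRing R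
    module RS = ℤSolver R
    open R using (0#; 1#) renaming (Carrier to A; _≈_ to _~_; _+_ to _⊕_; _*_ to _⊗_; -_ to ⊖_)
    open Relation.Binary.Reasoning.Setoid R.setoid

  PS : Set
  PS = ℕ → A

  infix 4 _≋_
  _≋_ : PS → PS → Set
  f ≋ g = ∀ n → f n ~ g n

  tail : PS → PS
  tail f n = f (suc n)

  conv : PS → PS → PS
  conv f g zero    = f 0 ⊗ g 0
  conv f g (suc n) = f 0 ⊗ g (suc n) ⊕ conv (tail f) g n

  addS : PS → PS → PS
  addS f g n = f n ⊕ g n

  const : A → PS
  const a zero    = a
  const a (suc n) = 0#

  conv-cong : ∀ {f f′ g g′} → f ≋ f′ → g ≋ g′ → conv f g ≋ conv f′ g′
  conv-cong p q zero    = R.*-cong (p 0) (q 0)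
  conv-cong p q (suc n) = R.+-cong (R.*-cong (p 0) (q (suc n))) (conv-cong (λ k → p (suc k)) q n)

  -- `conv` peels off the front of its first argument. Peeling off the back instead is the same
  -- recursion with the arguments exchanged, which turns `conv-comm` into an induction.
  conv-last : ∀ f g n → conv f g (suc n) ~ conv f (tail g) n ⊕ f (suc n) ⊗ g 0
  conv-last f g zero    = R.refl
  conv-last f g (suc n) = R.trans (R.+-congˡ (conv-last (tail f) g n)) (R.sym (R.+-assoc _ _ _))

  conv-comm : ∀ f g → conv f g ≋ conv g f
  conv-comm f g zero    = R.*-comm _ _
  conv-comm f g (suc n) = begin
    f 0 ⊗ g (suc n) ⊕ conv (tail f) g n ≈⟨ R.+-cong (R.*-comm _ _) (conv-comm (tail f) g n) ⟩
    g (suc n) ⊗ f 0 ⊕ conv g (tail f) n ≈⟨ R.+-comm _ _ ⟩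
    conv g (tail f) n ⊕ g (suc n) ⊗ f 0 ≈⟨ conv-last g f n ⟨
    conv g f (suc n) ∎

  conv-distribʳ : ∀ h f g → conv (addS f g) h ≋ addS (conv f h) (conv g h)
  conv-distribʳ h f g zero    = R.distribʳ _ _ _
  conv-distribʳ h f g (suc n) = R.trans
    (R.+-cong (R.distribʳ _ _ _) (conv-distribʳ h (tail f) (tail g) n))
    (RS.solve 4 (λ x y u v → (x RS.:+ y) RS.:+ (u RS.:+ v) RS.:= (x RS.:+ u) RS.:+ (y RS.:+ v)) R.refl _ _ _ _)

  conv-scale : ∀ a f g → conv (λ n → a ⊗ f n) g ≋ (λ n → a ⊗ conv f g n)
  conv-scale a f g zero    = R.*-assoc _ _ _
  conv-scale a f g (suc n) = R.trans (R.+-cong (R.*-assoc _ _ _) (conv-scale a (tail f) g n)) (R.sym (R.distribˡ _ _ _))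

  conv-assoc : ∀ f g h → conv (conv f g) h ≋ conv f (conv g h)
  conv-assoc f g h zero    = R.*-assoc _ _ _
  conv-assoc f g h (suc n) = begin
    (f 0 ⊗ g 0) ⊗ h (suc n) ⊕ conv (addS (λ k → f 0 ⊗ g (suc k)) (conv (tail f) g)) h n
      ≈⟨ R.+-cong (R.*-assoc _ _ _) (conv-distribʳ h _ _ n) ⟩
    f 0 ⊗ (g 0 ⊗ h (suc n)) ⊕ (conv (λ k → f 0 ⊗ g (suc k)) h n ⊕ conv (conv (tail f) g) h n)
      ≈⟨ R.+-congˡ (R.+-cong (conv-scale (f 0) (tail g) h n) (conv-assoc (tail f) g h n)) ⟩
    f 0 ⊗ (g 0 ⊗ h (suc n)) ⊕ (f 0 ⊗ conv (tail g) h n ⊕ conv (tail f) (conv g h) n)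
      ≈⟨ RS.solve 4 (λ a x y r → a RS.:* x RS.:+ (a RS.:* y RS.:+ r) RS.:= a RS.:* (x RS.:+ y) RS.:+ r) R.refl _ _ _ _ ⟩
    f 0 ⊗ (g 0 ⊗ h (suc n) ⊕ conv (tail g) h n) ⊕ conv (tail f) (conv g h) n ∎

  conv-zeroˡ : ∀ g → conv (λ _ → 0#) g ≋ (λ _ → 0#)
  conv-zeroˡ g zero    = R.zeroˡ _
  conv-zeroˡ g (suc n) = R.trans (R.+-cong (R.zeroˡ _) (conv-zeroˡ g n)) (R.+-identityʳ _)

  conv-constˡ : ∀ a g → conv (const a) g ≋ (λ n → a ⊗ g n)
  conv-constˡ a g zero    = R.refl
  conv-constˡ a g (suc n) = R.trans (R.+-congˡ (conv-zeroˡ g n)) (R.+-identityʳ _)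

  ring : CommutativeRing 0ℓ 0ℓ
  ring = record
    { Carrier = PS
    ; _≈_ = _≋_
    ; _+_ = addS
    ; _*_ = conv
    ; -_  = λ f n → ⊖ f n
    ; 0#  = λ _ → 0#
    ; 1#  = const 1#
    ; isCommutativeRing = record
      { isRing = record
        { +-isAbelianGroup = record
          { isGroup = record
            { isMonoid = record
              { isSemigroup = record
                { isMagma = record
                  { isEquivalence = record
                    { refl = λ n → R.refl ; sym = λ p n → R.sym (p n) ; trans = λ p q n → R.trans (p n) (q n) }
                  ; ∙-cong = λ p q n → R.+-cong (p n) (q n) }
                ; assoc = λ f g h n → R.+-assoc _ _ _ }
              ; identity = (λ f n → R.+-identityˡ _) , (λ f n → R.+-identityʳ _) }
            ; inverse = (λ f n → R.-‿inverseˡ _) , (λ f n → R.-‿inverseʳ _)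
            ; ⁻¹-cong = λ p n → R.-‿cong (p n) }
          ; comm = λ f g n → R.+-comm _ _ }
        ; *-cong = conv-cong
        ; *-assoc = conv-assoc
        ; *-identity = (λ f n → R.trans (conv-constˡ 1# f n) (R.*-identityˡ _))
                     , (λ f n → R.trans (conv-comm f (const 1#) n) (R.trans (conv-constˡ 1# f n) (R.*-identityˡ _)))
        ; distrib = (λ h f g n → R.trans (conv-comm h (addS f g) n) (R.trans (conv-distribʳ h f g n) (R.+-cong (conv-comm f h n) (conv-comm g h n))))
                  , conv-distribʳ
        }
      ; *-comm = conv-comm
      }
    }

  shift : PS → PS
  shift f zero    = 0#
  shift f (suc n) = f n

  var : PS
  var = shift (const 1#)

  conv-shiftˡ : ∀ f g → conv (shift f) g ≋ shift (conv f g)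
  conv-shiftˡ f g zero    = R.zeroˡ _
  conv-shiftˡ f g (suc n) = R.trans (R.+-congʳ (R.zeroˡ _)) (R.+-identityˡ _)

  shift-cong : ∀ {f g} → f ≋ g → shift f ≋ shift g
  shift-cong p zero    = R.refl
  shift-cong p (suc n) = p n

  shift≋var : ∀ f → shift f ≋ conv var f
  shift≋var f n = R.sym (R.trans (conv-shiftˡ (const 1#) f n) (shift-cong (λ k → R.trans (conv-constˡ 1# f k) (R.*-identityˡ _)) n))

  Regular : PS → Set
  Regular a = ∀ f → conv a f ≋ (λ _ → 0#) → f ≋ (λ _ → 0#)

  -- Once the coefficients of `f` below `n` vanish, coefficient `n` of the product is `a 0` times
  -- `f n`. No inverse of `a 0` is needed, so this also applies to constant terms such as `v - 1`.
  regular-head : ∀ a → (∀ x → a 0 ⊗ x ~ 0# → x ~ 0#) → Regular a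
  regular-head a reg f e n = below n n ≤-refl
    where
    vanish : ∀ (g : PS) f n → (∀ k → k ≤ n → f k ~ 0#) → conv g f n ~ 0#
    vanish g f zero    z = R.trans (R.*-congˡ (z 0 z≤n)) (R.zeroʳ _)
    vanish g f (suc n) z = R.trans (R.+-cong (R.trans (R.*-congˡ (z (suc n) ≤-refl)) (R.zeroʳ _)) (vanish (tail g) f n (λ k le → z k (m≤n⇒m≤1+n le)))) (R.+-identityʳ _)

    at : ∀ n → (∀ k → k < n → f k ~ 0#) → f n ~ 0#
    at zero    z = reg _ (e 0)
    at (suc n) z = reg _ (R.trans (R.sym (R.trans (R.+-congˡ (vanish (tail a) f n (λ k le → z k (s≤s le)))) (R.+-identityʳ _))) (e (suc n)))

    below : ∀ n k → k ≤ n → f k ~ 0#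
    below zero    .0 z≤n = at 0 (λ _ ())
    below (suc n) k  le with m≤n⇒m<n∨m≡n le
    ... | inj₁ (s≤s lt) = below n k lt
    ... | inj₂ refl     = at (suc n) (λ j lt → below n j (≤-pred lt))

  Regular-sub : ∀ {a} → Regular a → ∀ f g → conv a f ≋ conv a g → f ≋ g
  Regular-sub {a} reg f g e n = R.trans (R.trans (R.sym (R.+-identityʳ _)) (R.trans (R.+-congˡ (R.sym (R.-‿inverseˡ (g n))))
    (R.sym (R.+-assoc _ _ _)))) (R.trans (R.+-congʳ (reg (λ k → f k ⊕ (⊖ g k)) difference n)) (R.+-identityˡ _))
    where
    module PSS = ℤSolver ring
    module P = CommutativeRing ring
    difference : conv a (λ k → f k ⊕ (⊖ g k)) ≋ (λ _ → 0#)
    difference = P.trans (PSS.solve 3 (λ a f g → a PSS.:* (f PSS.:+ (PSS.:- g)) PSS.:= a PSS.:* f PSS.:+ (PSS.:- (a PSS.:* g))) P.refl a f g)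
                   (P.trans (P.+-congʳ e) (P.-‿inverseʳ (conv a g)))

  regular-var : Regular var
  regular-var f e n = R.trans (shift≋var f (suc n)) (e (suc n))

  conv-local : ∀ {f f′ g g′} n → (∀ k → k ≤ n → f k ~ f′ k) → (∀ k → k ≤ n → g k ~ g′ k) → conv f g n ~ conv f′ g′ n
  conv-local zero    p q = R.*-cong (p 0 z≤n) (q 0 z≤n)
  conv-local (suc n) p q = R.+-cong (R.*-cong (p 0 z≤n) (q (suc n) ≤-refl))
    (conv-local n (λ k le → p (suc k) (s≤s le)) (λ k le → q k (m≤n⇒m≤1+n le)))

  Local : (PS → PS) → Set
  Local Φ = ∀ {f g} n → (∀ k → k ≤ n → f k ~ g k) → Φ f n ~ Φ g n

  -- The solution of b = 1 + z Φ(b), by iteration.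
  module Fixpoint (Φ : PS → PS) (local : Local Φ) where
    step : PS → PS
    step f = addS (const 1#) (shift (Φ f))

    approx : ℕ → PS
    approx zero    = λ _ → 0#
    approx (suc k) = step (approx k)

    stable : ∀ k k′ n → n < k → n < k′ → approx k n ~ approx k′ n
    stable (suc k) (suc k′) zero    lt lt′ = R.refl
    stable (suc k) (suc k′) (suc n) (s≤s lt) (s≤s lt′) =
      R.+-congˡ (local n λ j le → stable k k′ j (≤-<-trans le lt) (≤-<-trans le lt′))

    fix : PS
    fix n = approx (suc n) n

    fix-eq : fix ≋ step fix
    fix-eq zero    = R.refl
    fix-eq (suc n) = R.+-congˡ (local n λ j le → stable (suc n) (suc j) j (s≤s le) ≤-refl)

-- Substituting the variable of R[[z]] for the outer variable of R[[z]][[w]].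
module Diagonal (R : CommutativeRing 0ℓ 0ℓ) where
  module R  = CommutativeRing R
  module S  = PowerSeries R
  module SR = CommutativeRing S.ring
  module SS = PowerSeries S.ring
  open R using () renaming (_≈_ to _~_; _+_ to _⊕_; _*_ to _⊗_)
  open S using (PS; _≋_; conv; addS; shift)
  private
    module RS = ℤSolver R
    open Relation.Binary.Reasoning.Setoid R.setoid

  diag : SS.PS → PS
  diag F zero    = F 0 0
  diag F (suc n) = F 0 (suc n) ⊕ diag (SS.tail F) n

  diag-cong : ∀ {F G} → F SS.≋ G → diag F ≋ diag G
  diag-cong p zero    = p 0 0
  diag-cong p (suc n) = R.+-cong (p 0 (suc n)) (diag-cong (λ k → p (suc k)) n)

  diag-+ : ∀ F G → diag (SS.addS F G) ≋ addS (diag F) (diag G)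
  diag-+ F G zero    = R.refl
  diag-+ F G (suc n) = R.trans (R.+-congˡ (diag-+ (SS.tail F) (SS.tail G) n))
    (RS.solve 4 (λ x y u v → (x RS.:+ y) RS.:+ (u RS.:+ v) RS.:= (x RS.:+ u) RS.:+ (y RS.:+ v)) R.refl _ _ _ _)

  diag-unfold : ∀ F → diag F ≋ addS (F 0) (shift (diag (SS.tail F)))
  diag-unfold F zero    = R.sym (R.+-identityʳ _)
  diag-unfold F (suc n) = R.refl

  diag-0 : ∀ n → diag (λ _ _ → R.0#) n ~ R.0#
  diag-0 zero    = R.refl
  diag-0 (suc n) = R.trans (R.+-identityˡ _) (diag-0 n)

  diag-const : ∀ f → diag (SS.const f) ≋ f
  diag-const f zero    = R.refl
  diag-const f (suc n) = R.trans (R.+-congˡ (diag-0 n)) (R.+-identityʳ _)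

  diag-shift : ∀ F → diag (SS.shift F) ≋ shift (diag F)
  diag-shift F zero    = R.refl
  diag-shift F (suc n) = R.+-identityˡ _

  diag-scale : ∀ a F → diag (λ k → conv a (F k)) ≋ conv a (diag F)
  diag-scale a F n = R.trans (go F n) (S.conv-comm (diag F) a n)
    where
    go : ∀ F → diag (λ k → conv a (F k)) ≋ conv (diag F) a
    go F zero    = R.*-comm _ _
    go F (suc n) = begin
      conv a (F 0) (suc n) ⊕ diag (λ k → conv a (F (suc k))) n ≈⟨ R.+-cong (S.conv-comm a (F 0) (suc n)) (go (SS.tail F) n) ⟩
      conv (F 0) a (suc n) ⊕ conv (diag (SS.tail F)) a n ≈⟨ R.+-congˡ (S.conv-shiftˡ (diag (SS.tail F)) a (suc n)) ⟨
      addS (conv (F 0) a) (conv (shift (diag (SS.tail F))) a) (suc n) ≈⟨ S.conv-distribʳ a (F 0) (shift (diag (SS.tail F))) (suc n) ⟨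
      conv (addS (F 0) (shift (diag (SS.tail F)))) a (suc n) ≈⟨ S.conv-cong (diag-unfold F) (λ _ → R.refl) (suc n) ⟨
      conv (diag F) a (suc n) ∎

  -- With `diag-+` and `diag-const`, this makes `diag` a ring homomorphism. The equations of the
  -- tree series hold over every coefficient ring; taken over power series they allow a series in
  -- place of the variable `x`, and `diag` then merges the two size variables.
  diag-* : ∀ F G → diag (SS.conv F G) ≋ conv (diag F) (diag G)
  diag-* F G zero    = R.refl
  diag-* F G (suc n) = begin
    conv (F 0) (G 0) (suc n) ⊕ diag (SS.tail (SS.conv F G)) n
      ≈⟨ R.+-congˡ (diag-+ (λ k → conv (F 0) (G (suc k))) (SS.conv (SS.tail F) G) n) ⟩
    conv (F 0) (G 0) (suc n) ⊕ (diag (λ k → conv (F 0) (G (suc k))) n ⊕ diag (SS.conv (SS.tail F) G) n)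
      ≈⟨ R.+-assoc _ _ _ ⟨
    (conv (F 0) (G 0) (suc n) ⊕ diag (λ k → conv (F 0) (G (suc k))) n) ⊕ diag (SS.conv (SS.tail F) G) n
      ≈⟨ R.+-cong (diag-scale (F 0) G (suc n)) (diag-* (SS.tail F) G n) ⟩
    conv (F 0) (diag G) (suc n) ⊕ conv (diag (SS.tail F)) (diag G) n
      ≈⟨ R.+-congˡ (S.conv-shiftˡ (diag (SS.tail F)) (diag G) (suc n)) ⟨
    addS (conv (F 0) (diag G)) (conv (shift (diag (SS.tail F))) (diag G)) (suc n)
      ≈⟨ S.conv-distribʳ (diag G) (F 0) (shift (diag (SS.tail F))) (suc n) ⟨
    conv (addS (F 0) (shift (diag (SS.tail F)))) (diag G) (suc n)
      ≈⟨ S.conv-cong (diag-unfold F) (λ _ → R.refl) (suc n) ⟨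
    conv (diag F) (diag G) (suc n) ∎

-- Weighted binary trees and their generating functions

data Tree : Set
weight : Tree → ℕ

data Tree where
  leaf : Tree
  node : (t₁ : Tree) → Fin (weight t₁) → Tree → Tree

weight leaf = 1
weight (node t₁ j t₂) = suc (toℕ j) + weight t₂

leaves depth : Tree → ℕ
leaves leaf = 1
leaves (node t₁ j t₂) = leaves t₁ + leaves t₂
depth leaf = 1
depth (node t₁ j t₂) = suc (depth t₁)

grafts : Tree → List Tree → List Tree
grafts t₁ ts = concatMap (λ j → map (node t₁ j) ts) (allFin (weight t₁))

combine : List Tree → List Tree → List Tree
combine ss ts = concatMap (λ t₁ → grafts t₁ ts) ss

-- The recursion copies that of `conv`, so that sums over these lists become products of series
-- clause by clause.
convT : (ℕ → List Tree) → (ℕ → List Tree) → ℕ → List Tree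
convT f g zero    = combine (f 0) (g 0)
convT f g (suc n) = combine (f 0) (g (suc n)) ++ convT (λ k → f (suc k)) g n

convT-local : ∀ {f f′ g g′} n → (∀ k → k ≤ n → f k ≡ f′ k) → (∀ k → k ≤ n → g k ≡ g′ k) → convT f g n ≡ convT f′ g′ n
convT-local zero    p q = cong₂ combine (p 0 z≤n) (q 0 z≤n)
convT-local (suc n) p q = cong₂ _++_ (cong₂ combine (p 0 z≤n) (q (suc n) ≤-refl))
  (convT-local n (λ k le → p (suc k) (s≤s le)) (λ k le → q k (m≤n⇒m≤1+n le)))

-- The first argument bounds the recursion, which needs the lists of all smaller sizes at once; by
-- `treesBelow-stable` the bound is immaterial as soon as it exceeds the size.
treesBelow : ℕ → ℕ → List Tree
treesBelow zero    n = []
treesBelow (suc k) zero    = [ leaf ]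
treesBelow (suc k) (suc n) = convT (treesBelow k) (treesBelow k) n

treesBelow-stable : ∀ k k′ n → n < k → n < k′ → treesBelow k n ≡ treesBelow k′ n
treesBelow-stable (suc k) (suc k′) zero    lt lt′ = refl
treesBelow-stable (suc k) (suc k′) (suc n) (s≤s lt) (s≤s lt′) = convT-local n same same
  where
  same : ∀ j → j ≤ n → treesBelow k j ≡ treesBelow k′ j
  same j le = treesBelow-stable k k′ j (≤-<-trans le lt) (≤-<-trans le lt′)

-- With suc n leaves.
trees : ℕ → List Tree
trees n = treesBelow (suc n) n

trees-suc : ∀ n → trees (suc n) ≡ convT trees trees n
trees-suc n = convT-local n same same
  where
  same : ∀ j → j ≤ n → treesBelow (suc n) j ≡ trees j
  same j le = treesBelow-stable (suc n) (suc j) j (s≤s le) ≤-refl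

module Sums (R : CommutativeRing 0ℓ 0ℓ) where
  open CommutativeRing R using (0#; 1#) renaming (Carrier to A; _≈_ to _~_; _+_ to _⊕_; _*_ to _⊗_; -_ to ⊖_) public
  private
    module R = CommutativeRing R
    module RS = ℤSolver R
  open Relation.Binary.Reasoning.Setoid R.setoid
  open Algebra.Properties.Semiring.Mult R.semiring using (×-homo-+; ×1-homo-*; ×-congˡ) renaming (_×_ to _×ᵣ_)

  infixr 8 _↑_
  _↑_ : A → ℕ → A
  x ↑ zero  = 1#
  x ↑ suc n = x ⊗ (x ↑ n)

  ↑-+ : ∀ x m n → x ↑ (m + n) ~ x ↑ m ⊗ x ↑ n
  ↑-+ x zero    n = R.sym (R.*-identityˡ _)
  ↑-+ x (suc m) n = R.trans (R.*-congˡ (↑-+ x m n)) (R.sym (R.*-assoc _ _ _))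

  1↑ : ∀ n → 1# ↑ n ~ 1#
  1↑ zero    = R.refl
  1↑ (suc n) = R.trans (R.*-identityˡ _) (1↑ n)

  ι : ℕ → A
  ι n = n ×ᵣ 1#

  ι-+ : ∀ m n → ι (m + n) ~ ι m ⊕ ι n
  ι-+ = ×-homo-+ 1#

  ι-* : ∀ m n → ι (m * n) ~ ι m ⊗ ι n
  ι-* = ×1-homo-*

  Σ[_] : ∀ {B : Set} → (B → A) → List B → A
  Σ[ f ] [] = 0#
  Σ[ f ] (x ∷ xs) = f x ⊕ Σ[ f ] xs

  Σ-++ : ∀ {B : Set} (f : B → A) xs ys → Σ[ f ] (xs ++ ys) ~ Σ[ f ] xs ⊕ Σ[ f ] ys
  Σ-++ f [] ys = R.sym (R.+-identityˡ _)
  Σ-++ f (x ∷ xs) ys = R.trans (R.+-congˡ (Σ-++ f xs ys)) (R.sym (R.+-assoc _ _ _))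

  Σ-cong : ∀ {B : Set} {f g : B → A} → (∀ x → f x ~ g x) → ∀ xs → Σ[ f ] xs ~ Σ[ g ] xs
  Σ-cong e [] = R.refl
  Σ-cong e (x ∷ xs) = R.+-cong (e x) (Σ-cong e xs)

  Σ-scaleˡ : ∀ {B : Set} a (f : B → A) xs → Σ[ (λ x → a ⊗ f x) ] xs ~ a ⊗ Σ[ f ] xs
  Σ-scaleˡ a f [] = R.sym (R.zeroʳ _)
  Σ-scaleˡ a f (x ∷ xs) = R.trans (R.+-congˡ (Σ-scaleˡ a f xs)) (R.sym (R.distribˡ _ _ _))

  Σ-map : ∀ {B C : Set} (f : C → A) (g : B → C) xs → Σ[ f ] (map g xs) ≡ Σ[ (λ x → f (g x)) ] xs
  Σ-map f g [] = refl
  Σ-map f g (x ∷ xs) = cong (f (g x) ⊕_) (Σ-map f g xs)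

  Σ-concatMap : ∀ {B C : Set} (f : C → A) (g : B → List C) xs → Σ[ f ] (concatMap g xs) ~ Σ[ (λ x → Σ[ f ] (g x)) ] xs
  Σ-concatMap f g [] = R.refl
  Σ-concatMap f g (x ∷ xs) = R.trans (Σ-++ f (g x) (concatMap g xs)) (R.+-congˡ (Σ-concatMap f g xs))

  Σ-diff : ∀ {B : Set} (f g : B → A) xs → Σ[ (λ x → f x ⊕ (⊖ g x)) ] xs ~ Σ[ f ] xs ⊕ (⊖ Σ[ g ] xs)
  Σ-diff f g [] = R.sym (R.-‿inverseʳ 0#)
  Σ-diff f g (x ∷ xs) = R.trans (R.+-congˡ (Σ-diff f g xs))
    (RS.solve 4 (λ a b c d → (a RS.:+ RS.:- b) RS.:+ (c RS.:+ RS.:- d) RS.:= (a RS.:+ c) RS.:+ RS.:- (b RS.:+ d)) R.refl _ _ _ _)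

  geo : A → ℕ → A
  geo x zero    = 0#
  geo x (suc n) = 1# ⊕ x ⊗ geo x n

  geo-telescope : ∀ x n → (x ⊕ (⊖ 1#)) ⊗ geo x n ~ x ↑ n ⊕ (⊖ 1#)
  geo-telescope x zero    = RS.solve 1 (λ x → (x RS.:+ RS.:- RS.:1) RS.:* RS.:0 RS.:= RS.:1 RS.:+ RS.:- RS.:1) R.refl x
  geo-telescope x (suc n) = begin
    (x ⊕ (⊖ 1#)) ⊗ (1# ⊕ x ⊗ geo x n) ≈⟨ RS.solve 2 (λ x g → (x RS.:+ RS.:- RS.:1) RS.:* (RS.:1 RS.:+ x RS.:* g) RS.:= (x RS.:+ RS.:- RS.:1) RS.:+ x RS.:* ((x RS.:+ RS.:- RS.:1) RS.:* g)) R.refl x (geo x n) ⟩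
    (x ⊕ (⊖ 1#)) ⊕ x ⊗ ((x ⊕ (⊖ 1#)) ⊗ geo x n) ≈⟨ R.+-congˡ (R.*-congˡ (geo-telescope x n)) ⟩
    (x ⊕ (⊖ 1#)) ⊕ x ⊗ (x ↑ n ⊕ (⊖ 1#)) ≈⟨ RS.solve 2 (λ x y → (x RS.:+ RS.:- RS.:1) RS.:+ x RS.:* (y RS.:+ RS.:- RS.:1) RS.:= x RS.:* y RS.:+ RS.:- RS.:1) R.refl x (x ↑ n) ⟩
    x ⊗ x ↑ n ⊕ (⊖ 1#) ∎

  Σ-allFin : ∀ x n → Σ[ (λ (j : Fin n) → x ↑ toℕ j) ] (allFin n) ~ geo x n
  Σ-allFin x zero    = R.refl
  Σ-allFin x (suc n) = R.+-congˡ (begin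
    Σ[ (λ (j : Fin (suc n)) → x ↑ toℕ j) ] (tabulate {n = n} fsuc) ≡⟨ cong Σ[ (λ (j : Fin (suc n)) → x ↑ toℕ j) ] (map-tabulate {n = n} id fsuc) ⟨
    Σ[ (λ j → x ↑ toℕ j) ] (map fsuc (allFin n)) ≡⟨ Σ-map (λ (j : Fin (suc n)) → x ↑ toℕ j) fsuc (allFin n) ⟩
    Σ[ (λ j → x ⊗ x ↑ toℕ j) ] (allFin n) ≈⟨ Σ-scaleˡ x (λ j → x ↑ toℕ j) (allFin n) ⟩
    x ⊗ Σ[ (λ j → x ↑ toℕ j) ] (allFin n) ≈⟨ R.*-congˡ (Σ-allFin x n) ⟩
    x ⊗ geo x n ∎)

  module S = PowerSeries R
  open S using (PS; _≋_; conv; const; addS; shift) public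

  -- Bivariate generating function of depth and weight; v marks the depth.
  module _ (v x : A) where
    monomial : Tree → A
    monomial t = v ↑ depth t ⊗ x ↑ weight t

    J K : PS
    J n = Σ[ monomial ] (trees n)
    K n = Σ[ (λ t → v ↑ depth t ⊗ geo x (weight t)) ] (trees n)

  W : A → PS
  W x n = Σ[ (λ t → x ↑ weight t) ] (trees n)

  -- The divided difference (W x - W 1) / (x - 1), in the polynomial form that makes sense without
  -- dividing; see `G-eq`.
  G : A → PS
  G x n = Σ[ (λ t → geo x (weight t)) ] (trees n)

  private
    grafts-sum : ∀ (φ : Tree → A) a x t₁ ts → (∀ j t₂ → φ (node t₁ j t₂) ~ (a ⊗ (x ⊗ x ↑ toℕ j)) ⊗ x ↑ weight t₂) →
      Σ[ φ ] (grafts t₁ ts) ~ ((a ⊗ x) ⊗ geo x (weight t₁)) ⊗ Σ[ (λ t → x ↑ weight t) ] ts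
    grafts-sum φ a x t₁ ts e = begin
      Σ[ φ ] (grafts t₁ ts)
        ≈⟨ Σ-concatMap φ (λ j → map (node t₁ j) ts) (allFin (weight t₁)) ⟩
      Σ[ (λ j → Σ[ φ ] (map (node t₁ j) ts)) ] (allFin (weight t₁))
        ≈⟨ Σ-cong (λ j → R.trans (R.reflexive (Σ-map φ (node t₁ j) ts)) (R.trans (Σ-cong (e j) ts) (R.trans (Σ-scaleˡ _ _ ts)
             (RS.solve 4 (λ a x y s → (a RS.:* (x RS.:* y)) RS.:* s RS.:= ((a RS.:* x) RS.:* s) RS.:* y) R.refl a x (x ↑ toℕ j) _)))) (allFin (weight t₁)) ⟩
      Σ[ (λ j → ((a ⊗ x) ⊗ s) ⊗ x ↑ toℕ j) ] (allFin (weight t₁))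
        ≈⟨ R.trans (Σ-scaleˡ _ _ (allFin (weight t₁))) (R.*-congˡ (Σ-allFin x (weight t₁))) ⟩
      ((a ⊗ x) ⊗ s) ⊗ geo x (weight t₁)
        ≈⟨ RS.solve 3 (λ b s g → (b RS.:* s) RS.:* g RS.:= (b RS.:* g) RS.:* s) R.refl (a ⊗ x) s _ ⟩
      ((a ⊗ x) ⊗ geo x (weight t₁)) ⊗ s ∎
      where s = Σ[ (λ t → x ↑ weight t) ] ts

    combine-sum : ∀ (φ ψ : Tree → A) a x ss ts →
      (∀ t₁ j t₂ → φ (node t₁ j t₂) ~ ((a ⊗ ψ t₁) ⊗ (x ⊗ x ↑ toℕ j)) ⊗ x ↑ weight t₂) →
      Σ[ φ ] (combine ss ts) ~ ((a ⊗ x) ⊗ Σ[ (λ t → ψ t ⊗ geo x (weight t)) ] ss) ⊗ Σ[ (λ t → x ↑ weight t) ] ts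
    combine-sum φ ψ a x [] ts e = RS.solve 3 (λ a x s → RS.:0 RS.:= ((a RS.:* x) RS.:* RS.:0) RS.:* s) R.refl a x _
    combine-sum φ ψ a x (t ∷ ss) ts e = R.trans (Σ-++ φ (grafts t ts) (combine ss ts))
      (R.trans (R.+-cong (grafts-sum φ (a ⊗ ψ t) x t ts (e t)) (combine-sum φ ψ a x ss ts e))
        (RS.solve 6 (λ a p x g s r → ((a RS.:* p) RS.:* x RS.:* g) RS.:* s RS.:+ ((a RS.:* x) RS.:* r) RS.:* s RS.:= ((a RS.:* x) RS.:* (p RS.:* g RS.:+ r)) RS.:* s) R.refl a (ψ t) x _ _ _))

    convT-sum : ∀ (φ ψ : Tree → A) a x →
      (∀ t₁ j t₂ → φ (node t₁ j t₂) ~ ((a ⊗ ψ t₁) ⊗ (x ⊗ x ↑ toℕ j)) ⊗ x ↑ weight t₂) →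
      ∀ f g n → Σ[ φ ] (convT f g n) ~ conv (λ k → (a ⊗ x) ⊗ Σ[ (λ t → ψ t ⊗ geo x (weight t)) ] (f k)) (λ k → Σ[ (λ t → x ↑ weight t) ] (g k)) n
    convT-sum φ ψ a x e f g zero    = combine-sum φ ψ a x (f 0) (g 0) e
    convT-sum φ ψ a x e f g (suc n) = R.trans (Σ-++ φ (combine (f 0) (g (suc n))) _)
      (R.+-cong (combine-sum φ ψ a x (f 0) (g (suc n)) e) (convT-sum φ ψ a x e (λ k → f (suc k)) g n))

    trees-sum : ∀ (φ ψ : Tree → A) a x →
      (∀ t₁ j t₂ → φ (node t₁ j t₂) ~ ((a ⊗ ψ t₁) ⊗ (x ⊗ x ↑ toℕ j)) ⊗ x ↑ weight t₂) →
      (λ n → Σ[ φ ] (trees n)) ≋ addS (const (φ leaf)) (shift (conv (conv (const (a ⊗ x)) (λ k → Σ[ (λ t → ψ t ⊗ geo x (weight t)) ] (trees k))) (W x)))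
    trees-sum φ ψ a x e zero    = R.refl
    trees-sum φ ψ a x e (suc n) = R.trans (R.reflexive (cong Σ[ φ ] (trees-suc n)))
      (R.trans (convT-sum φ ψ a x e trees trees n)
        (R.trans (S.conv-cong (λ k → R.sym (S.conv-constˡ (a ⊗ x) _ k)) (λ k → R.refl) n) (R.sym (R.+-identityˡ _))))

  -- A node has depth one more than its first subtree, whence the factor `v`, and weight
  -- `1 + j + weight t₂`, whence `x` and `W x`. The sum of `x ↑ j` over the places of `t₁` is
  -- `geo x (weight t₁)`, which turns `J` into `K`.
  J-eq : ∀ v x → J v x ≋ addS (const (v ⊗ x)) (shift (conv (conv (const (v ⊗ x)) (K v x)) (W x)))
  J-eq v x n = R.trans (trees-sum (monomial v x) (λ t → v ↑ depth t) v x
      (λ t₁ j t₂ → R.trans (R.*-congˡ (↑-+ x (suc (toℕ j)) (weight t₂))) (R.sym (R.*-assoc _ _ _))) n)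
    (R.+-congʳ (const-cong n))
    where
    const-cong : const ((v ⊗ 1#) ⊗ (x ⊗ 1#)) ≋ const (v ⊗ x)
    const-cong zero    = R.*-cong (R.*-identityʳ v) (R.*-identityʳ x)
    const-cong (suc n) = R.refl

  W-eq : ∀ x → W x ≋ addS (const x) (shift (conv (conv (const x) (G x)) (W x)))
  W-eq x n = R.trans (trees-sum (λ t → x ↑ weight t) (λ _ → 1#) 1# x
      (λ t₁ j t₂ → R.trans (↑-+ x (suc (toℕ j)) (weight t₂)) (R.*-congʳ (RS.solve 1 (λ y → y RS.:= (RS.:1 RS.:* RS.:1) RS.:* y) R.refl _))) n)
    (R.+-cong (const-cong (R.*-identityʳ x) n) (S.shift-cong (S.conv-cong (S.conv-cong (const-cong (R.*-identityˡ x)) (λ k → Σ-cong (λ t → R.*-identityˡ _) (trees k))) (λ _ → R.refl)) n))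
    where
    const-cong : ∀ {a b} → a ~ b → const a ≋ const b
    const-cong e zero    = e
    const-cong e (suc n) = R.refl

  G-eq : ∀ x n → (x ⊕ (⊖ 1#)) ⊗ G x n ~ W x n ⊕ (⊖ W 1# n)
  G-eq x n = R.trans (R.sym (Σ-scaleˡ _ _ (trees n))) (R.trans (Σ-cong (λ t → R.trans (geo-telescope x (weight t)) (R.+-congˡ (R.-‿cong (R.sym (1↑ (weight t)))))) (trees n)) (Σ-diff _ _ (trees n)))

  K-eq : ∀ v x n → (x ⊕ (⊖ 1#)) ⊗ K v x n ~ J v x n ⊕ (⊖ J v 1# n)
  K-eq v x n = R.trans (R.sym (Σ-scaleˡ _ _ (trees n))) (R.trans (Σ-cong each (trees n)) (Σ-diff _ _ (trees n)))
    where
    each : ∀ t → (x ⊕ (⊖ 1#)) ⊗ (v ↑ depth t ⊗ geo x (weight t)) ~ monomial v x t ⊕ (⊖ monomial v 1# t)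
    each t = begin
      (x ⊕ (⊖ 1#)) ⊗ (d ⊗ geo x (weight t)) ≈⟨ RS.solve 3 (λ a d g → a RS.:* (d RS.:* g) RS.:= d RS.:* (a RS.:* g)) R.refl _ _ _ ⟩
      d ⊗ ((x ⊕ (⊖ 1#)) ⊗ geo x (weight t)) ≈⟨ R.*-congˡ (R.trans (geo-telescope x (weight t)) (R.+-congˡ (R.-‿cong (R.sym (1↑ (weight t)))))) ⟩
      d ⊗ (x ↑ weight t ⊕ (⊖ 1# ↑ weight t)) ≈⟨ RS.solve 3 (λ d y z → d RS.:* (y RS.:+ RS.:- z) RS.:= d RS.:* y RS.:+ RS.:- (d RS.:* z)) R.refl _ _ _ ⟩
      monomial v x t ⊕ (⊖ monomial v 1# t) ∎
      where d = v ↑ depth t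

module TreeSeries (R : CommutativeRing 0ℓ 0ℓ) (v : CommutativeRing.Carrier R) where
  open Diagonal R public
  open S using (PS) public
  open R using () renaming (_≈_ to _~_; _+_ to _⊕_; _*_ to _⊗_; -_ to ⊖_) public
  module ΣR = Sums R
  module ΣS = Sums S.ring
  module Q  = CommutativeRing S.ring
  module QS = ℤSolver S.ring
  open Q using (_≈_; 1#; 0#) renaming (_+_ to _⊞_; _*_ to _⊡_; -_ to ⊟_) public
  open QS using (solve; _:+_; _:*_; :-_; _:=_; :1; :0) public

  -- The pattern of the algebraic proofs below: `e` collects known equations multiplied by suitable
  -- cofactors, and what remains as `d` is a polynomial identity for the solver.
  cancel : ∀ {x y u w} → u ≈ w → x ⊞ u ≈ y ⊞ w → x ≈ y
  cancel {x} {y} {u} {w} e d = Q.trans (solve 2 (λ x u → x := (x :+ u) :+ :- u) Q.refl x u)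
    (Q.trans (Q.+-cong d (Q.-‿cong e)) (solve 2 (λ y w → (y :+ w) :+ :- w := y) Q.refl y w))

  z cv p g f₁ : PS
  z  = S.var
  cv = S.const v
  p  = ΣR.W v
  g  = ΣR.G v
  f₁ = ΣR.W R.1#

  const-minus : cv ⊞ (⊟ 1#) ≈ S.const (v R.- R.1#)
  const-minus zero    = R.refl
  const-minus (suc n) = R.-‿inverseʳ R.0#

  p-eq : p ≈ cv ⊞ z ⊡ ((cv ⊡ g) ⊡ p)
  p-eq = Q.trans (ΣR.W-eq v) (Q.+-congˡ (S.shift≋var ((cv ⊡ g) ⊡ p)))

  g-eq : (cv ⊞ (⊟ 1#)) ⊡ g ≈ p ⊞ (⊟ f₁)
  g-eq = Q.trans (Q.*-congʳ (const-minus)) (Q.trans (S.conv-constˡ _ g) (ΣR.G-eq v))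

-- Kernel method: x := U in the functional equation of the bivariate series,
-- where W v = v U, turns the unknown specialisation x = 1 into v U.
module DepthWeight (R : CommutativeRing 0ℓ 0ℓ) (v : CommutativeRing.Carrier R)
  (v-1-regular : ∀ x → CommutativeRing._≈_ R (CommutativeRing._*_ R (CommutativeRing._-_ R v (CommutativeRing.1# R)) x) (CommutativeRing.0# R)
    → CommutativeRing._≈_ R x (CommutativeRing.0# R)) where

  open TreeSeries R v

  -- Chosen so that `p` is `v U` and `U - 1` is `z v U g`. Hence the kernel `x - 1 - z v x W(x)` of
  -- the equation for the depth vanishes at `x = U` as soon as `W(U)` is known to be `g`.
  U : PS
  U = 1# ⊞ z ⊡ (g ⊡ p)

  p≈vU : p ≈ cv ⊡ U
  p≈vU = Q.trans p-eq (solve 4 (λ v z g p → v :+ z :* ((v :* g) :* p) := v :* (:1 :+ z :* (g :* p))) Q.refl cv z g p)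

  U-eq : U ≈ 1# ⊞ z ⊡ (cv ⊡ (U ⊡ g))
  U-eq = Q.+-congˡ (Q.*-congˡ (Q.trans (Q.*-congˡ p≈vU) (solve 3 (λ v u g → g :* (v :* u) := v :* (u :* g)) Q.refl cv U g)))

  diag-equation : ∀ {F G H a b} → F SS.≋ SS.addS (SS.const a) (SS.shift (SS.conv (SS.conv (SS.const b) G) H)) →
    diag F ≈ a ⊞ z ⊡ ((b ⊡ diag G) ⊡ diag H)
  diag-equation {F} {G} {H} {a} {b} e = Q.trans (diag-cong e) (Q.trans (diag-+ (SS.const a) (SS.shift _))
    (Q.+-cong (diag-const a) (Q.trans (diag-shift _) (Q.trans (S.shift≋var _) (Q.*-congˡ
      (Q.trans (diag-* (SS.conv (SS.const b) G) H) (Q.*-congʳ (Q.trans (diag-* (SS.const b) G) (Q.*-congʳ (diag-const b))))))))))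

  diag-difference : ∀ {F G H} a → (∀ n → a ⊡ F n ≈ G n ⊞ (⊟ H n)) → a ⊡ diag F ≈ diag G ⊞ (⊟ diag H)
  diag-difference {F} {G} {H} a e = cancel Q.refl (Q.trans added (solve 2 (λ g h → g := (g :+ :- h) :+ h) Q.refl (diag G) (diag H)))
    where
    added : a ⊡ diag F ⊞ diag H ≈ diag G
    added = Q.trans (Q.+-congʳ (Q.sym (diag-scale a F))) (Q.trans (Q.sym (diag-+ _ H))
      (diag-cong λ n → Q.trans (Q.+-congʳ (e n)) (solve 2 (λ g h → (g :+ :- h) :+ h := g) Q.refl (G n) (H n))))

  const-* : ∀ a b → S.const a ⊡ S.const b ≈ S.const (a ⊗ b)
  const-* a b zero    = R.refl
  const-* a b (suc n) = R.trans (S.conv-constˡ a (S.const b) (suc n)) (R.zeroʳ a)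

  const-↑ : ∀ a n → S.const a ΣS.↑ n ≈ S.const (a ΣR.↑ n)
  const-↑ a zero    = Q.refl
  const-↑ a (suc n) = Q.trans (Q.*-congˡ (const-↑ a n)) (const-* a (a ΣR.↑ n))

  const-Σ : ∀ {B : Set} (F : B → PS) (f : B → R.Carrier) → (∀ x → F x ≈ S.const (f x)) → ∀ xs → ΣS.Σ[ F ] xs ≈ S.const (ΣR.Σ[ f ] xs)
  const-Σ F f e [] zero    = R.refl
  const-Σ F f e [] (suc n) = R.refl
  const-Σ F f e (x ∷ xs) n = R.trans (Q.+-cong (e x) (const-Σ F f e xs) n) (const-+ n)
    where
    const-+ : S.const (f x) ⊞ S.const (ΣR.Σ[ f ] xs) ≈ S.const (f x ⊕ ΣR.Σ[ f ] xs)
    const-+ zero    = R.refl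
    const-+ (suc n) = R.+-identityˡ _

  -- For the specialisations at `x = 1`, into which no series is substituted.
  diag-constants : ∀ {F : ℕ → PS} a → (∀ n → F n ≈ S.const (a n)) → diag F ≈ a
  diag-constants a e zero    = e 0 0
  diag-constants a e (suc n) = R.trans (R.+-cong (e 0 (suc n)) (diag-constants (λ k → a (suc k)) (λ k → e (suc k)) n)) (R.+-identityˡ _)

  y γ : PS
  y = diag (ΣS.W U)
  γ = diag (ΣS.G U)

  y-eq : y ≈ U ⊞ z ⊡ ((U ⊡ γ) ⊡ y)
  y-eq = diag-equation (ΣS.W-eq U)

  γ-eq : (U ⊞ (⊟ 1#)) ⊡ γ ≈ y ⊞ (⊟ f₁)
  γ-eq = Q.trans (diag-difference (U ⊞ (⊟ 1#)) (ΣS.G-eq U))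
    (Q.+-congˡ (Q.-‿cong (diag-constants f₁ (λ n → const-Σ _ (λ t → R.1# ΣR.↑ weight t) (λ t → const-↑ R.1# (weight t)) (trees n)))))

  -- Eliminating `γ` and `f₁` from the equations of `y`, `U`, `g` and `p` leaves
  -- `z U (p - y) (y - g) = 0`. All factors but the last are regular: `U` has constant term 1, and
  -- `p - y` has constant term `v - 1`.
  y≈g : y ≈ g
  y≈g = S.Regular-sub regular-p-y y g (S.Regular-sub regular-U _ _ (S.Regular-sub S.regular-var _ _ identity))
    where
    head-U : U 0 ~ R.1#
    head-U = R.trans (R.+-congˡ (R.zeroˡ _)) (R.+-identityʳ _)

    regular-U : S.Regular U
    regular-U = S.regular-head U λ x e → R.trans (R.sym (R.trans (R.*-congʳ head-U) (R.*-identityˡ x))) e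

    head-p-y : (p ⊞ (⊟ y)) 0 ~ (v R.- R.1#)
    head-p-y = R.+-cong (R.trans (R.+-identityʳ _) (R.*-identityʳ v))
      (R.-‿cong (R.trans (R.+-identityʳ _) (R.trans (R.*-identityʳ _) head-U)))

    regular-p-y : S.Regular (p ⊞ (⊟ y))
    regular-p-y = S.regular-head (p ⊞ (⊟ y)) λ x e → v-1-regular x (R.trans (R.sym (R.*-congʳ head-p-y)) e)

    identity : z ⊡ (U ⊡ ((p ⊞ (⊟ y)) ⊡ y)) ≈ z ⊡ (U ⊡ ((p ⊞ (⊟ y)) ⊡ g))
    identity = cancel
      (Q.+-cong (Q.+-cong (Q.+-cong (Q.+-cong
        (Q.*-congˡ {U ⊞ (⊟ 1#)} (Q.sym y-eq))
        (Q.*-congˡ {z ⊡ (U ⊡ y)} (Q.sym γ-eq)))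
        (Q.*-congˡ {⊟ (y ⊞ (⊟ U))} (Q.sym U-eq)))
        (Q.*-congˡ {⊟ (z ⊡ (U ⊡ y))} (Q.sym g-eq)))
        (Q.*-congˡ {⊟ (z ⊡ (U ⊡ g))} (Q.sym p≈vU)))
      (solve 8 (λ z v p g f U y γ →
          z :* (U :* ((p :+ :- y) :* y)) :+
            ((((((U :+ :- :1) :* (U :+ z :* ((U :* γ) :* y)))
              :+ (z :* (U :* y)) :* (y :+ :- f))
              :+ (:- (y :+ :- U)) :* (:1 :+ z :* (v :* (U :* g))))
              :+ (:- (z :* (U :* y))) :* (p :+ :- f))
              :+ (:- (z :* (U :* g))) :* (v :* U))
          := z :* (U :* ((p :+ :- y) :* g)) :+
            ((((((U :+ :- :1) :* y)
              :+ (z :* (U :* y)) :* ((U :+ :- :1) :* γ))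
              :+ (:- (y :+ :- U)) :* U)
              :+ (:- (z :* (U :* y))) :* ((v :+ :- :1) :* g))
              :+ (:- (z :* (U :* g))) :* p))
        Q.refl z cv p g f₁ U y γ)

  -- At `x = U` the equation is `j = v U + z v U k y`, and with `y ≈ g` its last term is
  -- `(U - 1) k`, which is `j - j₁`. So `j₁`, the wanted series, equals `v U`.
  depth-weight : ΣR.J v R.1# ≈ p
  depth-weight = Q.trans (Q.sym specialise) (cancel
      (Q.+-cong (Q.+-cong (Q.+-cong (Q.+-cong
        (Q.sym j-eq) (Q.sym k-eq))
        (Q.*-congˡ {z ⊡ ((cv ⊡ U) ⊡ k)} (Q.sym y≈g)))
        (Q.*-congˡ {k} U-eq)) p≈vU)
      (solve 9 (λ z v U j k j₁ p g y →
         j₁ :+ (((((v :* U :+ z :* (((v :* U) :* k) :* y)) :+ (j :+ :- j₁))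
            :+ (z :* ((v :* U) :* k)) :* g) :+ k :* U) :+ p)
         := p :+ ((((j :+ ((U :+ :- :1) :* k)) :+ (z :* ((v :* U) :* k)) :* y) :+ k :* (:1 :+ z :* (v :* (U :* g)))) :+ v :* U)) Q.refl z cv U j k j₁ p g y))
    where
    j k j₁ : PS
    j  = diag (ΣS.J cv U)
    k  = diag (ΣS.K cv U)
    j₁ = diag (ΣS.J cv 1#)

    j-eq : j ≈ cv ⊡ U ⊞ z ⊡ (((cv ⊡ U) ⊡ k) ⊡ y)
    j-eq = diag-equation (ΣS.J-eq cv U)

    k-eq : (U ⊞ (⊟ 1#)) ⊡ k ≈ j ⊞ (⊟ j₁)
    k-eq = diag-difference (U ⊞ (⊟ 1#)) (ΣS.K-eq cv U)

    specialise : j₁ ≈ ΣR.J v R.1#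
    specialise = diag-constants _ λ n → const-Σ _ (ΣR.monomial v R.1#)
      (λ t → Q.trans (Q.*-cong (const-↑ v (depth t)) (const-↑ R.1# (weight t))) (const-* _ _)) (trees n)

-- The coefficient of z^m in b^p, where b = 1 + z b^k.
raney : ℕ → ℕ → ℕ → ℕ
raney k zero    p = 1
raney k (suc m) zero    = 0
raney k (suc m) (suc p) = raney k (suc m) p + raney k m (p + k)

catalan : ℕ → ℕ
catalan d = raney 2 d 1

private
  module RaneyStep (k m q r₁ r₂ : ℕ) where
    open ≡-Reasoning
    open +-*-Solver
    A : ℕ
    A = k * m + k + q

    raney-step : r₁ * (suc m ! * A !) ≡ q * (m + A) ! → r₂ * (m ! * suc A !) ≡ suc (q + k) * (m + A) ! →
      (r₁ + r₂) * (suc m ! * (k * suc m + suc q) !) ≡ suc q * (suc m + k * suc m + q) !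
    raney-step first second = begin
      (r₁ + r₂) * (suc m ! * (k * suc m + suc q) !)
        ≡⟨ cong (λ x → (r₁ + r₂) * (suc m ! * x !)) (solve 3 (λ k m q → k :* (con 1 :+ m) :+ (con 1 :+ q) := con 1 :+ (k :* m :+ k :+ q)) refl k m q) ⟩
      (r₁ + r₂) * ((suc m * m !) * (suc A * A !))
        ≡⟨ solve 6 (λ r₁ r₂ m f A g → (r₁ :+ r₂) :* (((con 1 :+ m) :* f) :* ((con 1 :+ A) :* g)) :=
             (con 1 :+ A) :* (r₁ :* (((con 1 :+ m) :* f) :* g)) :+ (con 1 :+ m) :* (r₂ :* (f :* ((con 1 :+ A) :* g)))) refl r₁ r₂ m (m !) A (A !) ⟩
      suc A * (r₁ * (suc m ! * A !)) + suc m * (r₂ * (m ! * suc A !))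
        ≡⟨ cong₂ (λ x y → suc A * x + suc m * y) first second ⟩
      suc A * (q * (m + A) !) + suc m * (suc (q + k) * (m + A) !)
        ≡⟨ solve 4 (λ q k m f → let A = k :* m :+ k :+ q in
             (con 1 :+ A) :* (q :* f) :+ (con 1 :+ m) :* ((con 1 :+ (q :+ k)) :* f) := (con 1 :+ q) :* ((con 1 :+ (m :+ A)) :* f)) refl q k m ((m + A) !) ⟩
      suc q * (suc (m + A)) !
        ≡⟨ cong (λ x → suc q * x !) (solve 3 (λ k m q → con 1 :+ (m :+ (k :* m :+ k :+ q)) := con 1 :+ m :+ k :* (con 1 :+ m) :+ q) refl k m q) ⟩
      suc q * (suc m + k * suc m + q) ! ∎

-- With `p = q + 1` this is the Raney number `p / ((k + 1) m + p)` times the binomial coefficient of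
-- `(k + 1) m + p` over `m`, with denominators cleared. In the recursion of `raney` both terms lead
-- to the same factorial `(m + A) !`, so that their coefficients simply add up.
raney-formula : ∀ k m q → raney (suc k) m (suc q) * (m ! * (k * m + suc q) !) ≡ suc q * (m + k * m + q) !
raney-formula k zero    q rewrite ℕP.*-zeroʳ k = trans (ℕP.*-identityˡ _) (ℕP.*-identityˡ _)
raney-formula k (suc m) zero = RaneyStep.raney-step k m 0 0 (raney (suc k) m (suc k)) refl
    (trans (cong (λ y → raney (suc k) m (suc k) * (m ! * y !)) (solve 2 (λ k m → con 1 :+ (k :* m :+ k :+ con 0) := k :* m :+ (con 1 :+ k)) refl k m))
      (trans (raney-formula k m k)
        (cong (λ x → suc k * x !) (solve 2 (λ k m → m :+ k :* m :+ k := m :+ (k :* m :+ k :+ con 0)) refl k m))))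
  where open +-*-Solver
raney-formula k (suc m) (suc q) = RaneyStep.raney-step k m (suc q) (raney (suc k) (suc m) (suc q)) (raney (suc k) m (suc q + suc k))
    (trans (cong (λ x → raney (suc k) (suc m) (suc q) * (suc m ! * x !)) (solve 3 (λ k m q → k :* m :+ k :+ (con 1 :+ q) := k :* (con 1 :+ m) :+ (con 1 :+ q)) refl k m q))
      (trans (raney-formula k (suc m) q)
        (cong (λ x → suc q * x !) (solve 3 (λ k m q → con 1 :+ m :+ k :* (con 1 :+ m) :+ q := m :+ (k :* m :+ k :+ (con 1 :+ q))) refl k m q))))
    (trans (cong (λ y → raney (suc k) m (suc (q + suc k)) * (m ! * y !))
        (solve 3 (λ k m q → con 1 :+ (k :* m :+ k :+ (con 1 :+ q)) := k :* m :+ (con 1 :+ (q :+ (con 1 :+ k)))) refl k m q))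
      (trans (raney-formula k m (q + suc k))
        (cong₂ (λ y x → y * x !) (cong suc (+-suc q k)) (solve 3 (λ k m q → m :+ k :* m :+ (q :+ (con 1 :+ k)) := m :+ (k :* m :+ k :+ (con 1 :+ q))) refl k m q))))
  where open +-*-Solver

module Root (R : CommutativeRing 0ℓ 0ℓ) where
  private
    module R  = CommutativeRing R
    module S  = PowerSeries R
    module Q  = CommutativeRing S.ring
    module ΣR = Sums R
    module ΣS = Sums S.ring
    open R using () renaming (_≈_ to _~_; _+_ to _⊕_; _*_ to _⊗_)

  ↑-local : ∀ k → S.Local (λ b → b ΣS.↑ k)
  ↑-local zero    n e = R.refl
  ↑-local (suc k) n e = S.conv-local n e (λ j le → ↑-local k j (λ i i≤j → e i (≤-trans i≤j le)))

  root : ℕ → S.PS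
  root k = S.Fixpoint.fix (λ b → b ΣS.↑ k) (↑-local k)

  root-eq : ∀ k → root k S.≋ S.addS (S.const R.1#) (S.shift (root k ΣS.↑ k))
  root-eq k = S.Fixpoint.fix-eq (λ b → b ΣS.↑ k) (↑-local k)

  root-suc : ∀ k p → root k ΣS.↑ suc p S.≋ S.addS (root k ΣS.↑ p) (S.shift (root k ΣS.↑ (p + k)))
  root-suc k p = Q.trans (Q.*-congʳ (root-eq k)) (Q.trans (Q.distribʳ _ _ _)
    (Q.+-cong (Q.*-identityˡ _) (Q.trans (S.conv-shiftˡ _ _) (S.shift-cong
      (Q.trans (Q.*-comm _ _) (Q.sym (ΣS.↑-+ (root k) p k)))))))

  root-coefficient : ∀ k m p → (root k ΣS.↑ p) m ~ ΣR.ι (raney k m p)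
  root-coefficient k zero    zero    = R.sym (R.+-identityʳ _)
  root-coefficient k zero    (suc p) = R.trans (R.*-cong (R.+-identityʳ _) (root-coefficient k zero p)) (R.*-identityˡ _)
  root-coefficient k (suc m) zero    = R.refl
  root-coefficient k (suc m) (suc p) = R.trans (root-suc k p (suc m))
    (R.trans (R.+-cong (root-coefficient k (suc m) p) (root-coefficient k m (p + k))) (R.sym (ΣR.ι-+ (raney k (suc m) p) (raney k m (p + k)))))

-- Coefficients of the two parts of the solution, before the division by z.
N₁ N₂ : ℕ → ℕ → ℕ
N₁ d m = catalan d * raney 4 m (suc (d + d))
N₂ d m = catalan d * raney 4 m (suc (suc (d + d)))

-- B = 1 + z B⁴ and c = 1 + z v B² c², the Catalan series at z v B².
module Candidate (R : CommutativeRing 0ℓ 0ℓ) (v : CommutativeRing.Carrier R) where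
  open TreeSeries R v public
  open Root R
  private
    module RS = ℤSolver R

  B κ u : PS
  B  = root 4
  κ  = root 2
  u  = cv ⊡ (B ⊡ B)

  -- The series a(w u).
  scaled : PS → SS.PS
  scaled a d = S.const (a d) ⊡ u ΣS.↑ d

  const-+ : ∀ a b → S.const (a ⊕ b) ≈ S.const a ⊞ S.const b
  const-+ a b zero    = R.refl
  const-+ a b (suc n) = R.sym (R.+-identityʳ _)

  const-* : ∀ a b → S.const (a ⊗ b) ≈ S.const a ⊡ S.const b
  const-* a b zero    = R.refl
  const-* a b (suc n) = R.sym (R.trans (S.conv-constˡ a (S.const b) (suc n)) (R.zeroʳ a))

  scaled-* : ∀ a b → scaled (S.conv a b) SS.≋ SS.conv (scaled a) (scaled b)
  scaled-* a b zero    = Q.trans (Q.*-congʳ (const-* _ _)) (solve 2 (λ x y → (x :* y) :* :1 := (x :* :1) :* (y :* :1)) Q.refl _ _)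
  scaled-* a b (suc d) = Q.trans (Q.*-congʳ (Q.trans (const-+ _ _) (Q.+-congʳ (const-* _ _))))
    (Q.trans (solve 5 (λ x y t u p → (x :* y :+ t) :* (u :* p) := (x :* :1) :* (y :* (u :* p)) :+ u :* (t :* p)) Q.refl _ _ _ _ _)
      (Q.+-congˡ (Q.trans (Q.*-congˡ (scaled-* (S.tail a) b d)) (Q.trans (Q.sym (SS.conv-scale u (scaled (S.tail a)) (scaled b) d))
        (SS.conv-cong {g′ = scaled b} (λ k → solve 3 (λ u x p → u :* (x :* p) := x :* (u :* p)) Q.refl u _ _) (λ _ → Q.refl) d)))))

  c : PS
  c = diag (scaled κ)

  c-eq : c ≈ 1# ⊞ z ⊡ (u ⊡ (c ⊡ c))
  c-eq = Q.trans (diag-cong unfold) (Q.trans (diag-+ (SS.const 1#) (SS.shift _)) (Q.+-cong (diag-const 1#)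
      (Q.trans (diag-shift _) (Q.trans (S.shift≋var _) (Q.*-congˡ (Q.trans (diag-scale u _) (Q.*-congˡ (diag-* (scaled κ) (scaled κ)))))))))
    where
    κ² : ∀ d → κ (suc d) ~ S.conv κ κ d
    κ² d = R.trans (root-eq 2 (suc d)) (R.trans (R.+-identityˡ _) (S.conv-cong {κ} {κ} (λ _ → R.refl) (λ n → R.trans (S.conv-comm κ (S.const R.1#) n) (R.trans (S.conv-constˡ R.1# κ n) (R.*-identityˡ _))) d))

    const-cong : ∀ {a b} → a ~ b → S.const a ≈ S.const b
    const-cong e zero    = e
    const-cong e (suc n) = R.refl

    unfold : scaled κ SS.≋ SS.addS (SS.const 1#) (SS.shift (λ d → u ⊡ SS.conv (scaled κ) (scaled κ) d))
    unfold zero    = Q.trans (Q.*-identityʳ _) (Q.trans (const-cong (R.+-identityʳ R.1#)) (Q.sym (Q.+-identityʳ _)))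
    unfold (suc d) = Q.trans (Q.*-congʳ (const-cong (κ² d))) (Q.trans (solve 3 (λ x u p → x :* (u :* p) := u :* (x :* p)) Q.refl _ _ _)
      (Q.trans (Q.*-congˡ (scaled-* κ κ d)) (Q.sym (Q.+-identityˡ _))))

  B-eq : B ≈ 1# ⊞ z ⊡ ((B ⊡ B) ⊡ (B ⊡ B))
  B-eq = Q.trans (root-eq 4) (Q.+-congˡ (Q.trans (S.shift≋var _) (Q.*-congˡ (solve 1 (λ b → b :* (b :* (b :* (b :* :1))) := (b :* b) :* (b :* b)) Q.refl B))))

  -- The guessed values of `p` and `f₁`: by `X-eq` they satisfy the same relation as these do by
  -- `p-equation`, and by `X≈f` they agree at `v = 1`, as they must.
  X f : PS
  X = cv ⊡ (B ⊡ c) ⊞ (⊟ ((B ⊡ B) ⊡ (c ⊞ (⊟ 1#))))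
  f = (B ⊡ B) ⊡ ((1# ⊞ 1#) ⊞ (⊟ B))

  X-eq : (cv ⊞ (⊟ 1#)) ⊡ X ≈ (cv ⊞ (⊟ 1#)) ⊡ cv ⊞ z ⊡ (cv ⊡ ((X ⊞ (⊟ f)) ⊡ X))
  X-eq = cancel (Q.+-cong
      -- The cofactors of the equations of `c` and `B` that reduce the claim to an identity in the
      -- free variables `z`, `v`, `B`, `c`.
      (Q.*-congˡ {cv ⊡ cv ⊞ (⊟ (cv ⊡ B ⊞ cv ⊡ B)) ⊞ B ⊡ B} (Q.sym c-eq))
      (Q.*-congˡ {cv ⊡ (1# ⊞ (⊟ (c ⊞ c))) ⊞ (cv ⊡ cv) ⊡ c ⊞ (cv ⊡ ((1# ⊞ 1#) ⊞ (⊟ B))) ⊡ (c ⊞ (⊟ 1#))} (Q.sym B-eq)))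
    (solve 4 (λ z v B c → let X = v :* (B :* c) :+ :- ((B :* B) :* (c :+ :- :1))
                              f = (B :* B) :* ((:1 :+ :1) :+ :- B)
                              k = v :* v :+ :- (v :* B :+ v :* B) :+ B :* B
                              l = v :* (:1 :+ :- (c :+ c)) :+ (v :* v) :* c :+ (v :* ((:1 :+ :1) :+ :- B)) :* (c :+ :- :1) in
        (v :+ :- :1) :* X :+ (k :* (:1 :+ z :* ((v :* (B :* B)) :* (c :* c))) :+ l :* (:1 :+ z :* ((B :* B) :* (B :* B))))
        := ((v :+ :- :1) :* v :+ z :* (v :* ((X :+ :- f) :* X))) :+ (k :* c :+ l :* B))
      Q.refl z cv B c)

  -- The coefficient of `z^n` in the double series with terms `a d m v^d z^(d + m)`, in Horner form.
  expansion : (ℕ → ℕ → ℕ) → PS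
  expansion a zero    = ΣR.ι (a 0 0)
  expansion a (suc n) = ΣR.ι (a 0 (suc n)) ⊕ v ⊗ expansion (λ d → a (suc d)) n

  diag-expansion : ∀ (F : ℕ → PS) a w → (∀ d m → F d m ~ w ⊗ (ΣR.ι (a d m) ⊗ v ΣR.↑ d)) → ∀ n → diag F n ~ w ⊗ expansion a n
  diag-expansion F a w e zero    = R.trans (e 0 0) (R.*-congˡ (R.*-identityʳ _))
  diag-expansion F a w e (suc n) = R.trans
    (R.+-cong (R.trans (e 0 (suc n)) (R.*-congˡ (R.*-identityʳ _)))
      (diag-expansion (SS.tail F) (λ d → a (suc d)) (w ⊗ v) (λ d m → R.trans (e (suc d) m)
        (RS.solve 4 (λ w x v p → w RS.:* (x RS.:* (v RS.:* p)) RS.:= (w RS.:* v) RS.:* (x RS.:* p)) R.refl w _ v _)) n))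
    (RS.solve 4 (λ w x v p → w RS.:* x RS.:+ (w RS.:* v) RS.:* p RS.:= w RS.:* (x RS.:+ v RS.:* p)) R.refl w _ v _)

  const-coefficient : ∀ a g n → (S.const a ⊡ g) n ~ a ⊗ g n
  const-coefficient a g n = S.conv-constˡ a g n

  u↑ : ∀ d → u ΣS.↑ d ≈ S.const (v ΣR.↑ d) ⊡ B ΣS.↑ (d + d)
  u↑ zero    = Q.sym (Q.*-identityˡ _)
  u↑ (suc d) = Q.trans (Q.*-congˡ (u↑ d)) (Q.trans
    (solve 4 (λ v b x y → (v :* (b :* b)) :* (x :* y) := (v :* x) :* (b :* (b :* y))) Q.refl cv B _ _)
    (Q.*-cong (Q.sym (const-* v (v ΣR.↑ d))) (Q.reflexive (cong (λ e → B ⊡ B ΣS.↑ e) (sym (+-suc d d))))))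

  κ-coefficient : ∀ d → κ d ~ ΣR.ι (catalan d)
  κ-coefficient d = R.trans (R.sym (Q.*-identityʳ κ d)) (root-coefficient 2 d 1)

  B↑c-coefficient : ∀ e n → (B ΣS.↑ e ⊡ c) n ~ expansion (λ d m → catalan d * raney 4 m (e + (d + d))) n
  B↑c-coefficient e n = R.trans (R.sym (diag-scale (B ΣS.↑ e) (scaled κ) n))
    (R.trans (diag-expansion _ _ R.1# term n) (R.*-identityˡ _))
    where
    term : ∀ d m → (B ΣS.↑ e ⊡ scaled κ d) m ~ R.1# ⊗ (ΣR.ι (catalan d * raney 4 m (e + (d + d))) ⊗ v ΣR.↑ d)
    term d m = R.trans (Q.trans (Q.*-congˡ (Q.*-congˡ (u↑ d))) (solve 4 (λ b x y p → b :* (x :* (y :* p)) := x :* (y :* (b :* p))) Q.refl _ _ _ _) m)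
      (R.trans (const-coefficient (κ d) _ m) (R.trans (R.*-cong (κ-coefficient d) (const-coefficient _ _ m))
        (R.trans (R.*-congˡ (R.*-congˡ (R.trans (Q.sym (ΣS.↑-+ B e (d + d)) m) (root-coefficient 4 m (e + (d + d))))))
          (R.trans (RS.solve 3 (λ x p y → x RS.:* (p RS.:* y) RS.:= RS.:1 RS.:* ((x RS.:* y) RS.:* p)) R.refl _ _ _)
            (R.*-congˡ (R.*-congʳ (R.sym (ΣR.ι-* (catalan d) _))))))))

  X-coefficient : ∀ n → X n ~ v ⊗ expansion N₁ n ⊕ (⊖ (expansion N₂ n ⊕ (⊖ ΣR.ι (raney 4 n 2))))
  X-coefficient n = R.+-cong
    (R.trans (const-coefficient v _ n) (R.*-congˡ (R.trans (Q.*-congʳ {c} (Q.sym (Q.*-identityʳ B)) n) (B↑c-coefficient 1 n))))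
    (R.-‿cong (R.trans (solve 2 (λ b c → (b :* b) :* (c :+ :- :1) := (b :* (b :* :1)) :* c :+ :- (b :* (b :* :1))) Q.refl B c n)
      (R.+-cong (B↑c-coefficient 2 n) (R.-‿cong (root-coefficient 4 n 2)))))

  f-coefficient : ∀ n → f n ~ (ΣR.ι (raney 4 n 2) ⊕ ΣR.ι (raney 4 n 2)) ⊕ (⊖ ΣR.ι (raney 4 n 3))
  f-coefficient n = R.trans
    (solve 1 (λ b → (b :* b) :* ((:1 :+ :1) :+ :- b) := (b :* (b :* :1) :+ b :* (b :* :1)) :+ :- (b :* (b :* (b :* :1)))) Q.refl B n)
    (R.+-cong (R.+-cong (root-coefficient 4 n 2) (root-coefficient 4 n 2)) (R.-‿cong (root-coefficient 4 n 3)))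

  p-equation : (cv ⊞ (⊟ 1#)) ⊡ p ≈ (cv ⊞ (⊟ 1#)) ⊡ cv ⊞ z ⊡ (cv ⊡ ((p ⊞ (⊟ f₁)) ⊡ p))
  p-equation = cancel (Q.+-cong (Q.*-congˡ {cv ⊞ (⊟ 1#)} (Q.sym p-eq)) (Q.*-congˡ {z ⊡ (cv ⊡ p)} (Q.sym g-eq)))
    (solve 5 (λ z v p g f → (v :+ :- :1) :* p :+ ((v :+ :- :1) :* (v :+ z :* ((v :* g) :* p)) :+ (z :* (v :* p)) :* (p :+ :- f))
      := ((v :+ :- :1) :* v :+ z :* (v :* ((p :+ :- f) :* p))) :+ ((v :+ :- :1) :* p :+ (z :* (v :* p)) :* ((v :+ :- :1) :* g))) Q.refl z cv p g f₁)

  -- Because of the factor `z`, coefficient `n` of the right side of `p-equation` involves only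
  -- coefficients below `n`, and `v - 1` cancels. The equation says nothing by itself about `f₁`,
  -- whose lower coefficients are therefore assumed as well.
  p-determined : (∀ x y → (v R.- R.1#) ⊗ x ~ (v R.- R.1#) ⊗ y → x ~ y) →
    ∀ n → (∀ k → k < n → p k ~ X k × f₁ k ~ f k) → p n ~ X n
  p-determined regular n ih = regular (p n) (X n) (R.trans (times p n) (R.trans (p-equation n)
    (R.trans (R.+-congˡ (step n ih)) (R.trans (R.sym (X-eq n)) (R.sym (times X n))))))
    where
    times : ∀ h n → (v R.- R.1#) ⊗ h n ~ ((cv ⊞ (⊟ 1#)) ⊡ h) n
    times h n = R.sym (R.trans (Q.*-congʳ {h} const-minus n) (const-coefficient _ h n))

    step : ∀ n → (∀ k → k < n → p k ~ X k × f₁ k ~ f k) → (z ⊡ (cv ⊡ ((p ⊞ (⊟ f₁)) ⊡ p))) n ~ (z ⊡ (cv ⊡ ((X ⊞ (⊟ f)) ⊡ X))) n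
    step zero    ih = R.trans (R.zeroˡ _) (R.sym (R.zeroˡ _))
    step (suc n) ih = R.trans (R.sym (S.shift≋var _ (suc n))) (R.trans (const-coefficient v _ n) (R.trans
      (R.*-congˡ (S.conv-local n (λ k le → R.+-cong (proj₁ (ih k (s≤s le))) (R.-‿cong (proj₂ (ih k (s≤s le))))) (λ k le → proj₁ (ih k (s≤s le)))))
      (R.trans (R.sym (const-coefficient v _ n)) (S.shift≋var _ (suc n)))))

  module _ (v≈1 : v ~ R.1#) where
    cv≈1 : cv ≈ 1#
    cv≈1 zero    = v≈1
    cv≈1 (suc n) = R.refl

    -- At `v = 1` both solve `y = 1 + z B² y²`. The difference of the two equations is
    -- `(1 - z B² (c + B)) (c - B) = 0`, and the first factor has constant term 1.
    c≈B : c ≈ B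
    c≈B = S.Regular-sub (S.regular-head (1# ⊞ (⊟ (z ⊡ ((B ⊡ B) ⊡ (c ⊞ B))))) λ x e → R.trans (R.sym (R.trans (R.*-congʳ head) (R.*-identityˡ x))) e) c B
      (cancel (Q.+-cong (Q.sym (Q.trans c-eq (Q.+-congˡ (Q.*-congˡ (Q.*-congʳ (Q.trans (Q.*-congʳ cv≈1) (Q.*-identityˡ _))))))) B-eq)
        (solve 3 (λ z b c → (:1 :+ :- (z :* ((b :* b) :* (c :+ b)))) :* c :+ ((:1 :+ z :* ((b :* b) :* (c :* c))) :+ b)
          := (:1 :+ :- (z :* ((b :* b) :* (c :+ b)))) :* b :+ (c :+ (:1 :+ z :* ((b :* b) :* (b :* b))))) Q.refl z B c))
      where
      head : (1# ⊞ (⊟ (z ⊡ ((B ⊡ B) ⊡ (c ⊞ B))))) 0 ~ R.1#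
      head = RS.solve 1 (λ x → RS.:1 RS.:+ RS.:- (RS.:0 RS.:* x) RS.:= RS.:1) R.refl _

    X≈f : X ≈ f
    X≈f = Q.trans (Q.+-cong (Q.*-cong cv≈1 (Q.*-congˡ c≈B)) (Q.-‿cong (Q.*-congˡ (Q.+-congʳ c≈B))))
      (solve 1 (λ b → :1 :* (b :* b) :+ :- ((b :* b) :* (b :+ :- :1)) := (b :* b) :* ((:1 :+ :1) :+ :- b)) Q.refl B)

-- Counting by lists without repetition; the list of all trees

module _ {A : Set} where
  lookup-injective : ∀ {xs : List A} → Unique xs → ∀ i j → lookup xs i ≡ lookup xs j → i ≡ j
  lookup-injective (x∉ ∷ u) fzero    fzero    e = refl
  lookup-injective (x∉ ∷ u) fzero    (fsuc j) e = contradiction e (All.lookup x∉ (∈-lookup j))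
  lookup-injective (x∉ ∷ u) (fsuc i) fzero    e = contradiction (sym e) (All.lookup x∉ (∈-lookup i))
  lookup-injective (x∉ ∷ u) (fsuc i) (fsuc j) e = cong fsuc (lookup-injective u i j e)

  lookup-∈ : ∀ {x : A} {xs} (p : x ∈ xs) → lookup xs (index p) ≡ x
  lookup-∈ p = sym (lookup-index p)

module _ {A B : Set} where
  length-≤ : ∀ {xs : List A} {ys : List B} (f : A → B) → Unique xs → (∀ {x} → x ∈ xs → f x ∈ ys) →
    (∀ {x y} → x ∈ xs → y ∈ xs → f x ≡ f y → x ≡ y) → length xs ≤ length ys
  length-≤ {xs} {ys} f u into inj = injective⇒≤ {f = λ i → index (into (∈-lookup i))} λ {i} {j} e →
    lookup-injective u i j (inj (∈-lookup i) (∈-lookup j)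
      (trans (sym (lookup-∈ (into (∈-lookup i)))) (trans (cong (lookup ys) e) (lookup-∈ (into (∈-lookup j))))))

  -- The pieces are disjoint because `key` reads off from any element which piece it comes from.
  unique-concatMap : ∀ {C : Set} (f : A → List B) (key : B → C) (k : A → C) → (∀ {x y} → k x ≡ k y → x ≡ y) →
    (∀ {x y} → y ∈ f x → key y ≡ k x) → ∀ {xs} → (∀ x → x ∈ xs → Unique (f x)) → Unique xs → Unique (concatMap f xs)
  unique-concatMap f key k inj keys {xs} uf u = Unique.concat⁺ (AllP.map⁺ (All.tabulate (uf _)))
    (AllPairsP.map⁺ (AllPairs.map (λ x≢y {_} pq → x≢y (inj (trans (sym (keys (proj₁ pq))) (keys (proj₂ pq))))) u))

module _ {A : Set} where
  length-⊆ : ∀ {xs ys : List A} → Unique xs → (∀ {x} → x ∈ xs → x ∈ ys) → length xs ≤ length ys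
  length-⊆ u into = length-≤ (λ x → x) u into (λ _ _ e → e)

  length-≡ : ∀ {xs ys : List A} → Unique xs → Unique ys → (∀ {x} → x ∈ xs → x ∈ ys) → (∀ {x} → x ∈ ys → x ∈ xs) → length xs ≡ length ys
  length-≡ u v p q = ≤-antisym (length-⊆ u p) (length-⊆ v q)

chosen : ∀ {n} {P : Fin n → Set} (P? : Decidable P) {x} → x ∈ filter P? (allFin n) → P x
chosen {n} P? x∈ = proj₂ (∈-filter⁻ P? {xs = allFin n} x∈)

count : ∀ {n} {P : Fin n → Set} → Decidable P → ℕ
count {n} P? = length (filter P? (allFin n))

module _ {m n} {P : Fin m → Set} {Q : Fin n → Set} (P? : Decidable P) (Q? : Decidable Q) where
  count-≤ : (f : Fin m → Fin n) → (∀ {x} → P x → Q (f x)) → (∀ {x y} → P x → P y → f x ≡ f y → x ≡ y) → count P? ≤ count Q?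
  count-≤ f into inj = length-≤ f (Unique.filter⁺ P? (Unique.allFin⁺ m))
    (λ x∈ → ∈-filter⁺ Q? (∈-allFin _) (into (chosen P? x∈)))
    (λ x∈ y∈ → inj (chosen P? x∈) (chosen P? y∈))

private
  left-subtree : Tree → Maybe Tree
  left-subtree leaf = nothing
  left-subtree (node t₁ _ _) = just t₁

  placeIndex : Tree → ℕ
  placeIndex leaf = 0
  placeIndex (node _ j _) = toℕ j

  just-injective : ∀ {x y : Tree} → just x ≡ just y → x ≡ y
  just-injective refl = refl

weight-≤ : ∀ t → weight t ≤ leaves t
weight-≤ leaf = ≤-refl
weight-≤ (node t₁ j t₂) = ℕP.+-mono-≤ (≤-trans (toℕ<n j) (weight-≤ t₁)) (weight-≤ t₂)

leaves>0 : ∀ t → 0 < leaves t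
leaves>0 leaf = s≤s z≤n
leaves>0 (node t₁ j t₂) = ≤-trans (leaves>0 t₁) (m≤m+n _ _)

last-place : ∀ t → Σ[ n ∈ ℕ ] suc n ≡ weight t
last-place leaf = 0 , refl
last-place (node t₁ j t₂) = toℕ j + weight t₂ , refl

weight>0 : ∀ t → 0 < weight t
weight>0 t = subst (0 <_) (proj₂ (last-place t)) (s≤s z≤n)

∈-grafts⁻ : ∀ {t} t₁ ts → t ∈ grafts t₁ ts → Σ[ j ∈ _ ] Σ[ t₂ ∈ Tree ] t₂ ∈ ts × t ≡ node t₁ j t₂
∈-grafts⁻ t₁ ts t∈ with find (∈-concatMap⁻ (λ j → map (node t₁ j) ts) {xs = allFin (weight t₁)} t∈)
... | j , _ , t∈′ with ∈-map⁻ (node t₁ j) t∈′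
...   | t₂ , t₂∈ , e = j , t₂ , t₂∈ , e

∈-grafts⁺ : ∀ t₁ ts j {t₂} → t₂ ∈ ts → node t₁ j t₂ ∈ grafts t₁ ts
∈-grafts⁺ t₁ ts j t₂∈ = ∈-concatMap⁺ (λ j → map (node t₁ j) ts) (lose (∈-allFin j) (∈-map⁺ (node t₁ j) t₂∈))

∈-combine⁻ : ∀ {t} ss ts → t ∈ combine ss ts → Σ[ t₁ ∈ Tree ] t₁ ∈ ss × t ∈ grafts t₁ ts
∈-combine⁻ ss ts t∈ = find (∈-concatMap⁻ (λ t₁ → grafts t₁ ts) {xs = ss} t∈)

∈-combine⁺ : ∀ ss ts {t₁} j {t₂} → t₁ ∈ ss → t₂ ∈ ts → node t₁ j t₂ ∈ combine ss ts
∈-combine⁺ ss ts j t₁∈ t₂∈ = ∈-concatMap⁺ (λ t₁ → grafts t₁ ts) (lose t₁∈ (∈-grafts⁺ _ ts j t₂∈))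

∈-convT⁻ : ∀ {t} f g n → t ∈ convT f g n → Σ[ k ∈ ℕ ] k ≤ n × Σ[ t₁ ∈ Tree ] t₁ ∈ f k × t ∈ grafts t₁ (g (n ∸ k))
∈-convT⁻ f g zero    t∈ = 0 , z≤n , ∈-combine⁻ (f 0) (g 0) t∈
∈-convT⁻ f g (suc n) t∈ with ∈-++⁻ (combine (f 0) (g (suc n))) t∈
... | inj₁ t∈′ = 0 , z≤n , ∈-combine⁻ (f 0) (g (suc n)) t∈′
... | inj₂ t∈′ with ∈-convT⁻ (λ k → f (suc k)) g n t∈′
...   | k , k≤n , r = suc k , s≤s k≤n , r

∈-convT⁺ : ∀ f g n k {t₁} j {t₂} → k ≤ n → t₁ ∈ f k → t₂ ∈ g (n ∸ k) → node t₁ j t₂ ∈ convT f g n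
∈-convT⁺ f g zero    .0 j z≤n t₁∈ t₂∈ = ∈-combine⁺ (f 0) (g 0) j t₁∈ t₂∈
∈-convT⁺ f g (suc n) zero    j le t₁∈ t₂∈ = ∈-++⁺ˡ (∈-combine⁺ (f 0) (g (suc n)) j t₁∈ t₂∈)
∈-convT⁺ f g (suc n) (suc k) j (s≤s le) t₁∈ t₂∈ = ∈-++⁺ʳ (combine (f 0) (g (suc n))) (∈-convT⁺ (λ k → f (suc k)) g n k j le t₁∈ t₂∈)

private
  sizes : ∀ b n → n < b → ∀ {t} → t ∈ trees n → leaves t ≡ suc n
  sizes (suc b) zero    lt (here refl) = refl
  sizes (suc b) (suc n) (s≤s lt) {t} t∈ with ∈-convT⁻ trees trees n (subst (t ∈_) (trees-suc n) t∈)
  ... | k , k≤n , t₁ , t₁∈ , t∈′ with ∈-grafts⁻ t₁ (trees (n ∸ k)) t∈′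
  ...   | j , t₂ , t₂∈ , refl = trans (cong₂ _+_ (sizes b k (≤-<-trans k≤n lt) t₁∈) (sizes b (n ∸ k) (≤-<-trans (ℕP.m∸n≤m n k) lt) t₂∈))
      (cong suc (trans (+-suc k (n ∸ k)) (cong suc (m+[n∸m]≡n k≤n))))

∈-trees-leaves : ∀ n {t} → t ∈ trees n → leaves t ≡ suc n
∈-trees-leaves n = sizes (suc n) n ≤-refl

∈-trees : ∀ t {n} → leaves t ≡ suc n → t ∈ trees n
∈-trees leaf refl = here refl
∈-trees (node t₁ j t₂) {n} e with leaves t₁ in e₁ | leaves>0 t₁ | leaves t₂ in e₂ | leaves>0 t₂
∈-trees (node t₁ j t₂) {zero} e  | suc k | _ | suc l | _ = contradiction (trans (sym (+-suc k l)) (suc-injective e)) λ ()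
∈-trees (node t₁ j t₂) {suc n} e | suc k | _ | suc l | _ = subst (node t₁ j t₂ ∈_) (sym (trees-suc n))
  (∈-convT⁺ trees trees n k j (subst (k ≤_) k+l (m≤m+n k l)) (∈-trees t₁ e₁)
    (subst (λ x → t₂ ∈ trees x) (trans (sym (m+n∸m≡n k l)) (cong (_∸ k) k+l)) (∈-trees t₂ e₂)))
  where
  k+l : k + l ≡ n
  k+l = suc-injective (trans (sym (+-suc k l)) (suc-injective e))

private
  unique-grafts : ∀ t₁ {ts} → Unique ts → Unique (grafts t₁ ts)
  unique-grafts t₁ {ts} u = unique-concatMap (λ j → map (node t₁ j) ts) placeIndex toℕ toℕ-injective
    (λ {j} y∈ → let (_ , _ , e) = ∈-map⁻ (node t₁ j) y∈ in cong placeIndex e)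
    (λ j _ → Unique.map⁺ (λ { refl → refl }) u) (Unique.allFin⁺ (weight t₁))

  unique-combine : ∀ {ss ts} → Unique ss → Unique ts → Unique (combine ss ts)
  unique-combine {ss} {ts} u v = unique-concatMap (λ t₁ → grafts t₁ ts) left-subtree just just-injective
    (λ {t₁} y∈ → let (_ , _ , _ , e) = ∈-grafts⁻ t₁ ts y∈ in cong left-subtree e)
    (λ t₁ _ → unique-grafts t₁ v) u

  unique-convT : ∀ f g n → (∀ k → k ≤ n → Unique (f k)) → (∀ k → k ≤ n → Unique (g k)) →
    (s : ℕ) → (∀ k {t} → t ∈ f k → leaves t ≡ s + k) → Unique (convT f g n)
  unique-convT f g zero    uf ug s sz = unique-combine (uf 0 z≤n) (ug 0 z≤n)
  unique-convT f g (suc n) uf ug s sz = Unique.++⁺ (unique-combine (uf 0 z≤n) (ug (suc n) ≤-refl))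
    (unique-convT (λ k → f (suc k)) g n (λ k le → uf (suc k) (s≤s le)) (λ k le → ug k (m≤n⇒m≤1+n le)) (suc s)
      (λ k t∈ → trans (sz (suc k) t∈) (+-suc s k)))
    disjoint
    where
    disjoint : ∀ {t} → ¬ (t ∈ combine (f 0) (g (suc n)) × t ∈ convT (λ k → f (suc k)) g n)
    disjoint (p , q) with ∈-combine⁻ (f 0) (g (suc n)) p | ∈-convT⁻ (λ k → f (suc k)) g n q
    ... | t₁ , t₁∈ , p′ | k , _ , t₂ , t₂∈ , q′ with ∈-grafts⁻ t₁ _ p′ | ∈-grafts⁻ t₂ _ q′
    ...   | _ , _ , _ , refl | _ , _ , _ , refl = contradiction
      (ℕP.+-cancelˡ-≡ s 0 (suc k) (trans (sym (sz 0 t₁∈)) (sz (suc k) t₂∈))) λ ()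

  uniques : ∀ b n → n < b → Unique (trees n)
  uniques (suc b) zero    lt = [] ∷ []
  uniques (suc b) (suc n) (s≤s lt) = subst Unique (sym (trees-suc n))
    (unique-convT trees trees n u u 1 (λ k → ∈-trees-leaves k))
    where
    u : ∀ k → k ≤ n → Unique (trees k)
    u k le = uniques b k (≤-<-trans le lt)

unique-trees : ∀ n → Unique (trees n)
unique-trees n = uniques (suc n) n ≤-refl

-- Solving the functional equation and extracting coefficients

module Coefficients where
  Z : CommutativeRing _ _
  Z = ℤP.+-*-commutativeRing

  module V  = PowerSeries Z
  module ΣZ = Sums Z
  module ΣV = Sums V.ring
  module VR = CommutativeRing V.ring

  v : V.PS
  v = V.var

  v-1-regular : V.Regular (v VR.- VR.1#)
  v-1-regular = V.regular-head (v VR.- VR.1#) λ x e → ℤP.neg-injective (trans (sym (ℤP.-1*i≡-i x)) e)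

  δ : ℕ → ℕ → ℤ
  δ zero    zero    = + 1
  δ zero    (suc i) = + 0
  δ (suc k) zero    = + 0
  δ (suc k) (suc i) = δ k i

  v↑-coefficient : ∀ k i → (v ΣV.↑ k) i ≡ δ k i
  v↑-coefficient zero    zero    = refl
  v↑-coefficient zero    (suc i) = refl
  v↑-coefficient (suc k) zero    = refl
  v↑-coefficient (suc k) (suc i) = trans (sym (V.shift≋var (v ΣV.↑ k) (suc i))) (v↑-coefficient k i)

  Σ-coefficient : ∀ {B : Set} (f : B → V.PS) xs i → ΣV.Σ[ f ] xs i ≡ ΣZ.Σ[ (λ x → f x i) ] xs
  Σ-coefficient f [] i = refl
  Σ-coefficient f (x ∷ xs) i = cong (ℤ._+_ (f x i)) (Σ-coefficient f xs i)

  δ-≡ : ∀ k → δ k k ≡ + 1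
  δ-≡ zero    = refl
  δ-≡ (suc k) = δ-≡ k

  δ-≢ : ∀ k i → k ≢ i → δ k i ≡ + 0
  δ-≢ zero    zero    ne = contradiction refl ne
  δ-≢ zero    (suc i) ne = refl
  δ-≢ (suc k) zero    ne = refl
  δ-≢ (suc k) (suc i) ne = δ-≢ k i (ne ∘ cong suc)

  Σδ : ∀ {B : Set} (s : B → ℕ) xs i → ΣZ.Σ[ (λ x → δ (s x) i) ] xs ≡ + length (filter (λ x → s x ℕP.≟ i) xs)
  Σδ s [] i = refl
  Σδ s (x ∷ xs) i with s x ℕP.≟ i
  ... | yes refl = trans (cong₂ ℤ._+_ (δ-≡ (s x)) (Σδ s xs i)) (cong (+_ ∘ length) (sym (filter-accept (λ x → s x ℕP.≟ i) refl)))
  ... | no  ne   = trans (cong₂ ℤ._+_ (δ-≢ (s x) i ne) (Σδ s xs i))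
    (trans (ℤP.+-identityˡ _) (cong (+_ ∘ length) (sym (filter-reject (λ x → s x ℕP.≟ i) ne))))

  ι-coefficient : ∀ k i → ΣV.ι k (suc i) ≡ + 0
  ι-coefficient zero    i = refl
  ι-coefficient (suc k) i = trans (ℤP.+-identityˡ _) (ι-coefficient k i)

  ι-head : ∀ k → ΣV.ι k 0 ≡ + k
  ι-head zero    = refl
  ι-head (suc k) = cong (ℤ._+_ (+ 1)) (ι-head k)

  ιZ : ∀ k → ΣZ.ι k ≡ + k
  ιZ zero    = refl
  ιZ (suc k) = cong (ℤ._+_ (+ 1)) (ιZ k)

countTrees : (Tree → ℕ) → ℕ → ℕ → ℕ
countTrees s n i = length (filter (λ t → s t ℕP.≟ i) (trees n))

module CountingProof where
  private
    open Coefficients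
    module DW = DepthWeight V.ring v v-1-regular
    module C  = Candidate V.ring v
    module C₁ = Candidate Z (+ 1)

    weight-series : ∀ n i → C.p n i ≡ + countTrees weight n i
    weight-series n i = trans (Σ-coefficient _ (trees n) i) (trans (ΣZ.Σ-cong (λ t → v↑-coefficient (weight t) i) (trees n)) (Σδ weight (trees n) i))

  countTrees-depth : ∀ n i → countTrees depth n i ≡ countTrees weight n i
  countTrees-depth n i = ℤP.+-injective (begin
    + countTrees depth n i ≡⟨ Σδ depth (trees n) i ⟨
    ΣZ.Σ[ (λ t → δ (depth t) i) ] (trees n) ≡⟨ ΣZ.Σ-cong (λ t → sym (trans (VR.trans (VR.*-congˡ {v ΣV.↑ depth t} (ΣV.1↑ (weight t))) (VR.*-identityʳ _) i) (v↑-coefficient (depth t) i))) (trees n) ⟩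
    ΣZ.Σ[ (λ t → ΣV.monomial v VR.1# t i) ] (trees n) ≡⟨ Σ-coefficient _ (trees n) i ⟨
    ΣV.J v VR.1# n i ≡⟨ DW.depth-weight n i ⟩
    C.p n i ≡⟨ weight-series n i ⟩
    + countTrees weight n i ∎)
    where open ≡-Reasoning

  private
    -- Evaluation at v = 1 of a series of degree at most m.
    eval : ℕ → V.PS → ℤ
    eval zero    f = f 0
    eval (suc m) f = f 0 ℤ.+ eval m (V.tail f)

    eval-cong : ∀ m {f g} → f V.≋ g → eval m f ≡ eval m g
    eval-cong zero    e = e 0
    eval-cong (suc m) e = cong₂ ℤ._+_ (e 0) (eval-cong m (λ k → e (suc k)))

    eval-+ : ∀ m f g → eval m (V.addS f g) ≡ eval m f ℤ.+ eval m g
    eval-+ zero    f g = refl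
    eval-+ (suc m) f g = trans (cong (ℤ._+_ (f 0 ℤ.+ g 0)) (eval-+ m (V.tail f) (V.tail g)))
      (ZS.solve 4 (λ x y u v → (x ZS.:+ y) ZS.:+ (u ZS.:+ v) ZS.:= (x ZS.:+ u) ZS.:+ (y ZS.:+ v)) refl (f 0) (g 0) _ _)
      where module ZS = ℤSolver Z

    eval-neg : ∀ m f → eval m (λ n → ℤ.- f n) ≡ ℤ.- eval m f
    eval-neg zero    f = refl
    eval-neg (suc m) f = trans (cong (ℤ._+_ (ℤ.- f 0)) (eval-neg m (V.tail f))) (sym (ℤP.neg-distrib-+ (f 0) _))

    eval-0 : ∀ m → eval m (λ _ → + 0) ≡ + 0
    eval-0 zero    = refl
    eval-0 (suc m) = trans (ℤP.+-identityˡ _) (eval-0 m)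

    eval-ι : ∀ m k → eval m (ΣV.ι k) ≡ + k
    eval-ι zero    k = ι-head k
    eval-ι (suc m) k = trans (cong₂ ℤ._+_ (ι-head k) (trans (eval-cong m (ι-coefficient k)) (eval-0 m))) (ℤP.+-identityʳ _)

    eval-v : ∀ m f → eval (suc m) (V.conv v f) ≡ eval m f
    eval-v m f = trans (eval-cong (suc m) (λ k → sym (V.shift≋var f k))) (ℤP.+-identityˡ _)

    eval-δ : ∀ m k → k ≤ m → eval m (δ k) ≡ + 1
    eval-δ zero    .0 z≤n = refl
    eval-δ (suc m) zero    le = cong (λ x → + 1 ℤ.+ x) (eval-0 m)
    eval-δ (suc m) (suc k) (s≤s le) = trans (ℤP.+-identityˡ _) (eval-δ m k le)

    eval-expansion : ∀ a n m → n ≤ m → eval m (C.expansion a n) ≡ C₁.expansion a n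
    eval-expansion a zero    m le = trans (eval-ι m (a 0 0)) (sym (ιZ (a 0 0)))
    eval-expansion a (suc n) (suc m) (s≤s le) = trans (eval-+ (suc m) (ΣV.ι (a 0 (suc n))) (V.conv v (C.expansion (λ d → a (suc d)) n)))
      (cong₂ ℤ._+_ (trans (eval-ι (suc m) (a 0 (suc n))) (sym (ιZ (a 0 (suc n)))))
        (trans (eval-v m (C.expansion (λ d → a (suc d)) n)) (trans (eval-expansion (λ d → a (suc d)) n m le) (sym (ℤP.*-identityˡ _)))))

    eval-X : ∀ n → eval (suc n) (C.X n) ≡ C₁.X n
    eval-X n = begin
      eval (suc n) (C.X n)
        ≡⟨ eval-cong (suc n) (C.X-coefficient n) ⟩
      eval (suc n) (V.addS (V.conv v E₁) (λ k → ℤ.- (E₂ k ℤ.+ ℤ.- ΣV.ι (raney 4 n 2) k)))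
        ≡⟨ eval-+ (suc n) (V.conv v E₁) (λ k → ℤ.- (E₂ k ℤ.+ ℤ.- ΣV.ι (raney 4 n 2) k)) ⟩
      eval (suc n) (V.conv v E₁) ℤ.+ eval (suc n) (λ k → ℤ.- (E₂ k ℤ.+ ℤ.- ΣV.ι (raney 4 n 2) k))
        ≡⟨ cong₂ ℤ._+_ (trans (eval-v n E₁) (trans (eval-expansion N₁ n n ≤-refl) (sym (ℤP.*-identityˡ _))))
             (trans (eval-neg (suc n) (λ k → E₂ k ℤ.+ ℤ.- ΣV.ι (raney 4 n 2) k)) (cong ℤ.-_ (trans (eval-+ (suc n) E₂ (λ k → ℤ.- ΣV.ι (raney 4 n 2) k))
               (cong₂ ℤ._+_ (eval-expansion N₂ n (suc n) (n≤1+n n)) (trans (eval-neg (suc n) (ΣV.ι (raney 4 n 2))) (cong ℤ.-_ (trans (eval-ι (suc n) (raney 4 n 2)) (sym (ιZ (raney 4 n 2)))))))))) ⟩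
      + 1 ℤ.* C₁.expansion N₁ n ℤ.+ ℤ.- (C₁.expansion N₂ n ℤ.+ ℤ.- ΣZ.ι (raney 4 n 2))
        ≡⟨ C₁.X-coefficient n ⟨
      C₁.X n ∎
      where
      open ≡-Reasoning
      E₁ = C.expansion N₁ n
      E₂ = C.expansion N₂ n

    eval-Σ : ∀ m (xs : List Tree) → (∀ {t} → t ∈ xs → weight t ≤ m) → eval m (ΣV.Σ[ (λ t → v ΣV.↑ weight t) ] xs) ≡ + length xs
    eval-Σ m [] le = eval-0 m
    eval-Σ m (t ∷ xs) le = trans (eval-+ m (v ΣV.↑ weight t) (ΣV.Σ[ (λ t → v ΣV.↑ weight t) ] xs))
      (cong₂ ℤ._+_ (trans (eval-cong m (v↑-coefficient (weight t))) (eval-δ m (weight t) (le (here refl)))) (eval-Σ m xs (le ∘ there)))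

    Σ1 : ∀ (xs : List Tree) → ΣV.Σ[ (λ t → VR.1# ΣV.↑ weight t) ] xs V.≋ ΣV.ι (length xs)
    Σ1 [] = VR.refl
    Σ1 (t ∷ xs) = VR.+-cong (ΣV.1↑ (weight t)) (Σ1 xs)

    -- Joint induction: `solved` at `n` uses both statements below `n`, and `total` at `n` uses
    -- `solved` at `n`, since the number of trees is the value at `v = 1` of the polynomial `C.p n`,
    -- and that of `C.X n` is known from `X≈f`. The number `b` only bounds the recursion.
    solved : ∀ b n → n < b → C.p n V.≋ C.X n
    total  : ∀ b n → n < b → C.f₁ n V.≋ C.f n

    solved (suc b) n (s≤s le) = C.p-determined (λ x y → V.Regular-sub v-1-regular x y) n
      (λ k lt → solved b k (<-≤-trans lt le) , total b k (<-≤-trans lt le))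

    total b n lt = VR.trans (Σ1 (trees n)) (VR.trans
      (VS.solve 2 (λ x y → y VS.:= (y VS.:+ x) VS.:+ VS.:- x) VR.refl (ΣV.ι r₃) (ΣV.ι (length (trees n))))
      (VR.trans (VR.+-congʳ (VR.trans (VR.sym (ΣV.ι-+ (length (trees n)) r₃)) (VR.trans (VR.reflexive (cong ΣV.ι balance)) (ΣV.ι-+ r₂ r₂))))
        (VR.sym (C.f-coefficient n))))
      where
      module VS = ℤSolver V.ring
      open ≡-Reasoning
      r₂ = raney 4 n 2
      r₃ = raney 4 n 3

      in-ℤ : + length (trees n) ≡ (+ r₂ ℤ.+ + r₂) ℤ.+ ℤ.- + r₃
      in-ℤ = begin
        -- A tree with `suc n` leaves has weight at most `suc n`, so evaluation up to this degree
        -- loses nothing.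
        + length (trees n) ≡⟨ eval-Σ (suc n) (trees n) (λ {t} t∈ → subst (weight t ≤_) (∈-trees-leaves n t∈) (weight-≤ t)) ⟨
        eval (suc n) (C.p n) ≡⟨ eval-cong (suc n) (solved b n lt) ⟩
        eval (suc n) (C.X n) ≡⟨ eval-X n ⟩
        C₁.X n ≡⟨ C₁.X≈f refl n ⟩
        C₁.f n ≡⟨ C₁.f-coefficient n ⟩
        (ΣZ.ι r₂ ℤ.+ ΣZ.ι r₂) ℤ.+ ℤ.- ΣZ.ι r₃ ≡⟨ cong₂ (λ x y → (x ℤ.+ x) ℤ.+ ℤ.- y) (ιZ r₂) (ιZ r₃) ⟩
        (+ r₂ ℤ.+ + r₂) ℤ.+ ℤ.- + r₃ ∎

      balance : length (trees n) + r₃ ≡ r₂ + r₂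
      balance = ℤP.+-injective (trans (cong (ℤ._+ + r₃) in-ℤ) (trans (ℤP.+-assoc (+ (r₂ + r₂)) (ℤ.- + r₃) (+ r₃))
        (trans (cong (ℤ._+_ (+ (r₂ + r₂))) (ℤP.+-inverseˡ (+ r₃))) (ℤP.+-identityʳ _))))

  private
    expansion-coefficient : ∀ a n i → i ≤ n → C.expansion a n i ≡ + a i (n ∸ i)
    expansion-coefficient a zero    zero    le = ι-head (a 0 0)
    expansion-coefficient a (suc n) zero    le = trans (ℤP.+-identityʳ _) (ι-head (a 0 (suc n)))
    expansion-coefficient a (suc n) (suc i) (s≤s le) = trans
      (cong₂ ℤ._+_ (ι-coefficient (a 0 (suc n)) i) (sym (V.shift≋var (C.expansion (λ d → a (suc d)) n) (suc i))))
      (trans (ℤP.+-identityˡ _) (expansion-coefficient (λ d → a (suc d)) n i le))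

    expansion-vanishes : ∀ a n i → n < i → C.expansion a n i ≡ + 0
    expansion-vanishes a zero    (suc i) lt = ι-coefficient (a 0 0) i
    expansion-vanishes a (suc n) (suc i) (s≤s lt) = trans
      (cong₂ ℤ._+_ (ι-coefficient (a 0 (suc n)) i) (sym (V.shift≋var (C.expansion (λ d → a (suc d)) n) (suc i))))
      (trans (ℤP.+-identityˡ _) (expansion-vanishes (λ d → a (suc d)) n i lt))

    -- The subtracted part of `X-coefficient` is moved to the other side to stay among natural
    -- numbers. The summand `raney 4 n 2` is free of `v` and drops out at positive powers of `v`.
    count-N : ∀ n i t → C.expansion N₂ n (suc i) ≡ + t → i ≤ n → countTrees weight n (suc i) + t ≡ N₁ i (n ∸ i)
    count-N n i t e le = ℤP.+-injective (begin
      + countTrees weight n (suc i) ℤ.+ + t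
        ≡⟨ cong (ℤ._+ + t) (trans (sym (weight-series n (suc i))) (trans (solved (suc n) n ≤-refl (suc i)) (C.X-coefficient n (suc i)))) ⟩
      (V.conv v (C.expansion N₁ n) (suc i) ℤ.+ ℤ.- (C.expansion N₂ n (suc i) ℤ.+ ℤ.- ΣV.ι (raney 4 n 2) (suc i))) ℤ.+ + t
        ≡⟨ cong₂ (λ x y → (x ℤ.+ ℤ.- (y ℤ.+ ℤ.- ΣV.ι (raney 4 n 2) (suc i))) ℤ.+ + t) (sym (V.shift≋var (C.expansion N₁ n) (suc i))) e ⟩
      (C.expansion N₁ n i ℤ.+ ℤ.- (+ t ℤ.+ ℤ.- ΣV.ι (raney 4 n 2) (suc i))) ℤ.+ + t
        ≡⟨ cong₂ (λ x y → (x ℤ.+ ℤ.- (+ t ℤ.+ ℤ.- y)) ℤ.+ + t) (expansion-coefficient N₁ n i le) (ι-coefficient (raney 4 n 2) i) ⟩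
      (+ N₁ i (n ∸ i) ℤ.+ ℤ.- (+ t ℤ.+ + 0)) ℤ.+ + t
        ≡⟨ cong (λ y → (+ N₁ i (n ∸ i) ℤ.+ ℤ.- y) ℤ.+ + t) (ℤP.+-identityʳ (+ t)) ⟩
      (+ N₁ i (n ∸ i) ℤ.+ ℤ.- + t) ℤ.+ + t
        ≡⟨ trans (ℤP.+-assoc (+ N₁ i (n ∸ i)) (ℤ.- + t) (+ t)) (trans (cong (ℤ._+_ (+ N₁ i (n ∸ i))) (ℤP.+-inverseˡ (+ t))) (ℤP.+-identityʳ _)) ⟩
      + N₁ i (n ∸ i) ∎)
      where open ≡-Reasoning

    -- In terms of the final formula `i = e + 2` and `n = m + i`. Then `W` is `3 n - i - 1`, `M` is
    -- `4 n - 2 i - 3`, `D` is the denominator and `2 * K` the numerator.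
    module Formula (m e : ℕ) where
      open ≡-Reasoning
      open +-*-Solver

      W M K D : ℕ
      W = 3 * m + (e + e + 3)
      M = 4 * m + (e + e + 1)
      K = (e + e + 3) ! * M !
      D = e ! * (2 + e) ! * m ! * W !

      catalan-first : catalan (suc e) * ((1 + e) ! * (2 + e) !) ≡ (e + e + 2) !
      catalan-first = trans (cong (λ x → catalan (suc e) * ((1 + e) ! * x !)) (solve 1 (λ e → con 2 :+ e := (con 1 :* (con 1 :+ e)) :+ con 1) refl e))
        (trans (raney-formula 1 (suc e) 0) (trans (ℕP.*-identityˡ _) (cong _! (solve 1 (λ e → con 1 :+ e :+ con 1 :* (con 1 :+ e) :+ con 0 := e :+ e :+ con 2) refl e))))

      first : suc e * (N₁ (suc e) m * D) ≡ (M + 1) * K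
      first = begin
        suc e * (c * a * (e ! * (2 + e) ! * m ! * W !))
          ≡⟨ solve 7 (λ e c a f g h w → (con 1 :+ e) :* (c :* a :* (f :* g :* h :* w)) := (c :* (((con 1 :+ e) :* f) :* g)) :* (a :* (h :* w))) refl e c a (e !) ((2 + e) !) (m !) (W !) ⟩
        c * ((1 + e) ! * (2 + e) !) * (a * (m ! * W !))
          ≡⟨ cong₂ _*_ catalan-first (trans (cong (λ x → a * (m ! * x !)) (solve 2 (λ m e → con 3 :* m :+ (e :+ e :+ con 3) := con 3 :* m :+ (con 1 :+ (con 1 :+ e :+ (con 1 :+ e)))) refl m e)) (raney-formula 3 m (suc e + suc e))) ⟩
        (e + e + 2) ! * (suc (suc e + suc e) * (m + 3 * m + (suc e + suc e)) !)
          ≡⟨ cong₂ (λ x y → (e + e + 2) ! * (x * y !)) (solve 1 (λ e → con 1 :+ (con 1 :+ e :+ (con 1 :+ e)) := con 1 :+ (e :+ e :+ con 2)) refl e)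
               (solve 2 (λ m e → m :+ con 3 :* m :+ (con 1 :+ e :+ (con 1 :+ e)) := con 1 :+ (con 4 :* m :+ (e :+ e :+ con 1))) refl m e) ⟩
        (e + e + 2) ! * (suc (e + e + 2) * (suc M * M !))
          ≡⟨ solve 4 (λ x y z w → x :* (y :* ((con 1 :+ z) :* w)) := (z :+ con 1) :* ((y :* x) :* w)) refl ((e + e + 2) !) (suc (e + e + 2)) M (M !) ⟩
        (M + 1) * ((suc (e + e + 2)) ! * M !)
          ≡⟨ cong (λ x → (M + 1) * (x ! * M !)) (solve 1 (λ e → con 1 :+ (e :+ e :+ con 2) := e :+ e :+ con 3) refl e) ⟩
        (M + 1) * K ∎
        where
        c = catalan (suc e)
        a = raney 4 m (suc (suc e + suc e))

      -- The terms of the difference contribute `(M + 1) * K` and `4 * m * K`; as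
      -- `M + 1 - 4 m = 2 (e + 1)`, the factor `e + 1` cancels and `2 * K` remains.
      conclude : ∀ c t → c + t ≡ N₁ (suc e) m → suc e * (t * D) ≡ 4 * m * K → c * D ≡ 2 * K
      conclude c t sum second = ℕP.*-cancelˡ-≡ _ _ (suc e) (ℕP.+-cancelʳ-≡ (4 * m * K) _ _ (begin
        suc e * (c * D) + 4 * m * K ≡⟨ cong (_+_ (suc e * (c * D))) second ⟨
        suc e * (c * D) + suc e * (t * D) ≡⟨ solve 4 (λ e c t d → e :* (c :* d) :+ e :* (t :* d) := e :* ((c :+ t) :* d)) refl (suc e) c t D ⟩
        suc e * ((c + t) * D) ≡⟨ cong (λ x → suc e * (x * D)) sum ⟩
        suc e * (N₁ (suc e) m * D) ≡⟨ first ⟩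
        (M + 1) * K ≡⟨ solve 3 (λ m e k → ((con 4 :* m :+ (e :+ e :+ con 1)) :+ con 1) :* k := (con 1 :+ e) :* (con 2 :* k) :+ con 4 :* m :* k) refl m e K ⟩
        suc e * (2 * K) + 4 * m * K ∎))

    second-term : ∀ m₀ e → (let open Formula (suc m₀) e) → suc e * (N₂ (suc (suc e)) m₀ * D) ≡ 4 * suc m₀ * K
    second-term m₀ e = begin
      suc e * (c * b * (e ! * (2 + e) ! * (suc m₀ * m₀ !) * W !))
        ≡⟨ solve 8 (λ e c b f g m h w → (con 1 :+ e) :* (c :* b :* (f :* g :* ((con 1 :+ m) :* h) :* w)) := (con 1 :+ m) :* (c :* (((con 1 :+ e) :* f) :* g)) :* (b :* (h :* w))) refl e c b (e !) ((2 + e) !) m₀ (m₀ !) (W !) ⟩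
      suc m₀ * (c * ((1 + e) ! * (2 + e) !)) * (b * (m₀ ! * W !))
        ≡⟨ cong (λ x → suc m₀ * (c * ((1 + e) ! * (2 + e) !)) * x) (trans (cong (λ x → b * (m₀ ! * x !)) (solve 2 (λ m e → con 3 :* (con 1 :+ m) :+ (e :+ e :+ con 3) := con 3 :* m :+ (con 1 :+ (con 1 :+ (con 2 :+ e :+ (con 2 :+ e))))) refl m₀ e)) (raney-formula 3 m₀ (suc (2 + e + (2 + e))))) ⟩
      suc m₀ * (c * ((1 + e) ! * (2 + e) !)) * (suc (suc (2 + e + (2 + e))) * (m₀ + 3 * m₀ + suc (2 + e + (2 + e))) !)
        ≡⟨ cong₂ (λ x y → suc m₀ * (c * ((1 + e) ! * (2 + e) !)) * (x * y !)) (solve 1 (λ e → con 1 :+ (con 1 :+ (con 2 :+ e :+ (con 2 :+ e))) := con 2 :* (con 3 :+ e)) refl e)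
             (solve 2 (λ m e → m :+ con 3 :* m :+ (con 1 :+ (con 2 :+ e :+ (con 2 :+ e))) := con 4 :* (con 1 :+ m) :+ (e :+ e :+ con 1)) refl m₀ e) ⟩
      suc m₀ * (c * ((1 + e) ! * (2 + e) !)) * (2 * (3 + e) * M !)
        ≡⟨ solve 4 (λ m x e w → (con 1 :+ m) :* x :* (con 2 :* (con 3 :+ e) :* w) := con 2 :* (con 1 :+ m) :* ((con 3 :+ e) :* x) :* w) refl m₀ (c * ((1 + e) ! * (2 + e) !)) e (M !) ⟩
      2 * suc m₀ * ((3 + e) * (c * ((1 + e) ! * (2 + e) !))) * M !
        ≡⟨ cong (λ x → 2 * suc m₀ * x * M !) catalan-second ⟩
      2 * suc m₀ * (2 * (e + e + 3) !) * M !
        ≡⟨ solve 3 (λ m x w → con 2 :* (con 1 :+ m) :* (con 2 :* x) :* w := con 4 :* (con 1 :+ m) :* (x :* w)) refl m₀ ((e + e + 3) !) (M !) ⟩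
      4 * suc m₀ * K ∎
      where
      open Formula (suc m₀) e
      open ≡-Reasoning
      open +-*-Solver
      c = catalan (suc (suc e))
      b = raney 4 m₀ (suc (suc (suc (suc e) + suc (suc e))))

      catalan-second : (3 + e) * (c * ((1 + e) ! * (2 + e) !)) ≡ 2 * (e + e + 3) !
      catalan-second = ℕP.*-cancelˡ-≡ _ _ (2 + e) (begin
        (2 + e) * ((3 + e) * (c * ((1 + e) ! * (2 + e) !)))
          ≡⟨ solve 4 (λ e c x y → (con 2 :+ e) :* ((con 3 :+ e) :* (c :* (x :* y))) := c :* (((con 2 :+ e) :* x) :* ((con 3 :+ e) :* y))) refl e c ((1 + e) !) ((2 + e) !) ⟩
        c * ((2 + e) ! * (3 + e) !)
          ≡⟨ cong (λ x → c * ((2 + e) ! * x !)) (solve 1 (λ e → con 3 :+ e := con 1 :* (con 2 :+ e) :+ con 1) refl e) ⟩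
        c * ((2 + e) ! * (1 * (2 + e) + 1) !)
          ≡⟨ trans (raney-formula 1 (2 + e) 0) (ℕP.*-identityˡ _) ⟩
        ((2 + e) + 1 * (2 + e) + 0) !
          ≡⟨ cong _! (solve 1 (λ e → (con 2 :+ e) :+ con 1 :* (con 2 :+ e) :+ con 0 := con 1 :+ (e :+ e :+ con 3)) refl e) ⟩
        suc (e + e + 3) * (e + e + 3) !
          ≡⟨ solve 2 (λ e x → (con 1 :+ (e :+ e :+ con 3)) :* x := (con 2 :+ e) :* (con 2 :* x)) refl e ((e + e + 3) !) ⟩
        (2 + e) * (2 * (e + e + 3) !) ∎)

  count-weight : ∀ m e → countTrees weight (m + suc e) (suc (suc e)) * (e ! * (2 + e) ! * m ! * (3 * m + (e + e + 3)) !)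
    ≡ 2 * ((e + e + 3) ! * (4 * m + (e + e + 1)) !)
  -- For `m = 0` the exponent `e + 2` exceeds the degree in `v` of the subtracted series, so the
  -- second term is 0.
  count-weight zero     e = Formula.conclude 0 e _ 0
    (trans (count-N (suc e) (suc e) 0 (expansion-vanishes N₂ (suc e) (suc (suc e)) ≤-refl) ≤-refl) (cong (N₁ (suc e)) (ℕP.n∸n≡0 (suc e))))
    (ℕP.*-zeroʳ (suc e))
  count-weight (suc m₀) e = Formula.conclude (suc m₀) e _ (N₂ (suc (suc e)) m₀)
    (trans (count-N n (suc e) (N₂ (suc (suc e)) m₀)
        (trans (expansion-coefficient N₂ n (suc (suc e)) (s≤s (m≤n+m (suc e) m₀))) (cong (λ x → + N₂ (suc (suc e)) x) (ℕP.m+n∸n≡m m₀ (suc e))))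
        (m≤n+m (suc e) (suc m₀)))
      (cong (N₁ (suc e)) (ℕP.m+n∸n≡m (suc m₀) (suc e))))
    (second-term m₀ e)
    where
    n = suc m₀ + suc e

open CountingProof public using (countTrees-depth; count-weight)

-- Planar maps and their search contours

module _ {A : Set} where
  pow : (A → A) → ℕ → A → A
  pow f zero    x = x
  pow f (suc k) x = pow f k (f x)

  pow-+ : ∀ f k l x → pow f (k + l) x ≡ pow f l (pow f k x)
  pow-+ f zero    l x = refl
  pow-+ f (suc k) l x = pow-+ f k l (f x)

  pow-suc : ∀ f k x → pow f (suc k) x ≡ f (pow f k x)
  pow-suc f zero    x = refl
  pow-suc f (suc k) x = pow-suc f k (f x)

  pow-injective : ∀ {f} → (∀ {x y} → f x ≡ f y → x ≡ y) → ∀ k {x y} → pow f k x ≡ pow f k y → x ≡ y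
  pow-injective inj zero    e = e
  pow-injective inj (suc k) e = inj (pow-injective inj k e)

  ∈-iterate⁺ : ∀ f k n x → k < n → pow f k x ∈ iterate f x n
  ∈-iterate⁺ f zero    (suc n) x lt = here refl
  ∈-iterate⁺ f (suc k) (suc n) x (s≤s lt) = there (∈-iterate⁺ f k n (f x) lt)

  ∈-iterate⁻ : ∀ f n x {y} → y ∈ iterate f x n → Σ[ k ∈ ℕ ] y ≡ pow f k x
  ∈-iterate⁻ f (suc n) x (here e)   = 0 , e
  ∈-iterate⁻ f (suc n) x (there y∈) = let (k , e) = ∈-iterate⁻ f n (f x) y∈ in suc k , e

pow-hom : ∀ {A B : Set} (φ : A → B) {f g} → (∀ x → φ (f x) ≡ g (φ x)) → ∀ k x → φ (pow f k x) ≡ pow g k (φ x)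
pow-hom φ h zero    x = refl
pow-hom φ {f} {g} h (suc k) x = trans (pow-hom φ h k (f x)) (cong (pow g k) (h x))

module Orbit {m} (π : Fin m → Fin m) (injective : ∀ {x y} → π x ≡ π y → x ≡ y) where

  period : ∀ x → Σ[ p ∈ ℕ ] 0 < p × p ≤ m × pow π p x ≡ x
  period x with FinP.pigeonhole (n<1+n m) (λ (i : Fin (suc m)) → pow π (toℕ i) x)
  ... | i , j , i<j , e = toℕ j ∸ toℕ i , ℕP.m<n⇒0<n∸m i<j , ≤-trans (ℕP.m∸n≤m (toℕ j) (toℕ i)) (≤-pred (toℕ<n j)) ,
    pow-injective injective (toℕ i) (trans (sym (pow-+ π (toℕ j ∸ toℕ i) (toℕ i) x))
      (trans (cong (λ n → pow π n x) (m∸n+n≡m (<⇒≤ i<j))) (sym e)))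

  pow-∈ : ∀ k x → pow π k x ∈ orbit π x
  pow-∈ k x = go k (NatInd.<-wellFounded k)
    where
    go : ∀ k → Acc _<_ k → pow π k x ∈ orbit π x
    go k (acc rec) with k ℕP.<? m | period x
    ... | yes lt | _ = ∈-iterate⁺ π k m x lt
    ... | no ge  | p , p>0 , p≤m , e = subst (_∈ orbit π x)
      (trans (cong (pow π (k ∸ p)) (sym e)) (trans (sym (pow-+ π p (k ∸ p) x)) (cong (λ n → pow π n x) (m+[n∸m]≡n p≤k))))
      (go (k ∸ p) (rec (ℕP.∸-monoʳ-< p>0 p≤k)))
      where
      p≤k : p ≤ k
      p≤k = ≤-trans p≤m (≮⇒≥ ge)

  orbit-pow : ∀ {x y} → y ∈ orbit π x → Σ[ k ∈ ℕ ] y ≡ pow π k x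
  orbit-pow {x} = ∈-iterate⁻ π m x

  orbit-refl : ∀ {x} → x ∈ orbit π x
  orbit-refl {x} = pow-∈ 0 x

  orbit-step : ∀ {x} → π x ∈ orbit π x
  orbit-step {x} = pow-∈ 1 x

  orbit-trans : ∀ {x y z} → y ∈ orbit π x → z ∈ orbit π y → z ∈ orbit π x
  orbit-trans {x} y∈ z∈ with orbit-pow y∈ | orbit-pow z∈
  ... | k , refl | l , refl = subst (_∈ orbit π x) (pow-+ π k l x) (pow-∈ (k + l) x)

  -- If `p` is the period, then `k * p ∸ k` further steps lead from `pow π k x` back to `x`.
  orbit-sym : ∀ {x y} → y ∈ orbit π x → x ∈ orbit π y
  orbit-sym {x} y∈ with orbit-pow y∈ | period x
  ... | k , refl | p , p>0 , _ , e = subst (_∈ orbit π (pow π k x))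
    (trans (sym (pow-+ π k (k * p ∸ k) x)) (trans (cong (λ n → pow π n x) (m+[n∸m]≡n (ℕP.m≤m*n k p {{ℕ.>-nonZero p>0}}))) (cycles k)))
    (pow-∈ (k * p ∸ k) (pow π k x))
    where
    import Data.Nat as ℕ
    cycles : ∀ k → pow π (k * p) x ≡ x
    cycles zero    = refl
    cycles (suc k) = trans (pow-+ π p (k * p) x) (trans (cong (pow π (k * p)) e) (cycles k))

  IsMin : Fin m → Set
  IsMin x = All (Data.Fin._≤_ x) (orbit π x)
    where import Data.Fin

  isMin? : Decidable IsMin
  isMin? x = all? (x FinP.≤?_) (orbit π x)

  isMin-pow : ∀ {x} → IsMin x → ∀ k → toℕ x ≤ toℕ (pow π k x)
  isMin-pow {x} least k = All.lookup least (pow-∈ k x)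
    where import Data.List.Relation.Unary.All as All

  least : ∀ x → Σ[ y ∈ Fin m ] y ∈ orbit π x × IsMin y
  least x = go x (NatInd.<-wellFounded (toℕ x))
    where
    import Data.List.Relation.Unary.All as All
    go : ∀ x → Acc _<_ (toℕ x) → Σ[ y ∈ Fin m ] y ∈ orbit π x × IsMin y
    go x (acc rec) with any? (FinP._<? x) (orbit π x)
    ... | no none = x , orbit-refl , All.tabulate (λ y∈ → ≮⇒≥ (λ y<x → none (lose y∈ y<x)))
    ... | yes some with find some
    ...   | z , z∈ , z<x with go z (rec z<x)
    ...     | y , y∈ , min = y , orbit-trans z∈ y∈ , min

  isMin-unique : ∀ {x y} → IsMin x → IsMin y → y ∈ orbit π x → x ≡ y
  isMin-unique minx miny y∈ = FinP.≤-antisym (All.lookup minx y∈) (All.lookup miny (orbit-sym y∈))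
    where import Data.List.Relation.Unary.All as All

module _ {m m′} {π : Fin m → Fin m} {π′ : Fin m′ → Fin m′}
  (inj : ∀ {x y} → π x ≡ π y → x ≡ y) (inj′ : ∀ {x y} → π′ x ≡ π′ y → x ≡ y)
  (φ : Fin m → Fin m′) (φ-inj : ∀ {x y} → φ x ≡ φ y → x ≡ y) (hom : ∀ x → φ (π x) ≡ π′ (φ x)) where
  private
    module O  = Orbit π inj
    module O′ = Orbit π′ inj′

  orbit-map⁺ : ∀ {x y} → y ∈ orbit π x → φ y ∈ orbit π′ (φ x)
  orbit-map⁺ {x} y∈ with O.orbit-pow y∈
  ... | k , refl = subst (_∈ orbit π′ (φ x)) (sym (pow-hom φ hom k x)) (O′.pow-∈ k (φ x))

  orbit-map⁻ : ∀ {x y} → φ y ∈ orbit π′ (φ x) → y ∈ orbit π x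
  orbit-map⁻ {x} y∈ with O′.orbit-pow y∈
  ... | k , e = subst (_∈ orbit π x) (φ-inj (trans (pow-hom φ hom k x) (sym e))) (O.pow-∈ k x)

  -- `φ` preserves and reflects cycles but not the order. Therefore the least element of a cycle is
  -- sent to the least element of the image cycle rather than to its own image.
  numCycles-≤ : numCycles π ≤ numCycles π′
  numCycles-≤ = count-≤ O.isMin? O′.isMin? (λ x → proj₁ (O′.least (φ x))) (λ {x} _ → proj₂ (proj₂ (O′.least (φ x))))
    λ {x} {y} minx miny e → O.isMin-unique minx miny (orbit-map⁻
      (O′.orbit-trans (proj₁ (proj₂ (O′.least (φ x)))) (O′.orbit-sym (subst (_∈ orbit π′ (φ y)) (sym e) (proj₁ (proj₂ (O′.least (φ y))))))))

-- Matchings on a circle and their numbers of cycles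

infix 4 _≺_ _⪯_
_≺_ _⪯_ : ∀ {m n} → Fin m → Fin n → Set
x ≺ y = toℕ x < toℕ y
x ⪯ y = toℕ x ≤ toℕ y

module _ {k : ℕ} where
  last : Fin (suc k)
  last = fromℕ k

  ⪯last : (x : Fin (suc k)) → x ⪯ last
  ⪯last x = subst (toℕ x ≤_) (sym (toℕ-fromℕ k)) (≤-pred (toℕ<n x))

  ≢last⇒< : ∀ {x : Fin (suc k)} → x ≢ last → toℕ x < k
  ≢last⇒< {x} ne = ≤∧≢⇒< (≤-pred (toℕ<n x)) (λ e → ne (toℕ-injective (trans e (sym (toℕ-fromℕ k)))))

  ≺⇒≢last : ∀ {n} {x : Fin (suc k)} {y : Fin n} → n ≤ suc k → x ≺ y → x ≢ last
  ≺⇒≢last {n} {x} {y} le x<y refl = <⇒≱ (subst (_< toℕ y) (toℕ-fromℕ k) x<y) (≤-pred (≤-trans (toℕ<n y) le))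

  next : Fin (suc k) → Fin (suc k)
  next x with toℕ x <? k
  ... | yes lt = fsuc (fromℕ< lt)
  ... | no _   = fzero

  prev : Fin (suc k) → Fin (suc k)
  prev fzero    = last
  prev (fsuc x) = inject₁ x

  next-< : ∀ {x} → toℕ x < k → toℕ (next x) ≡ suc (toℕ x)
  next-< {x} lt with toℕ x <? k
  ... | yes lt′ = cong suc (toℕ-fromℕ< lt′)
  ... | no ge   = contradiction lt ge

  next-last : next last ≡ fzero
  next-last with toℕ last <? k
  ... | yes lt = contradiction (subst (_< k) (toℕ-fromℕ k) lt) (<-irrefl refl)
  ... | no _   = refl

  prev-next : ∀ x → prev (next x) ≡ x
  prev-next x with toℕ x <? k
  ... | yes lt = toℕ-injective (trans (toℕ-inject₁ _) (toℕ-fromℕ< lt))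
  ... | no ge  = toℕ-injective (trans (toℕ-fromℕ k) (sym (≤-antisym (≤-pred (toℕ<n x)) (≮⇒≥ ge))))

  next-prev : ∀ x → next (prev x) ≡ x
  next-prev fzero    = next-last
  next-prev (fsuc x) = toℕ-injective (trans (next-< lt) (cong suc (toℕ-inject₁ x)))
    where
    lt : toℕ (inject₁ x) < k
    lt = subst (_< k) (sym (toℕ-inject₁ x)) (toℕ<n x)

  next-injective : ∀ {x y} → next x ≡ next y → x ≡ y
  next-injective {x} {y} e = trans (sym (prev-next x)) (trans (cong prev e) (prev-next y))

  ≺-next : ∀ {n} {x} {y : Fin n} → n ≤ suc k → x ≺ y → toℕ (next x) ≡ suc (toℕ x)
  ≺-next le x<y = next-< (≢last⇒< (≺⇒≢last le x<y))

  -- The genus formula for a matching on a circle: `next ∘ β` has at most one cycle more than there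
  -- are matched pairs, and equality characterises the noncrossing matchings.
  module CycleCount (β : Fin (suc k) → Fin (suc k)) (β-inv : ∀ x → β (β x) ≡ x) (β-last : β last ≡ last) where

    β-injective : ∀ {x y} → β x ≡ β y → x ≡ y
    β-injective {x} {y} e = trans (sym (β-inv x)) (trans (cong β e) (β-inv y))

    f : Fin (suc k) → Fin (suc k)
    f x = next (β x)

    f-injective : ∀ {x y} → f x ≡ f y → x ≡ y
    f-injective e = β-injective (next-injective e)

    open Orbit f f-injective

    opener? : Decidable (λ x → x ≺ β x)
    opener? x = x FinP.<? β x

    NC : Set
    NC = ∀ x y → x ≺ y → y ≺ β x → x ≺ β y × β y ≺ β x

    private
      candidates : List (Fin (suc k))
      candidates = fzero ∷ map next (filter opener? (allFin (suc k)))

      minima : List (Fin (suc k))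
      minima = filter isMin? (allFin (suc k))

      length-candidates : length candidates ≡ suc (count opener?)
      length-candidates = cong suc (length-map next (filter opener? (allFin (suc k))))

      unique-minima : Unique minima
      unique-minima = Unique.filter⁺ isMin? (Unique.allFin⁺ (suc k))

      unique-candidates : Unique candidates
      unique-candidates = AllP.map⁺ (All.tabulate λ {x} x∈ e → case trans (cong toℕ e) (≺-next ≤-refl (chosen opener? x∈)) of λ ())
        ∷ Unique.map⁺ next-injective (Unique.filter⁺ opener? (Unique.allFin⁺ (suc k)))

      -- If `x` precedes the least element of a cycle, then `β x`, which `f` maps to that element,
      -- lies on the same cycle and hence after `x`; so `x` is an opener. This bounds the number of
      -- cycles.
      minima⊆candidates : ∀ {x} → x ∈ minima → x ∈ candidates
      minima⊆candidates {fzero}  x∈ = here refl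
      minima⊆candidates {fsuc x} x∈ = there (subst (_∈ map next (filter opener? (allFin (suc k)))) (next-prev (fsuc x))
        (∈-map⁺ next (∈-filter⁺ opener? (∈-allFin (inject₁ x)) (subst (_< toℕ (β (inject₁ x))) (sym (toℕ-inject₁ x))
          (All.lookup (chosen isMin? x∈) (orbit-sym (subst (_∈ orbit f (β (inject₁ x))) back orbit-step)))))))
        where
        back : f (β (inject₁ x)) ≡ fsuc x
        back = trans (cong next (β-inv (inject₁ x))) (next-prev (fsuc x))

    -- A point inside goes to the successor of its partner, which stays inside since nothing crosses
    -- `p`, and `β p` itself returns to `next p`. For the matching `τ` the interval is the part of
    -- the map beyond a tree edge.
    interval-step : NC → ∀ {p} → p ≺ β p → ∀ {z} → p ≺ z → z ⪯ β p → p ≺ f z × f z ⪯ β p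
    interval-step nc {p} p<βp {z} lo hi with m≤n⇒m<n∨m≡n hi
    ... | inj₂ e  = subst (λ x → p ≺ next x × next x ⪯ β p) (sym (trans (cong β (toℕ-injective e)) (β-inv p)))
                      (subst (λ m → toℕ p < m × m ≤ toℕ (β p)) (sym (≺-next ≤-refl p<βp)) (≤-refl , p<βp))
    ... | inj₁ lt with nc p z lo lt
    ...   | lo′ , hi′ = subst (λ m → toℕ p < m × m ≤ toℕ (β p)) (sym (≺-next ≤-refl hi′)) (m≤n⇒m≤1+n lo′ , hi′)

    interval-orbit : NC → ∀ {p} → p ≺ β p → ∀ {z y} → p ≺ z → z ⪯ β p → y ∈ orbit f z → p ≺ y × y ⪯ β p
    interval-orbit nc {p} p<βp {z} lo hi y∈ with orbit-pow y∈
    ... | j , refl = go j lo hi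
      where
      go : ∀ j {z} → p ≺ z → z ⪯ β p → p ≺ pow f j z × pow f j z ⪯ β p
      go zero    lo hi = lo , hi
      go (suc j) lo hi = let (lo′ , hi′) = interval-step nc p<βp lo hi in go j lo′ hi′

    isMin⇒opener : ∀ {x} → IsMin x → x ≡ fzero ⊎ Σ[ p ∈ Fin (suc k) ] p ≺ β p × x ≡ next p
    isMin⇒opener {x} min with minima⊆candidates (∈-filter⁺ isMin? (∈-allFin x) min)
    ... | here e   = inj₁ e
    ... | there x∈ with ∈-map⁻ next x∈
    ...   | p , p∈ , e = inj₂ (p , chosen opener? p∈ , e)

    private
      NC⇒min : NC → ∀ p → p ≺ β p → IsMin (next p)
      NC⇒min nc p p<βp = All.tabulate λ y∈ → subst (_≤ _) (sym np) (proj₁ (interval-orbit nc p<βp (subst (toℕ p <_) (sym np) ≤-refl) (subst (_≤ toℕ (β p)) (sym np) p<βp) y∈))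
        where
        np : toℕ (next p) ≡ suc (toℕ p)
        np = ≺-next ≤-refl p<βp

      min⇒ : ∀ x → IsMin x → x ∈ minima
      min⇒ x min = ∈-filter⁺ isMin? (∈-allFin x) min

    NC⇒numCycles : NC → numCycles f ≡ suc (count opener?)
    NC⇒numCycles nc = trans (length-≡ unique-minima unique-candidates minima⊆candidates back) length-candidates
      where
      back : ∀ {x} → x ∈ candidates → x ∈ minima
      back (here refl) = min⇒ fzero (All.tabulate (λ _ → z≤n))
      back (there x∈) with ∈-map⁻ next x∈
      ... | p , p∈ , refl = min⇒ (next p) (NC⇒min nc p (chosen opener? p∈))

    private
      numCycles⇒min : numCycles f ≡ suc (count opener?) → ∀ p → p ≺ β p → IsMin (next p)
      numCycles⇒min e p p<βp with isMin? (next p)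
      ... | yes min = min
      ... | no ¬min = contradiction (length-⊆ (All.tabulate (λ {x} x∈ e′ → ¬min (subst IsMin (sym e′) (chosen isMin? x∈))) ∷ unique-minima) sub)
          (<⇒≱ (subst (_< suc (numCycles f)) (trans e (sym length-candidates)) ≤-refl))
        where
        sub : ∀ {x} → x ∈ next p ∷ minima → x ∈ candidates
        sub (here refl) = there (∈-map⁺ next (∈-filter⁺ opener? (∈-allFin p) p<βp))
        sub (there x∈)  = minima⊆candidates x∈

      -- Following the cycle of next p′ up to β p′ across q = β p yields a
      -- crossing of p with a later opener.
      descend : (∀ p → p ≺ β p → IsMin (next p)) → ∀ n p p′ → toℕ (β p) ≤ toℕ p′ + n → p ≺ p′ → p′ ≺ β p → β p ≺ β p′ → ⊥
      descend mins zero    p p′ le p<p′ p′<q q<q′ = <⇒≱ p′<q (subst (toℕ (β p) ≤_) (ℕP.+-identityʳ _) le)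
      descend mins (suc n) p p′ le p<p′ p′<q q<q′ = finish (crossing j (subst (_≤ toℕ (β p)) (sym np) p′<q) (subst (λ z → β p ≺ z) e q<q′))
        where
        around = orbit-pow (orbit-sym (subst (_∈ orbit f (β p′)) (cong next (β-inv p′)) orbit-step))
        j = proj₁ around
        e = proj₂ around

        np : toℕ (next p′) ≡ suc (toℕ p′)
        np = ≺-next ≤-refl p′<q

        Crossing : Set
        Crossing = Σ[ i ∈ ℕ ] pow f i (next p′) ⪯ β p × β p ≺ f (pow f i (next p′))

        crossing : ∀ j → next p′ ⪯ β p → β p ≺ pow f j (next p′) → Crossing
        crossing zero    a b = contradiction a (<⇒≱ b)
        crossing (suc j) a b = case <-≤-connex (toℕ (β p)) (toℕ (pow f j (next p′))) of λ
          { (inj₁ lt) → crossing j a lt ; (inj₂ le) → j , le , subst (λ z → β p ≺ z) (pow-suc f j (next p′)) b }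

        finish : Crossing → ⊥
        finish (i , z≤q , q<fz) = descend mins n p z (≤-trans le (subst (_≤ toℕ z + n) (sym (+-suc (toℕ p′) n)) (+-monoˡ-≤ n p′<z)))
          (<-trans p<p′ p′<z) z<q q<βz
          where
          z = pow f i (next p′)

          beyond-p′ : ∀ k → suc (toℕ p′) ≤ toℕ (pow f k (next p′))
          beyond-p′ k = subst (_≤ toℕ (pow f k (next p′))) np (isMin-pow (mins p′ (<-trans p′<q q<q′)) k)

          p′<z : p′ ≺ z
          p′<z = beyond-p′ i

          z≢q : z ≢ β p
          z≢q e = <⇒≱ p<p′ (≤-pred (subst (suc (toℕ p′) ≤_) (trans (cong toℕ (trans (pow-suc f i (next p′)) (cong next (trans (cong β e) (β-inv p)))))
            (≺-next ≤-refl (<-trans p<p′ p′<q))) (beyond-p′ (suc i))))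

          z<q : z ≺ β p
          z<q = ≤∧≢⇒< z≤q (z≢q ∘ toℕ-injective)

          q<βz : β p ≺ β z
          q<βz with β z FinP.≟ last
          ... | yes e = contradiction (subst (λ x → β p ≺ next x) e q<fz) (subst (λ x → ¬ (β p ≺ x)) (sym next-last) λ ())
          ... | no ne = ≤∧≢⇒< (≤-pred (subst (toℕ (β p) <_) (next-< (≢last⇒< ne)) q<fz))
            (λ e → <⇒≢ (<-trans p<p′ p′<z) (cong toℕ (β-injective (toℕ-injective e))))

    numCycles⇒NC : numCycles f ≡ suc (count opener?) → NC
    numCycles⇒NC e x y x<y y<βx = lo , hi
      where
      uncrossed : ∀ {p p′} → p ≺ p′ → p′ ≺ β p → ¬ (β p ≺ β p′)
      uncrossed {p} {p′} a b c = descend (numCycles⇒min e) (toℕ (β p)) p p′ (m≤n+m _ _) a b c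

      lo : x ≺ β y
      lo with <-cmp (toℕ (β y)) (toℕ x)
      ... | tri> _ _ gt = gt
      ... | tri≈ _ e _ = contradiction (trans (sym (β-inv y)) (cong β (toℕ-injective e))) (λ e′ → <⇒≢ y<βx (cong toℕ e′))
      ... | tri< lt _ _ = contradiction (subst (λ z → z ≺ β x) (sym (β-inv y)) y<βx) (uncrossed lt (subst (x ≺_) (sym (β-inv y)) x<y))

      hi : β y ≺ β x
      hi = ≤∧≢⇒< (≮⇒≥ (uncrossed x<y y<βx)) (λ e → <⇒≢ x<y (cong toℕ (sym (β-injective (toℕ-injective e)))))

-- Invariance under isomorphism of maps

module Isomorphism where
  open RootedMap

  map-σ-injective : ∀ M {x y} → σ M x ≡ σ M y → x ≡ y
  map-σ-injective M {x} {y} e = trans (sym (inverseˡ (rotation M))) (trans (cong (rotation M ⟨$⟩ˡ_) e) (inverseˡ (rotation M)))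

  map-α-injective : ∀ M {x y} → α M x ≡ α M y → x ≡ y
  map-α-injective M {x} {y} e = trans (sym (α-involutive M x)) (trans (cong (α M) e) (α-involutive M y))

  module _ {M N : RootedMap} (M≅N : M ≅ N) where
    open _≅_ M≅N

    φ : HalfEdge M → HalfEdge N
    φ h = iso ⟨$⟩ʳ h

    φ-injective : ∀ {x y} → φ x ≡ φ y → x ≡ y
    φ-injective {x} {y} e = trans (sym (inverseˡ iso)) (trans (cong (iso ⟨$⟩ˡ_) e) (inverseˡ iso))

    σα-hom : ∀ h → φ (σ M (α M h)) ≡ σ N (α N (φ h))
    σα-hom h = trans (σ-hom (α M h)) (cong (σ N) (α-hom h))

    numVertices-≤ : numVertices M ≤ numVertices N
    numVertices-≤ = numCycles-≤ (map-σ-injective M) (map-σ-injective N) φ φ-injective σ-hom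

    numEdges-≤ : numEdges M ≤ numEdges N
    numEdges-≤ = numCycles-≤ (map-α-injective M) (map-α-injective N) φ φ-injective α-hom

    numFaces-≤ : numFaces M ≤ numFaces N
    numFaces-≤ = numCycles-≤ (λ e → map-α-injective M (map-σ-injective M e)) (λ e → map-α-injective N (map-σ-injective N e)) φ φ-injective σα-hom

    Bridgeless-map : Bridgeless M → Bridgeless N
    Bridgeless-map bl e (e≢root , ¬conn) = bl e′ (e′≢root , λ conn → ¬conn λ g h →
        subst₂ (EqClosure _) (inverseʳ iso) (inverseʳ iso) (Eq.gmap φ step (conn (iso ⟨$⟩ˡ g) (iso ⟨$⟩ˡ h))))
      where
      e′ : HalfEdge M
      e′ = iso ⟨$⟩ˡ e
      e′≢root : e′ ≢ root M
      e′≢root eq = e≢root (trans (sym (inverseʳ iso)) (trans (cong φ eq) root↦))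
      step : ∀ {x y} → σ M x ≡ y ⊎ (x ≢ e′ × x ≢ α M e′ × α M x ≡ y) → σ N (φ x) ≡ φ y ⊎ (φ x ≢ e × φ x ≢ α N e × α N (φ x) ≡ φ y)
      step (inj₁ refl) = inj₁ (sym (σ-hom _))
      step (inj₂ (ne , ne′ , refl)) = inj₂ ((λ eq → ne (φ-injective (trans eq (sym (inverseʳ iso)))))
        , (λ eq → ne′ (φ-injective (trans eq (trans (cong (α N) (sym (inverseʳ iso))) (sym (α-hom e′)))))) , sym (α-hom _))

    private
      ∈-map-⇔ : ∀ h S → h ∈ S ⇔ φ h ∈ map φ S
      ∈-map-⇔ h S = mk⇔ (∈-map⁺ φ) λ p → let (h′ , h′∈ , e) = ∈-map⁻ φ p in subst (_∈ S) (φ-injective (sym e)) h′∈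

      orbit-⇔ : ∀ x y → y ∈ orbit (σ M) x ⇔ φ y ∈ orbit (σ N) (φ x)
      orbit-⇔ x y = mk⇔ (orbit-map⁺ (map-σ-injective M) (map-σ-injective N) φ φ-injective σ-hom) (orbit-map⁻ (map-σ-injective M) (map-σ-injective N) φ φ-injective σ-hom)

      module D {m} = DecMembership (FinP._≟_ {m})

      touches-⇔ : ∀ x S → Any (λ y → y ∈ orbit (σ M) x) S ⇔ Any (λ y → y ∈ orbit (σ N) (φ x)) (map φ S)
      touches-⇔ x S = mk⇔ (λ a → map⁺ (Any.map (λ {y} → Equivalence.to (orbit-⇔ x y)) a)) (λ a → Any.map (λ {y} → Equivalence.from (orbit-⇔ x y)) (map⁻ a))

    private
      -- The nested conditional of `explore`, isolated so that its three tests and four branches can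
      -- be transported together.
      branch : ∀ {A : Set} → Bool → Bool → Bool → A → A → A → A → A
      branch a b c w x y z = if a then w else if b then x else if c then y else z

      branch-map : ∀ {A B : Set} (f : A → B) {a a′ b b′ c c′} {w x y z : A} {w′ x′ y′ z′ : B} → a′ ≡ a → b′ ≡ b → c′ ≡ c →
        w′ ≡ f w → x′ ≡ f x → y′ ≡ f y → z′ ≡ f z → branch a′ b′ c′ w′ x′ y′ z′ ≡ f (branch a b c w x y z)
      branch-map f {true} refl refl refl p q r s = p
      branch-map f {false} {_} {true}     refl refl refl p q r s = q
      branch-map f {false} {_} {false} {_} {true}  refl refl refl p q r s = r
      branch-map f {false} {_} {false} {_} {false} refl refl refl p q r s = s

    explore-map : ∀ k e h S → explore N k (φ e) (φ h) (map φ S) ≡ map φ (explore M k e h S)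
    explore-map zero    e h S = refl
    explore-map (suc k) e h S = branch-map (map φ)
        (does-⇔ (mk⇔ φ-injective (cong φ)) (φ h FinP.≟ φ e) (h FinP.≟ e))
        (cong₂ _∨_ (sym (does-⇔ (∈-map-⇔ h S) (h D.∈? S) (φ h D.∈? map φ S)))
          (trans (cong (λ x → does (x D.∈? map φ S)) (sym (α-hom h))) (sym (does-⇔ (∈-map-⇔ (α M h) S) (α M h D.∈? S) (φ (α M h) D.∈? map φ S)))))
        (trans (cong (λ x → does (any? (D._∈? orbit (σ N) x) (map φ S))) (sym (α-hom h)))
          (sym (does-⇔ (touches-⇔ (α M h) S) (any? (D._∈? orbit (σ M) (α M h)) S) (any? (D._∈? orbit (σ N) (φ (α M h))) (map φ S)))))
        refl
        (trans (cong (λ x → explore N k (φ e) x (map φ S)) (sym (σ-hom h))) (explore-map k e (σ M h) S))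
        (trans (cong₂ (λ x y → explore N k (φ e) x (y ∷ map φ S)) (sym (σ-hom h)) (sym (α-hom h))) (explore-map k e (σ M h) (α M h ∷ S)))
        (trans (cong₂ (explore N k (φ e)) (sym (σ-hom h))
            (trans (cong₂ (λ x y → explore N k x y (x ∷ map φ S)) (sym (α-hom h)) (trans (cong (σ N) (sym (α-hom h))) (sym (σ-hom (α M h)))))
              (explore-map k (α M h) (σ M (α M h)) (α M h ∷ S))))
          (explore-map k e (σ M h) (explore M k (α M h) (σ M (α M h)) (α M h ∷ S))))

    dfsSinks-map : dfsSinks N ≡ map φ (dfsSinks M)
    dfsSinks-map = trans (sym (cong (λ n → explore N n (root N) (σ N (root N)) [ root N ]) (↔⇒≡ iso)))
      (trans (cong₂ (λ r s → explore N (size M) r s [ r ]) (sym root↦) (trans (cong (σ N) (sym root↦)) (sym (σ-hom (root M)))))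
        (explore-map (size M) (root M) (σ M (root M)) [ root M ]))

    rootIndegree-≡ : rootIndegree M ≡ rootIndegree N
    rootIndegree-≡ = sym (trans (cong (λ S → length (filter (D._∈? orbit (σ N) (root N)) S)) dfsSinks-map)
      (trans (cong (λ r → length (filter (D._∈? orbit (σ N) r) (map φ (dfsSinks M)))) (sym root↦)) (go (dfsSinks M))))
      where
      go : ∀ S → length (filter (D._∈? orbit (σ N) (φ (root M))) (map φ S)) ≡ length (filter (D._∈? orbit (σ M) (root M)) S)
      go [] = refl
      go (x ∷ S) rewrite sym (does-⇔ (orbit-⇔ (root M) x) (x D.∈? orbit (σ M) (root M)) (φ x D.∈? orbit (σ N) (φ (root M))))
        with does (x D.∈? orbit (σ M) (root M))
      ... | true  = cong suc (go S)
      ... | false = go S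

  ≅-sym : ∀ {M N} → M ≅ N → N ≅ M
  ≅-sym {M} {N} = Relation.Binary.Setoid.sym rootedMaps {M} {N}

  module _ {M N : RootedMap} (M≅N : M ≅ N) where
    numEdges-≡ : numEdges M ≡ numEdges N
    numEdges-≡ = ≤-antisym (numEdges-≤ M≅N) (numEdges-≤ (≅-sym M≅N))

    private
      numVertices-≡ : numVertices M ≡ numVertices N
      numVertices-≡ = ≤-antisym (numVertices-≤ M≅N) (numVertices-≤ (≅-sym M≅N))

      numFaces-≡ : numFaces M ≡ numFaces N
      numFaces-≡ = ≤-antisym (numFaces-≤ M≅N) (numFaces-≤ (≅-sym M≅N))

      euler : ∀ {V V′ E E′ F F′} → V ≡ V′ → E ≡ E′ → F ≡ F′ →
        + V ℤ.- + (E ∸ 1) ℤ.+ + F ≡ + 2 → + V′ ℤ.- + (E′ ∸ 1) ℤ.+ + F′ ≡ + 2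
      euler refl refl refl p = p

    Planar-map : Planar M → Planar N
    Planar-map = euler numVertices-≡ numEdges-≡ numFaces-≡

open Isomorphism public using (map-σ-injective; map-α-injective; Bridgeless-map; rootIndegree-≡; ≅-sym; numEdges-≡; Planar-map)

closure-invariant : ∀ {A : Set} {R : A → A → Set} (P : A → Set) → (∀ {x y} → R x y → P x ⇔ P y) →
  ∀ {x y} → EqClosure R x y → P x → P y
closure-invariant P inv ε px = px
closure-invariant P inv (fwd r ◅ rest) px = closure-invariant P inv rest (Equivalence.to (inv r) px)
closure-invariant P inv (bwd r ◅ rest) px = closure-invariant P inv rest (Equivalence.from (inv r) px)

-- A rooted map whose half-edges are numbered in the order of a walk around
-- a spanning tree; τ is the restriction of α to the tree edges.  The root
-- comes last.
record Contour (k : ℕ) : Set where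
  field
    α τ     : Fin (suc k) → Fin (suc k)
    α-inv   : ∀ x → α (α x) ≡ x
    α-fixed : ∀ x → α x ≡ x ⇔ x ≡ last
    τ-inv   : ∀ x → τ (τ x) ≡ x
    τ-α     : ∀ x → τ x ≡ x ⊎ τ x ≡ α x

  -- The matching by the edges outside the tree: it fixes the half-edges of tree edges, while `τ`
  -- fixes all the others.
  β : Fin (suc k) → Fin (suc k)
  β x = α (τ x)

  τα : ∀ x → τ (α x) ≡ β x
  τα x with τ-α x | τ-α (α x)
  ... | inj₂ e | _ = trans (cong τ (sym e)) (trans (τ-inv x) (trans (sym (α-inv x)) (cong α (sym e))))
  ... | inj₁ e | inj₁ d = trans d (cong α (sym e))
  ... | inj₁ e | inj₂ d = trans (cong τ fixed) (trans e (trans (sym fixed) (cong α (sym e))))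
    where
    fixed : α x ≡ x
    fixed = trans (sym (τ-inv (α x))) (trans (cong τ (trans d (α-inv x))) e)

  β-inv : ∀ x → β (β x) ≡ x
  β-inv x = trans (cong α (τα (τ x))) (trans (α-inv (τ (τ x))) (τ-inv x))

  α-injective : ∀ {x y} → α x ≡ α y → x ≡ y
  α-injective {x} {y} e = trans (sym (α-inv x)) (trans (cong α e) (α-inv y))

  τ-injective : ∀ {x y} → τ x ≡ τ y → x ≡ y
  τ-injective {x} {y} e = trans (sym (τ-inv x)) (trans (cong τ e) (τ-inv y))

  α-last : α last ≡ last
  α-last = Equivalence.from (α-fixed last) refl

  τ-last : τ last ≡ last
  τ-last with τ-α last
  ... | inj₁ e = e
  ... | inj₂ e = trans e α-last

  β-last : β last ≡ last
  β-last = trans (cong α τ-last) α-last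

  tree⇒ : ∀ {x} → τ x ≢ x → τ x ≡ α x
  tree⇒ {x} ne with τ-α x
  ... | inj₁ e = contradiction e ne
  ... | inj₂ e = e

  module CT = CycleCount τ τ-inv τ-last
  module CB = CycleCount β β-inv β-last

  -- The walk crosses a tree edge as soon as it meets one and then turns to the next half-edge at
  -- the vertex reached, so its successor function is `σ ∘ τ`. Numbering along the walk makes that
  -- `next`.
  σ : Fin (suc k) → Fin (suc k)
  σ x = next (τ x)

  σ-τ : ∀ x → σ (τ x) ≡ next x
  σ-τ x = cong next (τ-inv x)

  σ-last : σ last ≡ fzero
  σ-last = trans (cong next τ-last) next-last

  private
    chain : ∀ {R : Fin (suc k) → Fin (suc k) → Set} n p q → toℕ q ≡ n + toℕ p → (∀ y → p ⪯ y → y ≺ q → EqClosure R y (next y)) → EqClosure R p q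
    chain zero    p q e step = subst (EqClosure _ p) (toℕ-injective (sym e)) ε
    chain (suc n) p q e step = step p ≤-refl p<q ◅◅ chain n (next p) q (trans e (trans (sym (+-suc n (toℕ p))) (cong (_+_ n) (sym np))))
        (λ y le lt → step y (≤-trans (n≤1+n _) (subst (_≤ toℕ y) np le)) lt)
      where
      p<q : p ≺ q
      p<q = subst (toℕ p <_) (sym e) (s≤s (m≤n+m _ n))
      np : toℕ (next p) ≡ suc (toℕ p)
      np = ≺-next ≤-refl p<q

  connect : ∀ {R : Fin (suc k) → Fin (suc k) → Set} p q → p ⪯ q → (∀ y → p ⪯ y → y ≺ q → EqClosure R y (next y)) → EqClosure R p q
  connect p q le = chain (toℕ q ∸ toℕ p) p q (sym (m∸n+n≡m le))

  toMap : RootedMap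
  toMap = record
    { size = suc k
    ; rotation     = permutation σ (λ y → τ (prev y)) (λ y → trans (σ-τ (prev y)) (next-prev y)) (λ x → trans (cong τ (prev-next (τ x))) (τ-inv x))
    ; α = α
    ; α-involutive = α-inv
    ; root = last
    ; α-fixed = α-fixed
    ; transitive   = λ g h → Eq.symmetric _ (connect fzero g z≤n (step {fzero} {g})) ◅◅ connect fzero h z≤n (step {fzero} {h})
    }
    where
    step : ∀ {p q : Fin (suc k)} y → p ⪯ y → y ≺ q → EqClosure (λ x y → σ x ≡ y ⊎ α x ≡ y) y (next y)
    step y _ _ with τ-α y
    ... | inj₁ e = fwd (inj₁ (cong next e)) ◅ ε
    ... | inj₂ e = fwd (inj₂ refl) ◅ fwd (inj₁ (trans (cong σ (sym e)) (σ-τ y))) ◅ ε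

  module O = Orbit σ CT.f-injective

  private
    module OA = Orbit α α-injective

    opener? : Decidable (λ x → x ≺ α x)
    opener? x = x FinP.<? α x

    pow-α : ∀ j x → pow α j x ≡ x ⊎ pow α j x ≡ α x
    pow-α zero    x = inj₁ refl
    pow-α (suc j) x with pow-α j (α x)
    ... | inj₁ e = inj₂ e
    ... | inj₂ e = inj₁ (trans e (α-inv x))

    ⪯α⇒min : ∀ {x} → x ⪯ α x → OA.IsMin x
    ⪯α⇒min {x} le = All.tabulate λ y∈ → case OA.orbit-pow y∈ of λ (j , e) → case pow-α j x of λ
      { (inj₁ d) → subst (x ⪯_) (sym (trans e d)) ≤-refl ; (inj₂ d) → subst (x ⪯_) (sym (trans e d)) le }

  numEdges-openers : numCycles α ≡ suc (count (λ x → x FinP.<? α x))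
  numEdges-openers = length-≡ {ys = last ∷ filter opener? (allFin (suc k))} (Unique.filter⁺ OA.isMin? (Unique.allFin⁺ (suc k)))
    (All.tabulate (λ x∈ e → <-irrefl (cong toℕ (trans (sym e) (trans (sym α-last) (cong α e)))) (chosen opener? x∈)) ∷ Unique.filter⁺ opener? (Unique.allFin⁺ (suc k)))
    into back
    where
    into : ∀ {x} → x ∈ filter OA.isMin? (allFin (suc k)) → x ∈ last ∷ filter opener? (allFin (suc k))
    into {x} x∈ with m≤n⇒m<n∨m≡n (All.lookup (chosen OA.isMin? x∈) OA.orbit-step)
    ... | inj₁ lt = there (∈-filter⁺ opener? (∈-allFin x) lt)
    ... | inj₂ e  = here (Equivalence.to (α-fixed x) (toℕ-injective (sym e)))
    back : ∀ {x} → x ∈ last ∷ filter opener? (allFin (suc k)) → x ∈ filter OA.isMin? (allFin (suc k))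
    back (here refl) = ∈-filter⁺ OA.isMin? (∈-allFin last) (⪯α⇒min (≤-reflexive (cong toℕ (sym α-last))))
    back {x} (there x∈) = ∈-filter⁺ OA.isMin? (∈-allFin x) (⪯α⇒min (<⇒≤ (chosen opener? x∈)))

  private
    openers-split : count opener? ≡ count CT.opener? + count CB.opener?
    openers-split = trans (length-≡ {ys = filter CT.opener? (allFin (suc k)) ++ filter CB.opener? (allFin (suc k))} (Unique.filter⁺ opener? (Unique.allFin⁺ (suc k)))
      (Unique.++⁺ (Unique.filter⁺ CT.opener? (Unique.allFin⁺ (suc k))) (Unique.filter⁺ CB.opener? (Unique.allFin⁺ (suc k)))
        (λ {x} (p , q) → both x (chosen CT.opener? p) (chosen CB.opener? q)))
      into back) (length-++ (filter CT.opener? (allFin (suc k))))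
      where
      both : ∀ x → x ≺ τ x → x ≺ β x → ⊥
      both x p q with τ-α x
      ... | inj₁ e = <-irrefl (cong toℕ (sym e)) p
      ... | inj₂ e = <-irrefl (cong toℕ (sym (trans (cong α e) (α-inv x)))) q
      into : ∀ {x} → x ∈ filter opener? (allFin (suc k)) → x ∈ filter CT.opener? (allFin (suc k)) ++ filter CB.opener? (allFin (suc k))
      into {x} x∈ with chosen opener? x∈ | τ-α x
      ... | lt | inj₂ e = ∈-++⁺ˡ (∈-filter⁺ CT.opener? (∈-allFin x) (subst (x ≺_) (sym e) lt))
      ... | lt | inj₁ e = ∈-++⁺ʳ _ (∈-filter⁺ CB.opener? (∈-allFin x) (subst (x ≺_) (cong α (sym e)) lt))
      back : ∀ {x} → x ∈ filter CT.opener? (allFin (suc k)) ++ filter CB.opener? (allFin (suc k)) → x ∈ filter opener? (allFin (suc k))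
      back {x} x∈ = ∈-filter⁺ opener? (∈-allFin x) (case ∈-++⁻ (filter CT.opener? (allFin (suc k))) x∈ of λ
        { (inj₁ p) → fromτ (chosen CT.opener? p) ; (inj₂ p) → fromβ (chosen CB.opener? p) })
        where
        fromτ : x ≺ τ x → x ≺ α x
        fromτ lt with τ-α x
        ... | inj₁ e = contradiction (cong toℕ (sym e)) (<⇒≢ lt)
        ... | inj₂ e = subst (x ≺_) e lt
        fromβ : x ≺ β x → x ≺ α x
        fromβ lt with τ-α x
        ... | inj₁ e = subst (x ≺_) (cong α e) lt
        ... | inj₂ e = contradiction (cong toℕ (sym (trans (cong α e) (α-inv x)))) (<⇒≢ lt)

    -- By `τα` the face permutation `σ ∘ α` is `next ∘ β`, so vertices and faces are counted by the
    -- same lemma, applied to `τ` and to `β`.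
    numFaces-β : RootedMap.numFaces toMap ≡ numCycles CB.f
    numFaces-β = ≤-antisym (numCycles-≤ inj CB.f-injective id id (λ x → cong next (τα x))) (numCycles-≤ CB.f-injective inj id id (λ x → cong next (sym (τα x))))
      where
      inj : ∀ {x y} → σ (α x) ≡ σ (α y) → x ≡ y
      inj e = α-injective (CT.f-injective e)

    module ZS = ℤSolver ℤP.+-*-commutativeRing

  numEdges-toMap : RootedMap.numEdges toMap ≡ suc (count CT.opener? + count CB.opener?)
  numEdges-toMap = trans numEdges-openers (cong suc openers-split)

  -- Since `τ` is noncrossing, there is one vertex more than tree edges. Euler characteristic 2 then
  -- leaves one face more than edges outside the tree, the maximum of the cycle count for `β`.
  Planar⇒NC : CT.NC → RootedMap.Planar toMap → CB.NC
  Planar⇒NC nc planar = CB.numCycles⇒NC (trans (sym numFaces-β) (ℤP.+-injective (faces (count CT.opener?) (count CB.opener?) _ euler)))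
    where
    euler : + suc (count CT.opener?) ℤ.- + (count CT.opener? + count CB.opener?) ℤ.+ + RootedMap.numFaces toMap ≡ + 2
    euler = subst₂ (λ V E → + V ℤ.- + (E ∸ 1) ℤ.+ + RootedMap.numFaces toMap ≡ + 2) (CT.NC⇒numCycles nc) numEdges-toMap planar
    faces : ∀ a b F → + suc a ℤ.- + (a + b) ℤ.+ + F ≡ + 2 → + F ≡ + suc b
    faces a b F e = trans (ZS.solve 3 (λ a b F → F ZS.:= (((ZS.:1 ZS.:+ a) ZS.:+ ZS.:- (a ZS.:+ b)) ZS.:+ F) ZS.:+ (b ZS.:+ ZS.:- ZS.:1)) refl (+ a) (+ b) (+ F))
      (trans (cong (ℤ._+ (+ b ℤ.+ ℤ.- + 1)) e) (ZS.solve 1 (λ b → (ZS.:1 ZS.:+ ZS.:1) ZS.:+ (b ZS.:+ ZS.:- ZS.:1) ZS.:= ZS.:1 ZS.:+ b) refl (+ b)))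

  NC⇒Planar : CT.NC → CB.NC → RootedMap.Planar toMap
  NC⇒Planar ncτ ncβ = trans (cong₂ (λ V E → + V ℤ.- + (E ∸ 1) ℤ.+ + RootedMap.numFaces toMap) (CT.NC⇒numCycles ncτ) numEdges-toMap)
    (trans (cong (λ F → + suc a ℤ.- + (a + b) ℤ.+ + F) (trans numFaces-β (CB.NC⇒numCycles ncβ)))
      (ZS.solve 2 (λ a b → ((ZS.:1 ZS.:+ a) ZS.:+ ZS.:- (a ZS.:+ b)) ZS.:+ (ZS.:1 ZS.:+ b) ZS.:= ZS.:1 ZS.:+ ZS.:1) refl (+ a) (+ b)))
    where
    a = count CT.opener?
    b = count CB.opener?

-- The walks along a depth-first search tree of a planar map: in addition to
-- both matchings being noncrossing, an edge that is not in the tree joins a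
-- half-edge to a vertex on the tree path to the root.
record SearchContour (k : ℕ) : Set where
  field
    contour : Contour k
  open Contour contour public
  field
    nc-τ : CT.NC
    nc-β : CB.NC
    dfs  : ∀ x a → x ≺ a → a ≺ β x → ¬ (β x ≺ τ a)

  -- The least half-edge of a vertex is either 0, and then the vertex is that of the root because
  -- `σ last` is 0, or it directly follows the opener `p` of the tree edge that leads to the vertex.
  vertex : ∀ z → last ∈ orbit σ z ⊎ Σ[ p ∈ Fin (suc k) ] p ≺ τ p × τ p ∈ orbit σ z × p ≺ z × z ⪯ τ p
  vertex z with O.least z
  ... | y , y∈ , min with CT.isMin⇒opener min
  ...   | inj₁ refl = inj₁ (O.orbit-trans y∈ (O.orbit-sym (subst (_∈ orbit σ last) σ-last O.orbit-step)))
  ...   | inj₂ (p , p<τp , refl) = inj₂ (p , p<τp ,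
      O.orbit-trans y∈ (O.orbit-sym (subst (_∈ orbit σ (τ p)) (σ-τ p) O.orbit-step)) ,
      CT.interval-orbit nc-τ p<τp (subst (toℕ p <_) (sym np) ≤-refl) (subst (_≤ toℕ (τ p)) (sym np) p<τp) (O.orbit-sym y∈))
    where
    np : toℕ (next p) ≡ suc (toℕ p)
    np = ≺-next ≤-refl p<τp

  tree-vertex : ∀ {a y} → a ≺ τ a → y ∈ orbit σ (τ a) → a ≺ y × y ⪯ τ a
  tree-vertex a<τa = CT.interval-orbit nc-τ a<τa a<τa ≤-refl

  -- The condition `dfs` excludes that the tree edge leading to the vertex of `α x` is opened after
  -- `x`. Hence this vertex has been visited when the search tries `x`.
  back-vertex : ∀ {x} → τ x ≡ x → x ≺ α x → last ∈ orbit σ (α x) ⊎ Σ[ p ∈ Fin (suc k) ] p ≺ τ p × τ p ∈ orbit σ (α x) × p ≺ x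
  back-vertex {x} e x<αx with vertex (α x)
  ... | inj₁ l = inj₁ l
  ... | inj₂ (p , p<τp , τp∈ , p<αx , αx≤τp) = inj₂ (p , p<τp , τp∈ , p<x)
    where
    βx≡ : β x ≡ α x
    βx≡ = cong α e
    p<x : p ≺ x
    p<x with <-cmp (toℕ p) (toℕ x)
    ... | tri< lt _ _ = lt
    ... | tri≈ _ d _  = contradiction (trans (cong τ (toℕ-injective d)) (trans e (sym (toℕ-injective d)))) (λ d′ → <⇒≢ p<τp (cong toℕ (sym d′)))
    ... | tri> _ _ gt with m≤n⇒m<n∨m≡n αx≤τp
    ...   | inj₁ lt = contradiction (subst (_≺ τ p) (sym βx≡) lt) (dfs x p gt (subst (p ≺_) (sym βx≡) p<αx))
    ...   | inj₂ d  = contradiction (τ-injective (trans (τα x) (trans βx≡ (trans (toℕ-injective d) refl)))) (λ d′ → <⇒≢ p<αx (cong toℕ (sym d′)))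

  private
    D : ∀ (h : Fin (suc k)) S → Dec (h ∈ S)
    D = DecMembership._∈?_ FinP._≟_

    -- The state of the search in terms of the walk: exactly the edges met at a position before `n`
    -- have been oriented, each towards its later half-edge.
    Sinks : List (Fin (suc k)) → ℕ → Set
    Sinks S n = ∀ y → y ∈ S ⇔ (y ≡ last ⊎ (α y ≺ y × toℕ (α y) < n))

    -- The position of the search in terms of the walk: `h` is tried at the vertex entered by `e`,
    -- that is, the tree edge closing at `e` is the innermost one around `h`.
    Level : Fin (suc k) → Fin (suc k) → Set
    Level e h = h ⪯ e × (e ≡ last ⊎ τ e ≺ h) × (∀ a → a ≺ h → h ⪯ τ a → e ⪯ τ a)

    sinks-suc : ∀ {S h} → ¬ (h ≺ α h) → Sinks S (toℕ h) → Sinks S (suc (toℕ h))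
    sinks-suc {S} {h} ne inv y = mk⇔ (λ y∈ → case Equivalence.to (inv y) y∈ of λ { (inj₁ e) → inj₁ e ; (inj₂ (p , q)) → inj₂ (p , m≤n⇒m≤1+n q) })
      λ { (inj₁ e) → Equivalence.from (inv y) (inj₁ e)
        ; (inj₂ (p , s≤s q)) → case m≤n⇒m<n∨m≡n q of λ
          { (inj₁ lt) → Equivalence.from (inv y) (inj₂ (p , lt))
          ; (inj₂ e) → contradiction (subst (_≺ α h) (toℕ-injective e) (subst (λ z → α y ≺ z) (trans (sym (α-inv y)) (cong α (toℕ-injective e))) p)) ne } }

    sinks-∷ : ∀ {S h} → h ≺ α h → Sinks S (toℕ h) → Sinks (α h ∷ S) (suc (toℕ h))
    sinks-∷ {S} {h} h<αh inv y = mk⇔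
      (λ { (here refl) → inj₂ (subst (_≺ α h) (sym (α-inv h)) h<αh , subst (_< suc (toℕ h)) (cong toℕ (sym (α-inv h))) ≤-refl)
         ; (there y∈) → case Equivalence.to (inv y) y∈ of λ { (inj₁ e) → inj₁ e ; (inj₂ (p , q)) → inj₂ (p , m≤n⇒m≤1+n q) } })
      λ { (inj₁ e) → there (Equivalence.from (inv y) (inj₁ e))
        ; (inj₂ (p , s≤s q)) → case m≤n⇒m<n∨m≡n q of λ
          { (inj₁ lt) → there (Equivalence.from (inv y) (inj₂ (p , lt)))
          ; (inj₂ e) → here (trans (sym (α-inv y)) (cong α (toℕ-injective e))) } }

    opener∉ : ∀ {S h} → h ≺ α h → Sinks S (toℕ h) → h ∉ S × α h ∉ S
    opener∉ {S} {h} h<αh inv = (λ h∈ → case Equivalence.to (inv h) h∈ of λ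
        { (inj₁ refl) → <⇒≱ h<αh (⪯last (α last)) ; (inj₂ (p , _)) → <-asym h<αh p })
      , λ αh∈ → case Equivalence.to (inv (α h)) αh∈ of λ
        { (inj₁ e) → <-irrefl (cong toℕ (trans (trans (sym (α-inv h)) (trans (cong α e) α-last)) (sym e))) h<αh
        ; (inj₂ (_ , q)) → <-irrefl (cong toℕ (α-inv h)) q }

    open RootedMap toMap using (explore)

    explore-done : ∀ {e h} n S → h ≡ e → explore n e h S ≡ S
    explore-done zero    S eq = refl
    explore-done {e} {h} (suc n) S eq rewrite dec-true (h FinP.≟ e) eq = refl

    explore-seen : ∀ {e h} n S → h ≢ e → h ∈ S → explore (suc n) e h S ≡ explore n e (σ h) S
    explore-seen {e} {h} n S ne h∈ rewrite dec-false (h FinP.≟ e) ne | dec-true (D h S) h∈ = refl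

    explore-back : ∀ {e h} n S → h ≢ e → h ∉ S → α h ∉ S → Any (_∈ orbit σ (α h)) S → explore (suc n) e h S ≡ explore n e (σ h) (α h ∷ S)
    explore-back {e} {h} n S ne h∉ αh∉ any rewrite dec-false (h FinP.≟ e) ne | dec-false (D h S) h∉ | dec-false (D (α h) S) αh∉
      | dec-true (any? (λ y → D y (orbit σ (α h))) S) any = refl

    explore-tree : ∀ {e h} n S → h ≢ e → h ∉ S → α h ∉ S → ¬ Any (_∈ orbit σ (α h)) S →
      explore (suc n) e h S ≡ explore n e (σ h) (explore n (α h) (σ (α h)) (α h ∷ S))
    explore-tree {e} {h} n S ne h∉ αh∉ none rewrite dec-false (h FinP.≟ e) ne | dec-false (D h S) h∉ | dec-false (D (α h) S) αh∉
      | dec-false (any? (λ y → D y (orbit σ (α h))) S) none = refl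

    Result : Fin (suc k) → List (Fin (suc k)) → Set
    Result e S = Sinks S (toℕ e) × Unique S

    -- The search tries the half-edges in increasing order, descending and returning along tree
    -- edges without gaps. So the call ends exactly at `e`, and the distance from `h` to `e` is
    -- enough fuel.
    explore-sinks : ∀ n e h S → Level e h → toℕ e ≤ toℕ h + n → Sinks S (toℕ h) → Unique S → Result e (explore n e h S)
    explore-sinks zero e h S (h≤e , _) fuel inv u = subst (λ x → Sinks S (toℕ x)) (toℕ-injective (≤-antisym h≤e (subst (toℕ e ≤_) (ℕP.+-identityʳ _) fuel))) inv , u
    explore-sinks (suc n) e h S level@(h≤e , top , inner) fuel inv u = decide (h FinP.≟ e)
      where
      module Step (h≢e : h ≢ e) where
        h<e : h ≺ e
        h<e = ≤∧≢⇒< h≤e (h≢e ∘ toℕ-injective)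

        nh : toℕ (next h) ≡ suc (toℕ h)
        nh = ≺-next ≤-refl h<e

        fuel′ : toℕ e ≤ toℕ (next h) + n
        fuel′ = subst (toℕ e ≤_) (trans (+-suc (toℕ h) n) (cong (λ x → x + n) (sym nh))) fuel

        level-next : τ h ≡ h → Level e (next h)
        level-next τh = subst (_≤ toℕ e) (sym nh) h<e
          , (case top of λ { (inj₁ e) → inj₁ e ; (inj₂ lt) → inj₂ (subst (toℕ (τ e) <_) (sym nh) (m≤n⇒m≤1+n lt)) })
          , λ a a<nh nh≤τa → case m≤n⇒m<n∨m≡n (≤-pred (subst (toℕ a <_) nh a<nh)) of λ
              { (inj₁ a<h) → inner a a<h (<⇒≤ (subst (_≤ toℕ (τ a)) nh nh≤τa))
              ; (inj₂ e) → contradiction (subst (_≤ toℕ (τ a)) nh nh≤τa) (≤⇒≯ (≤-reflexive (cong toℕ (trans (cong τ (toℕ-injective e)) τh)))) }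

        go-next : ∀ S′ → τ h ≡ h → Sinks S′ (suc (toℕ h)) → Unique S′ → Result e (explore n e (σ h) S′)
        go-next S′ τh inv′ u′ = subst (λ x → Result e (explore n e x S′)) (cong next (sym τh))
          (explore-sinks n e (next h) S′ (level-next τh) fuel′ (subst (Sinks S′) (sym nh) inv′) u′)

        case-h : Result e (explore (suc n) e h S)
        case-h with <-cmp (toℕ h) (toℕ (α h))
        ... | tri≈ _ d _ = contradiction (Equivalence.to (α-fixed h) (toℕ-injective (sym d))) (≺⇒≢last ≤-refl h<e)
        ... | tri> _ _ αh<h = subst (Result e) (sym (explore-seen {e} {h} n S h≢e (Equivalence.from (inv h) (inj₂ (αh<h , αh<h)))))
            (go-next S τh (sinks-suc (λ lt → <-asym lt αh<h) inv) u)
          where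
          -- Otherwise a tree edge opened at `α h` would close at `h`, in front of `e`, against the
          -- choice of `e` as innermost.
          τh : τ h ≡ h
          τh with τ-α h
          ... | inj₁ e = e
          ... | inj₂ d = contradiction (inner (α h) αh<h (≤-reflexive (cong toℕ (sym ταh)))) (<⇒≱ (subst (_≺ e) (sym ταh) h<e))
            where
            ταh : τ (α h) ≡ h
            ταh = trans (cong τ (sym d)) (τ-inv h)
        ... | tri< h<αh _ _ with opener∉ h<αh inv | τ-α h
        ...   | h∉ , αh∉ | inj₁ τh = subst (Result e) (sym (explore-back {e} {h} n S h≢e h∉ αh∉ touches))
              (go-next (α h ∷ S) τh (sinks-∷ h<αh inv) (All.tabulate (λ {x} x∈ d → αh∉ (subst (_∈ S) (sym d) x∈)) ∷ u))
          where
          touches : Any (_∈ orbit σ (α h)) S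
          touches with back-vertex τh h<αh
          ... | inj₁ l = lose (Equivalence.from (inv last) (inj₁ refl)) l
          ... | inj₂ (p , p<τp , τp∈ , p<h) = lose (Equivalence.from (inv (τ p)) (inj₂ (subst (_≺ τ p) (sym ατp) p<τp , subst (_≺ h) (sym ατp) p<h))) τp∈
            where
            ατp : α (τ p) ≡ p
            ατp = trans (cong α (tree⇒ (λ d → <⇒≢ p<τp (cong toℕ (sym d))))) (α-inv p)
        ...   | h∉ , αh∉ | inj₂ τh = subst (Result e) (sym (explore-tree {e} {h} n S h≢e h∉ αh∉ untouched)) outer
          where
          b = α h

          h<τh : h ≺ τ h
          h<τh = subst (h ≺_) (sym τh) h<αh

          -- A sink at the new vertex lies under the tree edge of `h` although its edge was opened
          -- before `h`: a tree edge would then cross that of `h`, any other edge would violate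
          -- `dfs`.
          untouched : ¬ Any (_∈ orbit σ b) S
          untouched any with find any
          ... | y , y∈S , y∈o with tree-vertex h<τh (subst (λ z → y ∈ orbit σ z) (sym τh) y∈o) | Equivalence.to (inv y) y∈S
          ...   | h<y , y≤τh | inj₁ refl = <-irrefl (cong toℕ (trans (sym (α-inv h)) (trans (cong α (sym l≡αh)) (trans α-last l≡αh)))) h<αh
            where
            l≡αh : last ≡ α h
            l≡αh = trans (toℕ-injective (≤-antisym y≤τh (⪯last (τ h)))) τh
          ...   | h<y , y≤τh | inj₂ (αy<y , αy<h) with m≤n⇒m<n∨m≡n y≤τh
          ...     | inj₂ d = <-irrefl (cong toℕ (trans (cong α (trans (toℕ-injective d) τh)) (α-inv h))) αy<h
          ...     | inj₁ y<τh with τ-α y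
          ... | inj₂ t = <-asym y<τh (subst (τ h ≺_) ταy (proj₂ (nc-τ (α y) h αy<h (subst (h ≺_) (sym ταy) h<y))))
            where
            ταy : τ (α y) ≡ y
            ταy = trans (cong τ (sym t)) (τ-inv y)
          ... | inj₁ t = dfs (α y) h αy<h (subst (h ≺_) (sym βαy) h<y) (subst (_≺ τ h) (sym βαy) y<τh)
            where
            βαy : β (α y) ≡ y
            βαy = trans (cong α (trans (τα y) (cong α t))) (α-inv y)

          b≤e : toℕ b ≤ toℕ e
          b≤e = case top of λ
            { (inj₁ refl) → ⪯last b
            ; (inj₂ τe<h) → subst₂ _≤_ (cong toℕ τh) (cong toℕ (τ-inv e)) (<⇒≤ (proj₂ (nc-τ (τ e) h τe<h (subst (h ≺_) (sym (τ-inv e)) h<e)))) }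

          b≢e : b ≢ e
          b≢e d = case top of λ
            { (inj₁ refl) → <-irrefl (cong toℕ (trans (sym (α-inv h)) (trans (cong α d) (trans α-last (sym d))))) h<αh
            ; (inj₂ τe<h) → <-irrefl (cong toℕ (trans (cong τ (trans (sym d) (sym τh))) (τ-inv h))) τe<h }

          nb : toℕ (next b) ≡ suc (toℕ b)
          nb = ≺-next ≤-refl (≤∧≢⇒< b≤e (b≢e ∘ toℕ-injective))

          σb : σ b ≡ next h
          σb = trans (cong σ (sym τh)) (σ-τ h)

          inside : Result b (explore n b (σ b) (b ∷ S))
          inside = subst (λ x → Result b (explore n b x (b ∷ S))) (sym σb)
            (explore-sinks n b (next h) (b ∷ S)
              ( subst (_≤ toℕ b) (sym nh) h<αh
              , inj₂ (subst₂ _<_ (cong toℕ (sym (trans (cong τ (sym τh)) (τ-inv h)))) (sym nh) ≤-refl)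
              , λ a a<nh nh≤τa → case m≤n⇒m<n∨m≡n (≤-pred (subst (toℕ a <_) nh a<nh)) of λ
                  { (inj₂ d) → ≤-reflexive (cong toℕ (trans (sym τh) (cong τ (sym (toℕ-injective d)))))
                  ; (inj₁ a<h) → subst (_≤ toℕ (τ a)) (cong toℕ τh) (<⇒≤ (proj₂ (nc-τ a h a<h (subst (_≤ toℕ (τ a)) nh nh≤τa)))) })
              (≤-trans b≤e fuel′)
              (subst (Sinks (b ∷ S)) (sym nh) (sinks-∷ h<αh inv))
              (All.tabulate (λ {x} x∈ d → αh∉ (subst (_∈ S) (sym d) x∈)) ∷ u))

          S₂ = explore n b (σ b) (b ∷ S)

          outer : Result e (explore n e (σ h) S₂)
          outer = subst (λ x → Result e (explore n e x S₂)) (cong next (sym τh))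
            (explore-sinks n e (next b) S₂
              ( subst (_≤ toℕ e) (sym nb) (≤∧≢⇒< b≤e (b≢e ∘ toℕ-injective))
              , (case top of λ { (inj₁ d) → inj₁ d ; (inj₂ lt) → inj₂ (<-trans lt (subst (toℕ h <_) (sym nb) (m≤n⇒m≤1+n h<αh))) })
              , inner′)
              (≤-trans fuel′ (+-monoˡ-≤ n (subst₂ _≤_ (sym nh) (sym nb) (m≤n⇒m≤1+n h<αh))))
              (subst (Sinks S₂) (sym nb) (sinks-suc (λ lt → <-asym (subst (b ≺_) (α-inv h) lt) h<αh) (proj₁ inside)))
              (proj₂ inside))
            where
            inner′ : ∀ a → a ≺ next b → next b ⪯ τ a → e ⪯ τ a
            inner′ a a<nb nb≤τa with subst (_≤ toℕ (τ a)) nb nb≤τa | m≤n⇒m<n∨m≡n (≤-pred (subst (toℕ a <_) nb a<nb))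
            ... | b<τa | inj₂ d = contradiction (subst (_≺ τ a) (toℕ-injective (sym d)) b<τa) (<⇒≱ (subst (_≺ a) (sym (trans (cong τ (trans (toℕ-injective d) (sym τh))) (τ-inv h))) (subst (h ≺_) (toℕ-injective (sym d)) h<αh)) ∘ <⇒≤)
            ... | b<τa | inj₁ a<b with <-cmp (toℕ a) (toℕ h)
            ...   | tri< a<h _ _ = inner a a<h (<⇒≤ (<-trans h<αh b<τa))
            ...   | tri≈ _ d _ = contradiction b<τa (<-irrefl (cong toℕ (sym (trans (cong τ (toℕ-injective d)) τh))))
            ...   | tri> _ _ h<a = contradiction b<τa (<⇒≱ (subst (τ a ≺_) τh (proj₂ (nc-τ h a h<a (subst (a ≺_) (sym τh) a<b)))) ∘ <⇒≤)

      decide : Dec (h ≡ e) → Result e (explore (suc n) e h S)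
      decide (yes refl) = subst (Result e) (sym (explore-done {e} {e} (suc n) S refl)) (inv , u)
      decide (no h≢e)   = Step.case-h h≢e

  -- To be at the root vertex means to lie under no tree edge.
  RootSink : Fin (suc k) → Set
  RootSink y = y ≡ last ⊎ (α y ≺ y × (∀ a → a ≺ y → ¬ (y ⪯ τ a)))

  rootIndegree-count : ∀ {L} → Unique L → (∀ y → y ∈ L ⇔ RootSink y) → RootedMap.rootIndegree toMap ≡ length L
  rootIndegree-count {L} u mem = length-≡ (Unique.filter⁺ D′ (proj₂ searched)) u
      (λ {y} y∈ → let (y∈S , y∈o) = ∈-filter⁻ D′ {xs = S} y∈ in Equivalence.from (mem y) (into y y∈S y∈o))
      (λ {y} y∈ → let (y∈S , y∈o) = back y (Equivalence.to (mem y) y∈) in ∈-filter⁺ D′ y∈S y∈o)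
    where
    D′ : ∀ y → Dec (y ∈ orbit σ last)
    D′ y = D y (orbit σ last)

    S : List (Fin (suc k))
    S = explore (suc k) last (σ last) [ last ]

    searched : Result last S
    searched = subst (λ x → Result last (explore (suc k) last x [ last ])) (sym σ-last)
      (explore-sinks (suc k) last fzero [ last ] (z≤n , inj₁ refl , λ a ()) (≤-trans (≤-reflexive (toℕ-fromℕ k)) (n≤1+n k))
        (λ y → mk⇔ (λ { (here e) → inj₁ e }) λ { (inj₁ e) → here e ; (inj₂ (_ , ())) }) ([] ∷ []))

    into : ∀ y → y ∈ S → y ∈ orbit σ last → RootSink y
    into y y∈ y∈o with Equivalence.to (proj₁ searched y) y∈
    ... | inj₁ e = inj₁ e
    ... | inj₂ (αy<y , _) = inj₂ (αy<y , λ a a<y y≤τa →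
      let (_ , l≤τa) = CT.interval-orbit nc-τ (<-≤-trans a<y y≤τa) a<y y≤τa (O.orbit-sym y∈o)
          τa≡last = toℕ-injective (≤-antisym (⪯last (τ a)) l≤τa)
      in <⇒≱ (<-≤-trans a<y y≤τa) (subst (τ a ⪯_) (trans (trans τa≡last (sym (trans (cong τ τa≡last) τ-last))) (τ-inv a)) ≤-refl))

    back : ∀ y → RootSink y → y ∈ S × y ∈ orbit σ last
    back y (inj₁ refl) = Equivalence.from (proj₁ searched last) (inj₁ refl) , O.orbit-refl
    back y (inj₂ (αy<y , free)) = Equivalence.from (proj₁ searched y) (inj₂ (αy<y , <-≤-trans αy<y (⪯last y))) , (case vertex y of λ
      { (inj₁ l) → O.orbit-sym l ; (inj₂ (p , _ , _ , p<y , y≤τp)) → contradiction y≤τp (free p p<y) })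

module _ {k} (K : SearchContour k) where
  open SearchContour K

  -- Bridgelessness along the walk. Only a tree edge can be a bridge; the part beyond it is the
  -- interval after `a` up to `τ a`, and by `dfs` a further edge leaving this part can only end
  -- after it, not before.
  Covered : Set
  Covered = ∀ a → a ≺ τ a → Σ[ x ∈ Fin (suc k) ] a ≺ x × x ≺ τ a × τ a ≺ β x

  Bridgeless⇒Covered : RootedMap.Bridgeless toMap → Covered
  Bridgeless⇒Covered bridgeless a a<τa with FinP.any? (λ x → (a FinP.<? x) ×-dec (x FinP.<? τ a) ×-dec (τ a FinP.<? β x))
  ... | yes found = found
  ... | no none   = contradiction (a≢last , disconnected) (bridgeless a)
    where
    a≢last : a ≢ last
    a≢last refl = <⇒≱ a<τa (⪯last (τ last))

    τa≡αa : τ a ≡ α a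
    τa≡αa = tree⇒ (λ e → <⇒≢ a<τa (cong toℕ (sym e)))

    Inside : Fin (suc k) → Set
    Inside x = a ≺ x × x ⪯ τ a

    α-inside : ∀ x → x ≢ a → x ≢ α a → Inside x → Inside (α x)
    α-inside x x≢a x≢αa (lo , hi) with τ-α x
    ... | inj₂ t = let (lo′ , hi′) = nc-τ a x lo x<τa in subst (λ y → a ≺ y × y ⪯ τ a) t (lo′ , <⇒≤ hi′)
      where
      x<τa : x ≺ τ a
      x<τa = ≤∧≢⇒< hi (λ e → x≢αa (trans (toℕ-injective e) τa≡αa))
    ... | inj₁ t with <-cmp (toℕ (α x)) (toℕ a) | toℕ (τ a) <? toℕ (α x)
    ...   | _ | yes gt = contradiction (x , lo , ≤∧≢⇒< hi (λ e → x≢αa (trans (toℕ-injective e) τa≡αa)) , subst (τ a ≺_) (cong α (sym t)) gt) none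
    ...   | tri> _ _ gt | no ge = gt , ≮⇒≥ ge
    ...   | tri≈ _ e _ | no _ = contradiction (trans (sym (α-inv x)) (cong α (toℕ-injective e))) x≢αa
    ...   | tri< lt _ _ | no _ = contradiction (subst (_≺ τ a) (sym βαx) (≤∧≢⇒< hi (λ e → x≢αa (trans (toℕ-injective e) τa≡αa))))
              (dfs (α x) a lt (subst (a ≺_) (sym βαx) lo))
      where
      βαx : β (α x) ≡ x
      βαx = trans (cong α (trans (τα x) (cong α t))) (α-inv x)

    σ-inside : ∀ {x y} → y ∈ orbit σ x → Inside x → Inside y
    σ-inside y∈ (lo , hi) = CT.interval-orbit nc-τ a<τa lo hi y∈

    disconnected : ¬ RootedMap.ConnectedWithout toMap a
    disconnected conn = a≢last (trans (sym (τ-inv a)) (trans (cong τ τa≡last) τ-last))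
      where
      end : Inside last
      end = closure-invariant Inside invariant (conn (τ a) last) (a<τa , ≤-refl)
        where
        invariant : ∀ {x y} → σ x ≡ y ⊎ (x ≢ a × x ≢ α a × α x ≡ y) → Inside x ⇔ Inside y
        invariant (inj₁ refl) = mk⇔ (σ-inside O.orbit-step) (σ-inside (O.orbit-sym O.orbit-step))
        invariant {x} (inj₂ (x≢a , x≢αa , refl)) = mk⇔ (α-inside x x≢a x≢αa)
          (λ i → subst Inside (α-inv x) (α-inside (α x) (λ e → x≢αa (trans (sym (α-inv x)) (cong α e))) (λ e → x≢a (α-injective e)) i))
      τa≡last : τ a ≡ last
      τa≡last = toℕ-injective (≤-antisym (⪯last (τ a)) (proj₂ end))

  Covered⇒Bridgeless : Covered → RootedMap.Bridgeless toMap
  Covered⇒Bridgeless covered e (e≢root , ¬conn) = ¬conn (λ g h → Eq.symmetric _ (to-start g) ◅◅ to-start h)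
    where
    Step : Fin (suc k) → Fin (suc k) → Set
    Step x y = σ x ≡ y ⊎ (x ≢ e × x ≢ α e × α x ≡ y)

    succ-step : ∀ y → (τ y ≡ y ⊎ (y ≢ e × y ≢ α e)) → EqClosure Step y (next y)
    succ-step y ok with τ-α y
    ... | inj₁ t = fwd (inj₁ (cong next t)) ◅ ε
    ... | inj₂ t with ok
    ...   | inj₁ t′ = fwd (inj₁ (cong next t′)) ◅ ε
    ...   | inj₂ (p , q) = fwd (inj₂ (p , q , refl)) ◅ fwd (inj₁ (trans (cong σ (sym t)) (σ-τ y))) ◅ ε

    -- Without the edge of `a` the walk falls into the positions up to `a`, those between and those
    -- after `τ a`. The rotation at `a` leaps over the middle piece, as `σ a` is `next (τ a)`, and
    -- the covering edge leads from beyond into that piece.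
    around : ∀ a → a ≺ τ a → (∀ y → y ≢ a → y ≢ τ a → y ≢ e × y ≢ α e) → ∀ g → EqClosure Step fzero g
    around a a<τa other g with covered a a<τa
    ... | x , a<x , x<τa , τa<βx = place
      where
      τx≡x : τ x ≡ x
      τx≡x with τ-α x
      ... | inj₁ t = t
      ... | inj₂ t = contradiction (trans (cong α t) (α-inv x)) (λ d → <-asym x<τa (subst (τ a ≺_) d τa<βx))

      na : toℕ (next a) ≡ suc (toℕ a)
      na = ≺-next ≤-refl a<τa

      nb : toℕ (next (τ a)) ≡ suc (toℕ (τ a))
      nb = ≺-next ≤-refl τa<βx

      free : ∀ y → y ≢ a → y ≢ τ a → EqClosure Step y (next y)
      free y p q = succ-step y (inj₂ (other y p q))

      ≢-< : ∀ {x y : Fin (suc k)} → x ≺ y → x ≢ y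
      ≢-< lt refl = <-irrefl refl lt

      before : ∀ g → g ⪯ a → EqClosure Step fzero g
      before g le = connect fzero g z≤n (λ y _ y<g → free y (≢-< (<-≤-trans y<g le)) (≢-< (<-trans (<-≤-trans y<g le) a<τa)))

      after : ∀ g → τ a ≺ g → EqClosure Step fzero g
      after g lt = before a ≤-refl ◅◅ fwd (inj₁ refl) ◅ connect (next (τ a)) g (subst (_≤ toℕ g) (sym nb) lt)
        (λ y le _ → let τa<y = subst (_≤ toℕ y) nb le in free y (λ d → ≢-< (<-trans a<τa τa<y) (sym d)) (λ d → ≢-< τa<y (sym d)))

      within : ∀ g → a ≺ g → g ⪯ τ a → EqClosure Step (next a) g
      within g lo hi = connect (next a) g (subst (_≤ toℕ g) (sym na) lo)
        (λ y le y<g → free y (λ d → ≢-< (subst (_≤ toℕ y) na le) (sym d)) (≢-< (<-≤-trans y<g hi)))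

      place : EqClosure Step fzero g
      place with toℕ g ≤? toℕ a | toℕ (τ a) <? toℕ g
      ... | yes le | _ = before g le
      ... | no _   | yes gt = after g gt
      ... | no gt  | no le  = after (β x) τa<βx
        ◅◅ bwd (inj₂ (proj₁ (other x (λ d → ≢-< a<x (sym d)) (≢-< x<τa)) , proj₂ (other x (λ d → ≢-< a<x (sym d)) (≢-< x<τa)) , cong α (sym τx≡x)))
        ◅ (Eq.symmetric _ (within x a<x (<⇒≤ x<τa)) ◅◅ within g (≰⇒> gt) (≮⇒≥ le))

    to-start : ∀ g → EqClosure Step fzero g
    to-start g with τ-α e
    -- The walk never crosses an edge outside the tree, so it still connects everything.
    ... | inj₁ t = connect fzero g z≤n (λ y _ _ → succ-step y (ok y))
      where
      ok : ∀ y → τ y ≡ y ⊎ (y ≢ e × y ≢ α e)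
      ok y with y FinP.≟ e | y FinP.≟ α e
      ... | yes refl | _ = inj₁ t
      ... | no _     | yes refl = inj₁ (trans (τα e) (cong α t))
      ... | no p     | no q     = inj₂ (p , q)
    ... | inj₂ t with <-cmp (toℕ e) (toℕ (τ e))
    ...   | tri< lt _ _ = around e lt (λ y p q → p , (λ d → q (trans d (sym t)))) g
    ...   | tri≈ _ d _  = contradiction (Equivalence.to (α-fixed e) (trans (sym t) (sym (toℕ-injective d)))) e≢root
    ...   | tri> _ _ gt = around (τ e) (subst (τ e ≺_) (sym (τ-inv e)) gt) (λ y p q → (λ d → q (trans d (sym (τ-inv e)))) , (λ d → p (trans d (sym t)))) g

-- The rooted map determines its walk. By induction along the walk an isomorphism fixes every
-- position: a newly met edge belongs to the tree iff its other end is a vertex without earlier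
-- half-edges. `early` and `late` express the two cases, and both are preserved by the isomorphism.
module Rigidity {k} (K K′ : SearchContour k) (iso : SearchContour.toMap K ≅ SearchContour.toMap K′) where
  private
    module K  = SearchContour K
    module K′ = SearchContour K′
    module I  = _≅_ iso

    φ : Fin (suc k) → Fin (suc k)
    φ h = I.iso ⟨$⟩ʳ h

    φ-injective : ∀ {x y} → φ x ≡ φ y → x ≡ y
    φ-injective {x} {y} e = trans (sym (inverseˡ I.iso)) (trans (cong (I.iso ⟨$⟩ˡ_) e) (inverseˡ I.iso))

    start : φ fzero ≡ fzero
    start = trans (cong φ (sym K.σ-last)) (trans (I.σ-hom last) (trans (cong K′.σ I.root↦) K′.σ-last))

    Known : ℕ → Set
    Known n = ∀ x → toℕ x < n → φ x ≡ x × φ (K.τ x) ≡ K′.τ x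

    orbit-fixed : ∀ {x z} → φ z ≡ z → z ∈ orbit K.σ x ⇔ z ∈ orbit K′.σ (φ x)
    orbit-fixed {x} {z} e = mk⇔ (λ z∈ → subst (_∈ orbit K′.σ (φ x)) e (orbit-map⁺ K.CT.f-injective K′.CT.f-injective φ φ-injective I.σ-hom z∈))
      (λ z∈ → orbit-map⁻ K.CT.f-injective K′.CT.f-injective φ φ-injective I.σ-hom (subst (_∈ orbit K′.σ (φ x)) (sym e) z∈))

    early : ∀ (L : SearchContour k) (let module L = SearchContour L) {x} → L.τ x ≡ x → x ≺ L.α x → Σ[ z ∈ Fin (suc k) ] z ⪯ x × z ∈ orbit L.σ (L.α x)
    early L {x} τx x<αx with SearchContour.back-vertex L τx x<αx
    ... | inj₁ l = fzero , z≤n , L.O.orbit-trans l (subst (_∈ orbit L.σ last) L.σ-last L.O.orbit-step)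
      where module L = SearchContour L
    ... | inj₂ (p , p<τp , τp∈ , p<x) = next p , subst (_≤ toℕ x) (sym (≺-next ≤-refl p<x)) p<x ,
        L.O.orbit-trans τp∈ (subst (_∈ orbit L.σ (L.τ p)) (L.σ-τ p) L.O.orbit-step)
      where module L = SearchContour L

    late : ∀ (L : SearchContour k) (let module L = SearchContour L) {x z} → L.τ x ≡ L.α x → x ≺ L.α x → z ∈ orbit L.σ (L.α x) → x ≺ z
    late L {x} {z} t x<αx z∈ = proj₁ (L.tree-vertex (subst (x ≺_) (sym t) x<αx) (subst (λ w → z ∈ orbit L.σ w) (sym t) z∈))
      where module L = SearchContour L

    fixed : ∀ {n} → Known n → ∀ {x} → toℕ x ≤ n → φ x ≡ x → ∀ {z} → z ⪯ x → φ z ≡ z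
    fixed known x≤n e z≤x with m≤n⇒m<n∨m≡n z≤x
    ... | inj₁ lt = proj₁ (known _ (<-≤-trans lt x≤n))
    ... | inj₂ d  = trans (cong φ (toℕ-injective d)) (trans e (sym (toℕ-injective d)))

    tree-step : ∀ x → Known (toℕ x) → φ x ≡ x → φ (K.τ x) ≡ K′.τ x
    tree-step x known e with <-cmp (toℕ (K.α x)) (toℕ x)
    ... | tri≈ _ d _ = let x≡last = Equivalence.to (K.α-fixed x) (toℕ-injective d) in
          subst (λ y → φ (K.τ y) ≡ K′.τ y) (sym x≡last) (trans (cong φ K.τ-last) (trans I.root↦ (sym K′.τ-last)))
    ... | tri< lt _ _ = back (K.τ-α (K.α x))
      where
      y = K.α x
      φy = proj₁ (known y lt)
      α′y : K′.α y ≡ x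
      α′y = trans (cong K′.α (sym φy)) (trans (sym (I.α-hom y)) (trans (cong φ (K.α-inv x)) e))
      back : K.τ y ≡ y ⊎ K.τ y ≡ K.α y → φ (K.τ x) ≡ K′.τ x
      back (inj₁ t) = trans (cong φ (trans (cong K.τ (sym (K.α-inv x))) (trans (K.τα y) (trans (cong K.α t) (K.α-inv x)))))
        (trans e (sym (trans (cong K′.τ (sym α′y)) (trans (K′.τα y) (trans (cong K′.α (trans (sym (proj₂ (known y lt))) (trans (cong φ t) φy))) α′y)))))
      back (inj₂ t) = trans (cong φ (trans (cong K.τ (trans (sym (K.α-inv x)) (sym t))) (K.τ-inv y)))
        (trans φy (sym (trans (cong K′.τ (sym (trans (sym (proj₂ (known y lt))) (trans (cong φ t) (trans (cong φ (K.α-inv x)) e))))) (K′.τ-inv y))))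
    ... | tri> _ _ gt = compare (K.τ-α x) (K′.τ-α x)
      where
      α′x : φ (K.α x) ≡ K′.α x
      α′x = trans (I.α-hom x) (cong K′.α e)
      x<α′x : x ≺ K′.α x
      x<α′x = ≰⇒> λ le → <⇒≱ gt (subst (_⪯ x) (sym (φ-injective (trans α′x (sym (fixed known ≤-refl e le))))) le)
      compare : K.τ x ≡ x ⊎ K.τ x ≡ K.α x → K′.τ x ≡ x ⊎ K′.τ x ≡ K′.α x → φ (K.τ x) ≡ K′.τ x
      compare (inj₁ t) (inj₁ t′) = trans (cong φ t) (trans e (sym t′))
      compare (inj₂ t) (inj₂ t′) = trans (cong φ t) (trans α′x (sym t′))
      compare (inj₁ t) (inj₂ t′) with early K t gt
      ... | z , z≤x , z∈ = contradiction z≤x (<⇒≱ (late K′ t′ x<α′x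
            (subst (λ w → z ∈ orbit K′.σ w) α′x (Equivalence.to (orbit-fixed (fixed known ≤-refl e z≤x)) z∈))))
      compare (inj₂ t) (inj₁ t′) with early K′ t′ x<α′x
      ... | z , z≤x , z∈ = contradiction z≤x (<⇒≱ (late K t gt
            (Equivalence.from (orbit-fixed (fixed known ≤-refl e z≤x)) (subst (λ w → z ∈ orbit K′.σ w) (sym α′x) z∈))))

    known-all : ∀ n → Known n
    known-all (suc n) x (s≤s le) with m≤n⇒m<n∨m≡n le
    ... | inj₁ lt = known-all n x lt
    ... | inj₂ d  = φx , tree-step x here′ φx
      where
      here′ : Known (toℕ x)
      here′ y lt = known-all n y (<-≤-trans lt le)
      φ-next : ∀ y → toℕ y < n → toℕ (next y) ≡ suc (toℕ y) → φ (next y) ≡ next y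
      φ-next y lt nx = let (φy , φτy) = known-all n y lt in
        trans (cong φ (sym (K.σ-τ y))) (trans (I.σ-hom (K.τ y)) (trans (cong K′.σ φτy) (K′.σ-τ y)))
      φx : φ x ≡ x
      φx = go x refl
        where
        go : ∀ y → y ≡ x → φ y ≡ y
        go fzero    _    = start
        go (fsuc y) refl = subst (λ z → φ z ≡ z) (next-prev (fsuc y)) (φ-next (prev (fsuc y)) lt (≺-next ≤-refl (subst (_< suc (toℕ y)) (sym (toℕ-inject₁ y)) (n<1+n (toℕ y)))))
          where
          lt : toℕ (inject₁ y) < n
          lt = subst (_< n) (sym (toℕ-inject₁ y)) le

  α-equal : ∀ x → K.α x ≡ K′.α x
  α-equal x = trans (sym (proj₁ (known-all (suc k) (K.α x) (toℕ<n (K.α x)))))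
    (trans (I.α-hom x) (cong K′.α (proj₁ (known-all (suc k) x (toℕ<n x)))))

-- Depth-first walks of arbitrary maps

module _ {A : Set} where
  data Before : List A → A → A → Set where
    here  : ∀ {u v xs} → v ∈ xs → Before (u ∷ xs) u v
    there : ∀ {u v x xs} → Before xs u v → Before (x ∷ xs) u v

  before-∈ˡ : ∀ {L u v} → Before L u v → u ∈ L
  before-∈ˡ (here _)  = here refl
  before-∈ˡ (there b) = there (before-∈ˡ b)

  before-∈ʳ : ∀ {L u v} → Before L u v → v ∈ L
  before-∈ʳ (here v∈) = there v∈
  before-∈ʳ (there b) = there (before-∈ʳ b)

  before-++ : ∀ {P Q u v} → u ∈ P → v ∈ Q → Before (P ++ Q) u v
  before-++ {x ∷ P} (here refl) v∈ = here (∈-++⁺ʳ P v∈)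
  before-++ {x ∷ P} (there u∈)  v∈ = there (before-++ u∈ v∈)

  before-++ʳ : ∀ P {Q u v} → Before Q u v → Before (P ++ Q) u v
  before-++ʳ [] b = b
  before-++ʳ (x ∷ P) b = there (before-++ʳ P b)

  before-asym : ∀ {L u v} → Unique L → Before L u v → ¬ Before L v u
  before-asym (x∉ ∷ u) (here v∈)  (here u∈)  = All.lookup x∉ u∈ refl
  before-asym (x∉ ∷ u) (here v∈)  (there b)  = All.lookup x∉ (before-∈ʳ b) refl
  before-asym (x∉ ∷ u) (there b)  (here u∈)  = All.lookup x∉ (before-∈ʳ b) refl
  before-asym (x∉ ∷ u) (there b)  (there b′) = before-asym u b b′

  before-insert⁺ : ∀ P V {Q u v} → Before (P ++ Q) u v → Before (P ++ V ++ Q) u v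
  before-insert⁺ [] V b = before-++ʳ V b
  before-insert⁺ (x ∷ P) V (here v∈) = here (case ∈-++⁻ P v∈ of λ { (inj₁ p) → ∈-++⁺ˡ p ; (inj₂ q) → ∈-++⁺ʳ P (∈-++⁺ʳ V q) })
  before-insert⁺ (x ∷ P) V (there b) = there (before-insert⁺ P V b)

  before-insert⁻ : ∀ P V {Q u v} → u ∉ V → v ∉ V → Before (P ++ V ++ Q) u v → Before (P ++ Q) u v
  before-insert⁻ [] [] u∉ v∉ b = b
  before-insert⁻ [] (x ∷ V) u∉ v∉ (here _)  = contradiction (here refl) u∉
  before-insert⁻ [] (x ∷ V) u∉ v∉ (there b) = before-insert⁻ [] V (u∉ ∘ there) (v∉ ∘ there) b
  before-insert⁻ (x ∷ P) V u∉ v∉ (here v∈) = here (case ∈-++⁻ P v∈ of λ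
    { (inj₁ p) → ∈-++⁺ˡ p ; (inj₂ q) → case ∈-++⁻ V q of λ { (inj₁ r) → contradiction r v∉ ; (inj₂ r) → ∈-++⁺ʳ P r } })
  before-insert⁻ (x ∷ P) V u∉ v∉ (there b) = there (before-insert⁻ P V u∉ v∉ b)

  lookup-before : ∀ L (i j : Fin (length L)) → i ≺ j → Before L (lookup L i) (lookup L j)
  lookup-before (x ∷ L) fzero    (fsuc j) lt = here (∈-lookup j)
  lookup-before (x ∷ L) (fsuc i) (fsuc j) (s≤s lt) = there (lookup-before L i j lt)

  data Path (R : A → A → Set) : A → List A → A → Set where
    []  : ∀ {x} → Path R x [] x
    _∷_ : ∀ {x y ys z} → R x y → Path R y ys z → Path R x (y ∷ ys) z

  path-++ : ∀ {R x xs y ys z} → Path R x xs y → Path R y ys z → Path R x (xs ++ ys) z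
  path-++ [] q = q
  path-++ (r ∷ p) q = r ∷ path-++ p q

  path-split : ∀ {R x} xs {y ys z} → Path R x (xs ++ y ∷ ys) z → Path R x (xs ++ [ y ]) y × Path R y ys z
  path-split [] (r ∷ p) = r ∷ [] , p
  path-split (w ∷ xs) (r ∷ p) = let (q , q′) = path-split xs p in r ∷ q , q′

  path-map : ∀ {R R′ x xs z} → Path R x (xs ++ [ z ]) z → (∀ {u w} → u ∈ x ∷ xs → R u w → R′ u w) → Path R′ x (xs ++ [ z ]) z
  path-map {xs = []}     (r ∷ []) f = f (here refl) r ∷ []
  path-map {xs = y ∷ xs} (r ∷ p)  f = f (here refl) r ∷ path-map p (f ∘ there)

  path-last : ∀ {R x y ys z} → Path R x (y ∷ ys) z → lookup (y ∷ ys) (fromℕ (length ys)) ≡ z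
  path-last (r ∷ []) = refl
  path-last (r ∷ (r′ ∷ p)) = path-last (r′ ∷ p)

  path-inject : ∀ {R x y ys z} → Path R x (y ∷ ys) z → ∀ i → R (lookup (y ∷ ys) (inject₁ i)) (lookup (y ∷ ys) (fsuc i))
  path-inject (r ∷ (r′ ∷ p)) fzero    = r′
  path-inject (r ∷ (r′ ∷ p)) (fsuc i) = path-inject (r′ ∷ p) i

module _ {A : Set} where
  lookup-index-≡ : ∀ {L : List A} → Unique L → (p : ∀ x → x ∈ L) → ∀ i → index (p (lookup L i)) ≡ i
  lookup-index-≡ u p i = lookup-injective u _ _ (lookup-∈ (p _))

-- A list of all half-edges of a map, ending with the root, along a walk
-- around the tree whose edges are opened by the elements of TO.
module Number (M : RootedMap) where
  open RootedMap M
  open DecMembership (FinP._≟_ {size}) using (_∈?_)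

  InTree : List HalfEdge → HalfEdge → Set
  InTree TO x = x ∈ TO ⊎ α x ∈ TO

  tree? : ∀ TO x → Dec (InTree TO x)
  tree? TO x = (x ∈? TO) ⊎-dec (α x ∈? TO)

  τ : List HalfEdge → HalfEdge → HalfEdge
  τ TO x with tree? TO x
  ... | yes _ = α x
  ... | no  _ = x

  τ-tree : ∀ {TO x} → InTree TO x → τ TO x ≡ α x
  τ-tree {TO} {x} t with tree? TO x
  ... | yes _ = refl
  ... | no ¬t = contradiction t ¬t

  τ-free : ∀ {TO x} → ¬ InTree TO x → τ TO x ≡ x
  τ-free {TO} {x} ¬t with tree? TO x
  ... | yes t = contradiction t ¬t
  ... | no _  = refl

  tree-α : ∀ {TO x} → InTree TO x → InTree TO (α x)
  tree-α {TO} {x} (inj₁ x∈) = inj₂ (subst (_∈ TO) (sym (α-involutive x)) x∈)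
  tree-α (inj₂ αx∈) = inj₁ αx∈

  τ-involutive : ∀ TO x → τ TO (τ TO x) ≡ x
  τ-involutive TO x with tree? TO x
  ... | yes t = trans (τ-tree (tree-α t)) (α-involutive x)
  ... | no ¬t = τ-free ¬t

  Succ : List HalfEdge → HalfEdge → HalfEdge → Set
  Succ TO x y = σ (τ TO x) ≡ y

  -- The conditions of a search contour for a walk given as a list: `nested` will become the
  -- noncrossing of `τ`, and `search` the condition `dfs`. Planarity enters only later.
  record Numbering (TO L : List HalfEdge) : Set where
    field
      unique   : Unique L
      complete : ∀ h → h ∈ L
      walk     : Path (Succ TO) root L root
      opened   : ∀ {a} → a ∈ TO → Before L a (α a)
      nested   : ∀ {a a′} → a ∈ TO → a′ ∈ TO → Before L a a′ → Before L a′ (α a) → ¬ Before L (α a) (α a′)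
      search   : ∀ {x a} → ¬ InTree TO x → a ∈ TO → Before L x a → Before L a (α x) → ¬ Before L (α x) (α a)

  module FromNumbering {TO y ys} (N : Numbering TO (y ∷ ys)) where
    open Numbering N

    k : ℕ
    k = length ys

    at : Fin (suc k) → HalfEdge
    at = lookup (y ∷ ys)

    pos : HalfEdge → Fin (suc k)
    pos h = index (complete h)

    at-pos : ∀ h → at (pos h) ≡ h
    at-pos h = lookup-∈ (complete h)

    pos-at : ∀ i → pos (at i) ≡ i
    pos-at = lookup-index-≡ unique complete

    pos-root : pos root ≡ last
    pos-root = trans (cong pos (sym (path-last walk))) (pos-at last)

    at-last : at last ≡ root
    at-last = path-last walk

    pos-next : ∀ h → pos (σ (τ TO h)) ≡ next (pos h)
    pos-next h = trans (cong (λ z → pos (σ (τ TO z))) (sym (at-pos h))) (go (pos h))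
      where
      first : ∀ {z} → Path (Succ TO) root (y ∷ ys) z → σ (τ TO root) ≡ y
      first (r ∷ _) = r
      go : ∀ i → pos (σ (τ TO (at i))) ≡ next i
      go i = trans (cong (λ z → pos (σ (τ TO (at z)))) (sym (prev-next i))) (at-prev (next i))
        where
        at-prev : ∀ j → pos (σ (τ TO (at (prev j)))) ≡ j
        at-prev fzero    = trans (cong pos (trans (cong (λ z → σ (τ TO z)) at-last) (first walk))) (pos-at fzero)
        at-prev (fsuc j) = trans (cong pos (path-inject walk j)) (pos-at (fsuc j))

    contour : Contour k
    contour = record
      { α = λ i → pos (α (at i))
      ; τ = λ i → pos (τ TO (at i))
      ; α-inv   = λ i → trans (cong (pos ∘ α) (at-pos _)) (trans (cong pos (α-involutive (at i))) (pos-at i))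
      ; α-fixed = λ i → mk⇔
          (λ e → trans (sym (pos-at i)) (trans (cong pos (Equivalence.to (α-fixed (at i)) (trans (sym (at-pos _)) (cong at e)))) pos-root))
          (λ { refl → trans (cong pos (Equivalence.from (α-fixed (at last)) at-last)) (pos-at last) })
      ; τ-inv   = λ i → trans (cong (pos ∘ τ TO) (at-pos _)) (trans (cong pos (τ-involutive TO (at i))) (pos-at i))
      ; τ-α     = λ i → case tree? TO (at i) of λ
          { (yes t) → inj₂ (cong pos (τ-tree t)) ; (no ¬t) → inj₁ (trans (cong pos (τ-free ¬t)) (pos-at i)) }
      }
    private
      module C = Contour contour

    iso : M ≅ C.toMap
    iso = record
      { iso   = permutation pos at pos-at at-pos
      ; σ-hom = λ h → trans (cong (pos ∘ σ) (sym (τ-involutive TO h))) (trans (pos-next (τ TO h)) (cong (next ∘ pos ∘ τ TO) (sym (at-pos h))))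
      ; α-hom = λ h → cong (pos ∘ α) (sym (at-pos h))
      ; root↦ = pos-root
      }

    private
      before : ∀ {i j} → i ≺ j → Before (y ∷ ys) (at i) (at j)
      before {i} {j} = lookup-before (y ∷ ys) i j

      before′ : ∀ {i} {h} → i ≺ pos h → Before (y ∷ ys) (at i) h
      before′ {i} {h} lt = subst (Before (y ∷ ys) (at i)) (at-pos h) (before lt)

      ′before : ∀ {i} {h} → pos h ≺ i → Before (y ∷ ys) h (at i)
      ′before {i} {h} lt = subst (λ z → Before (y ∷ ys) z (at i)) (at-pos h) (before lt)

      ′before′ : ∀ {g h} → pos g ≺ pos h → Before (y ∷ ys) g h
      ′before′ {g} {h} lt = subst (Before (y ∷ ys) g) (at-pos h) (′before lt)

      opener : ∀ {i} → i ≺ C.τ i → at i ∈ TO × C.τ i ≡ pos (α (at i))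
      opener {i} lt with tree? TO (at i)
      ... | yes (inj₁ i∈)  = i∈ , refl
      ... | yes (inj₂ αi∈) = contradiction (subst (Before (y ∷ ys) (α (at i))) (α-involutive (at i)) (opened αi∈)) (before-asym unique (before′ lt))
      ... | no _ = contradiction (cong toℕ (sym (pos-at i))) (<⇒≢ lt)

    nc-τ : C.CT.NC
    nc-τ i j i<j j<τi with opener (<-trans i<j j<τi) | tree? TO (at j)
    ... | i∈ , e | no ¬t = subst (i ≺_) (sym (pos-at j)) i<j , subst (_≺ C.τ i) (sym (pos-at j)) j<τi
    ... | i∈ , e | yes (inj₁ j∈) = <-trans i<j j<αj , ≤∧≢⇒< (≮⇒≥ (λ lt → nested i∈ j∈ (before i<j) (before′ (subst (j ≺_) e j<τi)) (′before′ (subst (_≺ pos (α (at j))) e lt))))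
          (λ d → <⇒≢ i<j (cong toℕ (sym (trans (sym (pos-at j)) (trans (cong pos (map-α-injective M {at j} {at i} (trans (sym (at-pos (α (at j)))) (trans (cong at (trans (toℕ-injective d) e)) (at-pos (α (at i))))))) (pos-at i))))))
      where
      j<αj : j ≺ pos (α (at j))
      j<αj = ≰⇒> λ le → case m≤n⇒m<n∨m≡n le of λ
        { (inj₁ lt) → before-asym unique (opened j∈) (′before lt)
        ; (inj₂ d) → before-asym unique (opened j∈) (subst₂ (Before (y ∷ ys)) (sym (trans (sym (at-pos _)) (cong at (toℕ-injective d)))) (trans (sym (at-pos _)) (cong at (toℕ-injective d))) (opened j∈)) }
    ... | i∈ , e | yes (inj₂ αj∈) = i<αj , <-trans αj<j j<τi
      where
      opened′ : Before (y ∷ ys) (α (at j)) (at j)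
      opened′ = subst (Before (y ∷ ys) (α (at j))) (α-involutive (at j)) (opened αj∈)
      αj<j : pos (α (at j)) ≺ j
      αj<j = ≰⇒> λ le → case m≤n⇒m<n∨m≡n le of λ
        { (inj₁ lt) → before-asym unique opened′ (before′ lt)
        ; (inj₂ d) → before-asym unique opened′ (subst₂ (Before (y ∷ ys)) (sym (trans (cong at (toℕ-injective d)) (at-pos _))) (trans (cong at (toℕ-injective d)) (at-pos _)) opened′) }
      i<αj : i ≺ pos (α (at j))
      i<αj = ≤∧≢⇒< (≮⇒≥ (λ lt → nested αj∈ i∈ (′before lt) (subst (Before (y ∷ ys) (at i)) (sym (α-involutive (at j))) (before i<j))
            (subst (λ z → Before (y ∷ ys) z (α (at i))) (sym (α-involutive (at j))) (before′ (subst (j ≺_) e j<τi)))))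
          (λ d → <⇒≢ j<τi (cong toℕ (trans (sym (pos-at j)) (trans (cong pos (trans (sym (α-involutive (at j))) (cong α (trans (sym (at-pos _)) (cong at (sym (toℕ-injective d))))))) (sym e)))))

    dfs : ∀ i a → i ≺ a → a ≺ C.β i → ¬ (C.β i ≺ C.τ a)
    dfs i a i<a a<βi βi<τa with opener (<-trans a<βi βi<τa)
    ... | a∈ , e = decide (tree? TO (at i))
      where
      βi : C.β i ≡ pos (α (τ TO (at i)))
      βi = cong (pos ∘ α) (at-pos _)
      decide : Dec (InTree TO (at i)) → ⊥
      decide (yes t) = <-asym i<a (subst (a ≺_) (trans βi (trans (cong (pos ∘ α) (τ-tree t)) (trans (cong pos (α-involutive (at i))) (pos-at i)))) a<βi)
      decide (no ¬t) = search ¬t a∈ (before i<a) (before′ (subst (a ≺_) βi′ a<βi)) (′before′ (subst₂ _≺_ βi′ e βi<τa))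
        where
        βi′ : C.β i ≡ pos (α (at i))
        βi′ = trans βi (cong (pos ∘ α) (τ-free ¬t))

module _ {A : Set} (_≟_ : (x y : A) → Dec (x ≡ y)) (f : A → A) where
  private
    Step : A → A → Set
    Step u w = f u ≡ w

  first-return : ∀ n u y → pow f (suc n) u ≡ y → Σ[ V ∈ List A ] y ∉ V × Path Step u (V ++ [ y ]) y
  first-return n u y e with f u ≟ y
  first-return n u y e | yes d = [] , (λ ()) , d ∷ []
  first-return zero    u y e | no ne = contradiction e ne
  first-return (suc n) u y e | no ne with first-return n (f u) y e
  ... | V , y∉V , p = f u ∷ V , (λ { (here d) → ne (sym d) ; (there y∈) → y∉V y∈ }) , refl ∷ p

  private
    deterministic : ∀ {u y} V V′ → y ∉ V → y ∉ V′ → Path Step u (V ++ [ y ]) y → Path Step u (V′ ++ [ y ]) y → V ≡ V′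
    deterministic [] [] n n′ p q = refl
    deterministic [] (x ∷ V′)  n n′ (d ∷ _) (d′ ∷ _) = contradiction (here (trans (sym d) d′)) n′
    deterministic (x ∷ V) [] n n′ (d ∷ _) (d′ ∷ _) = contradiction (here (trans (sym d′) d)) n
    deterministic (x ∷ V) (x′ ∷ V′) n n′ (refl ∷ p) (refl ∷ q) = cong (x ∷_) (deterministic V V′ (n ∘ there) (n′ ∘ there) p q)

    split : ∀ {h : A} {V} → h ∈ V → Σ[ P ∈ List A ] Σ[ Q ∈ List A ] V ≡ P ++ h ∷ Q
    split (here refl) = [] , _ , refl
    split {V = x ∷ V} (there h∈) = let (P , Q , e) = split h∈ in x ∷ P , Q , cong (x ∷_) e

    -- If `h` came back, the rest of the path from there would be a shorter path from `h` to `y`,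
    -- but a deterministic step relation allows only one.
    ∉-self : ∀ {h y} V → y ∉ V → Path Step h (V ++ [ y ]) y → h ∉ V
    ∉-self {h} {y} V y∉ p h∈ with split h∈
    ... | P , Q , refl = <-irrefl (cong length (deterministic Q (P ++ h ∷ Q) (λ q → y∉ (∈-++⁺ʳ P (there q))) y∉
            (proj₂ (path-split P (subst (λ xs → Path Step h xs y) (++-assoc P (h ∷ Q) [ y ]) p))) p))
          (subst (length Q <_) (sym (length-++ P)) (m≤n+m (suc (length Q)) (length P)))

  path-unique : ∀ {u y} V → y ∉ V → Path Step u (V ++ [ y ]) y → Unique (V ++ [ y ])
  path-unique [] n p = [] ∷ []
  path-unique (x ∷ V) n (refl ∷ p) = All.tabulate (λ z∈ d → case ∈-++⁻ V z∈ of λ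
      { (inj₁ z∈V) → ∉-self V (n ∘ there) p (subst (_∈ V) (sym d) z∈V) ; (inj₂ (here e)) → n (here (sym (trans d e))) })
    ∷ path-unique V (n ∘ there) p

  path-closed : ∀ {u xs z} → Path Step u xs z → ∀ {w} → w ∈ u ∷ xs → f w ∈ xs ⊎ w ≡ z
  path-closed [] (here refl) = inj₂ refl
  path-closed (refl ∷ p)  (here refl) = inj₁ (here refl)
  path-closed (refl ∷ p)  (there w∈)  = case path-closed p w∈ of λ { (inj₁ q) → inj₁ (there q) ; (inj₂ e) → inj₂ e }

  path-orbit : ∀ {u xs z} → Path Step u xs z → ∀ {w} → w ∈ xs → Σ[ k ∈ ℕ ] w ≡ pow f k u
  path-orbit (refl ∷ p) (here refl) = 1 , refl
  path-orbit (refl ∷ p) (there w∈)  = let (k , e) = path-orbit p w∈ in suc k , e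

module Grow (M : RootedMap) where
  open RootedMap M
  open Number M
  open DecMembership (FinP._≟_ {size}) using (_∈?_)
  private
    module Oσ = Orbit σ (map-σ-injective M)

  -- The half-edges at the vertex of `y` in cyclic order from `σ y` on, with `y` at the end: the
  -- order in which the search leaves and finally quits a vertex entered by `y`.
  record Vertex (y : HalfEdge) : Set where
    field
      V : List HalfEdge
      unique : Unique (V ++ [ y ])
      walk   : Path (λ u w → σ u ≡ w) y (V ++ [ y ]) y
      sound  : ∀ {z} → z ∈ V ++ [ y ] → z ∈ orbit σ y
      closed : ∀ {z} → z ∈ V ++ [ y ] → σ z ∈ V ++ [ y ]

  vertex : ∀ y → Vertex y
  vertex y with Oσ.period y
  ... | suc p , _ , _ , e with first-return FinP._≟_ σ p y y e
  ...   | V , y∉V , path = record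
    { V = V ; unique = path-unique FinP._≟_ σ V y∉V path ; walk = path
    ; sound = λ z∈ → let (j , d) = path-orbit FinP._≟_ σ path z∈ in subst (_∈ orbit σ y) (sym d) (Oσ.pow-∈ j y)
    ; closed = λ {z} z∈ → case path-closed FinP._≟_ σ path (there z∈) of λ
        { (inj₁ q) → q
        ; (inj₂ d) → subst (λ w → σ w ∈ V ++ [ y ]) (sym d) (case path-closed FinP._≟_ σ path (here refl) of λ
            { (inj₁ q) → q ; (inj₂ _) → start path }) } }
    where
    start : ∀ {z} → Path (λ u w → σ u ≡ w) y (V ++ [ y ]) z → σ y ∈ V ++ [ y ]
    start p = go V p
      where
      go : ∀ V {z} → Path (λ u w → σ u ≡ w) y (V ++ [ y ]) z → σ y ∈ V ++ [ y ]
      go [] (d ∷ _) = here d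
      go (_ ∷ V) (d ∷ _) = here d

  -- The half-edges in A are processed, those in B are to be processed.
  record State (TO A B : List HalfEdge) : Set where
    L : List HalfEdge
    L = A ++ B ++ [ root ]
    field
      unique    : Unique L
      closed    : ∀ {x} → x ∈ L → σ x ∈ L
      walk : Path (Succ TO) root L root
      processed : ∀ {a} → a ∈ TO → a ∈ A
      opened    : ∀ {a} → a ∈ TO → Before L a (α a)
      seen : ∀ {x} → x ∈ A → α x ∈ L
      nested    : ∀ {a a′} → a ∈ TO → a′ ∈ TO → Before L a a′ → Before L a′ (α a) → ¬ Before L (α a) (α a′)
      search    : ∀ {x a} → x ∈ A → ¬ InTree TO x → a ∈ TO → Before L x a → Before L a (α x) → ¬ Before L (α x) (α a)

  start : Σ[ B ∈ List HalfEdge ] State [] [] B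
  start = V , record
    { unique = unique ; closed = closed
    ; walk = path-map walk (λ _ e → trans (cong σ (τ-free {[]} λ { (inj₁ ()) ; (inj₂ ()) })) e)
    ; processed = λ () ; opened = λ () ; seen = λ () ; nested = λ () ; search = λ () }
    where open Vertex (vertex root)

  -- When nothing is left to process, the list is closed under `σ` and `α`; as the map is
  -- transitive, it contains every half-edge.
  finished : ∀ {TO A} → State TO A [] → Numbering TO (A ++ [ root ])
  finished {TO} {A} S = record
    { unique = unique ; complete = complete ; walk = walk ; opened = opened ; nested = nested
    ; search = λ {x} ¬t a∈ b₁ b₂ b₃ → case ∈-++⁻ A (before-∈ˡ b₁) of λ
        { (inj₁ x∈) → search x∈ ¬t a∈ b₁ b₂ b₃
        ; (inj₂ (here refl)) → before-asym unique b₁ (before-++ (processed a∈) (here refl)) } }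
    where
    open State S
    inside : ∀ {x y} → σ x ≡ y ⊎ α x ≡ y → x ∈ A ++ [ root ] ⇔ y ∈ A ++ [ root ]
    inside (inj₁ refl) = mk⇔ closed backwards
      where
      go : ∀ j {x} → x ∈ A ++ [ root ] → pow σ j x ∈ A ++ [ root ]
      go zero    x∈ = x∈
      go (suc j) x∈ = go j (closed x∈)
      backwards : ∀ {x} → σ x ∈ A ++ [ root ] → x ∈ A ++ [ root ]
      backwards {x} σx∈ = let (j , e) = Oσ.orbit-pow (Oσ.orbit-sym (Oσ.orbit-step {x})) in subst (_∈ A ++ [ root ]) (sym e) (go j σx∈)
    inside {x} (inj₂ refl) = mk⇔ forth (λ αx∈ → subst (_∈ A ++ [ root ]) (α-involutive x) (forth αx∈))
      where
      forth : ∀ {x} → x ∈ A ++ [ root ] → α x ∈ A ++ [ root ]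
      forth x∈ = case ∈-++⁻ A x∈ of λ
        { (inj₁ x∈A) → seen x∈A
        ; (inj₂ (here refl)) → subst (_∈ A ++ [ root ]) (sym (Equivalence.from (α-fixed root) refl)) (∈-++⁺ʳ A (here refl)) }
    complete : ∀ h → h ∈ A ++ [ root ]
    complete h = closure-invariant (_∈ A ++ [ root ]) inside (transitive root h) (∈-++⁺ʳ A (here refl))

  skip : ∀ {TO A x B} → State TO A (x ∷ B) → α x ∈ A ++ x ∷ B ++ [ root ] → State TO (A ++ [ x ]) B
  skip {TO} {A} {x} {B} S αx∈ = record
    { unique = subst Unique e unique ; closed = subst (λ L → ∀ {x} → x ∈ L → σ x ∈ L) e (λ {x} → closed {x})
    ; walk = subst (λ L → Path (Succ TO) root L root) e walk
    ; processed = λ a∈ → ∈-++⁺ˡ (processed a∈)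
    ; opened = λ {a} a∈ → subst (λ L → Before L a (α a)) e (opened a∈)
    ; seen = λ {y} y∈ → subst (α y ∈_) e (case ∈-++⁻ A y∈ of λ { (inj₁ p) → seen p ; (inj₂ (here refl)) → αx∈ })
    ; nested = subst (λ L → ∀ {a a′} → a ∈ TO → a′ ∈ TO → Before L a a′ → Before L a′ (α a) → ¬ Before L (α a) (α a′)) e (λ {a} {a′} → nested {a} {a′})
    ; search = λ {y} {a} y∈ ¬t a∈ → subst (λ L → Before L y a → Before L a (α y) → ¬ Before L (α y) (α a)) e
        (case ∈-++⁻ A y∈ of λ { (inj₁ p) → search p ¬t a∈
          ; (inj₂ (here refl)) → λ b₁ _ _ → before-asym unique b₁ (before-++ (processed a∈) (here refl)) }) }
    where
    open State S
    e : A ++ x ∷ B ++ [ root ] ≡ (A ++ [ x ]) ++ B ++ [ root ]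
    e = sym (++-assoc A [ x ] (B ++ [ root ]))

  -- The edge from `x` leads to a new vertex. Its half-edges are inserted directly behind `x`, in
  -- front of everything still waiting; this is what makes the walk depth-first.
  module Attach {TO A x B} (S : State TO A (x ∷ B)) (y∉L : α x ∉ A ++ x ∷ B ++ [ root ]) where
    open State S
    y : HalfEdge
    y = α x
    module Vy = Vertex (vertex y)
    V : List HalfEdge
    V = Vy.V

    P Q L′ : List HalfEdge
    P = A ++ [ x ]
    Q = B ++ [ root ]
    L′ = P ++ (V ++ [ y ]) ++ Q

    L≡ : L ≡ P ++ Q
    L≡ = sym (++-assoc A [ x ] Q)

    new∉L : ∀ {z} → z ∈ V ++ [ y ] → z ∉ L
    new∉L z∈ z∈L = y∉L (let (j , e) = Oσ.orbit-pow (Oσ.orbit-sym (Vy.sound z∈)) in subst (_∈ L) (sym e) (go j z∈L))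
      where
      go : ∀ j {z} → z ∈ L → pow σ j z ∈ L
      go zero    z∈ = z∈
      go (suc j) z∈ = go j (closed z∈)

    old∉new : ∀ {z} → z ∈ L → z ∉ V ++ [ y ]
    old∉new z∈L z∈ = new∉L z∈ z∈L

    L⊆L′ : ∀ {z} → z ∈ L → z ∈ L′
    L⊆L′ z∈ = case ∈-++⁻ P (subst (_ ∈_) L≡ z∈) of λ { (inj₁ p) → ∈-++⁺ˡ p ; (inj₂ q) → ∈-++⁺ʳ P (∈-++⁺ʳ (V ++ [ y ]) q) }

    new⊆L′ : ∀ {z} → z ∈ V ++ [ y ] → z ∈ L′
    new⊆L′ z∈ = ∈-++⁺ʳ P (∈-++⁺ˡ z∈)

    L′⁻ : ∀ {z} → z ∈ L′ → z ∈ L ⊎ z ∈ V ++ [ y ]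
    L′⁻ z∈ = case ∈-++⁻ P z∈ of λ
      { (inj₁ p) → inj₁ (subst (_ ∈_) (sym L≡) (∈-++⁺ˡ p))
      ; (inj₂ q) → case ∈-++⁻ (V ++ [ y ]) q of λ { (inj₁ r) → inj₂ r ; (inj₂ r) → inj₁ (subst (_ ∈_) (sym L≡) (∈-++⁺ʳ P r)) } }

    before⁺ : ∀ {u v} → Before L u v → Before L′ u v
    before⁺ b = before-insert⁺ P (V ++ [ y ]) (subst (λ L → Before L _ _) L≡ b)

    before⁻ : ∀ {u v} → u ∈ L → v ∈ L → Before L′ u v → Before L u v
    before⁻ u∈ v∈ b = subst (λ L → Before L _ _) (sym L≡) (before-insert⁻ P (V ++ [ y ]) (old∉new u∈) (old∉new v∈) b)

    unique′ : Unique L′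
    unique′ = insert P (subst Unique L≡ unique) (λ z∈ → subst (_ ∉_) L≡ (new∉L z∈))
      where
      insert : ∀ P → Unique (P ++ Q) → (∀ {z} → z ∈ V ++ [ y ] → z ∉ P ++ Q) → Unique (P ++ (V ++ [ y ]) ++ Q)
      insert [] u n = Unique.++⁺ Vy.unique u (λ (p , q) → n p q)
      insert (z ∷ P) (z∉ ∷ u) n = All.tabulate (λ w∈ d → case ∈-++⁻ P w∈ of λ
          { (inj₁ p) → All.lookup z∉ (∈-++⁺ˡ p) d
          ; (inj₂ q) → case ∈-++⁻ (V ++ [ y ]) q of λ { (inj₁ r) → n r (here (sym d)) ; (inj₂ r) → All.lookup z∉ (∈-++⁺ʳ P r) d } })
        ∷ insert P u (λ z∈ → n z∈ ∘ there)

    -- The inserted block starts directly behind `x` and ends with `y`, so no old half-edge lies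
    -- between the two. Hence the new tree edge violates neither `nested` nor `search`.
    before-y : ∀ {z} → z ∈ L → Before L′ x z → ¬ Before L′ z y
    before-y z∈ b c = case ∈-++⁻ P (subst (_ ∈_) L≡ z∈) of λ
      { (inj₂ q) → before-asym unique′ c (before-++ʳ P (before-++ {P = V ++ [ y ]} (∈-++⁺ʳ V (here refl)) q))
      ; (inj₁ p) → case ∈-++⁻ A p of λ
          { (inj₁ a) → before-asym unique′ b (subst (λ L → Before L _ x) (sym (++-assoc A [ x ] _)) (before-++ a (here refl)))
          ; (inj₂ (here refl)) → before-asym unique′ b b } }

    TO′ : List HalfEdge
    TO′ = x ∷ TO

    old-tree : ∀ {u} → u ≢ x → u ≢ y → InTree TO′ u ⇔ InTree TO u
    old-tree u≢x u≢y = mk⇔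
      (λ { (inj₁ (here e)) → contradiction e u≢x ; (inj₁ (there p)) → inj₁ p
         ; (inj₂ (here e)) → contradiction (trans (sym (α-involutive _)) (cong α e)) u≢y ; (inj₂ (there p)) → inj₂ p })
      λ { (inj₁ p) → inj₁ (there p) ; (inj₂ p) → inj₂ (there p) }

    τ-old : ∀ {u} → u ≢ x → u ≢ y → τ TO′ u ≡ τ TO u
    τ-old {u} u≢x u≢y = decide (tree? TO u)
      where
      decide : Dec (InTree TO u) → τ TO′ u ≡ τ TO u
      decide (yes t) = trans (τ-tree (Equivalence.from (old-tree u≢x u≢y) t)) (sym (τ-tree t))
      decide (no ¬t) = trans (τ-free (¬t ∘ Equivalence.to (old-tree u≢x u≢y))) (sym (τ-free ¬t))

    x∈L : x ∈ L
    x∈L = ∈-++⁺ʳ A (here refl)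

    x∉A : x ∉ A
    x∉A x∈ = before-asym unique (before-++ {P = A} x∈ (here refl)) (before-++ {P = A} x∈ (here refl))

    ¬tree-x : ¬ InTree TO x
    ¬tree-x (inj₁ x∈) = x∉A (processed x∈)
    ¬tree-x (inj₂ y∈) = y∉L (∈-++⁺ˡ (processed y∈))

    walk′ : Path (Succ TO′) root L′ root
    walk′ with path-split A walk
    ... | before-x , after-x = path-++ (path-map before-x λ u∈ r → trans (cong σ (τ-old (≢x u∈) (≢y u∈))) r)
        (path-++ (new Vy.walk) (rest after-x))
      where
      x≢root : x ≢ root
      x≢root refl = y∉L (subst (_∈ L) (sym (Equivalence.from (α-fixed root) refl)) x∈L)
      ≢x : ∀ {u} → u ∈ root ∷ A → u ≢ x
      ≢x (here refl) e = x≢root (sym e)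
      ≢x (there u∈)  e = x∉A (subst (_∈ A) e u∈)
      ≢y : ∀ {u} → u ∈ root ∷ A → u ≢ y
      ≢y (here refl) e = y∉L (subst (_∈ L) e (∈-++⁺ʳ A (there (∈-++⁺ʳ B (here refl)))))
      ≢y (there u∈)  e = y∉L (subst (_∈ L) e (∈-++⁺ˡ u∈))
      map-new : ∀ {u xs} → u ∉ L → u ≢ y → (∀ {z} → z ∈ xs → z ∉ L × z ≢ y) → Path (λ u w → σ u ≡ w) u (xs ++ [ y ]) y → Path (Succ TO′) u (xs ++ [ y ]) y
      map-new {u} n ne ns p = path-map p λ
        { (here refl) r → trans (cong σ (free n ne)) r
        ; (there u∈)  r → trans (cong σ (free (proj₁ (ns u∈)) (proj₂ (ns u∈)))) r }
        where
        free : ∀ {u} → u ∉ L → u ≢ y → τ TO′ u ≡ u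
        free {u} n ne = τ-free {TO′} λ
          { (inj₁ (here e)) → n (subst (_∈ L) (sym e) x∈L)
          ; (inj₁ (there u∈)) → n (∈-++⁺ˡ (processed u∈))
          ; (inj₂ (here e)) → ne (trans (sym (α-involutive u)) (cong α e))
          ; (inj₂ (there αu∈)) → n (subst (_∈ L) (α-involutive u) (before-∈ʳ (opened αu∈))) }
      from-x : ∀ {w} → σ y ≡ w → Succ TO′ x w
      from-x e = trans (cong σ (τ-tree (inj₁ (here refl)))) e
      interior : ∀ {V} → Unique (V ++ [ y ]) → (∀ {z} → z ∈ V ++ [ y ] → z ∉ L) → ∀ {z} → z ∈ V → z ∉ L × z ≢ y
      interior {V} u n {z} z∈ = n (∈-++⁺ˡ z∈) , λ e → before-asym u (before-++ {P = V} z∈ (here refl)) (subst₂ (Before (V ++ [ y ])) e (sym e) (before-++ {P = V} z∈ (here refl)))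
      new : Path (λ u w → σ u ≡ w) y (V ++ [ y ]) y → Path (Succ TO′) x (V ++ [ y ]) y
      new = go V (interior Vy.unique new∉L)
        where
        go : ∀ V → (∀ {z} → z ∈ V → z ∉ L × z ≢ y) → Path (λ u w → σ u ≡ w) y (V ++ [ y ]) y → Path (Succ TO′) x (V ++ [ y ]) y
        go [] ns (r ∷ p) = from-x r ∷ []
        go (z ∷ V) ns (r ∷ p) = from-x r ∷ map-new (proj₁ (ns (here refl))) (proj₂ (ns (here refl))) (ns ∘ there) p
      later : ∀ {u} → u ∈ B → u ≢ x × u ≢ y
      later u∈ = (λ e → before-asym unique (x-before u∈) (subst₂ (Before L) (sym e) e (x-before u∈)))
        , (λ e → y∉L (subst (_∈ L) e (∈-++⁺ʳ A (there (∈-++⁺ˡ u∈)))))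
        where
        x-before : ∀ {u} → u ∈ B → Before L x u
        x-before u∈ = before-++ʳ A (here (∈-++⁺ˡ u∈))
      rest : Path (Succ TO) x (B ++ [ root ]) root → Path (Succ TO′) y (B ++ [ root ]) root
      rest = go B (λ {u} → later {u})
        where
        from-y : ∀ {w} → Succ TO x w → Succ TO′ y w
        from-y r = trans (cong σ (trans (τ-tree (inj₂ (here (α-involutive x)))) (α-involutive x))) (trans (cong σ (sym (τ-free ¬tree-x))) r)
        go : ∀ B → (∀ {u} → u ∈ B → u ≢ x × u ≢ y) → Path (Succ TO) x (B ++ [ root ]) root → Path (Succ TO′) y (B ++ [ root ]) root
        go [] ns (r ∷ []) = from-y r ∷ []
        go (b ∷ B) ns (r ∷ p)  = from-y r ∷ path-map p λ u∈ r → trans (cong σ (τ-old (proj₁ (ns u∈)) (proj₂ (ns u∈)))) r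

    before-xy : Before L′ x y
    before-xy = before-++ {P = P} (∈-++⁺ʳ A (here refl)) (∈-++⁺ˡ (∈-++⁺ʳ V (here refl)))

    A-before : ∀ {a} → a ∈ A → Before L′ a x
    A-before a∈ = subst (λ L → Before L _ x) (sym (++-assoc A [ x ] _)) (before-++ a∈ (here refl))

    αa∈L : ∀ {a} → a ∈ TO → α a ∈ L
    αa∈L a∈ = before-∈ʳ (opened a∈)

    a∈L : ∀ {a} → a ∈ TO → a ∈ L
    a∈L a∈ = before-∈ˡ (opened a∈)

    nested′ : ∀ {a a′} → a ∈ TO′ → a′ ∈ TO′ → Before L′ a a′ → Before L′ a′ (α a) → ¬ Before L′ (α a) (α a′)
    nested′ (here refl) (here refl) b₁ _  _  = before-asym unique′ b₁ b₁
    nested′ (here refl) (there a′∈) b₁ _  _  = before-asym unique′ b₁ (A-before (processed a′∈))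
    nested′ (there a∈)  (here refl) _  b₂ b₃ = before-y (αa∈L a∈) b₂ b₃
    nested′ (there a∈)  (there a′∈) b₁ b₂ b₃ = nested a∈ a′∈ (before⁻ (a∈L a∈) (a∈L a′∈) b₁) (before⁻ (a∈L a′∈) (αa∈L a∈) b₂) (before⁻ (αa∈L a∈) (αa∈L a′∈) b₃)

    search′ : ∀ {u a} → u ∈ P → ¬ InTree TO′ u → a ∈ TO′ → Before L′ u a → Before L′ a (α u) → ¬ Before L′ (α u) (α a)
    search′ u∈ ¬t a∈ b₁ b₂ b₃ with ∈-++⁻ A u∈
    ... | inj₂ (here refl) = ¬t (inj₁ (here refl))
    search′ u∈ ¬t (here refl) b₁ b₂ b₃ | inj₁ u∈A = before-y (seen u∈A) b₂ b₃
    search′ u∈ ¬t (there a∈)  b₁ b₂ b₃ | inj₁ u∈A = search u∈A (λ { (inj₁ p) → ¬t (inj₁ (there p)) ; (inj₂ p) → ¬t (inj₂ (there p)) }) a∈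
      (before⁻ (∈-++⁺ˡ u∈A) (a∈L a∈) b₁) (before⁻ (a∈L a∈) (seen u∈A) b₂) (before⁻ (seen u∈A) (αa∈L a∈) b₃)

    L′≡ : L′ ≡ P ++ (V ++ y ∷ B) ++ [ root ]
    L′≡ = cong (P ++_) (trans (++-assoc V [ y ] Q) (sym (++-assoc V (y ∷ B) [ root ])))

    attached : State TO′ P (V ++ y ∷ B)
    attached = record
      { unique = subst Unique L′≡ unique′
      ; closed = subst (λ L → ∀ {x} → x ∈ L → σ x ∈ L) L′≡ (λ z∈ → case L′⁻ z∈ of λ { (inj₁ p) → L⊆L′ (closed p) ; (inj₂ q) → new⊆L′ (Vy.closed q) })
      ; walk = subst (λ L → Path (Succ TO′) root L root) L′≡ walk′
      ; processed = λ { (here refl) → ∈-++⁺ʳ A (here refl) ; (there a∈) → ∈-++⁺ˡ (processed a∈) }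
      ; opened = λ {a} a∈ → subst (λ L → Before L a (α a)) L′≡ (case a∈ of λ { (here refl) → before-xy ; (there p) → before⁺ (opened p) })
      ; seen = λ {u} u∈ → subst (α u ∈_) L′≡ (case ∈-++⁻ A u∈ of λ { (inj₁ p) → L⊆L′ (seen p) ; (inj₂ (here refl)) → new⊆L′ (∈-++⁺ʳ V (here refl)) })
      ; nested = subst (λ L → ∀ {a a′} → a ∈ TO′ → a′ ∈ TO′ → Before L a a′ → Before L a′ (α a) → ¬ Before L (α a) (α a′)) L′≡ (λ {a} {a′} → nested′ {a} {a′})
      ; search = subst (λ L → ∀ {u a} → u ∈ P → ¬ InTree TO′ u → a ∈ TO′ → Before L u a → Before L a (α u) → ¬ Before L (α u) (α a)) L′≡ (λ {u} {a} → search′ {u} {a})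
      }

  -- Each step processes one half-edge, and a list without repetition has at most `size` entries.
  run : ∀ n {TO A B} → State TO A B → size ≤ length A + n → Σ[ TO ∈ List HalfEdge ] Σ[ A ∈ List HalfEdge ] State TO A []
  run n {TO} {A} {[]} S le = TO , A , S
  run zero {TO} {A} {x ∷ B} S le = contradiction
    (≤-trans (length-⊆ (State.unique S) (λ {h} _ → ∈-allFin h)) (≤-trans (≤-reflexive (length-tabulate id)) (subst (size ≤_) (ℕP.+-identityʳ (length A)) le)))
    (<⇒≱ (subst (length A <_) (sym (length-++ A)) (m<m+n (length A) (s≤s z≤n))))
  run (suc n) {TO} {A} {x ∷ B} S le with α x ∈? A ++ x ∷ B ++ [ root ]
  ... | yes αx∈ = run n (skip S αx∈) (subst (size ≤_) (longer x) le)
    where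
    longer : ∀ x → length A + suc n ≡ length (A ++ [ x ]) + n
    longer x = trans (sym (ℕP.+-assoc (length A) 1 n)) (cong (λ m → m + n) (sym (length-++ A)))
  ... | no αx∉ = run n (Attach.attached S αx∉) (subst (size ≤_) (longer x) le)
    where
    longer : ∀ x → length A + suc n ≡ length (A ++ [ x ]) + n
    longer x = trans (sym (ℕP.+-assoc (length A) 1 n)) (cong (λ m → m + n) (sym (length-++ A)))

  search-contour : Planar → Σ[ k ∈ ℕ ] Σ[ K ∈ SearchContour k ] M ≅ SearchContour.toMap K
  search-contour planar with run size (proj₂ start) ≤-refl
  ... | TO , A , S = go A (finished S)
    where
    from : ∀ {y ys} → Numbering TO (y ∷ ys) → Σ[ k ∈ ℕ ] Σ[ K ∈ SearchContour k ] M ≅ SearchContour.toMap K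
    from N = k , record { contour = contour ; nc-τ = nc-τ ; nc-β = Contour.Planar⇒NC contour nc-τ (Planar-map iso planar) ; dfs = dfs } , iso
      where open FromNumbering N
    go : ∀ A → Numbering TO (A ++ [ root ]) → Σ[ k ∈ ℕ ] Σ[ K ∈ SearchContour k ] M ≅ SearchContour.toMap K
    go [] N = from N
    go (_ ∷ _) N = from N

-- The map of a tree

-- The half-edges, other than the root, of the map coded by a tree.  A node
-- adds the edge src - snk in front of the half-edges of the first map and
-- inserts the second map after snk, the word of the first map being cut
-- before one of its sinks at the root vertex: src w snk q r, where w r is the
-- first and q the second word.  The edge is a tree edge unless the word is
-- cut at its end, that is before the root.
data Half : Tree → Set where
  src snk : ∀ {t₁ j t₂} → Half (node t₁ j t₂)
  in₁     : ∀ {t₁ j t₂} → Half t₁ → Half (node t₁ j t₂)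
  in₂     : ∀ {t₁ j t₂} → Half t₂ → Half (node t₁ j t₂)

halves : Tree → ℕ
halves leaf = 0
halves (node t₁ j t₂) = 2 + (halves t₁ + halves t₂)

mate : ∀ {t} → Half t → Half t
mate src     = snk
mate snk     = src
mate (in₁ x) = in₁ (mate x)
mate (in₂ x) = in₂ (mate x)

map-in₁ : ∀ {t₁ j t₂} → Maybe (Half t₁) → Maybe (Half (node t₁ j t₂))
map-in₁ (just x) = just (in₁ x)
map-in₁ nothing  = nothing

map-in₂ : ∀ {t₁ j t₂} → Maybe (Half t₂) → Maybe (Half (node t₁ j t₂))
map-in₂ (just x) = just (in₂ x)
map-in₂ nothing  = nothing

snk-or : ∀ {t₁ j t₂} → Maybe (Half t₂) → Half (node t₁ j t₂)
snk-or (just x) = in₂ x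
snk-or nothing  = snk

-- The sinks at the root vertex from the last to the first, followed by
-- nothing, which stands for the root.
sink : (t : Tree) → ℕ → Maybe (Half t)
sink leaf n = nothing
sink (node t₁ j t₂) n with sink t₁ (toℕ j) | n ≤? toℕ j | n <? weight t₂
... | just _  | yes _ | _     = map-in₁ (sink t₁ n)
... | just _  | no _  | _     = map-in₂ (sink t₂ (n ∸ suc (toℕ j)))
... | nothing | _     | yes _ = just (snk-or (sink t₂ n))
... | nothing | _     | no _  = map-in₁ (sink t₁ (n ∸ weight t₂))

tree-partner : ∀ {t} → Half t → Half t
tree-partner {node t₁ j t₂} src with sink t₁ (toℕ j)
... | just _  = snk
... | nothing = src
tree-partner {node t₁ j t₂} snk with sink t₁ (toℕ j)
... | just _  = src
... | nothing = snk
tree-partner (in₁ x) = in₁ (tree-partner x)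
tree-partner (in₂ x) = in₂ (tree-partner x)

shiftFrom : ℕ → ℕ → ℕ → ℕ
shiftFrom c e n with n <? c
... | yes _ = n
... | no _  = n + e

shift-below : ∀ {c e n} → n < c → shiftFrom c e n ≡ n
shift-below {c} {e} {n} lt with n <? c
... | yes _ = refl
... | no ¬p = contradiction lt ¬p

shift-above : ∀ {c e n} → c ≤ n → shiftFrom c e n ≡ n + e
shift-above {c} {e} {n} le with n <? c
... | yes lt = contradiction le (<⇒≱ lt)
... | no _   = refl

shift-< : ∀ c e {m n} → m < n → shiftFrom c e m < shiftFrom c e n
shift-< c e {m} {n} lt with m <? c | n <? c
... | yes _ | yes _ = lt
... | yes _ | no _  = <-≤-trans lt (m≤m+n n e)
... | no ge | yes p = contradiction (<-trans lt p) ge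
... | no _  | no _  = +-monoˡ-< e lt

shift-<⁻ : ∀ c e {m n} → shiftFrom c e m < shiftFrom c e n → m < n
shift-<⁻ c e {m} {n} lt with <-cmp m n
... | tri< p _ _    = p
... | tri≈ _ refl _ = contradiction lt (<-irrefl refl)
... | tri> _ _ p    = contradiction lt (<-asym (shift-< c e p))

rank : ∀ {t} → Half t → ℕ

cutRank : ∀ {t} → Maybe (Half t) → ℕ
cutRank {t} nothing  = halves t
cutRank     (just s) = rank s

cut : (t₁ : Tree) → Fin (weight t₁) → ℕ
cut t₁ j = cutRank (sink t₁ (toℕ j))

rank src = 0
rank {node t₁ j t₂} snk     = suc (cut t₁ j)
rank {node t₁ j t₂} (in₁ x) = suc (shiftFrom (cut t₁ j) (suc (halves t₂)) (rank x))
rank {node t₁ j t₂} (in₂ y) = suc (suc (cut t₁ j + rank y))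

rank-bound : ∀ {t} (x : Half t) → rank x < halves t

cutRank-bound : ∀ {t} (s : Maybe (Half t)) → cutRank s ≤ halves t
cutRank-bound nothing  = ≤-refl
cutRank-bound (just s) = <⇒≤ (rank-bound s)

cut-bound : ∀ t₁ j → cut t₁ j ≤ halves t₁
cut-bound t₁ j = cutRank-bound (sink t₁ (toℕ j))

rank-bound {node t₁ j t₂} src     = s≤s z≤n
rank-bound {node t₁ j t₂} snk     = s≤s (s≤s (≤-trans (cut-bound t₁ j) (m≤m+n _ _)))
rank-bound {node t₁ j t₂} (in₂ y) = s≤s (s≤s (<-≤-trans (+-monoʳ-< (cut t₁ j) (rank-bound y)) (+-monoˡ-≤ (halves t₂) (cut-bound t₁ j))))
rank-bound {node t₁ j t₂} (in₁ x) with rank x <? cut t₁ j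
... | yes _ = s≤s (≤-trans (rank-bound x) (≤-trans (m≤m+n _ _) (n≤1+n _)))
... | no _  = s≤s (subst (_≤ suc (halves t₁ + halves t₂)) (cong suc (sym (+-suc (rank x) (halves t₂)))) (s≤s (+-monoˡ-≤ (halves t₂) (rank-bound x))))

infix 4 _⊏_
record _⊏_ {t} (x y : Half t) : Set where
  constructor ⟨_⟩
  field
    ranks : rank x < rank y
open _⊏_ public

-- The order of the letters in `src w snk q r`. Half-edges of `t₁` belong to `w` or to `r` according
-- to whether their rank lies below the cut.
data View {t₁ j t₂} : Half (node t₁ j t₂) → Half (node t₁ j t₂) → Set where
  src-snk : View src snk
  src-in₁ : ∀ {x} → View src (in₁ x)
  src-in₂ : ∀ {y} → View src (in₂ y)
  in₁-in₁ : ∀ {x x′} → x ⊏ x′ → View (in₁ x) (in₁ x′)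
  in₂-in₂ : ∀ {y y′} → y ⊏ y′ → View (in₂ y) (in₂ y′)
  w-snk   : ∀ {x} → rank x < cut t₁ j → View (in₁ x) snk
  w-in₂   : ∀ {x y} → rank x < cut t₁ j → View (in₁ x) (in₂ y)
  snk-in₂ : ∀ {y} → View snk (in₂ y)
  snk-r   : ∀ {x} → cut t₁ j ≤ rank x → View snk (in₁ x)
  in₂-r   : ∀ {x y} → cut t₁ j ≤ rank x → View (in₂ y) (in₁ x)

module _ {t₁ : Tree} {j : Fin (weight t₁)} {t₂ : Tree} where
  private
    c = cut t₁ j

  view : {x y : Half (node t₁ j t₂)} → x ⊏ y → View x y
  view {src} {snk}   _ = src-snk
  view {src} {in₁ _} _ = src-in₁
  view {src} {in₂ _} _ = src-in₂
  view {snk} {snk} ⟨ lt ⟩  = contradiction lt (<-irrefl refl)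
  view {snk} {in₁ x} ⟨ lt ⟩ with rank x <? c
  ... | yes p = contradiction (≤-pred lt) (<-asym p)
  ... | no p  = snk-r (≮⇒≥ p)
  view {snk} {in₂ y} ⟨ lt ⟩ = snk-in₂
  view {in₁ x} {snk} ⟨ lt ⟩ with rank x <? c
  ... | yes p = w-snk p
  ... | no p  = contradiction (≤-pred lt) (≤⇒≯ (≤-trans (≮⇒≥ p) (m≤m+n _ _)))
  view {in₁ x} {in₁ y} ⟨ lt ⟩ = in₁-in₁ ⟨ shift-<⁻ c (suc (halves t₂)) (≤-pred lt) ⟩
  view {in₁ x} {in₂ y} ⟨ lt ⟩ with rank x <? c
  ... | yes p = w-in₂ p
  ... | no p  = contradiction (≤-pred lt) (≤⇒≯ (subst (suc (c + rank y) ≤_) (sym (+-suc (rank x) (halves t₂))) (s≤s (ℕP.+-mono-≤ (≮⇒≥ p) (<⇒≤ (rank-bound y))))))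
  view {in₂ y} {snk} ⟨ lt ⟩ = contradiction (≤-pred lt) (≤⇒≯ (≤-trans (m≤m+n c (rank y)) (n≤1+n _)))
  view {in₂ y} {in₁ x} ⟨ lt ⟩ with rank x <? c
  ... | yes p = contradiction (≤-pred lt) (≤⇒≯ (≤-trans (<⇒≤ p) (≤-trans (m≤m+n c (rank y)) (n≤1+n _))))
  ... | no p  = in₂-r (≮⇒≥ p)
  view {in₂ y} {in₂ y′} ⟨ lt ⟩ = in₂-in₂ ⟨ +-cancelˡ-< c _ _ (≤-pred (≤-pred lt)) ⟩

  unview : {x y : Half (node t₁ j t₂)} → View x y → x ⊏ y
  unview src-snk     = ⟨ s≤s z≤n ⟩
  unview src-in₁     = ⟨ s≤s z≤n ⟩
  unview src-in₂     = ⟨ s≤s z≤n ⟩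
  unview (in₁-in₁ ⟨ p ⟩) = ⟨ s≤s (shift-< c (suc (halves t₂)) p) ⟩
  unview (in₂-in₂ ⟨ p ⟩) = ⟨ s≤s (s≤s (+-monoʳ-< c p)) ⟩
  unview (w-snk p)   = ⟨ s≤s (subst (_< c) (sym (shift-below p)) p) ⟩
  unview (w-in₂ p)   = ⟨ s≤s (subst (_< suc _) (sym (shift-below p)) (m≤n⇒m≤1+n (≤-trans p (m≤m+n c _)))) ⟩
  unview snk-in₂     = ⟨ s≤s (s≤s (m≤m+n c _)) ⟩
  unview (snk-r {x} p) = ⟨ s≤s (subst (c <_) (sym (shift-above p)) (subst (c <_) (sym (+-suc (rank x) (halves t₂))) (s≤s (≤-trans p (m≤m+n _ _))))) ⟩
  unview (in₂-r {x} {y} p) = ⟨ s≤s (subst (suc (c + rank y) <_) (sym (shift-above p)) (subst (suc (c + rank y) <_) (sym (+-suc (rank x) (halves t₂))) (s≤s (+-mono-≤-< p (rank-bound y))))) ⟩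

⊏-total : ∀ {t} (x y : Half t) → x ≡ y ⊎ x ⊏ y ⊎ y ⊏ x
⊏-total src     src     = inj₁ refl
⊏-total src     snk     = inj₂ (inj₁ (unview src-snk))
⊏-total src     (in₁ _) = inj₂ (inj₁ (unview src-in₁))
⊏-total src     (in₂ _) = inj₂ (inj₁ (unview src-in₂))
⊏-total snk     src     = inj₂ (inj₂ (unview src-snk))
⊏-total snk     snk     = inj₁ refl
⊏-total {node t₁ j t₂} snk (in₁ x) with <-≤-connex (rank x) (cut t₁ j)
... | inj₁ p = inj₂ (inj₂ (unview (w-snk p)))
... | inj₂ p = inj₂ (inj₁ (unview (snk-r p)))
⊏-total snk     (in₂ _) = inj₂ (inj₁ (unview snk-in₂))
⊏-total (in₁ _) src     = inj₂ (inj₂ (unview src-in₁))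
⊏-total {node t₁ j t₂} (in₁ x) snk with <-≤-connex (rank x) (cut t₁ j)
... | inj₁ p = inj₂ (inj₁ (unview (w-snk p)))
... | inj₂ p = inj₂ (inj₂ (unview (snk-r p)))
⊏-total (in₁ x) (in₁ y) with ⊏-total x y
... | inj₁ refl     = inj₁ refl
... | inj₂ (inj₁ p) = inj₂ (inj₁ (unview (in₁-in₁ p)))
... | inj₂ (inj₂ p) = inj₂ (inj₂ (unview (in₁-in₁ p)))
⊏-total {node t₁ j t₂} (in₁ x) (in₂ y) with <-≤-connex (rank x) (cut t₁ j)
... | inj₁ p = inj₂ (inj₁ (unview (w-in₂ p)))
... | inj₂ p = inj₂ (inj₂ (unview (in₂-r p)))
⊏-total (in₂ _) src     = inj₂ (inj₂ (unview src-in₂))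
⊏-total (in₂ _) snk     = inj₂ (inj₂ (unview snk-in₂))
⊏-total {node t₁ j t₂} (in₂ y) (in₁ x) with <-≤-connex (rank x) (cut t₁ j)
... | inj₁ p = inj₂ (inj₂ (unview (w-in₂ p)))
... | inj₂ p = inj₂ (inj₁ (unview (in₂-r p)))
⊏-total (in₂ x) (in₂ y) with ⊏-total x y
... | inj₁ refl     = inj₁ refl
... | inj₂ (inj₁ p) = inj₂ (inj₁ (unview (in₂-in₂ p)))
... | inj₂ (inj₂ p) = inj₂ (inj₂ (unview (in₂-in₂ p)))

rank-injective : ∀ {t} {x y : Half t} → rank x ≡ rank y → x ≡ y
rank-injective {x = x} {y} e with ⊏-total x y
... | inj₁ d = d
... | inj₂ (inj₁ p) = contradiction e (<⇒≢ (ranks p))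
... | inj₂ (inj₂ p) = contradiction (sym e) (<⇒≢ (ranks p))

halves-leaves : ∀ t → 2 + halves t ≡ leaves t + leaves t
halves-leaves leaf = refl
halves-leaves (node t₁ j t₂) = begin
  2 + (2 + (halves t₁ + halves t₂)) ≡⟨ solve 2 (λ a b → con 2 :+ (con 2 :+ (a :+ b)) := (con 2 :+ a) :+ (con 2 :+ b)) refl (halves t₁) (halves t₂) ⟩
  (2 + halves t₁) + (2 + halves t₂) ≡⟨ cong₂ _+_ (halves-leaves t₁) (halves-leaves t₂) ⟩
  (leaves t₁ + leaves t₁) + (leaves t₂ + leaves t₂) ≡⟨ solve 2 (λ a b → (a :+ a) :+ (b :+ b) := (a :+ b) :+ (a :+ b)) refl (leaves t₁) (leaves t₂) ⟩
  (leaves t₁ + leaves t₂) + (leaves t₁ + leaves t₂) ∎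
  where
  open ≡-Reasoning
  open import Data.Nat.Solver using (module +-*-Solver)
  open +-*-Solver

-- The counterpart of `β` in a contour.
coface : ∀ {t} → Half t → Half t
coface x = mate (tree-partner x)

-- The half-edge is at the root vertex: it lies under no tree edge, as in `RootSink`.
Top : ∀ {t} → Half t → Set
Top {t} y = ∀ (a : Half t) → a ⊏ y → tree-partner a ⊏ y

⊏-asym : ∀ {t} {x y : Half t} → x ⊏ y → ¬ (y ⊏ x)
⊏-asym ⟨ p ⟩ ⟨ q ⟩ = <-asym p q

⊏-irrefl : ∀ {t} {x : Half t} → ¬ (x ⊏ x)
⊏-irrefl ⟨ p ⟩ = <-irrefl refl p

mate-inv : ∀ {t} (x : Half t) → mate (mate x) ≡ x
mate-inv src     = refl
mate-inv snk     = refl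
mate-inv (in₁ x) = cong in₁ (mate-inv x)
mate-inv (in₂ x) = cong in₂ (mate-inv x)

mate-≢ : ∀ {t} (x : Half t) → mate x ≢ x
mate-≢ src     ()
mate-≢ snk     ()
mate-≢ (in₁ x) e = mate-≢ x (in₁-inj e)
  where
  in₁-inj : ∀ {t₁ j t₂} {x y : Half t₁} → in₁ {t₁} {j} {t₂} x ≡ in₁ y → x ≡ y
  in₁-inj refl = refl
mate-≢ (in₂ x) e = mate-≢ x (in₂-inj e)
  where
  in₂-inj : ∀ {t₁ j t₂} {x y : Half t₂} → in₂ {t₁} {j} {t₂} x ≡ in₂ y → x ≡ y
  in₂-inj refl = refl

module NodeKind {t₁ : Tree} {j : Fin (weight t₁)} {t₂ : Tree} where
  N : Set
  N = Half (node t₁ j t₂)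

  module TreeEdge {s} (e : sink t₁ (toℕ j) ≡ just s) where
    partner-src : tree-partner {node t₁ j t₂} src ≡ snk
    partner-src rewrite e = refl
    partner-snk : tree-partner {node t₁ j t₂} snk ≡ src
    partner-snk rewrite e = refl
    cut≡ : cut t₁ j ≡ rank s
    cut≡ = cong cutRank e
    sink₁ : ∀ {n} → n ≤ toℕ j → sink (node t₁ j t₂) n ≡ map-in₁ (sink t₁ n)
    sink₁ {n} le rewrite e with n ≤? toℕ j
    ... | yes _ = refl
    ... | no gt = contradiction le gt
    sink₂ : ∀ {n} → toℕ j < n → sink (node t₁ j t₂) n ≡ map-in₂ (sink t₂ (n ∸ suc (toℕ j)))
    sink₂ {n} lt rewrite e with n ≤? toℕ j
    ... | yes le = contradiction lt (≤⇒≯ le)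
    ... | no _   = refl

  module LoopEdge (e : sink t₁ (toℕ j) ≡ nothing) where
    partner-src : tree-partner {node t₁ j t₂} src ≡ src
    partner-src rewrite e = refl
    partner-snk : tree-partner {node t₁ j t₂} snk ≡ snk
    partner-snk rewrite e = refl
    cut≡ : cut t₁ j ≡ halves t₁
    cut≡ = cong cutRank e
    in-w : ∀ (x : Half t₁) → rank x < cut t₁ j
    in-w x = subst (rank x <_) (sym cut≡) (rank-bound x)
    not-r : ∀ (x : Half t₁) → ¬ (cut t₁ j ≤ rank x)
    not-r x = <⇒≱ (in-w x)
    sink₁ : ∀ {n} → n < weight t₂ → sink (node t₁ j t₂) n ≡ just (snk-or (sink t₂ n))
    sink₁ {n} lt rewrite e with n <? weight t₂
    ... | yes _ = refl
    ... | no ge = contradiction lt ge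
    sink₂ : ∀ {n} → weight t₂ ≤ n → sink (node t₁ j t₂) n ≡ map-in₁ (sink t₁ (n ∸ weight t₂))
    sink₂ {n} le rewrite e with n <? weight t₂
    ... | yes lt = contradiction le (<⇒≱ lt)
    ... | no _   = refl

tree-partner-inv : ∀ {t} (x : Half t) → tree-partner (tree-partner x) ≡ x
tree-partner-inv {node t₁ j t₂} src with sink t₁ (toℕ j) in e
... | just _  = NodeKind.TreeEdge.partner-snk e
... | nothing = NodeKind.LoopEdge.partner-src e
tree-partner-inv {node t₁ j t₂} snk with sink t₁ (toℕ j) in e
... | just _  = NodeKind.TreeEdge.partner-src e
... | nothing = NodeKind.LoopEdge.partner-snk e
tree-partner-inv (in₁ x) = cong in₁ (tree-partner-inv x)
tree-partner-inv (in₂ x) = cong in₂ (tree-partner-inv x)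

tree-partner-mate : ∀ {t} (x : Half t) → tree-partner x ≡ x ⊎ tree-partner x ≡ mate x
tree-partner-mate {node t₁ j t₂} src with sink t₁ (toℕ j)
... | just _  = inj₂ refl
... | nothing = inj₁ refl
tree-partner-mate {node t₁ j t₂} snk with sink t₁ (toℕ j)
... | just _  = inj₂ refl
... | nothing = inj₁ refl
tree-partner-mate (in₁ x) with tree-partner-mate x
... | inj₁ e = inj₁ (cong in₁ e)
... | inj₂ e = inj₂ (cong in₁ e)
tree-partner-mate (in₂ x) with tree-partner-mate x
... | inj₁ e = inj₁ (cong in₂ e)
... | inj₂ e = inj₂ (cong in₂ e)

top-free : ∀ {t} {y : Half t} → mate y ⊏ y → Top y → tree-partner y ≡ y
top-free {y = y} p top with tree-partner-mate y
... | inj₁ e = e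
... | inj₂ e = contradiction (subst (_⊏ y) (trans (cong tree-partner (sym e)) (tree-partner-inv y)) (top (mate y) p)) ⊏-irrefl

coface-mate : ∀ {t} {y : Half t} → tree-partner y ≡ y → coface (mate y) ≡ y
coface-mate {y = y} e with tree-partner-mate (mate y)
... | inj₁ d = trans (cong mate d) (mate-inv y)
... | inj₂ d = contradiction (trans (sym (tree-partner-inv (mate y))) (trans (cong tree-partner (trans d (mate-inv y))) e)) (mate-≢ y)

-- That `sink` lists the sinks at the root vertex, from the last to the first. The laws must be
-- proved together, since the shape of a node depends on whether `sink` of its first subtree returns
-- a half-edge.
record SinkLaws (t : Tree) : Set where
  field
    end     : ∀ {n} → n < weight t → sink t n ≡ nothing → suc n ≡ weight t
    root    : ∀ {n} → suc n ≡ weight t → sink t n ≡ nothing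
    isSink  : ∀ {n y} → n < weight t → sink t n ≡ just y → mate y ⊏ y × Top y
    isIndex : ∀ {y} → mate y ⊏ y → Top y → Σ[ n ∈ ℕ ] n < weight t × sink t n ≡ just y
    order   : ∀ {m n y z} → m < n → n < weight t → sink t m ≡ just y → sink t n ≡ just z → z ⊏ y

  some : ∀ {n} → suc n < weight t → Σ[ y ∈ Half t ] sink t n ≡ just y
  some {n} lt with sink t n in e
  ... | just y  = y , refl
  ... | nothing = contradiction (end (<-trans (n<1+n n) lt) e) (<⇒≢ lt)

private
  just-inj : ∀ {A : Set} {x y : A} → just x ≡ just y → x ≡ y
  just-inj refl = refl

  just≢nothing : ∀ {A : Set} {x : A} → just x ≢ nothing
  just≢nothing ()

  map-in₁-just : ∀ {t₁ j t₂} {m : Maybe (Half t₁)} {y : Half (node t₁ j t₂)} → map-in₁ m ≡ just y → Σ[ x ∈ Half t₁ ] m ≡ just x × y ≡ in₁ x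
  map-in₁-just {m = just x} refl = x , refl , refl

  map-in₂-just : ∀ {t₁ j t₂} {m : Maybe (Half t₂)} {y : Half (node t₁ j t₂)} → map-in₂ m ≡ just y → Σ[ x ∈ Half t₂ ] m ≡ just x × y ≡ in₂ x
  map-in₂-just {m = just x} refl = x , refl , refl

  module NodeSinks {t₁ : Tree} {j : Fin (weight t₁)} {t₂ : Tree} (L₁ : SinkLaws t₁) (L₂ : SinkLaws t₂) where
    private
      module L₁ = SinkLaws L₁
      module L₂ = SinkLaws L₂
      W = weight (node t₁ j t₂)
      M = node t₁ j t₂

      top-in₁⁻ : ∀ {x} → Top {M} (in₁ x) → Top x
      top-in₁⁻ top a lt = case view (top (in₁ a) (unview (in₁-in₁ lt))) of λ { (in₁-in₁ r) → r }

      top-in₂⁻ : ∀ {y} → Top {M} (in₂ y) → Top y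
      top-in₂⁻ top a lt = case view (top (in₂ a) (unview (in₂-in₂ lt))) of λ { (in₂-in₂ r) → r }

    module AsTree {s} (e : sink t₁ (toℕ j) ≡ just s) where
      open NodeKind.TreeEdge {t₁} {j} {t₂} e

      j<end : suc (toℕ j) < weight t₁
      j<end = ≤∧≢⇒< (toℕ<n j) (λ d → just≢nothing (trans (sym e) (L₁.root d)))

      s-sink : mate s ⊏ s × Top s
      s-sink = L₁.isSink (toℕ<n j) e

      w-closed : ∀ {x : Half t₁} → rank x < cut t₁ j → rank (tree-partner x) < cut t₁ j
      w-closed {x} lt = subst (rank (tree-partner x) <_) (sym cut≡) (ranks (proj₂ s-sink x ⟨ subst (rank x <_) cut≡ lt ⟩))

      top-in₁ : ∀ {x} → cut t₁ j ≤ rank x → Top x → Top {M} (in₁ x)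
      top-in₁ {x} c≤x top src     _ = subst (_⊏ in₁ x) (sym partner-src) (unview (snk-r c≤x))
      top-in₁ {x} c≤x top snk     _ = subst (_⊏ in₁ x) (sym partner-snk) (unview src-in₁)
      top-in₁     c≤x top (in₂ _) _ = unview (in₂-r c≤x)
      top-in₁     c≤x top (in₁ a) lt with view lt
      ... | in₁-in₁ p = unview (in₁-in₁ (top a p))

      top-in₂ : ∀ {y} → Top y → Top {M} (in₂ y)
      top-in₂ {y} top src     _  = subst (_⊏ in₂ y) (sym partner-src) (unview snk-in₂)
      top-in₂ {y} top snk     _  = subst (_⊏ in₂ y) (sym partner-snk) (unview src-in₂)
      top-in₂     top (in₁ a) lt with view lt
      ... | w-in₂ p   = unview (w-in₂ (w-closed p))
      top-in₂     top (in₂ a) lt with view lt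
      ... | in₂-in₂ p = unview (in₂-in₂ (top a p))

      after-cut : ∀ {n x} → n ≤ toℕ j → sink t₁ n ≡ just x → cut t₁ j ≤ rank x
      after-cut {n} {x} le d with m≤n⇒m<n∨m≡n le
      ... | inj₁ lt   = subst (_≤ rank x) (sym cut≡) (<⇒≤ (ranks (L₁.order lt (toℕ<n j) d e)))
      ... | inj₂ refl = ≤-reflexive (trans cut≡ (cong rank (just-inj (trans (sym e) d))))

      minus : ∀ {n} → toℕ j < n → n < W → n ∸ suc (toℕ j) < weight t₂
      minus {n} lt n<W = +-cancelˡ-< (suc (toℕ j)) _ _ (subst (_< W) (sym (m+[n∸m]≡n lt)) n<W)

      laws : SinkLaws M
      laws = record
        { end = λ {n} n<W d → case <-≤-connex (toℕ j) n of λ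
            { (inj₂ le) → let (x , f) = L₁.some (≤-<-trans (s≤s le) j<end) in
                contradiction (trans (sym (cong map-in₁ f)) (trans (sym (sink₁ le)) d)) just≢nothing
            ; (inj₁ lt) → trans (cong suc (sym (m+[n∸m]≡n lt))) (trans (sym (+-suc (suc (toℕ j)) (n ∸ suc (toℕ j))))
                (cong (_+_ (suc (toℕ j))) (L₂.end (minus lt n<W) (nothing₂ (trans (sym (sink₂ lt)) d))))) }
        ; root = λ {n} d → let lt = j<n d in trans (sink₂ lt) (cong map-in₂ (L₂.root (ℕP.+-cancelˡ-≡ (suc (toℕ j)) _ _
            (trans (+-suc (suc (toℕ j)) (n ∸ suc (toℕ j))) (trans (cong suc (m+[n∸m]≡n lt)) d)))))
        ; isSink = λ {n} {y} n<W d → case <-≤-connex (toℕ j) n of λ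
            { (inj₂ le) → case map-in₁-just (trans (sym (sink₁ le)) d) of λ { (x , f , refl) →
                let (p , top) = L₁.isSink (≤-<-trans le (toℕ<n j)) f in unview (in₁-in₁ p) , top-in₁ (after-cut le f) top }
            ; (inj₁ lt) → case map-in₂-just (trans (sym (sink₂ lt)) d) of λ { (x , f , refl) →
                let (p , top) = L₂.isSink (minus lt n<W) f in unview (in₂-in₂ p) , top-in₂ top } }
        ; isIndex = index′
        ; order = λ {m} {n} {y} {z} m<n n<W d d′ → case <-≤-connex (toℕ j) m of λ
            { (inj₁ lt) → case (map-in₂-just (trans (sym (sink₂ lt)) d) , map-in₂-just (trans (sym (sink₂ (<-trans lt m<n))) d′)) of λ { ((x , f , refl) , (x′ , f′ , refl)) →
                unview (in₂-in₂ (L₂.order (ℕP.∸-monoˡ-< m<n lt) (minus (<-trans lt m<n) n<W) f f′)) }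
            ; (inj₂ le) → case <-≤-connex (toℕ j) n of λ
                { (inj₂ le′) → case (map-in₁-just (trans (sym (sink₁ le)) d) , map-in₁-just (trans (sym (sink₁ le′)) d′)) of λ { ((x , f , refl) , (x′ , f′ , refl)) →
                    unview (in₁-in₁ (L₁.order m<n (≤-<-trans le′ (toℕ<n j)) f f′)) }
                ; (inj₁ lt) → case (map-in₁-just (trans (sym (sink₁ le)) d) , map-in₂-just (trans (sym (sink₂ lt)) d′)) of λ { ((x , f , refl) , (x′ , f′ , refl)) →
                    unview (in₂-r (after-cut le f)) } } }
        }
        where
        nothing₂ : ∀ {m : Maybe (Half t₂)} → map-in₂ {t₁} {j} m ≡ nothing → m ≡ nothing
        nothing₂ {nothing} _ = refl
        j<n : ∀ {n} → suc n ≡ W → toℕ j < n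
        j<n {n} d = ≤-pred (subst (suc (suc (toℕ j)) ≤_) (sym d) (m<m+n (suc (toℕ j)) (weight>0 t₂)))
        index′ : ∀ {y : Half M} → mate y ⊏ y → Top y → Σ[ n ∈ ℕ ] n < W × sink M n ≡ just y
        index′ {src}   p top = contradiction (unview src-snk) (⊏-asym p)
        index′ {snk}   p top = contradiction (subst (_⊏ snk) partner-src (top src (unview src-snk))) ⊏-irrefl
        index′ {in₂ y} p top with view p
        ... | in₂-in₂ q with L₂.isIndex q (top-in₂⁻ top)
        ...   | n , n<w , f = suc (toℕ j) + n , +-monoʳ-< (suc (toℕ j)) n<w ,
          trans (sink₂ (m≤m+n (suc (toℕ j)) n)) (cong map-in₂ (trans (cong (sink t₂) (m+n∸m≡n (suc (toℕ j)) n)) f))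
        index′ {in₁ x} p top with view p
        ... | in₁-in₁ q with L₁.isIndex q (top-in₁⁻ top)
        ...   | n , n<w , f = n , ≤-trans (s≤s n≤j) (m≤m+n (suc (toℕ j)) (weight t₂)) , trans (sink₁ n≤j) (cong map-in₁ f)
          where
          -- A half-edge in `w` lies under the tree edge from `src` to `snk`, so it is not at the
          -- root vertex.
          n≤j : n ≤ toℕ j
          n≤j = ≮⇒≥ λ lt → case view (subst (_⊏ in₁ x) partner-src (top src (unview src-in₁))) of λ
            { (snk-r c≤x) → <⇒≱ (ranks (L₁.order lt n<w e f)) (subst (_≤ rank x) cut≡ c≤x) }

    module AsLoop (e : sink t₁ (toℕ j) ≡ nothing) where
      open NodeKind.LoopEdge {t₁} {j} {t₂} e

      W≡ : W ≡ weight t₂ + weight t₁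
      W≡ = trans (cong (λ x → x + weight t₂) (L₁.end (toℕ<n j) e)) (ℕP.+-comm (weight t₁) (weight t₂))

      top-in₁ : ∀ {x} → Top x → Top {M} (in₁ x)
      top-in₁ {x} top src     _  = subst (_⊏ in₁ x) (sym partner-src) (unview src-in₁)
      top-in₁ {x} top snk     lt with view lt
      ... | snk-r p = contradiction p (not-r x)
      top-in₁ {x} top (in₂ _) lt with view lt
      ... | in₂-r p = contradiction p (not-r x)
      top-in₁     top (in₁ a) lt with view lt
      ... | in₁-in₁ p = unview (in₁-in₁ (top a p))

      top-in₂ : ∀ {y} → Top y → Top {M} (in₂ y)
      top-in₂ {y} top src     _  = subst (_⊏ in₂ y) (sym partner-src) (unview src-in₂)
      top-in₂ {y} top snk     _  = subst (_⊏ in₂ y) (sym partner-snk) (unview snk-in₂)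
      top-in₂     top (in₁ a) _  = unview (w-in₂ (in-w (tree-partner a)))
      top-in₂     top (in₂ a) lt with view lt
      ... | in₂-in₂ p = unview (in₂-in₂ (top a p))

      top-snk : Top {M} snk
      top-snk src     _  = subst (_⊏ snk) (sym partner-src) (unview src-snk)
      top-snk snk     lt = contradiction lt ⊏-irrefl
      top-snk (in₁ a) _  = unview (w-snk (in-w (tree-partner a)))
      top-snk (in₂ a) lt = contradiction (unview snk-in₂) (⊏-asym lt)

      minus : ∀ {n} → weight t₂ ≤ n → n < W → n ∸ weight t₂ < weight t₁
      minus {n} le n<W = +-cancelˡ-< (weight t₂) _ _ (subst₂ _<_ (sym (m+[n∸m]≡n le)) W≡ n<W)

      data Either (m : Maybe (Half t₂)) (y : Half M) : Set where
        isSnk : m ≡ nothing → y ≡ snk → Either m y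
        isIn₂ : ∀ {x} → m ≡ just x → y ≡ in₂ x → Either m y

      either : ∀ {m y} → just (snk-or m) ≡ just y → Either m y
      either {just x}  refl = isIn₂ refl refl
      either {nothing} refl = isSnk refl refl

      laws : SinkLaws M
      laws = record
        { end = λ {n} n<W d → case <-≤-connex n (weight t₂) of λ
            { (inj₁ lt) → contradiction (trans (sym (sink₁ lt)) d) just≢nothing
            ; (inj₂ le) → trans (cong suc (sym (m+[n∸m]≡n le))) (trans (sym (+-suc (weight t₂) (n ∸ weight t₂)))
                (trans (cong (_+_ (weight t₂)) (L₁.end (minus le n<W) (nothing₁ (trans (sym (sink₂ le)) d)))) (sym W≡))) }
        ; root = λ {n} d → let le = w≤n d in trans (sink₂ le) (cong map-in₁ (L₁.root (ℕP.+-cancelˡ-≡ (weight t₂) _ _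
            (trans (+-suc (weight t₂) (n ∸ weight t₂)) (trans (cong suc (m+[n∸m]≡n le)) (trans d W≡))))))
        ; isSink = λ {n} {y} n<W d → case <-≤-connex n (weight t₂) of λ
            { (inj₁ lt) → case either (trans (sym (sink₁ lt)) d) of λ
                { (isSnk _ refl) → unview src-snk , top-snk
                ; (isIn₂ f refl) → let (p , top) = L₂.isSink lt f in unview (in₂-in₂ p) , top-in₂ top }
            ; (inj₂ le) → case map-in₁-just (trans (sym (sink₂ le)) d) of λ { (x , f , refl) →
                let (p , top) = L₁.isSink (minus le n<W) f in unview (in₁-in₁ p) , top-in₁ top } }
        ; isIndex = index′
        ; order = λ {m} {n} {y} {z} m<n n<W d d′ → case <-≤-connex n (weight t₂) of λ
            { (inj₁ lt) → case (either (trans (sym (sink₁ (<-trans m<n lt))) d) , either (trans (sym (sink₁ lt)) d′)) of λ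
                { (isIn₂ f refl , isIn₂ f′ refl) → unview (in₂-in₂ (L₂.order m<n lt f f′))
                ; (isIn₂ f refl , isSnk f′ refl) → unview snk-in₂
                ; (isSnk f refl , _) → contradiction (subst (_≤ _) (L₂.end (<-trans m<n lt) f) m<n) (<⇒≱ lt) }
            ; (inj₂ le) → case map-in₁-just (trans (sym (sink₂ le)) d′) of λ { (x′ , f′ , refl) → case <-≤-connex m (weight t₂) of λ
                { (inj₂ le′) → case map-in₁-just (trans (sym (sink₂ le′)) d) of λ { (x , f , refl) →
                    unview (in₁-in₁ (L₁.order (ℕP.∸-monoˡ-< m<n le′) (minus le n<W) f f′)) }
                ; (inj₁ lt) → case either (trans (sym (sink₁ lt)) d) of λ
                    { (isSnk _ refl) → unview (w-snk (in-w x′)) ; (isIn₂ _ refl) → unview (w-in₂ (in-w x′)) } } } }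
        }
        where
        nothing₁ : ∀ {m : Maybe (Half t₁)} → map-in₁ {t₁} {j} {t₂} m ≡ nothing → m ≡ nothing
        nothing₁ {nothing} _ = refl
        w≤n : ∀ {n} → suc n ≡ W → weight t₂ ≤ n
        w≤n {n} d = ≤-pred (subst (suc (weight t₂) ≤_) (trans (sym W≡) (sym d)) (m<m+n (weight t₂) (weight>0 t₁)))
        index′ : ∀ {y : Half M} → mate y ⊏ y → Top y → Σ[ n ∈ ℕ ] n < W × sink M n ≡ just y
        index′ {src}   p top = contradiction (unview src-snk) (⊏-asym p)
        index′ {snk}   p top = let (k , e) = last-place t₂ ; lt = ≤-reflexive e in
          k , <-≤-trans lt (m≤n+m (weight t₂) (suc (toℕ j))) , trans (sink₁ lt) (cong (just ∘ snk-or) (L₂.root e))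
        index′ {in₂ y} p top with view p
        ... | in₂-in₂ q with L₂.isIndex q (top-in₂⁻ top)
        ...   | n , n<w , f = n , <-≤-trans n<w (m≤n+m (weight t₂) (suc (toℕ j))) , trans (sink₁ n<w) (cong (just ∘ snk-or) f)
        index′ {in₁ x} p top with view p
        ... | in₁-in₁ q with L₁.isIndex q (top-in₁⁻ top)
        ...   | n , n<w , f = weight t₂ + n , subst (weight t₂ + n <_) (sym W≡) (+-monoʳ-< (weight t₂) n<w) ,
          trans (sink₂ (m≤m+n (weight t₂) n)) (cong map-in₁ (trans (cong (sink t₁) (m+n∸m≡n (weight t₂) n)) f))

sinkLaws : ∀ t → SinkLaws t
sinkLaws leaf = record
  { end = λ { (s≤s z≤n) _ → refl } ; root = λ _ → refl ; isSink = λ _ () ; isIndex = λ { {()} } ; order = λ _ _ () }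
sinkLaws (node t₁ j t₂) = go (sink t₁ (toℕ j)) refl
  where
  go : ∀ m → sink t₁ (toℕ j) ≡ m → SinkLaws (node t₁ j t₂)
  go (just s) e = NodeSinks.AsTree.laws (sinkLaws t₁) (sinkLaws t₂) e
  go nothing  e = NodeSinks.AsLoop.laws (sinkLaws t₁) (sinkLaws t₂) e

HalfNC : ∀ {t} → (Half t → Half t) → Set
HalfNC {t} f = ∀ (x y : Half t) → x ⊏ y → y ⊏ f x → x ⊏ f y × f y ⊏ f x

HalfSearch : Tree → Set
HalfSearch t = ∀ (x a : Half t) → x ⊏ a → a ⊏ coface x → ¬ (coface x ⊏ tree-partner a)

HalfCovered : Tree → Set
HalfCovered t = ∀ (a : Half t) → a ⊏ tree-partner a → Σ[ x ∈ Half t ] a ⊏ x × x ⊏ tree-partner a × tree-partner a ⊏ coface x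

private
  module Node {t₁ : Tree} {j : Fin (weight t₁)} {t₂ : Tree} where
    N : Set
    N = Half (node t₁ j t₂)

    WClosed : Set
    WClosed = ∀ (x : Half t₁) → rank x < cut t₁ j → rank (tree-partner x) < cut t₁ j

    data Kind : Set where
      tree : tree-partner {node t₁ j t₂} src ≡ snk → tree-partner {node t₁ j t₂} snk ≡ src → ∀ s → sink t₁ (toℕ j) ≡ just s → Kind
      loop : tree-partner {node t₁ j t₂} src ≡ src → tree-partner {node t₁ j t₂} snk ≡ snk → (∀ (x : Half t₁) → rank x < cut t₁ j) → Kind

    kind : Kind
    kind with sink t₁ (toℕ j) in e
    ... | just s  = tree (NodeKind.TreeEdge.partner-src e) (NodeKind.TreeEdge.partner-snk e) s e
    ... | nothing = loop (NodeKind.LoopEdge.partner-src e) (NodeKind.LoopEdge.partner-snk e) (NodeKind.LoopEdge.in-w {t₂ = t₂} e)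

    wclosed : WClosed
    wclosed with kind
    ... | loop _ _ in-w = λ x _ → in-w (tree-partner x)
    ... | tree _ _ s e  = λ x lt → subst (rank (tree-partner x) <_) (sym (cong cutRank e))
      (ranks (proj₂ (SinkLaws.isSink (sinkLaws t₁) (toℕ<n j) e) x ⟨ subst (rank x <_) (cong cutRank e) lt ⟩))

    no-src : ∀ {x : N} → ¬ (x ⊏ src)
    no-src ⟨ () ⟩

    apart : ∀ {n} → n < cut t₁ j → ¬ (cut t₁ j ≤ n)
    apart = <⇒≱

    nc-τ : HalfNC {t₁} tree-partner → HalfNC {t₂} tree-partner → HalfNC {node t₁ j t₂} tree-partner
    nc-τ h₁ h₂ src y p q with kind
    nc-τ h₁ h₂ src y p q | loop s _ _ = contradiction (subst (y ⊏_) s q) no-src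
    nc-τ h₁ h₂ src src p q | tree _ _ _ _ = contradiction p no-src
    nc-τ h₁ h₂ src y@snk p q | tree s _ _ _ = contradiction (subst (y ⊏_) s q) ⊏-irrefl
    nc-τ h₁ h₂ src y@(in₂ _) p q | tree s _ _ _ = contradiction (subst (y ⊏_) s q) (⊏-asym (unview snk-in₂))
    nc-τ h₁ h₂ src y@(in₁ x) p q | tree s _ _ _ with view (subst (y ⊏_) s q)
    ... | w-snk lt = unview src-in₁ , subst (in₁ (tree-partner x) ⊏_) (sym s) (unview (w-snk (wclosed x lt)))
    nc-τ h₁ h₂ snk y p q with kind
    ... | tree _ s _ _ = contradiction (subst (y ⊏_) s q) no-src
    ... | loop _ s _   = contradiction (subst (y ⊏_) s q) (⊏-asym p)
    nc-τ h₁ h₂ (in₁ x) src p q = contradiction p no-src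
    nc-τ h₁ h₂ (in₁ x) snk p q with view p | view q
    ... | w-snk lt | snk-r le = contradiction le (apart (wclosed x lt))
    nc-τ h₁ h₂ (in₁ x) (in₁ y) p q with view p | view q
    ... | in₁-in₁ p′ | in₁-in₁ q′ = let (a , b) = h₁ x y p′ q′ in unview (in₁-in₁ a) , unview (in₁-in₁ b)
    nc-τ h₁ h₂ (in₁ x) (in₂ y) p q with view p | view q
    ... | w-in₂ lt | in₂-r le = contradiction le (apart (wclosed x lt))
    nc-τ h₁ h₂ (in₂ x) src p q = contradiction p no-src
    nc-τ h₁ h₂ (in₂ x) snk p q = contradiction p (⊏-asym (unview snk-in₂))
    nc-τ h₁ h₂ (in₂ x) (in₁ y) p q with view p | view q
    ... | in₂-r le | w-in₂ lt = contradiction le (apart lt)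
    nc-τ h₁ h₂ (in₂ x) (in₂ y) p q with view p | view q
    ... | in₂-in₂ p′ | in₂-in₂ q′ = let (a , b) = h₂ x y p′ q′ in unview (in₂-in₂ a) , unview (in₂-in₂ b)

    coface-snk : tree-partner {node t₁ j t₂} snk ≡ src → coface {node t₁ j t₂} snk ≡ snk
    coface-snk e = cong mate e

    nc-β : HalfNC {t₁} coface → HalfNC {t₂} coface → HalfNC {node t₁ j t₂} coface
    nc-β h₁ h₂ src y p q with kind
    nc-β h₁ h₂ src y p q | tree s _ _ _ = contradiction (subst (y ⊏_) (cong mate s) q) no-src
    nc-β h₁ h₂ src src p q | loop _ _ _ = contradiction p no-src
    nc-β h₁ h₂ src y@snk p q | loop s _ _ = contradiction (subst (y ⊏_) (cong mate s) q) ⊏-irrefl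
    nc-β h₁ h₂ src y@(in₂ _) p q | loop s _ _ = contradiction (subst (y ⊏_) (cong mate s) q) (⊏-asym (unview snk-in₂))
    nc-β h₁ h₂ src (in₁ x) p q | loop s _ in-w = unview src-in₁ , subst (in₁ (coface x) ⊏_) (sym (cong mate s)) (unview (w-snk (in-w (coface x))))
    nc-β h₁ h₂ snk y p q with kind
    ... | tree _ s _ _ = contradiction (subst (y ⊏_) (cong mate s) q) (⊏-asym p)
    ... | loop _ s _   = contradiction (subst (y ⊏_) (cong mate s) q) no-src
    nc-β h₁ h₂ (in₁ x) src p q = contradiction p no-src
    nc-β h₁ h₂ (in₁ x) snk p q with view q | kind
    ... | snk-r le | loop _ _ in-w = contradiction le (apart (in-w (coface x)))
    ... | snk-r le | tree _ s _ _  = subst (λ z → in₁ x ⊏ z × z ⊏ in₁ (coface x)) (sym (coface-snk s)) (p , q)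
    nc-β h₁ h₂ (in₁ x) (in₁ y) p q with view p | view q
    ... | in₁-in₁ p′ | in₁-in₁ q′ = let (a , b) = h₁ x y p′ q′ in unview (in₁-in₁ a) , unview (in₁-in₁ b)
    nc-β h₁ h₂ (in₁ x) (in₂ y) p q with view p | view q
    ... | w-in₂ lt | in₂-r le = unview (w-in₂ lt) , unview (in₂-r le)
    nc-β h₁ h₂ (in₂ x) src p q = contradiction p no-src
    nc-β h₁ h₂ (in₂ x) snk p q = contradiction p (⊏-asym (unview snk-in₂))
    nc-β h₁ h₂ (in₂ x) (in₁ y) p q with view p | view q
    ... | in₂-r le | w-in₂ lt = contradiction le (apart lt)
    nc-β h₁ h₂ (in₂ x) (in₂ y) p q with view p | view q
    ... | in₂-in₂ p′ | in₂-in₂ q′ = let (a , b) = h₂ x y p′ q′ in unview (in₂-in₂ a) , unview (in₂-in₂ b)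

    searching : HalfSearch t₁ → HalfSearch t₂ → HalfSearch (node t₁ j t₂)
    searching h₁ h₂ src a p q r with kind
    searching h₁ h₂ src a p q r | tree s _ _ _ = no-src (subst (a ⊏_) (cong mate s) q)
    searching h₁ h₂ src src p q r | loop _ _ _ = no-src p
    searching h₁ h₂ src a@snk p q r | loop s _ _ = ⊏-irrefl (subst (a ⊏_) (cong mate s) q)
    searching h₁ h₂ src a@(in₂ _) p q r | loop s _ _ = ⊏-asym (unview snk-in₂) (subst (a ⊏_) (cong mate s) q)
    searching h₁ h₂ src (in₁ x) p q r | loop s _ in-w with view (subst (_⊏ in₁ (tree-partner x)) (cong mate s) r)
    ... | snk-r le = apart (in-w (tree-partner x)) le
    searching h₁ h₂ snk a p q r with kind
    ... | tree _ s _ _ = ⊏-asym p (subst (a ⊏_) (cong mate s) q)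
    ... | loop _ s _   = no-src (subst (a ⊏_) (cong mate s) q)
    searching h₁ h₂ (in₁ x) src p q r = no-src p
    searching h₁ h₂ (in₁ x) snk p q r with view q | kind
    ... | snk-r le | loop _ _ in-w = apart (in-w (coface x)) le
    ... | snk-r le | tree _ s _ _  = no-src (subst (in₁ (coface x) ⊏_) s r)
    searching h₁ h₂ (in₁ x) (in₁ a) p q r with view p | view q | view r
    ... | in₁-in₁ p′ | in₁-in₁ q′ | in₁-in₁ r′ = h₁ x a p′ q′ r′
    searching h₁ h₂ (in₁ x) (in₂ a) p q r with view q | view r
    ... | in₂-r le | w-in₂ lt = apart lt le
    searching h₁ h₂ (in₂ x) src p q r = no-src p
    searching h₁ h₂ (in₂ x) snk p q r = ⊏-asym (unview snk-in₂) p
    searching h₁ h₂ (in₂ x) (in₁ a) p q r with view p | view q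
    ... | in₂-r le | w-in₂ lt = apart lt le
    searching h₁ h₂ (in₂ x) (in₂ a) p q r with view p | view q | view r
    ... | in₂-in₂ p′ | in₂-in₂ q′ | in₂-in₂ r′ = h₂ x a p′ q′ r′

    covered : HalfCovered t₁ → HalfCovered t₂ → HalfCovered (node t₁ j t₂)
    covered h₁ h₂ src p with kind
    ... | loop s _ _   = contradiction (subst (src ⊏_) s p) ⊏-irrefl
    -- The new tree edge is covered by the edge of the sink `s` at which the word is cut: its source
    -- lies in `w`, and `s` is the first letter of `r`. This is why cuts are made in front of sinks
    -- only.
    ... | tree e _ s d = let (p , top) = SinkLaws.isSink (sinkLaws t₁) (toℕ<n j) d in
        in₁ (mate s) , unview src-in₁ , subst (in₁ (mate s) ⊏_) (sym e) (unview (w-snk (subst (rank (mate s) <_) (sym (cong cutRank d)) (ranks p)))) ,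
        subst₂ (λ a b → a ⊏ in₁ b) (sym e) (sym (coface-mate (top-free p top))) (unview (snk-r (≤-reflexive (cong cutRank d))))
    covered h₁ h₂ snk p with kind
    ... | loop _ s _   = contradiction (subst (snk ⊏_) s p) ⊏-irrefl
    ... | tree _ s _ _ = contradiction (subst (snk ⊏_) s p) no-src
    covered h₁ h₂ (in₁ a) p with view p
    ... | in₁-in₁ p′ = let (x , u , v , w) = h₁ a p′ in in₁ x , unview (in₁-in₁ u) , unview (in₁-in₁ v) , unview (in₁-in₁ w)
    covered h₁ h₂ (in₂ a) p with view p
    ... | in₂-in₂ p′ = let (x , u , v , w) = h₂ a p′ in in₂ x , unview (in₂-in₂ u) , unview (in₂-in₂ v) , unview (in₂-in₂ w)

half-nc-τ : ∀ t → HalfNC {t} tree-partner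
half-nc-τ (node t₁ j t₂) = Node.nc-τ (half-nc-τ t₁) (half-nc-τ t₂)

half-nc-β : ∀ t → HalfNC {t} coface
half-nc-β (node t₁ j t₂) = Node.nc-β (half-nc-β t₁) (half-nc-β t₂)

half-search : ∀ t → HalfSearch t
half-search (node t₁ j t₂) = Node.searching (half-search t₁) (half-search t₂)

half-covered : ∀ t → HalfCovered t
half-covered (node t₁ j t₂) = Node.covered (half-covered t₁) (half-covered t₂)

unrank : ∀ {t} {n} → n < halves t → Σ[ x ∈ Half t ] rank x ≡ n
unrank {node t₁ j t₂} {zero}  _ = src , refl
unrank {node t₁ j t₂} {suc m} (s≤s lt) with <-cmp m (cut t₁ j)
... | tri< p _ _    = let (x , e) = unrank {t₁} (<-≤-trans p (cut-bound t₁ j)) in in₁ x , cong suc (trans (shift-below (subst (_< cut t₁ j) (sym e) p)) e)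
... | tri≈ _ refl _ = snk , refl
... | tri> _ _ p with <-≤-connex (m ∸ suc (cut t₁ j)) (halves t₂)
...   | inj₁ q = let (y , e) = unrank {t₂} q in in₂ y , cong suc (trans (cong (_+_ (suc (cut t₁ j))) e) (m+[n∸m]≡n p))
...   | inj₂ q = let (x , e) = unrank {t₁} bound in in₁ x , cong suc (trans (shift-above (subst (cut t₁ j ≤_) (sym e) above)) (trans (cong (λ r → r + suc (halves t₂)) e) m≡))
  where
  c≤m : cut t₁ j + suc (halves t₂) ≤ m
  c≤m = subst₂ _≤_ (sym (+-suc (cut t₁ j) (halves t₂))) (m+[n∸m]≡n p) (+-monoʳ-≤ (suc (cut t₁ j)) q)
  m≡ : m ∸ suc (halves t₂) + suc (halves t₂) ≡ m
  m≡ = m∸n+n≡m (≤-trans (m≤n+m _ (cut t₁ j)) c≤m)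
  above : cut t₁ j ≤ m ∸ suc (halves t₂)
  above = ℕP.+-cancelʳ-≤ (suc (halves t₂)) _ _ (subst (cut t₁ j + suc (halves t₂) ≤_) (sym m≡) c≤m)
  bound : m ∸ suc (halves t₂) < halves t₁
  bound = +-cancelʳ-< (suc (halves t₂)) _ _ (subst₂ _<_ (sym m≡) (sym (+-suc (halves t₁) (halves t₂))) lt)

module DecodeMap (t : Tree) where
  k : ℕ
  k = halves t

  pos : Maybe (Half t) → Fin (suc k)
  pos nothing  = last
  pos (just x) = fromℕ< (ℕP.m<n⇒m<1+n (rank-bound x))

  toℕ-pos : ∀ x → toℕ (pos (just x)) ≡ rank x
  toℕ-pos x = toℕ-fromℕ< _

  at : Fin (suc k) → Maybe (Half t)
  at i with toℕ i <? k
  ... | yes lt = just (proj₁ (unrank lt))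
  ... | no _   = nothing

  pos-at : ∀ i → pos (at i) ≡ i
  pos-at i with toℕ i <? k
  ... | yes lt = toℕ-injective (trans (toℕ-pos _) (proj₂ (unrank lt)))
  ... | no ge  = toℕ-injective (trans (toℕ-fromℕ k) (sym (≤-antisym (≤-pred (toℕ<n i)) (≮⇒≥ ge))))

  pos-just : ∀ {x y} → pos (just x) ≡ pos (just y) → x ≡ y
  pos-just {x} {y} e = rank-injective (trans (sym (toℕ-pos x)) (trans (cong toℕ e) (toℕ-pos y)))

  pos≢last : ∀ {x} → pos (just x) ≢ last
  pos≢last {x} e = <-irrefl (trans (sym (toℕ-pos x)) (trans (cong toℕ e) (toℕ-fromℕ k))) (rank-bound x)

  at-pos : ∀ p → at (pos p) ≡ p
  at-pos p with at (pos p) | pos-at (pos p)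
  at-pos (just x) | just y  | e = cong just (pos-just e)
  at-pos (just x) | nothing | e = contradiction (sym e) pos≢last
  at-pos nothing  | just y  | e = contradiction e pos≢last
  at-pos nothing  | nothing | e = refl

  lift : (Half t → Half t) → Fin (suc k) → Fin (suc k)
  lift f i = pos (Data.Maybe.map f (at i))

  lift-pos : ∀ f p → lift f (pos p) ≡ pos (Data.Maybe.map f p)
  lift-pos f p = cong (pos ∘ Data.Maybe.map f) (at-pos p)

  everywhere : (P : Fin (suc k) → Set) → P last → (∀ x → P (pos (just x))) → ∀ i → P i
  everywhere P root half i = subst P (pos-at i) (go (at i))
    where
    go : ∀ p → P (pos p)
    go nothing  = root
    go (just x) = half x

  lift-last : ∀ f → lift f last ≡ last
  lift-last f = lift-pos f nothing

  lift-half : ∀ f x → lift f (pos (just x)) ≡ pos (just (f x))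
  lift-half f x = lift-pos f (just x)

  lift-inv : ∀ {f} → (∀ x → f (f x) ≡ x) → ∀ i → lift f (lift f i) ≡ i
  lift-inv {f} inv = everywhere _ (trans (cong (lift f) (lift-last f)) (lift-last f))
    (λ x → trans (cong (lift f) (lift-half f x)) (trans (lift-half f (f x)) (cong (pos ∘ just) (inv x))))

  ⊏⇒≺ : ∀ {x y} → x ⊏ y → pos (just x) ≺ pos (just y)
  ⊏⇒≺ {x} {y} ⟨ p ⟩ = subst₂ _<_ (sym (toℕ-pos x)) (sym (toℕ-pos y)) p

  ≺⇒⊏ : ∀ {x y} → pos (just x) ≺ pos (just y) → x ⊏ y
  ≺⇒⊏ {x} {y} p = ⟨ subst₂ _<_ (toℕ-pos x) (toℕ-pos y) p ⟩

  last-max : ∀ {j : Fin (suc k)} → ¬ (last {k} ≺ j)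
  last-max {j} lt = <⇒≱ lt (⪯last j)

  lift-nc : ∀ {f} → HalfNC {t} f → ∀ i j → i ≺ j → j ≺ lift f i → i ≺ lift f j × lift f j ≺ lift f i
  lift-nc {f} nc = everywhere _ (λ j p _ → contradiction p (last-max {j})) λ x → everywhere _
    (λ _ q → contradiction q (last-max {lift f (pos (just x))}))
    λ y p q → let (a , b) = nc x y (≺⇒⊏ p) (≺⇒⊏ (subst (pos (just y) ≺_) (lift-half f x) q)) in
      subst (pos (just x) ≺_) (sym (lift-half f y)) (⊏⇒≺ a) , subst₂ _≺_ (sym (lift-half f y)) (sym (lift-half f x)) (⊏⇒≺ b)

  contour : Contour k
  contour = record
    { α = lift mate
    ; τ = lift tree-partner
    ; α-inv   = lift-inv mate-inv
    ; α-fixed = everywhere _ (mk⇔ (λ _ → refl) (λ _ → lift-last mate))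
        λ x → mk⇔ (λ e → contradiction (pos-just (trans (sym (lift-half mate x)) e)) (mate-≢ x)) (λ e → contradiction e pos≢last)
    ; τ-inv   = lift-inv tree-partner-inv
    ; τ-α     = everywhere _ (inj₁ (lift-last tree-partner)) λ x → case tree-partner-mate x of λ
        { (inj₁ e) → inj₁ (trans (lift-half tree-partner x) (cong (pos ∘ just) e))
        ; (inj₂ e) → inj₂ (trans (lift-half tree-partner x) (trans (cong (pos ∘ just) e) (sym (lift-half mate x)))) }
    }

  private
    β≡ : ∀ i → lift mate (lift tree-partner i) ≡ lift coface i
    β≡ = everywhere _ (trans (cong (lift mate) (lift-last tree-partner)) (trans (lift-last mate) (sym (lift-last coface))))
      λ x → trans (cong (lift mate) (lift-half tree-partner x)) (trans (lift-half mate (tree-partner x)) (sym (lift-half coface x)))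

    β-half : ∀ x → lift mate (lift tree-partner (pos (just x))) ≡ pos (just (coface x))
    β-half x = trans (β≡ (pos (just x))) (lift-half coface x)

  searchContour : SearchContour k
  searchContour = record
    { contour = contour
    ; nc-τ = lift-nc (half-nc-τ t)
    ; nc-β = λ i j p q → let (a , b) = lift-nc (half-nc-β t) i j p (subst (j ≺_) (β≡ i) q) in subst (i ≺_) (sym (β≡ j)) a , subst₂ _≺_ (sym (β≡ j)) (sym (β≡ i)) b
    ; dfs = everywhere _ (λ a p _ _ → last-max {a} p) λ x → everywhere _
        (λ _ q _ → last-max {lift mate (lift tree-partner (pos (just x)))} q)
        λ a p q r → half-search t x a (≺⇒⊏ p) (≺⇒⊏ (subst (pos (just a) ≺_) (β-half x) q)) (≺⇒⊏ (subst₂ _≺_ (β-half x) (lift-half tree-partner a) r))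
    }

  covered : Covered searchContour
  covered = everywhere _ (λ p → contradiction p (last-max {lift tree-partner last})) λ a p →
    let (x , u , v , w) = half-covered t a (≺⇒⊏ (subst (pos (just a) ≺_) (lift-half tree-partner a) p)) in
    pos (just x) , ⊏⇒≺ u , subst (pos (just x) ≺_) (sym (lift-half tree-partner a)) (⊏⇒≺ v) , subst₂ _≺_ (sym (lift-half tree-partner a)) (sym (β-half x)) (⊏⇒≺ w)

  open SearchContour searchContour using (toMap; RootSink; rootIndegree-count)

  rootIndegree≡weight : RootedMap.rootIndegree toMap ≡ weight t
  rootIndegree≡weight = trans (rootIndegree-count unique-sinks (λ y → mk⇔ (into y) (back y))) (trans (length-map sinkPos (allFin (weight t))) (length-tabulate id))
    where
    open SinkLaws (sinkLaws t)

    sinkPos : Fin (weight t) → Fin (suc k)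
    sinkPos n = pos (sink t (toℕ n))

    different : ∀ {m n} → m < n → n < weight t → pos (sink t m) ≢ pos (sink t n)
    different {m} {n} lt n<w e with sink t m in d | sink t n in d′
    ... | just x  | just y  = ⊏-irrefl (subst (y ⊏_) (pos-just e) (order lt n<w d d′))
    ... | just x  | nothing = pos≢last e
    ... | nothing | _ = <⇒≱ n<w (subst (_≤ n) (end (<-trans lt n<w) d) lt)

    unique-sinks : Unique (map sinkPos (allFin (weight t)))
    unique-sinks = Unique.map⁺ (λ {m} {n} e → case <-cmp (toℕ m) (toℕ n) of λ
      { (tri< lt _ _) → contradiction e (different lt (toℕ<n n))
      ; (tri≈ _ d _)  → toℕ-injective d
      ; (tri> _ _ gt) → contradiction (sym e) (different gt (toℕ<n m)) }) (Unique.allFin⁺ (weight t))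

    sink-root : ∀ m → ∀ {n} → n < weight t → sink t n ≡ m → RootSink (pos m)
    sink-root nothing  n<w e = inj₁ refl
    sink-root (just y) n<w e with isSink n<w e
    ... | p , top = inj₂ (subst (_≺ pos (just y)) (sym (lift-half mate y)) (⊏⇒≺ p) ,
      everywhere _ (λ p → contradiction p (last-max {pos (just y)}))
        λ a p le → <⇒≱ (⊏⇒≺ (top a (≺⇒⊏ p))) (subst (pos (just y) ⪯_) (lift-half tree-partner a) le))

    into : ∀ y → y ∈ map sinkPos (allFin (weight t)) → RootSink y
    into y y∈ with ∈-map⁻ sinkPos y∈
    ... | n , _ , refl = sink-root (sink t (toℕ n)) (toℕ<n n) refl

    member : ∀ {n m} → n < weight t → sink t n ≡ m → pos m ∈ map sinkPos (allFin (weight t))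
    member {n} n<w e = subst (_∈ map sinkPos (allFin (weight t))) (cong pos (trans (cong (sink t) (toℕ-fromℕ< n<w)) e)) (∈-map⁺ sinkPos (∈-allFin (fromℕ< n<w)))

    back-last : last ∈ map sinkPos (allFin (weight t))
    back-last = let (_ , e) = last-place t in member (≤-reflexive e) (root e)

    back : ∀ y → RootSink y → y ∈ map sinkPos (allFin (weight t))
    back = everywhere _ (λ _ → back-last) λ x → λ
      { (inj₁ e) → contradiction e pos≢last
      ; (inj₂ (p , free)) →
          let (n , n<w , e) = isIndex {x} (≺⇒⊏ (subst (_≺ pos (just x)) (lift-half mate x) p))
                (λ a lt → ≺⇒⊏ (≰⇒> λ le → free (pos (just a)) (⊏⇒≺ lt) (subst (pos (just x) ⪯_) (sym (lift-half tree-partner a)) le)))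
          in member n<w e }

-- The tree of a search contour

minimum : ∀ {n} (x : Fin n) xs → Σ[ m ∈ Fin n ] m ∈ x ∷ xs × (∀ {y} → y ∈ x ∷ xs → m ⪯ y)
minimum x [] = x , here refl , λ { (here refl) → ≤-refl }
minimum x (y ∷ ys) with minimum y ys
... | m , m∈ , least with ℕP.≤-total (toℕ x) (toℕ m)
...   | inj₁ le = x , here refl , λ { (here refl) → ≤-refl ; (there z∈) → ≤-trans le (least z∈) }
...   | inj₂ le = m , there m∈ , λ { (here refl) → le ; (there z∈) → least z∈ }

module Encode {k} (K : SearchContour k) where
  open SearchContour K

  record Code (S : List (Fin (suc k))) : Set where
    field
      t     : Tree
      g     : Half t → Fin (suc k)
      mono  : ∀ {x y} → x ⊏ y → g x ≺ g y
      α-g   : ∀ x → α (g x) ≡ g (mate x)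
      τ-g   : ∀ x → τ (g x) ≡ g (tree-partner x)
      g-∈   : ∀ x → g x ∈ S
      onto  : ∀ {y} → y ∈ S → Σ[ x ∈ Half t ] g x ≡ y

    injective : ∀ {x y} → g x ≡ g y → x ≡ y
    injective {x} {y} e with ⊏-total x y
    ... | inj₁ d = d
    ... | inj₂ (inj₁ p) = contradiction (cong toℕ e) (<⇒≢ (mono p))
    ... | inj₂ (inj₂ p) = contradiction (cong toℕ (sym e)) (<⇒≢ (mono p))

    mono⁻ : ∀ {x y} → g x ≺ g y → x ⊏ y
    mono⁻ {x} {y} lt with ⊏-total x y
    ... | inj₁ refl     = contradiction lt (<-irrefl refl)
    ... | inj₂ (inj₁ p) = p
    ... | inj₂ (inj₂ p) = contradiction lt (<-asym (mono p))

  -- What makes a set of positions the word of a bridgeless map by itself: the tree edges in it are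
  -- covered by edges that also belong to it.
  record Closed (S : List (Fin (suc k))) : Set where
    field
      α-∈     : ∀ {x} → x ∈ S → α x ∈ S
      no-root : last ∉ S
      covers  : ∀ {a} → a ∈ S → a ≺ τ a → Σ[ x ∈ Fin (suc k) ] x ∈ S × a ≺ x × x ≺ τ a × τ a ≺ β x

  -- S starts with the edge h - b; the second map occupies the positions
  -- between b and c.
  private
   module Split {S} (C : Closed S) {h} (h∈ : h ∈ S) (least : ∀ {y} → y ∈ S → h ⪯ y)
    (c : ℕ) (b<c : toℕ (α h) < c) (q-closed : ∀ {x} → x ∈ S → α h ≺ x → toℕ x < c → α h ≺ α x × toℕ (α x) < c)
    (w-closed : ∀ {x} → x ∈ S → h ≺ x → x ≺ α h → τ x ≺ α h) where
    open Closed C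

    b : Fin (suc k)
    b = α h

    h<b : h ≺ b
    h<b = ≤∧≢⇒< (least (α-∈ h∈)) (λ e → no-root (subst (_∈ S) (Equivalence.to (α-fixed h) (toℕ-injective (sym e))) h∈))

    First Second : Fin (suc k) → Set
    First  x = h ≺ x × (x ≺ b ⊎ c ≤ toℕ x)
    Second x = b ≺ x × toℕ x < c

    first? : Decidable First
    first? x = (h FinP.<? x) ×-dec ((x FinP.<? b) ⊎-dec (c ≤? toℕ x))

    second? : Decidable Second
    second? x = (b FinP.<? x) ×-dec (toℕ x <? c)

    S₁ S₂ : List (Fin (suc k))
    S₁ = filter first? S
    S₂ = filter second? S

    ∈S₁ : ∀ {x} → x ∈ S → First x → x ∈ S₁
    ∈S₁ = ∈-filter⁺ first?

    S₁∋ : ∀ {x} → x ∈ S₁ → x ∈ S × First x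
    S₁∋ = ∈-filter⁻ first? {xs = S}

    ∈S₂ : ∀ {x} → x ∈ S → Second x → x ∈ S₂
    ∈S₂ = ∈-filter⁺ second?

    S₂∋ : ∀ {x} → x ∈ S₂ → x ∈ S × Second x
    S₂∋ = ∈-filter⁻ second? {xs = S}

    data Part (x : Fin (suc k)) : Set where
      is-h     : x ≡ h → Part x
      is-b     : x ≡ b → Part x
      in-first : x ∈ S₁ → Part x
      in-second : x ∈ S₂ → Part x

    part : ∀ {x} → x ∈ S → Part x
    part {x} x∈ with x FinP.≟ h | <-cmp (toℕ x) (toℕ b) | <-≤-connex (toℕ x) c
    ... | yes e | _ | _ = is-h e
    ... | no ne | tri< lt _ _  | _ = in-first (∈S₁ x∈ (≤∧≢⇒< (least x∈) (λ e → ne (toℕ-injective (sym e))) , inj₁ lt))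
    ... | no ne | tri≈ _ e _   | _ = is-b (toℕ-injective e)
    ... | no ne | tri> _ _ gt  | inj₁ lt = in-second (∈S₂ x∈ (gt , lt))
    ... | no ne | tri> _ _ gt  | inj₂ le = in-first (∈S₁ x∈ (<-trans h<b gt , inj₂ le))

    closed₂ : Closed S₂
    closed₂ = record
      { α-∈ = λ x∈ → let (x∈S , b<x , x<c) = S₂∋ x∈ in ∈S₂ (α-∈ x∈S) (q-closed x∈S b<x x<c)
      ; no-root = λ l∈ → no-root (proj₁ (S₂∋ l∈))
      ; covers = λ {a} a∈ lt → let (a∈S , b<a , a<c) = S₂∋ a∈
                                   (x , x∈ , a<x , x<τa , r) = covers a∈S lt
                                   τa<c = [ (λ e → subst (_< c) (cong toℕ (sym e)) a<c) , (λ e → subst (_< c) (cong toℕ (sym e)) (proj₂ (q-closed a∈S b<a a<c))) ]′ (τ-α a)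
                               in x , ∈S₂ x∈ (<-trans b<a a<x , <-trans x<τa τa<c) , a<x , x<τa , r }

    closed₁ : Closed S₁
    closed₁ = record
      { α-∈ = λ x∈ → α-first x∈ (part (α-∈ (proj₁ (S₁∋ x∈))))
      ; no-root = λ l∈ → no-root (proj₁ (S₁∋ l∈))
      ; covers = λ {a} a∈ lt → let (a∈S , h<a , where-a) = S₁∋ a∈
                                   (x , x∈ , a<x , x<τa , r) = covers a∈S lt
                               in x , ∈S₁ x∈ (<-trans h<a a<x , (case where-a of λ
                                 { (inj₁ a<b) → inj₁ (<-trans x<τa (w-closed a∈S h<a a<b)) ; (inj₂ c≤a) → inj₂ (≤-trans c≤a (<⇒≤ a<x)) })) , a<x , x<τa , r }
      where
      α-first : ∀ {x} → x ∈ S₁ → Part (α x) → α x ∈ S₁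
      α-first x∈ (in-first p)  = p
      α-first {x} x∈ (in-second p) = let (αx∈ , b<αx , αx<c) = S₂∋ p
                                         (lo , hi) = q-closed αx∈ b<αx αx<c
                                     in case proj₂ (proj₂ (S₁∋ x∈)) of λ
        { (inj₁ x<b) → contradiction (subst (b ≺_) (α-inv x) lo) (<-asym x<b) ; (inj₂ c≤x) → contradiction (subst (λ z → toℕ z < c) (α-inv x) hi) (≤⇒≯ c≤x) }
      α-first {x} x∈ (is-h e) = let x≡b = trans (sym (α-inv x)) (cong α e) ; (_ , _ , w) = S₁∋ x∈ in case w of λ
        { (inj₁ x<b) → contradiction x<b (<-irrefl (cong toℕ x≡b)) ; (inj₂ c≤x) → contradiction (subst (c ≤_) (cong toℕ x≡b) c≤x) (<⇒≱ b<c) }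
      α-first {x} x∈ (is-b e) = contradiction (proj₁ (proj₂ (S₁∋ x∈))) (<-irrefl (cong toℕ (sym (α-injective e))))

    module Pieces (rec : ∀ S′ → length S′ < length S → Closed S′ → Code S′) where
      shorter : ∀ {P : Fin (suc k) → Set} (P? : Decidable P) → ¬ P h → length (filter P? S) < length S
      shorter P? ¬Ph = filter-notAll P? S (lose h∈ ¬Ph)

      C₁ : Code S₁
      C₁ = rec S₁ (shorter first? (λ p → <-irrefl refl (proj₁ p))) closed₁

      C₂ : Code S₂
      C₂ = rec S₂ (shorter second? (λ p → <-asym h<b (proj₁ p))) closed₂

    module _ (C₁ : Code S₁) (C₂ : Code S₂) where
      private
        module C₁ = Code C₁
        module C₂ = Code C₂

      module Join (j : Fin (weight C₁.t))
        (below : ∀ x → rank x < cut C₁.t j → C₁.g x ≺ b) (above : ∀ x → cut C₁.t j ≤ rank x → c ≤ toℕ (C₁.g x))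
        (partners : (τ h ≡ b × tree-partner {node C₁.t j C₂.t} src ≡ snk × tree-partner {node C₁.t j C₂.t} snk ≡ src)
                  ⊎ (τ h ≡ h × tree-partner {node C₁.t j C₂.t} src ≡ src × tree-partner {node C₁.t j C₂.t} snk ≡ snk)) where

        t : Tree
        t = node C₁.t j C₂.t

        g : Half t → Fin (suc k)
        g src     = h
        g snk     = b
        g (in₁ x) = C₁.g x
        g (in₂ y) = C₂.g y

        second : ∀ y → Second (C₂.g y)
        second y = proj₂ (S₂∋ (C₂.g-∈ y))

        mono-view : ∀ {x y} → View x y → g x ≺ g y
        mono-view src-snk     = h<b
        mono-view (src-in₁ {x}) = proj₁ (proj₂ (S₁∋ (C₁.g-∈ x)))
        mono-view (src-in₂ {y}) = <-trans h<b (proj₁ (second y))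
        mono-view (in₁-in₁ p) = C₁.mono p
        mono-view (in₂-in₂ p) = C₂.mono p
        mono-view (w-snk {x} p) = below x p
        mono-view (w-in₂ {x} {y} p) = <-trans (below x p) (proj₁ (second y))
        mono-view (snk-in₂ {y}) = proj₁ (second y)
        mono-view (snk-r {x} p) = <-≤-trans b<c (above x p)
        mono-view (in₂-r {x} {y} p) = <-≤-trans (proj₂ (second y)) (above x p)

        τb : ∀ {z} → τ h ≡ z → (z ≡ b → τ b ≡ h) × (z ≡ h → τ b ≡ b)
        τb e = (λ d → trans (cong τ (sym (trans e d))) (τ-inv h)) , (λ d → trans (τα h) (cong α (trans e d)))

        code : Code S
        code = record
          { t = t ; g = g
          ; mono = λ p → mono-view (view p)
          ; α-g = λ { src → refl ; snk → α-inv h ; (in₁ x) → C₁.α-g x ; (in₂ y) → C₂.α-g y }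
          ; τ-g = λ { src → case partners of λ { (inj₁ (e , p , _)) → trans e (cong g (sym p)) ; (inj₂ (e , p , _)) → trans e (cong g (sym p)) }
                    ; snk → case partners of λ { (inj₁ (e , _ , p)) → trans (proj₁ (τb refl) e) (cong g (sym p)) ; (inj₂ (e , _ , p)) → trans (proj₂ (τb refl) e) (cong g (sym p)) }
                    ; (in₁ x) → C₁.τ-g x ; (in₂ y) → C₂.τ-g y }
          ; g-∈ = λ { src → h∈ ; snk → α-∈ h∈ ; (in₁ x) → proj₁ (S₁∋ (C₁.g-∈ x)) ; (in₂ y) → proj₁ (S₂∋ (C₂.g-∈ y)) }
          ; onto = λ y∈ → case part y∈ of λ
              { (is-h e) → src , sym e ; (is-b e) → snk , sym e
              ; (in-first p) → let (x , e) = C₁.onto p in in₁ x , e ; (in-second p) → let (x , e) = C₂.onto p in in₂ x , e }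
          }

  private
   -- If the first edge is not in the tree, no edge joins a position after `b` to one before `b`. So
   -- the second word extends to the end, and the first one is cut before its root.
   module LoopCase {S} (C : Closed S) {h} (h∈ : h ∈ S) (least : ∀ {y} → y ∈ S → h ⪯ y)
    (q-closed : ∀ {x} → x ∈ S → α h ≺ x → toℕ x < suc k → α h ≺ α x × toℕ (α x) < suc k)
    (w-closed : ∀ {x} → x ∈ S → h ≺ x → x ≺ α h → τ x ≺ α h)
    (rec : ∀ S′ → length S′ < length S → Closed S′ → Code S′) (τh : τ h ≡ h) where
    open Split C h∈ least (suc k) (toℕ<n (α h)) q-closed w-closed
    open Pieces rec

    j : Fin (weight (Code.t C₁))
    j = fromℕ< (≤-reflexive (proj₂ (last-place (Code.t C₁))))

    sink-j : sink (Code.t C₁) (toℕ j) ≡ nothing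
    sink-j = SinkLaws.root (sinkLaws (Code.t C₁)) (trans (cong suc (toℕ-fromℕ< _)) (proj₂ (last-place (Code.t C₁))))

    first-b : ∀ x → Code.g C₁ x ≺ b
    first-b x with proj₂ (proj₂ (S₁∋ (Code.g-∈ C₁ x)))
    ... | inj₁ lt = lt
    ... | inj₂ le = contradiction (toℕ<n (Code.g C₁ x)) (≤⇒≯ le)

    code : Code S
    code = Join.code C₁ C₂ j (λ x _ → first-b x) (λ x c≤ → contradiction c≤ (<⇒≱ (NodeKind.LoopEdge.in-w {t₂ = leaf} sink-j x)))
      (inj₂ (τh , NodeKind.LoopEdge.partner-src sink-j , NodeKind.LoopEdge.partner-snk sink-j))

   -- Here `s` is the first position after `b` whose edge starts before `b`. The second word ends
   -- there, and in the first word `s` becomes a sink at the root vertex, whose index is the place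
   -- `j`.
   module TreeCase {S} (C : Closed S) {h} (h∈ : h ∈ S) (least : ∀ {y} → y ∈ S → h ⪯ y)
    {s} (s∈ : s ∈ S) (b<s : α h ≺ s) (αs<b : α s ≺ α h)
    (q-closed : ∀ {x} → x ∈ S → α h ≺ x → toℕ x < toℕ s → α h ≺ α x × toℕ (α x) < toℕ s)
    (inside : ∀ {x} → x ∈ S → h ≺ x → x ≺ α h → τ x ≺ α h)
    (rec : ∀ S′ → length S′ < length S → Closed S′ → Code S′) (τh : τ h ≡ α h) where
    open Split C h∈ least (toℕ s) b<s q-closed inside
    open Pieces rec

    module C₁ = Code C₁

    y₁ : Half C₁.t
    y₁ = proj₁ (C₁.onto (∈S₁ s∈ (<-trans h<b b<s , inj₂ ≤-refl)))

    gy₁ : C₁.g y₁ ≡ s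
    gy₁ = proj₂ (C₁.onto (∈S₁ s∈ (<-trans h<b b<s , inj₂ ≤-refl)))

    before-s : ∀ x → C₁.g x ≺ s → C₁.g x ≺ b
    before-s x lt with proj₂ (proj₂ (S₁∋ (C₁.g-∈ x)))
    ... | inj₁ p = p
    ... | inj₂ p = contradiction lt (≤⇒≯ p)

    index₁ : Σ[ n ∈ ℕ ] n < weight C₁.t × sink C₁.t n ≡ just y₁
    index₁ = SinkLaws.isIndex (sinkLaws C₁.t)
      (C₁.mono⁻ (subst₂ _≺_ (trans (cong α (sym gy₁)) (C₁.α-g y₁)) (sym gy₁) (<-trans αs<b b<s)))
      (λ a a<y → C₁.mono⁻ (subst₂ _≺_ (C₁.τ-g a) (sym gy₁) (<-trans (inside (proj₁ (S₁∋ (C₁.g-∈ a))) (proj₁ (proj₂ (S₁∋ (C₁.g-∈ a))))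
        (before-s a (subst (C₁.g a ≺_) gy₁ (C₁.mono a<y)))) b<s)))

    j : Fin (weight C₁.t)
    j = fromℕ< (proj₁ (proj₂ index₁))

    sink-j : sink C₁.t (toℕ j) ≡ just y₁
    sink-j = trans (cong (sink C₁.t) (toℕ-fromℕ< (proj₁ (proj₂ index₁)))) (proj₂ (proj₂ index₁))

    below : ∀ x → rank x < cut C₁.t j → C₁.g x ≺ b
    below x lt = before-s x (subst (C₁.g x ≺_) gy₁ (C₁.mono ⟨ subst (rank x <_) (cong cutRank sink-j) lt ⟩))

    above : ∀ x → cut C₁.t j ≤ rank x → toℕ s ≤ toℕ (C₁.g x)
    above x le = case ⊏-total y₁ x of λ
      { (inj₁ e) → ≤-reflexive (cong toℕ (trans (sym gy₁) (cong C₁.g e)))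
      ; (inj₂ (inj₁ p)) → subst (_⪯ C₁.g x) gy₁ (<⇒≤ (C₁.mono p))
      ; (inj₂ (inj₂ p)) → contradiction (subst (_≤ rank x) (cong cutRank sink-j) le) (<⇒≱ (ranks p)) }

    code : Code S
    code = Join.code C₁ C₂ j below above (inj₁ (τh , NodeKind.TreeEdge.partner-src sink-j , NodeKind.TreeEdge.partner-snk sink-j))

   module Step {S} (C : Closed S) {h} (h∈ : h ∈ S) (least : ∀ {y} → y ∈ S → h ⪯ y)
    (rec : ∀ S′ → length S′ < length S → Closed S′ → Code S′) where
    open Closed C
    b : Fin (suc k)
    b = α h

    h<b : h ≺ b
    h<b = ≤∧≢⇒< (least (α-∈ h∈)) (λ e → no-root (subst (_∈ S) (Equivalence.to (α-fixed h) (toℕ-injective (sym e))) h∈))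

    after-h : ∀ {x} → x ∈ S → b ≺ x → h ≺ α x
    after-h {x} x∈ b<x = ≤∧≢⇒< (least (α-∈ x∈)) (λ e → <-irrefl (cong toℕ (trans (cong α (toℕ-injective e)) (α-inv x))) b<x)

    by-kind : τ h ≡ h ⊎ τ h ≡ b → Code S
    by-kind (inj₁ τh) = LoopCase.code C h∈ least (λ {x} x∈ b<x _ → outside x∈ b<x , toℕ<n (α x)) inside rec τh
      where
      βh : β h ≡ b
      βh = cong α τh

      outside : ∀ {x} → x ∈ S → b ≺ x → b ≺ α x
      outside {x} x∈ b<x with <-cmp (toℕ (α x)) (toℕ b)
      ... | tri> _ _ gt = gt
      ... | tri≈ _ e _  = contradiction (trans (sym (cong toℕ (α-injective (toℕ-injective e)))) refl) (λ e → <-irrefl e (<-trans h<b b<x))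
      ... | tri< lt _ _ with τ-α x
      ...   | inj₁ e = contradiction (subst₂ _≺_ (trans (cong α (trans (τα x) (cong α e))) (α-inv x)) βh (proj₂ (nc-β h (α x) (after-h x∈ b<x) (subst (α x ≺_) (sym βh) lt)))) (<-asym b<x)
      ...   | inj₂ e = contradiction (subst₂ _≺_ (sym βh) (sym (trans (cong τ (sym e)) (τ-inv x))) b<x) (dfs h (α x) (after-h x∈ b<x) (subst (α x ≺_) (sym βh) lt))

      inside : ∀ {x} → x ∈ S → h ≺ x → x ≺ b → τ x ≺ b
      inside {x} x∈ h<x x<b with τ-α x
      ... | inj₁ e = subst (_≺ b) (sym e) x<b
      ... | inj₂ e with <-cmp (toℕ (α x)) (toℕ b)
      ...   | tri< lt _ _ = subst (_≺ b) (sym e) lt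
      ...   | tri≈ _ d _  = contradiction h<x (<-irrefl (cong toℕ (sym (α-injective (toℕ-injective d)))))
      ...   | tri> _ _ gt = contradiction (subst (b ≺_) (α-inv x) (outside (α-∈ x∈) gt)) (<-asym x<b)
    by-kind (inj₂ τh) = TreeCase.code C h∈ least s∈ b<s αs<b outside inside rec τh
      where
      Candidate : Fin (suc k) → Set
      Candidate x = b ≺ x × α x ≺ b

      candidate? : Decidable Candidate
      candidate? x = (b FinP.<? x) ×-dec (α x FinP.<? b)

      h<τh : h ≺ τ h
      h<τh = subst (h ≺_) (sym τh) h<b

      -- The edge that covers the tree edge from `h` to `b` ends after `b`; without bridgelessness
      -- there might be no place for the cut.
      some-candidate : Σ[ x ∈ Fin (suc k) ] x ∈ filter candidate? S
      some-candidate with covers h∈ h<τh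
      ... | x , x∈ , h<x , x<τh , τh<βx with τ-α x
      ...   | inj₁ e = α x , ∈-filter⁺ candidate? (α-∈ x∈) (subst₂ _≺_ τh (cong α e) τh<βx , subst₂ _≺_ (sym (α-inv x)) τh x<τh)
      ...   | inj₂ e = contradiction (subst (τ h ≺_) (trans (cong α e) (α-inv x)) τh<βx) (<-asym x<τh)

      first-candidate : Σ[ s ∈ Fin (suc k) ] s ∈ S × Candidate s × (∀ {x} → x ∈ S → Candidate x → s ⪯ x)
      first-candidate with filter candidate? S in e | some-candidate
      ... | y ∷ ys | _ with minimum y ys
      ...   | s , s∈ , min = let (s∈S , cs) = ∈-filter⁻ candidate? {xs = S} (subst (s ∈_) (sym e) s∈) in
        s , s∈S , cs , λ x∈ cx → min (subst (_ ∈_) e (∈-filter⁺ candidate? x∈ cx))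

      s = proj₁ first-candidate
      s∈ = proj₁ (proj₂ first-candidate)
      b<s = proj₁ (proj₁ (proj₂ (proj₂ first-candidate)))
      αs<b = proj₂ (proj₁ (proj₂ (proj₂ first-candidate)))
      s-least = proj₂ (proj₂ (proj₂ first-candidate))

      inside : ∀ {x} → x ∈ S → h ≺ x → x ≺ b → τ x ≺ b
      inside {x} _ h<x x<b = subst (τ x ≺_) τh (proj₂ (nc-τ h x h<x (subst (x ≺_) (sym τh) x<b)))

      τs : τ s ≡ s
      τs with τ-α s
      ... | inj₁ e = e
      ... | inj₂ e = contradiction (subst (_≺ b) (trans (cong τ (sym e)) (τ-inv s)) (inside (α-∈ s∈) (after-h s∈ b<s) αs<b)) (<-asym b<s)

      βu : β (α s) ≡ s
      βu = trans (cong α (trans (τα s) (cong α τs))) (α-inv s)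

      outside : ∀ {x} → x ∈ S → b ≺ x → x ≺ s → b ≺ α x × α x ≺ s
      outside {x} x∈ b<x x<s with <-cmp (toℕ (α x)) (toℕ b) | <-cmp (toℕ (α x)) (toℕ s)
      ... | tri< lt _ _ | _ = contradiction (s-least x∈ (b<x , lt)) (<⇒≱ x<s)
      ... | tri≈ _ e _  | _ = contradiction (<-trans h<b b<x) (<-irrefl (cong toℕ (sym (α-injective (toℕ-injective e)))))
      ... | tri> _ _ gt | tri< lt _ _ = gt , lt
      ... | tri> _ _ gt | tri≈ _ e _  = contradiction (subst (λ z → α z ≺ b) (toℕ-injective (sym e)) αs<b) (<-asym (subst (b ≺_) (sym (α-inv x)) b<x))
      ... | tri> _ _ gt | tri> _ _ s<αx with τ-α x
      ...   | inj₁ e = contradiction (subst₂ _≺_ (cong α e) βu (proj₂ (nc-β (α s) x (<-trans αs<b b<x) (subst (x ≺_) (sym βu) x<s)))) (<-asym s<αx)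
      ...   | inj₂ e = contradiction (subst₂ _≺_ (sym βu) (sym e) s<αx) (dfs (α s) x (<-trans αs<b b<x) (subst (x ≺_) (sym βu) x<s))

  encode : ∀ n S → length S ≤ n → Closed S → Code S
  encode n [] le C = record
    { t = leaf ; g = λ () ; mono = λ { {()} } ; α-g = λ () ; τ-g = λ () ; g-∈ = λ () ; onto = λ () }
  encode (suc n) (x ∷ xs) le C with minimum x xs
  ... | h , h∈ , least = Step.by-kind C h∈ least (λ S′ lt → encode n S′ (≤-pred (<-≤-trans lt le))) (τ-α h)

  everything : List (Fin (suc k))
  everything = filter (λ x → ¬? (x FinP.≟ last)) (allFin (suc k))

  ∈-everything : ∀ {x} → x ≢ last → x ∈ everything
  ∈-everything {x} ne = ∈-filter⁺ (λ x → ¬? (x FinP.≟ last)) (∈-allFin x) ne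

  code : Covered K → Code everything
  code covered = encode (length everything) everything ≤-refl record
    { α-∈ = λ x∈ → ∈-everything (λ e → ≢last x∈ (trans (sym (α-inv _)) (trans (cong α e) α-last)))
    ; no-root = λ l∈ → ≢last l∈ refl
    ; covers = λ {a} _ lt → let (x , a<x , x<τa , r) = covered a lt in x , ∈-everything (≺⇒≢last ≤-refl x<τa) , a<x , x<τa , r }
    where
    ≢last : ∀ {x} → x ∈ everything → x ≢ last
    ≢last x∈ = chosen (λ x → ¬? (x FinP.≟ last)) x∈

-- Uniqueness of the tree of a map

module OrderIsomorphism (F : Tree → Set) (_⊑_ : ∀ {t} → F t → F t → Set) (inv : ∀ {t} → F t → F t) (index : ∀ {t} → F t → ℕ)
  (to-< : ∀ {t} {x y : F t} → x ⊑ y → index x < index y) (from-< : ∀ {t} {x y : F t} → index x < index y → x ⊑ y)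
  (index-inj : ∀ {t} {x y : F t} → index x ≡ index y → x ≡ y) (predecessor : ∀ {t} {n} (x : F t) → index x ≡ suc n → Σ[ y ∈ F t ] index y ≡ n) where

  record Iso (t t′ : Tree) : Set where
    field
      φ     : F t → F t′
      ψ     : F t′ → F t
      φψ    : ∀ x → φ (ψ x) ≡ x
      ψφ    : ∀ x → ψ (φ x) ≡ x
      mono  : ∀ {x y} → x ⊑ y → φ x ⊑ φ y
      mates : ∀ x → φ (inv x) ≡ inv (φ x)

    mono-ψ : ∀ {x y} → x ⊑ y → ψ x ⊑ ψ y
    mono-ψ {x} {y} lt with <-cmp (index (ψ x)) (index (ψ y))
    ... | tri< p _ _ = from-< p
    ... | tri≈ _ e _ = contradiction (cong index (trans (sym (φψ x)) (trans (cong φ (index-inj e)) (φψ y)))) (<⇒≢ (to-< lt))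
    ... | tri> _ _ p = contradiction (to-< lt) (<-asym (subst₂ (λ x y → index x < index y) (φψ y) (φψ x) (to-< (mono (from-< p)))))

    -- By `predecessor` the indices leave no gaps, so a monotone map cannot lower them. Applied to
    -- both directions of an isomorphism this shows that indices are preserved.
    index-≥ : ∀ n x → index x ≡ n → n ≤ index (φ x)
    index-≥ zero    x e = z≤n
    index-≥ (suc n) x e with predecessor x e
    ... | x′ , e′ = ≤-<-trans (index-≥ n x′ e′) (to-< (mono (from-< (subst₂ _<_ (sym e′) (sym e) ≤-refl))))

  iso-sym : ∀ {t t′} → Iso t t′ → Iso t′ t
  iso-sym S = record { φ = ψ ; ψ = φ ; φψ = ψφ ; ψφ = φψ ; mono = mono-ψ
    ; mates = λ x → trans (cong (ψ ∘ inv) (sym (φψ x))) (trans (cong ψ (sym (mates (ψ x)))) (ψφ (inv (ψ x)))) }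
    where open Iso S

  iso-index : ∀ {t t′} (S : Iso t t′) x → index (Iso.φ S x) ≡ index x
  iso-index S x = ≤-antisym (subst (index (φ x) ≤_) (cong index (ψφ x)) (Iso.index-≥ (iso-sym S) _ (φ x) refl)) (Iso.index-≥ S _ x refl)
    where open Iso S

  module Restrict {t t′ u u′} (S : Iso t t′) (i : F u → F t) (i′ : F u′ → F t′)
    (i-⊑ : ∀ {x y} → x ⊑ y → i x ⊑ i y) (i′-⊑ : ∀ {x y} → i′ x ⊑ i′ y → x ⊑ y)
    (i-inj : ∀ {x y} → i x ≡ i y → x ≡ y) (i′-inj : ∀ {x y} → i′ x ≡ i′ y → x ≡ y)
    (i-inv : ∀ x → i (inv x) ≡ inv (i x)) (i′-inv : ∀ x → i′ (inv x) ≡ inv (i′ x))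
    (into : ∀ x → Σ[ y ∈ F u′ ] Iso.φ S (i x) ≡ i′ y) (back : ∀ y → Σ[ x ∈ F u ] Iso.ψ S (i′ y) ≡ i x) where
    open Iso S

    restrict : Iso u u′
    restrict = record
      { φ = proj₁ ∘ into ; ψ = proj₁ ∘ back
      ; φψ = λ y → i′-inj (trans (sym (proj₂ (into _))) (trans (cong φ (sym (proj₂ (back y)))) (φψ (i′ y))))
      ; ψφ = λ x → i-inj (trans (sym (proj₂ (back _))) (trans (cong ψ (sym (proj₂ (into x)))) (ψφ (i x))))
      ; mono = λ {x} {y} p → i′-⊑ (subst₂ _⊑_ (proj₂ (into x)) (proj₂ (into y)) (mono (i-⊑ p)))
      ; mates = λ x → i′-inj (trans (sym (proj₂ (into (inv x)))) (trans (cong φ (i-inv x)) (trans (mates (i x)) (trans (cong inv (proj₂ (into x))) (sym (i′-inv _)))))) }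

half-predecessor : ∀ {t n} (x : Half t) → rank x ≡ suc n → Σ[ y ∈ Half t ] rank y ≡ n
half-predecessor {t} x e = unrank {t} (<-trans (≤-reflexive (sym e)) (rank-bound x))

open OrderIsomorphism Half _⊏_ mate rank ranks ⟨_⟩ rank-injective half-predecessor public
  using () renaming (Iso to Same; iso-sym to same-sym; iso-index to same-rank; module Restrict to RestrictHalves; module Iso to Same)

-- Singles out the inserted map by means of the order and of mate only.
Inserted : ∀ {t₁ j t₂} → Half (node t₁ j t₂) → Set
Inserted u = snk ⊏ u × (∀ z → snk ⊏ z → mate z ⊏ snk → u ⊏ z)

inserted-in₂ : ∀ {t₁ j t₂} (y : Half t₂) → Inserted {t₁} {j} (in₂ y)
inserted-in₂ y = unview snk-in₂ , λ
  { src p _ → contradiction (unview src-snk) (⊏-asym p) ; snk p _ → contradiction p ⊏-irrefl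
  ; (in₁ x) p _ → case view p of λ { (snk-r le) → unview (in₂-r le) } ; (in₂ z) _ q → contradiction (unview snk-in₂) (⊏-asym q) }

-- A half-edge in `r` does not precede the first letter of `r`, the sink at the cut, whose source
-- lies in `w` and hence in front of `snk`.
¬inserted-in₁ : ∀ {t₁ j t₂} (x : Half t₁) → ¬ Inserted {t₁} {j} {t₂} (in₁ x)
¬inserted-in₁ {t₁} {j} {t₂} x (p , q) with view p
... | snk-r le = go (sink t₁ (toℕ j)) refl
  where
  go : ∀ m → sink t₁ (toℕ j) ≡ m → ⊥
  go nothing  e = <⇒≱ (rank-bound x) (subst (_≤ rank x) (cong cutRank e) le)
  go (just s) e with view (q (in₁ s) (unview (snk-r (≤-reflexive (cong cutRank e)))) (unview (w-snk (subst (rank (mate s) <_) (sym (cong cutRank e)) (ranks (proj₁ (SinkLaws.isSink (sinkLaws t₁) (toℕ<n j) e)))))))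
  ... | in₁-in₁ lt = <⇒≱ (ranks lt) (subst (_≤ rank x) (cong cutRank e) le)

module SameNode {t₁ j t₂ t₁′ j′ t₂′} (S : Same (node t₁ j t₂) (node t₁′ j′ t₂′)) where
  open Same S

  φ-src : φ src ≡ src
  φ-src with ⊏-total (φ src) src
  ... | inj₁ e = e
  ... | inj₂ (inj₁ ⟨ () ⟩)
  ... | inj₂ (inj₂ p) = contradiction (subst (ψ src ⊏_) (ψφ src) (mono-ψ p)) λ { ⟨ () ⟩ }

  φ-snk : φ snk ≡ snk
  φ-snk = trans (mates src) (cong mate φ-src)

  ψ-snk : ψ snk ≡ snk
  ψ-snk = trans (cong ψ (sym φ-snk)) (ψφ snk)

  φ-inserted : ∀ {u} → Inserted u → Inserted (φ u)
  φ-inserted {u} (p , q) = subst (_⊏ φ u) φ-snk (mono p) , λ z r s → subst (φ u ⊏_) (φψ z) (mono (q (ψ z) (subst (_⊏ ψ z) ψ-snk (mono-ψ r))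
    (subst₂ _⊏_ (Same.mates (same-sym S) z) ψ-snk (mono-ψ s))))

  φ-in₂ : ∀ y → Σ[ y′ ∈ Half t₂′ ] φ (in₂ y) ≡ in₂ y′
  φ-in₂ y with φ (in₂ y) | φ-inserted (inserted-in₂ y)
  ... | src    | p , _ = contradiction p λ { ⟨ () ⟩ }
  ... | snk    | p , _ = contradiction p ⊏-irrefl
  ... | in₁ x  | i = contradiction i (¬inserted-in₁ x)
  ... | in₂ y′ | _ = y′ , refl

module SameParts {t₁ j t₂ t₁′ j′ t₂′} (S : Same (node t₁ j t₂) (node t₁′ j′ t₂′)) where
  open Same S
  module F = SameNode S
  module B = SameNode (same-sym S)

  φ-in₁ : ∀ x → Σ[ x′ ∈ Half t₁′ ] φ (in₁ x) ≡ in₁ x′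
  φ-in₁ x with φ (in₁ x) in e
  ... | in₁ x′ = x′ , refl
  ... | src    = contradiction (trans (sym (ψφ (in₁ x))) (trans (cong ψ e) B.φ-src)) λ ()
  ... | snk    = contradiction (trans (sym (ψφ (in₁ x))) (trans (cong ψ e) B.φ-snk)) λ ()
  ... | in₂ y  = contradiction (trans (sym (proj₂ (B.φ-in₂ y))) (trans (cong ψ (sym e)) (ψφ (in₁ x)))) λ ()

module _ {t₁ j t₂ t₁′ j′ t₂′} (S : Same (node t₁ j t₂) (node t₁′ j′ t₂′)) where
  open Same S
  private
    module F = SameParts S
    module B = SameParts (same-sym S)

  same₁ : Same t₁ t₁′
  same₁ = RestrictHalves.restrict S in₁ in₁ (λ p → unview (in₁-in₁ p)) (λ p → case view p of λ { (in₁-in₁ q) → q })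
    (λ { refl → refl }) (λ { refl → refl }) (λ _ → refl) (λ _ → refl) F.φ-in₁ B.φ-in₁

  same₂ : Same t₂ t₂′
  same₂ = RestrictHalves.restrict S in₂ in₂ (λ p → unview (in₂-in₂ p)) (λ p → case view p of λ { (in₂-in₂ q) → q })
    (λ { refl → refl }) (λ { refl → refl }) (λ _ → refl) (λ _ → refl) F.F.φ-in₂ B.F.φ-in₂

  -- Recovers the place: the cut is the number of half-edges of `t₁` in front of `snk`.
  same-below : ∀ x → rank x < cut t₁ j → rank x < cut t₁′ j′
  same-below x lt = case view (subst₂ _⊏_ (proj₂ (F.φ-in₁ x)) F.F.φ-snk (mono (unview (w-snk lt)))) of λ
    { (w-snk p) → subst (_< cut t₁′ j′) (same-rank same₁ x) p }

cut-different : ∀ t {m n} → m < n → n < weight t → cutRank (sink t m) ≢ cutRank (sink t n)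
cut-different t {m} {n} lt n<w with sink t m in d | sink t n in d′
... | just x  | just y  = >⇒≢ (ranks (SinkLaws.order (sinkLaws t) lt n<w d d′))
... | just x  | nothing = <⇒≢ (rank-bound x)
... | nothing | _ = contradiction (SinkLaws.end (sinkLaws t) (<-trans lt n<w) d) (<⇒≢ (≤-<-trans lt n<w))

cut-injective : ∀ t {j j′ : Fin (weight t)} → cut t j ≡ cut t j′ → j ≡ j′
cut-injective t {j} {j′} e with <-cmp (toℕ j) (toℕ j′)
... | tri< lt _ _ = contradiction e (cut-different t lt (toℕ<n j′))
... | tri≈ _ d _  = toℕ-injective d
... | tri> _ _ gt = contradiction (sym e) (cut-different t gt (toℕ<n j))

same-≡ : ∀ t t′ → Same t t′ → t ≡ t′
same-≡ leaf leaf S = refl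
same-≡ leaf (node _ _ _) S = case Same.ψ S src of λ ()
same-≡ (node _ _ _)   leaf S = case Same.φ S src of λ ()
same-≡ (node t₁ j t₂) (node t₁′ j′ t₂′) S with same-≡ t₁ t₁′ (same₁ S) | same-≡ t₂ t₂′ (same₂ S)
... | refl | refl = cong (λ i → node t₁ i t₂) (cut-injective t₁ (≤-antisym (cut-≤ S) (cut-≤ (same-sym S))))
  where
  cut-≤ : ∀ {j j′} → Same (node t₁ j t₂) (node t₁ j′ t₂) → cut t₁ j ≤ cut t₁ j′
  cut-≤ {j} {j′} S = ≮⇒≥ λ lt → let (x , e) = unrank {t₁} (<-≤-trans lt (cut-bound t₁ j)) in
    <-irrefl e (same-below S x (subst (_< cut t₁ j) (sym e) lt))

-- Cardinalities from codings by trees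

module _ (S : Setoid 0ℓ 0ℓ) (n i : ℕ) (s : Tree → ℕ)
  (decode : ∀ t → leaves t ≡ suc n → s t ≡ i → Setoid.Carrier S)
  (encode : ∀ (x : Setoid.Carrier S) → Σ[ t ∈ Tree ] leaves t ≡ suc n × s t ≡ i × (∀ p q → Setoid._≈_ S (decode t p q) x))
  (decode-injective : ∀ {t t′ p q p′ q′} → Setoid._≈_ S (decode t p q) (decode t′ p′ q′) → t ≡ t′) where
  private
    module S = Setoid S
    open S using (_≈_) renaming (Carrier to A)

    L : List Tree
    L = filter (λ t → s t ℕP.≟ i) (trees n)

    unique-L : Unique L
    unique-L = Unique.filter⁺ (λ t → s t ℕP.≟ i) (unique-trees n)

    ∈L : ∀ {t} → t ∈ L → leaves t ≡ suc n × s t ≡ i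
    ∈L t∈ = let (p , q) = ∈-filter⁻ (λ t → s t ℕP.≟ i) {xs = trees n} t∈ in ∈-trees-leaves n p , q

    from : Fin (length L) → A
    from j = decode (lookup L j) (proj₁ (∈L (∈-lookup j))) (proj₂ (∈L (∈-lookup j)))

    member : ∀ x → proj₁ (encode x) ∈ L
    member x = let (t , p , q , _) = encode x in ∈-filter⁺ (λ t → s t ℕP.≟ i) (∈-trees t p) q

    to : A → Fin (length L)
    to x = index (member x)

    from-to : ∀ x → from (to x) ≈ x
    from-to x = go (lookup-∈ (member x))
      where
      go : ∀ {t p q} → t ≡ proj₁ (encode x) → decode t p q ≈ x
      go refl = proj₂ (proj₂ (proj₂ (encode x))) _ _

    from-injective : ∀ {j j′} → from j ≈ from j′ → j ≡ j′
    from-injective {j} {j′} e = lookup-injective unique-L j j′ (decode-injective e)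

  cardinality : HasCardinality S (countTrees s n i)
  cardinality = record
    { to = to
    ; from = from
    ; to-cong   = λ {x} {y} e → from-injective (S.trans (from-to x) (S.trans e (S.sym (from-to y))))
    ; from-cong = λ { refl → S.refl }
    ; inverse   = (λ {j} {x} e → from-injective (S.trans (from-to x) e)) , λ { {x} refl → from-to x }
    }

monotone-≥ : ∀ {m n} (h : Fin m → Fin n) → (∀ {i j} → i ≺ j → h i ≺ h j) → ∀ i → i ⪯ h i
monotone-≥ h mono i = go (toℕ i) i refl
  where
  go : ∀ n i → toℕ i ≡ n → n ≤ toℕ (h i)
  go zero    i e = z≤n
  go (suc n) (fsuc i) e = ≤-<-trans (go n (inject₁ i) (trans (toℕ-inject₁ i) (suc-injective e)))
    (mono (≤-reflexive (cong suc (toℕ-inject₁ i))))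

module _ {k} (K : SearchContour k) where
  open SearchContour K

  private
    opener? : Decidable (λ x → x ≺ α x)
    opener? x = x FinP.<? α x

    openers : List (Fin (suc k))
    openers = filter opener? (allFin (suc k))

    opener : ∀ {x} → x ∈ openers → x ≺ α x
    opener x∈ = chosen opener? x∈

    split : length (allFin (suc k)) ≡ length (last ∷ openers ++ map α openers)
    split = length-≡ (Unique.allFin⁺ (suc k))
      (All.tabulate (λ {x} x∈ e → case ∈-++⁻ openers x∈ of λ
        { (inj₁ p) → <-irrefl (cong toℕ (trans (sym e) (trans (sym α-last) (cong α e)))) (opener p)
        ; (inj₂ p) → case ∈-map⁻ α p of λ { (y , y∈ , refl) →
            let d = trans (sym (α-inv y)) (trans (cong α (sym e)) α-last) in <-irrefl (cong toℕ (trans d e)) (opener y∈) } })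
       ∷ Unique.++⁺ (Unique.filter⁺ opener? (Unique.allFin⁺ (suc k))) (Unique.map⁺ α-injective (Unique.filter⁺ opener? (Unique.allFin⁺ (suc k))))
           λ { (p , q) → case ∈-map⁻ α q of λ { (y , y∈ , refl) → <-asym (opener y∈) (subst (α y ≺_) (α-inv y) (opener p)) } })
      (λ {x} _ → place x) (λ _ → ∈-allFin _)
      where
      place : ∀ x → x ∈ last ∷ openers ++ map α openers
      place x with <-cmp (toℕ x) (toℕ (α x))
      ... | tri< lt _ _ = there (∈-++⁺ˡ (∈-filter⁺ opener? (∈-allFin x) lt))
      ... | tri≈ _ e _  = here (Equivalence.to (α-fixed x) (sym (toℕ-injective e)))
      ... | tri> _ _ gt = there (∈-++⁺ʳ openers (subst (_∈ map α openers) (α-inv x) (∈-map⁺ α (∈-filter⁺ opener? (∈-allFin (α x)) (subst (α x ≺_) (sym (α-inv x)) gt)))))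

  numEdges-double : 2 + k ≡ RootedMap.numEdges toMap + RootedMap.numEdges toMap
  numEdges-double = begin
    2 + k ≡⟨ cong suc (trans (sym (length-tabulate {n = suc k} id)) split) ⟩
    2 + length (openers ++ map α openers) ≡⟨ cong (_+_ 2) (trans (length-++ openers) (cong (_+_ (length openers)) (length-map α openers))) ⟩
    2 + (length openers + length openers) ≡⟨ cong suc (sym (+-suc (length openers) (length openers))) ⟩
    suc (length openers) + suc (length openers) ≡⟨ cong₂ _+_ numEdges-openers numEdges-openers ⟨
    RootedMap.numEdges toMap + RootedMap.numEdges toMap ∎
    where open ≡-Reasoning

double-injective : ∀ {a b} → a + a ≡ b + b → a ≡ b
double-injective {a} {b} e with <-cmp a b
... | tri< lt _ _ = contradiction e (<⇒≢ (+-mono-< lt lt))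
... | tri≈ _ d _  = d
... | tri> _ _ gt = contradiction e (>⇒≢ (+-mono-< gt gt))

module _ (t : Tree) where
  open DecodeMap t using (searchContour)
  open SearchContour searchContour using (toMap)

  numEdges≡leaves : RootedMap.numEdges toMap ≡ leaves t
  numEdges≡leaves = double-injective (trans (sym (numEdges-double searchContour)) (halves-leaves t))

toMap-≅ : ∀ {k} (K K′ : SearchContour k) (let module K = SearchContour K) (let module K′ = SearchContour K′) →
  (∀ i → K.α i ≡ K′.α i) → (∀ i → K.τ i ≡ K′.τ i) → K.toMap ≅ K′.toMap
toMap-≅ K K′ α≡ τ≡ = record { iso = Perm.id ; σ-hom = λ i → cong next (τ≡ i) ; α-hom = α≡ ; root↦ = refl }

module _ {k} (K : SearchContour k) (C : Encode.Code K (Encode.everything K)) where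
  open SearchContour K
  open Encode.Code C
  private
    module D = DecodeMap t

    point : Maybe (Half t) → Fin (suc k)
    point nothing  = last
    point (just x) = g x

    h : Fin (suc D.k) → Fin (suc k)
    h i = point (D.at i)

    h-last : h last ≡ last
    h-last = cong point (D.at-pos nothing)

    h-half : ∀ x → h (D.pos (just x)) ≡ g x
    h-half x = cong point (D.at-pos (just x))

    g≺last : ∀ x → g x ≺ last
    g≺last x = <-≤-trans (≢last⇒< (chosen (λ x → ¬? (x FinP.≟ last)) (g-∈ x))) (≤-reflexive (sym (toℕ-fromℕ k)))

    h-mono : ∀ {i j} → i ≺ j → h i ≺ h j
    h-mono {i} {j} = D.everywhere (λ i → ∀ j → i ≺ j → h i ≺ h j)
      (λ j p → contradiction p (D.last-max {j}))
      (λ x → D.everywhere _ (λ _ → subst₂ _≺_ (sym (h-half x)) (sym h-last) (g≺last x))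
        (λ y p → subst₂ _≺_ (sym (h-half x)) (sym (h-half y)) (mono (D.≺⇒⊏ p)))) i j

    h-onto : ∀ y → Σ[ i ∈ Fin (suc D.k) ] h i ≡ y
    h-onto y with y FinP.≟ last
    ... | yes refl = last , h-last
    ... | no ne    = let (x , e) = onto (Encode.∈-everything K ne) in D.pos (just x) , trans (h-half x) e

    h⁻¹-mono : ∀ {y z} → y ≺ z → proj₁ (h-onto y) ≺ proj₁ (h-onto z)
    h⁻¹-mono {y} {z} lt with <-cmp (toℕ (proj₁ (h-onto y))) (toℕ (proj₁ (h-onto z)))
    ... | tri< p _ _ = p
    ... | tri≈ _ e _ = contradiction (cong toℕ (trans (sym (proj₂ (h-onto y))) (trans (cong h (toℕ-injective e)) (proj₂ (h-onto z))))) (<⇒≢ lt)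
    ... | tri> _ _ p = contradiction lt (<-asym (subst₂ _≺_ (proj₂ (h-onto z)) (proj₂ (h-onto y)) (h-mono p)))

    -- `h` and its inverse are both monotone, so neither lowers a number; hence both keep all
    -- numbers, and the sizes agree.
    h-toℕ : ∀ i → toℕ (h i) ≡ toℕ i
    h-toℕ i = ≤-antisym (subst (λ j → h i ⪯ j) back (monotone-≥ (λ y → proj₁ (h-onto y)) h⁻¹-mono (h i))) (monotone-≥ h h-mono i)
      where
      back : proj₁ (h-onto (h i)) ≡ i
      back with <-cmp (toℕ (proj₁ (h-onto (h i)))) (toℕ i)
      ... | tri< p _ _ = contradiction (cong toℕ (proj₂ (h-onto (h i)))) (<⇒≢ (h-mono p))
      ... | tri≈ _ e _ = toℕ-injective e
      ... | tri> _ _ p = contradiction (cong toℕ (sym (proj₂ (h-onto (h i))))) (<⇒≢ (h-mono p))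

    size≡ : k ≡ D.k
    size≡ = trans (sym (toℕ-fromℕ k)) (trans (cong toℕ (sym h-last)) (trans (h-toℕ last) (toℕ-fromℕ D.k)))

    h-α : ∀ i → α (h i) ≡ h (D.lift mate i)
    h-α = D.everywhere _ (trans (cong α h-last) (trans α-last (trans (sym h-last) (cong h (sym (D.lift-last mate))))))
      (λ x → trans (cong α (h-half x)) (trans (α-g x) (trans (sym (h-half (mate x))) (cong h (sym (D.lift-half mate x))))))

    h-τ : ∀ i → τ (h i) ≡ h (D.lift tree-partner i)
    h-τ = D.everywhere _ (trans (cong τ h-last) (trans τ-last (trans (sym h-last) (cong h (sym (D.lift-last tree-partner))))))
      (λ x → trans (cong τ (h-half x)) (trans (τ-g x) (trans (sym (h-half (tree-partner x))) (cong h (sym (D.lift-half tree-partner x))))))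

    transport-≅ : ∀ {m n} (K : SearchContour m) (K′ : SearchContour n) (let module K = SearchContour K) (let module K′ = SearchContour K′) →
      m ≡ n → (h : Fin (suc n) → Fin (suc m)) → (∀ i → toℕ (h i) ≡ toℕ i) →
      (∀ i → K.α (h i) ≡ h (K′.α i)) → (∀ i → K.τ (h i) ≡ h (K′.τ i)) → K.toMap ≅ K′.toMap
    transport-≅ {m} K K′ refl h h≡ hα hτ = toMap-≅ K K′ (same (SearchContour.α K) (SearchContour.α K′) hα) (same (SearchContour.τ K) (SearchContour.τ K′) hτ)
      where
      same : ∀ (f f′ : Fin (suc m) → Fin (suc m)) → (∀ i → f (h i) ≡ h (f′ i)) → ∀ i → f i ≡ f′ i
      same f f′ e i = trans (cong f (sym (toℕ-injective (h≡ i)))) (trans (e i) (toℕ-injective (h≡ (f′ i))))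

  code-≅ : toMap ≅ SearchContour.toMap D.searchContour
  code-≅ = transport-≅ K D.searchContour size≡ h h-toℕ h-α h-τ

private
  α-rigid : ∀ {k k′} (K : SearchContour k) (K′ : SearchContour k′) → SearchContour.toMap K ≅ SearchContour.toMap K′ →
    k ≡ k′ × (∀ {i j} → toℕ i ≡ toℕ j → toℕ (SearchContour.α K i) ≡ toℕ (SearchContour.α K′ j))
  α-rigid K K′ e with ↔⇒≡ (_≅_.iso e)
  ... | refl = refl , λ {i} d → cong toℕ (trans (Rigidity.α-equal K K′ e i) (cong (SearchContour.α K′) (toℕ-injective d)))

decode-same : ∀ {t t′} → SearchContour.toMap (DecodeMap.searchContour t) ≅ SearchContour.toMap (DecodeMap.searchContour t′) → Same t t′
decode-same {t} {t′} e = record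
  { φ = λ x → proj₁ (move x) ; ψ = λ x → proj₁ (move⁻ x)
  ; φψ = λ x → rank-injective (trans (proj₂ (move _)) (proj₂ (move⁻ x)))
  ; ψφ = λ x → rank-injective (trans (proj₂ (move⁻ _)) (proj₂ (move x)))
  ; mono = λ {x} {y} p → ⟨ subst₂ _<_ (sym (proj₂ (move x))) (sym (proj₂ (move y))) (ranks p) ⟩
  ; mates = λ x → rank-injective (begin
      rank (proj₁ (move (mate x))) ≡⟨ proj₂ (move (mate x)) ⟩
      rank (mate x) ≡⟨ D.toℕ-pos (mate x) ⟨
      toℕ (D.pos (just (mate x))) ≡⟨ cong toℕ (D.lift-half mate x) ⟨
      toℕ (D.lift mate (D.pos (just x))) ≡⟨ proj₂ rigid (trans (D.toℕ-pos x) (trans (sym (proj₂ (move x))) (sym (D′.toℕ-pos _)))) ⟩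
      toℕ (D′.lift mate (D′.pos (just (proj₁ (move x))))) ≡⟨ cong toℕ (D′.lift-half mate _) ⟩
      toℕ (D′.pos (just (mate (proj₁ (move x))))) ≡⟨ D′.toℕ-pos _ ⟩
      rank (mate (proj₁ (move x))) ∎) }
  where
  open ≡-Reasoning
  module D = DecodeMap t
  module D′ = DecodeMap t′
  rigid : halves t ≡ halves t′ × _
  rigid = α-rigid D.searchContour D′.searchContour e
  move : ∀ x → Σ[ y ∈ Half t′ ] rank y ≡ rank x
  move x = unrank (subst (rank x <_) (proj₁ rigid) (rank-bound x))
  move⁻ : ∀ y → Σ[ x ∈ Half t ] rank x ≡ rank y
  move⁻ y = unrank (subst (rank y <_) (sym (proj₁ rigid)) (rank-bound y))

abstract
  decodeMap : Tree → RootedMap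
  decodeMap t = SearchContour.toMap (DecodeMap.searchContour t)

  decodeMap-planar : ∀ t → RootedMap.Planar (decodeMap t)
  decodeMap-planar t = NC⇒Planar nc-τ nc-β
    where open SearchContour (DecodeMap.searchContour t)

  decodeMap-bridgeless : ∀ t → RootedMap.Bridgeless (decodeMap t)
  decodeMap-bridgeless t = Covered⇒Bridgeless (DecodeMap.searchContour t) (DecodeMap.covered t)

  decodeMap-edges : ∀ t → RootedMap.numEdges (decodeMap t) ≡ leaves t
  decodeMap-edges = numEdges≡leaves

  decodeMap-degree : ∀ t → RootedMap.rootIndegree (decodeMap t) ≡ weight t
  decodeMap-degree t = DecodeMap.rootIndegree≡weight t

  decodeMap-injective : ∀ t t′ → decodeMap t ≅ decodeMap t′ → t ≡ t′
  decodeMap-injective t t′ e = same-≡ t t′ (decode-same e)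

  encodeMap : ∀ M → RootedMap.Planar M → RootedMap.Bridgeless M → Σ[ t ∈ Tree ] M ≅ decodeMap t
  encodeMap M planar bridgeless = go (Grow.search-contour M planar)
    where
    go : Σ[ k ∈ ℕ ] Σ[ K ∈ SearchContour k ] M ≅ SearchContour.toMap K → Σ[ t ∈ Tree ] M ≅ decodeMap t
    go (k , K , M≅K) = Encode.Code.t C , Setoid.trans rootedMaps {M} {SearchContour.toMap K} {decodeMap (Encode.Code.t C)} M≅K (code-≅ K C)
      where
      C : Encode.Code K (Encode.everything K)
      C = Encode.code K (Bridgeless⇒Covered K (Bridgeless-map {M} {SearchContour.toMap K} M≅K bridgeless))

maps-cardinality : ∀ n i → HasCardinality (planarBridgelessMaps (suc n) i) (countTrees weight n i)
maps-cardinality n i = cardinality (planarBridgelessMaps (suc n) i) n i weight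
  (λ t p q → decodeMap t , decodeMap-planar t , decodeMap-bridgeless t , trans (decodeMap-edges t) p , trans (decodeMap-degree t) q)
  (λ { (M , planar , bridgeless , edges , degree) → let (t , e) = encodeMap M planar bridgeless in
    t , trans (sym (decodeMap-edges t)) (trans (sym (numEdges-≡ {M} {decodeMap t} e)) edges)
      , trans (sym (decodeMap-degree t)) (trans (sym (rootIndegree-≡ {M} {decodeMap t} e)) degree) , λ _ _ → ≅-sym {M} {decodeMap t} e })
  (λ {t} {t′} → decodeMap-injective t t′)

-- The chord diagram of a tree

size : Tree → ℕ
size leaf = 2
size (node t₁ j t₂) = size t₁ + size t₂

-- The endpoints of the chords of the diagram coded by a tree.  The diagram of
-- a node consists of those of its two subtrees: the second one is split after
-- its first point, and the rest of it is inserted into a slot of the first one.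
data Point : Tree → Set where
  source target : Point leaf
  left  : ∀ {t₁ j t₂} → Point t₁ → Point (node t₁ j t₂)
  right : ∀ {t₁ j t₂} → Point t₂ → Point (node t₁ j t₂)

other : ∀ {t} → Point t → Point t
other source    = target
other target    = source
other (left x)  = left (other x)
other (right y) = right (other y)

choose : {A P : Set} → Dec P → A → A → A
choose P? x y = if does P? then x else y

module _ {A P : Set} {x y : A} where
  choose-yes : (P? : Dec P) → P → choose P? x y ≡ x
  choose-yes (yes _) p = refl
  choose-yes (no ¬p) p = contradiction p ¬p

  choose-no : (P? : Dec P) → ¬ P → choose P? x y ≡ y
  choose-no (yes p) ¬p = contradiction p ¬p
  choose-no (no _)  _  = refl

-- The number of points before a slot; the slots are numbered from the last to
-- the first.  The first one comes after the first point.
slot : Tree → ℕ → ℕ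
slot leaf n = 1
slot (node t₁ j t₂) n = choose (n ≤? toℕ j) (slot t₁ n + size t₂)
  (choose (suc (n ∸ suc (toℕ j)) ℕP.≟ weight t₂) 1 (slot t₁ (toℕ j) + slot t₂ (n ∸ suc (toℕ j))))

slotOf : ∀ t → Fin (weight t) → ℕ
slotOf t j = slot t (toℕ j)

insertAfter : ℕ → ℕ → ℕ
insertAfter c zero    = zero
insertAfter c (suc n) = c + suc n

insertAround : ℕ → ℕ → ℕ → ℕ
insertAround c e n = choose (n <? c) (suc n) (n + e)

-- The first point of `t₂` goes in front of everything. So the points of `t₁` before the slot move
-- up by one, and those behind it by the whole size of `t₂`.
place : ∀ {t} → Point t → ℕ
place source = 0
place target = 1
place {node t₁ j t₂} (left x)  = insertAround (slotOf t₁ j) (size t₂) (place x)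
place {node t₁ j t₂} (right y) = insertAfter (slotOf t₁ j) (place y)

infix 4 _◁_
record _◁_ {t} (x y : Point t) : Set where
  constructor ⟪_⟫
  field
    places : place x < place y
open _◁_ public

other-inv : ∀ {t} (x : Point t) → other (other x) ≡ x
other-inv source    = refl
other-inv target    = refl
other-inv (left x)  = cong left (other-inv x)
other-inv (right y) = cong right (other-inv y)

other-≢ : ∀ {t} (x : Point t) → other x ≢ x
other-≢ source ()
other-≢ target ()
other-≢ (left x)  e = other-≢ x (inj e)
  where
  inj : ∀ {t₁ j t₂} {x y : Point t₁} → left {t₁} {j} {t₂} x ≡ left y → x ≡ y
  inj refl = refl
other-≢ (right x) e = other-≢ x (inj e)
  where
  inj : ∀ {t₁ j t₂} {x y : Point t₂} → right {t₁} {j} {t₂} x ≡ right y → x ≡ y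
  inj refl = refl

data SlotView t₁ j t₂ (n : ℕ) : Set where
  outer : n ≤ toℕ j → slot (node t₁ j t₂) n ≡ slot t₁ n + size t₂ → SlotView t₁ j t₂ n
  inner : ∀ k → n ≡ suc (toℕ j) + k → suc k < weight t₂ → slot (node t₁ j t₂) n ≡ slotOf t₁ j + slot t₂ k → SlotView t₁ j t₂ n
  first : suc n ≡ weight (node t₁ j t₂) → slot (node t₁ j t₂) n ≡ 1 → SlotView t₁ j t₂ n

slotView : ∀ {t₁ j t₂} n → n < weight (node t₁ j t₂) → SlotView t₁ j t₂ n
slotView {t₁} {j} {t₂} n lt with n ≤? toℕ j
... | yes le = outer le (choose-yes (n ≤? toℕ j) le)
... | no gt  = split (suc k ℕP.≟ weight t₂)
  where
  k = n ∸ suc (toℕ j)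
  n≡ : suc (toℕ j) + k ≡ n
  n≡ = m+[n∸m]≡n (≰⇒> gt)
  split : Dec (suc k ≡ weight t₂) → SlotView t₁ j t₂ n
  split (yes d) = first (trans (cong suc (sym n≡)) (trans (sym (+-suc (suc (toℕ j)) k)) (cong (_+_ (suc (toℕ j))) d)))
    (trans (choose-no (n ≤? toℕ j) gt) (choose-yes (suc k ℕP.≟ weight t₂) d))
  split (no ne) = inner k (sym n≡) (≤∧≢⇒< (+-cancelˡ-< (suc (toℕ j)) _ _ (subst (_< suc (toℕ j) + weight t₂) (sym n≡) lt)) ne)
    (trans (choose-no (n ≤? toℕ j) gt) (choose-no (suc k ℕP.≟ weight t₂) ne))

module _ {t₁ : Tree} {j : Fin (weight t₁)} {t₂ : Tree} where
  slot-outer : ∀ {n} → n ≤ toℕ j → slot (node t₁ j t₂) n ≡ slot t₁ n + size t₂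
  slot-outer {n} le = choose-yes (n ≤? toℕ j) le

  slot-inner : ∀ {k} → suc k < weight t₂ → slot (node t₁ j t₂) (suc (toℕ j) + k) ≡ slotOf t₁ j + slot t₂ k
  slot-inner {k} lt with slotView {t₁} {j} {t₂} (suc (toℕ j) + k) (+-monoʳ-< (suc (toℕ j)) (<-trans (n<1+n k) lt))
  ... | outer le e = contradiction le (<⇒≱ (m≤m+n (suc (toℕ j)) k))
  ... | inner k′ d lt′ e  = trans e (cong (λ k → slotOf t₁ j + slot t₂ k) (sym (ℕP.+-cancelˡ-≡ (suc (toℕ j)) _ _ d)))
  ... | first d e = contradiction (ℕP.+-cancelˡ-≡ (suc (toℕ j)) _ _ (trans (+-suc (suc (toℕ j)) k) d)) (<⇒≢ lt)

slot-first : ∀ t {n} → suc n ≡ weight t → slot t n ≡ 1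
slot-first leaf e = refl
slot-first (node t₁ j t₂) {n} e with slotView {t₁} {j} {t₂} n (≤-reflexive e)
... | outer le _ = contradiction e (<⇒≢ (≤-<-trans (s≤s le) (m<m+n (suc (toℕ j)) (weight>0 t₂))))
... | first _ s = s
... | inner k d lt _  = contradiction (trans (+-suc (suc (toℕ j)) k) (trans (cong suc (sym d)) e)) (<⇒≢ (+-monoʳ-< (suc (toℕ j)) lt))

size>0 : ∀ t → 1 < size t
size>0 leaf = s≤s (s≤s z≤n)
size>0 (node t₁ j t₂) = <-≤-trans (size>0 t₁) (m≤m+n _ _)

slot-range : ∀ t {n} → n < weight t → 0 < slot t n × slot t n < size t
slot-range leaf _ = s≤s z≤n , s≤s (s≤s z≤n)
slot-range (node t₁ j t₂) {n} lt with slotView {t₁} {j} {t₂} n lt | slot-range t₁ (toℕ<n j)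
... | first _ e | _ = subst (0 <_) (sym e) (s≤s z≤n) , subst (_< size t₁ + size t₂) (sym e) (size>0 (node t₁ j t₂))
... | inner k _ lt′ e | _ , c< = subst (0 <_) (sym e) (<-≤-trans k> (m≤n+m _ (slotOf t₁ j))) , subst (_< size t₁ + size t₂) (sym e) (+-mono-< c< <k)
  where
  k> = proj₁ (slot-range t₂ (<-trans (n<1+n k) lt′))
  <k = proj₂ (slot-range t₂ (<-trans (n<1+n k) lt′))
... | outer le e | _ with slot-range t₁ (≤-<-trans le (toℕ<n j))
...   | n> , <n = subst (0 <_) (sym e) (<-≤-trans n> (m≤m+n _ _)) , subst (_< size t₁ + size t₂) (sym e) (+-monoˡ-< (size t₂) <n)

slotOf-range : ∀ t (j : Fin (weight t)) → 0 < slotOf t j × slotOf t j < size t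
slotOf-range t j = slot-range t (toℕ<n j)

slot-decreasing : ∀ t {m n} → m < n → n < weight t → slot t n < slot t m
slot-decreasing leaf m<n (s≤s z≤n) = contradiction m<n λ ()
slot-decreasing (node t₁ j t₂) {m} {n} m<n n<w with slotView {t₁} {j} {t₂} m (<-trans m<n n<w) | slotView {t₁} {j} {t₂} n n<w
... | outer le e | outer le′ e′ = subst₂ _<_ (sym e′) (sym e) (+-monoˡ-< (size t₂) (slot-decreasing t₁ m<n (≤-<-trans le′ (toℕ<n j))))
... | outer le e | first _ e′ = subst₂ _<_ (sym e′) (sym e) (+-mono-≤-< {0} z≤n (size>0 t₂))
... | outer le e | inner k _ lt e′ = subst₂ _<_ (sym e′) (sym e) (+-mono-≤-< c≤ (proj₂ (slot-range t₂ (<-trans (n<1+n k) lt))))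
  where
  c≤ : slotOf t₁ j ≤ slot t₁ m
  c≤ = [ (λ lt → <⇒≤ (slot-decreasing t₁ lt (toℕ<n j))) , (λ d → ≤-reflexive (cong (slot t₁) (sym d))) ]′ (m≤n⇒m<n∨m≡n le)
... | inner k d lt e | outer le _ = contradiction (≤-trans (m≤m+n _ k) (subst (_≤ toℕ j) d (≤-trans (<⇒≤ m<n) le))) (<-irrefl refl)
... | inner k d lt e | first _ e′ = subst₂ _<_ (sym e′) (sym e) (ℕP.+-mono-≤ (proj₁ (slotOf-range t₁ j)) (proj₁ (slot-range t₂ (<-trans (n<1+n k) lt))))
... | inner k d lt e | inner k′ d′ lt′ e′ = subst₂ _<_ (sym e′) (sym e) (+-monoʳ-< (slotOf t₁ j)
      (slot-decreasing t₂ (+-cancelˡ-< (suc (toℕ j)) _ _ (subst₂ _<_ d d′ m<n)) (<-trans (n<1+n k′) lt′)))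
... | first d _ | _ = contradiction n<w (≤⇒≯ (subst (_≤ n) d m<n))

slot-anti : ∀ t {m n} → m ≤ n → n < weight t → slot t n ≤ slot t m
slot-anti t le lt = [ (λ p → <⇒≤ (slot-decreasing t p lt)) , (λ { refl → ≤-refl }) ]′ (m≤n⇒m<n∨m≡n le)

slot-anti⁻ : ∀ t {m n} → m < weight t → slot t n ≤ slot t m → m ≤ n
slot-anti⁻ t lt le = ≮⇒≥ λ p → <⇒≱ (slot-decreasing t p lt) le

slotOf-injective : ∀ t {j j′ : Fin (weight t)} → slotOf t j ≡ slotOf t j′ → j ≡ j′
slotOf-injective t {j} {j′} e = toℕ-injective (≤-antisym (slot-anti⁻ t (toℕ<n j) (≤-reflexive (sym e))) (slot-anti⁻ t (toℕ<n j′) (≤-reflexive e)))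

module _ {c e : ℕ} where
  around-below : ∀ {n} → n < c → insertAround c e n ≡ suc n
  around-below {n} lt = choose-yes (n <? c) lt

  around-above : ∀ {n} → c ≤ n → insertAround c e n ≡ n + e
  around-above {n} le = choose-no (n <? c) (≤⇒≯ le)

module _ {t₁ : Tree} {j : Fin (weight t₁)} {t₂ : Tree} where
  private
    c e : ℕ
    c = slotOf t₁ j
    e = size t₂

  left-below : ∀ x → place x < c → place (left {t₁} {j} {t₂} x) ≡ suc (place x)
  left-below x = around-below

  left-above : ∀ x → c ≤ place x → place (left {t₁} {j} {t₂} x) ≡ place x + e
  left-above x = around-above

  right-inside : ∀ (y : Point t₂) → 0 < place y → place (right {t₁} {j} y) ≡ c + place y
  right-inside y lt with place y
  ... | suc _ = refl

  right-root : ∀ (y : Point t₂) → place y ≡ 0 → place (right {t₁} {j} y) ≡ 0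
  right-root y d rewrite d = refl

place-bound : ∀ {t} (x : Point t) → place x < size t
place-bound source = s≤s z≤n
place-bound target = s≤s (s≤s z≤n)
place-bound {node t₁ j t₂} (left x) with <-≤-connex (place x) (slotOf t₁ j)
... | inj₁ lt = subst (_< size t₁ + size t₂) (sym (left-below {t₁} {j} {t₂} x lt)) (<-≤-trans (s≤s lt) (≤-trans (proj₂ (slotOf-range t₁ j)) (m≤m+n _ _)))
... | inj₂ le = subst (_< size t₁ + size t₂) (sym (left-above {t₁} {j} {t₂} x le)) (+-monoˡ-< (size t₂) (place-bound x))
place-bound {node t₁ j t₂} (right y) with place y in d | place-bound y
... | zero  | _  = <-trans (n<1+n 0) (size>0 (node t₁ j t₂))
... | suc n | lt = +-mono-< (proj₂ (slotOf-range t₁ j)) lt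

-- The order on the points of a node. A point of `t₂` precedes one of `t₁` for two reasons: it is
-- the first point of all, or the point of `t₁` lies behind the slot.
data Seen {t₁ j t₂} : Point (node t₁ j t₂) → Point (node t₁ j t₂) → Set where
  ll     : ∀ {x x′} → x ◁ x′ → Seen (left x) (left x′)
  rr     : ∀ {y y′} → y ◁ y′ → Seen (right y) (right y′)
  lr     : ∀ {x y} → place x < slotOf t₁ j → 0 < place y → Seen (left x) (right y)
  root-l : ∀ {x y} → place y ≡ 0 → Seen (right y) (left x)
  rl     : ∀ {x y} → slotOf t₁ j ≤ place x → Seen (right y) (left x)

module _ {t₁ : Tree} {j : Fin (weight t₁)} {t₂ : Tree} where
  private
    c e : ℕ
    c = slotOf t₁ j
    e = size t₂

    c>0 : 0 < c
    c>0 = proj₁ (slotOf-range t₁ j)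

    around-< : ∀ {m n} → m < n → insertAround c e m < insertAround c e n
    around-< {m} {n} lt with <-≤-connex m c | <-≤-connex n c
    ... | inj₁ p | inj₁ q = subst₂ _<_ (sym (around-below p)) (sym (around-below q)) (s≤s lt)
    ... | inj₁ p | inj₂ q = subst₂ _<_ (sym (around-below p)) (sym (around-above q)) (subst (_< n + e) (ℕP.+-comm m 1) (ℕP.+-mono-<-≤ lt (<⇒≤ (size>0 t₂))))
    ... | inj₂ p | inj₁ q = contradiction (<-trans lt q) (≤⇒≯ p)
    ... | inj₂ p | inj₂ q = subst₂ _<_ (sym (around-above p)) (sym (around-above q)) (+-monoˡ-< e lt)

    after-< : ∀ {m n} → m < n → insertAfter c m < insertAfter c n
    after-< {zero}  {suc n} _  = <-≤-trans (s≤s z≤n) (m≤n+m (suc n) c)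
    after-< {suc m} {suc n} lt = +-monoʳ-< c lt

  unsee : {u v : Point (node t₁ j t₂)} → Seen u v → u ◁ v
  unsee (ll ⟪ p ⟫) = ⟪ around-< p ⟫
  unsee (rr ⟪ p ⟫) = ⟪ after-< p ⟫
  unsee (lr {x} {y} p q) = ⟪ subst₂ _<_ (sym (left-below {t₁} {j} {t₂} x p)) (sym (right-inside {t₁} {j} {t₂} y q)) (≤-<-trans p (m<m+n c q)) ⟫
  unsee (root-l {x} {y} p) = ⟪ subst (_< place (left {t₁} {j} {t₂} x)) (sym (right-root {t₁} {j} {t₂} y p)) (positive (<-≤-connex (place x) c)) ⟫
    where
    positive : place x < c ⊎ c ≤ place x → 0 < place (left {t₁} {j} {t₂} x)
    positive (inj₁ p) = subst (0 <_) (sym (left-below {t₁} {j} {t₂} x p)) (s≤s z≤n)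
    positive (inj₂ p) = subst (0 <_) (sym (left-above {t₁} {j} {t₂} x p)) (<-≤-trans c>0 (≤-trans p (m≤m+n _ e)))
  unsee (rl {x} {y} p) = ⟪ subst (place (right {t₁} {j} y) <_) (sym (left-above {t₁} {j} {t₂} x p)) (≤-<-trans (after-≤ (place y)) (+-mono-≤-< p (place-bound y))) ⟫
    where
    after-≤ : ∀ n → insertAfter c n ≤ c + n
    after-≤ zero    = z≤n
    after-≤ (suc n) = ≤-refl

◁-trans : ∀ {t} {x y z : Point t} → x ◁ y → y ◁ z → x ◁ z
◁-trans ⟪ p ⟫ ⟪ q ⟫ = ⟪ <-trans p q ⟫

◁-asym : ∀ {t} {x y : Point t} → x ◁ y → ¬ (y ◁ x)
◁-asym ⟪ p ⟫ ⟪ q ⟫ = <-asym p q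

◁-irrefl : ∀ {t} {x : Point t} → ¬ (x ◁ x)
◁-irrefl ⟪ p ⟫ = <-irrefl refl p

data Comparison {t} (x y : Point t) : Set where
  before : x ◁ y → Comparison x y
  same   : x ≡ y → Comparison x y
  after  : y ◁ x → Comparison x y

compare : ∀ {t} (x y : Point t) → Comparison x y
compare source source = same refl
compare source target = before ⟪ s≤s z≤n ⟫
compare target source = after ⟪ s≤s z≤n ⟫
compare target target = same refl
compare (left x) (left y) with compare x y
... | before p  = before (unsee (ll p))
... | same refl = same refl
... | after p   = after (unsee (ll p))
compare (right x) (right y) with compare x y
... | before p  = before (unsee (rr p))
... | same refl = same refl
... | after p   = after (unsee (rr p))
compare {node t₁ j t₂} (left x) (right y) with place y in e | <-≤-connex (place x) (slotOf t₁ j)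
... | zero  | _ = after (unsee (root-l e))
... | suc _ | inj₁ p = before (unsee (lr p (subst (0 <_) (sym e) (s≤s z≤n))))
... | suc _ | inj₂ p = after (unsee (rl p))
compare {node t₁ j t₂} (right y) (left x) with place y in e | <-≤-connex (place x) (slotOf t₁ j)
... | zero  | _ = before (unsee (root-l e))
... | suc _ | inj₁ p = after (unsee (lr p (subst (0 <_) (sym e) (s≤s z≤n))))
... | suc _ | inj₂ p = before (unsee (rl p))

place-injective : ∀ {t} {x y : Point t} → place x ≡ place y → x ≡ y
place-injective {x = x} {y} e with compare x y
... | before p = contradiction e (<⇒≢ (places p))
... | same d   = d
... | after p  = contradiction (sym e) (<⇒≢ (places p))

ll⁻ : ∀ {t₁ j t₂} {x x′ : Point t₁} → left {t₁} {j} {t₂} x ◁ left x′ → x ◁ x′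
ll⁻ {x = x} {x′} p with compare x x′
... | before q  = q
... | same refl = contradiction p ◁-irrefl
... | after q   = contradiction p (◁-asym (unsee (ll q)))

rr⁻ : ∀ {t₁ j t₂} {y y′ : Point t₂} → right {t₁} {j} {t₂} y ◁ right y′ → y ◁ y′
rr⁻ {y = y} {y′} p with compare y y′
... | before q  = q
... | same refl = contradiction p ◁-irrefl
... | after q   = contradiction p (◁-asym (unsee (rr q)))

see : ∀ {t₁ j t₂} {u v : Point (node t₁ j t₂)} → u ◁ v → Seen u v
see {u = left x}  {left x′}  p = ll (ll⁻ p)
see {u = right y} {right y′} p = rr (rr⁻ p)
see {t₁} {j} {u = left x}  {right y}  p with place y in e | <-≤-connex (place x) (slotOf t₁ j)
... | zero  | _ = contradiction p (◁-asym (unsee (root-l e)))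
... | suc _ | inj₁ q = lr q (subst (0 <_) (sym e) (s≤s z≤n))
... | suc _ | inj₂ q = contradiction p (◁-asym (unsee (rl q)))
see {t₁} {j} {u = right y} {left x} p with place y in e | <-≤-connex (place x) (slotOf t₁ j)
... | zero  | _ = root-l e
... | suc _ | inj₁ q = contradiction p (◁-asym (unsee (lr q (subst (0 <_) (sym e) (s≤s z≤n)))))
... | suc _ | inj₂ q = rl q

root : ∀ t → Point t
root leaf = source
root (node t₁ j t₂) = right (root t₂)

place-root : ∀ t → place (root t) ≡ 0
place-root leaf = refl
place-root (node t₁ j t₂) = right-root {t₁} {j} (root t₂) (place-root t₂)

at : ∀ {t} n → n < size t → Σ[ x ∈ Point t ] place x ≡ n
at {leaf} zero _ = source , refl
at {leaf} (suc zero)    _ = target , refl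
at {leaf} (suc (suc n)) (s≤s (s≤s ()))
at {t}    zero _ = root t , place-root t
at {node t₁ j t₂} (suc n) lt with <-≤-connex n (slotOf t₁ j)
... | inj₁ p = let (x , e) = at {t₁} n (<-trans p (proj₂ (slotOf-range t₁ j))) in
  left x , trans (left-below {t₁} {j} {t₂} x (subst (_< slotOf t₁ j) (sym e) p)) (cong suc e)
... | inj₂ p with <-≤-connex (suc n) (slotOf t₁ j + size t₂)
...   | inj₁ q = let (y , e) = at {t₂} (suc n ∸ slotOf t₁ j) (subst (suc n ∸ slotOf t₁ j <_) (m+n∸m≡n (slotOf t₁ j) (size t₂)) (ℕP.∸-monoˡ-< q (m≤n⇒m≤1+n p))) in
  right y , trans (right-inside {t₁} {j} {t₂} y (subst (0 <_) (sym e) (ℕP.m<n⇒0<n∸m (s≤s p)))) (trans (cong (_+_ (slotOf t₁ j)) e) (m+[n∸m]≡n (m≤n⇒m≤1+n p)))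
...   | inj₂ q = let (x , e) = at {t₁} (suc n ∸ size t₂) (+-cancelʳ-< (size t₂) _ _ (subst (_< size t₁ + size t₂) (sym n≡) lt)) in
  left x , trans (left-above {t₁} {j} {t₂} x (subst (slotOf t₁ j ≤_) (sym e) (ℕP.+-cancelʳ-≤ (size t₂) _ _ (subst (slotOf t₁ j + size t₂ ≤_) (sym n≡) q)))) (trans (cong (λ m → m + size t₂) e) n≡)
  where
  n≡ : suc n ∸ size t₂ + size t₂ ≡ suc n
  n≡ = m∸n+n≡m (≤-trans (m≤n+m (size t₂) (slotOf t₁ j)) q)

-- The chords of a top cycle after its first two chords, each chord f being
-- the right neighbour of the previous chord e but of no earlier one; the
-- cycle closes with the first chord having its sink past that of the long chord.
data Chain {A : Set} (_≪_ : A → A → Set) (α : A → A) (Past Before : A → Set) : A → A → Set where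
  end  : ∀ {lo e} → Past (α e) → Chain _≪_ α Past Before lo e
  step : ∀ {lo e} f → Before (α e) → lo ≪ f → f ≪ α e → α e ≪ α f → Chain _≪_ α Past Before (α e) f → Chain _≪_ α Past Before lo e

-- The first link has its lower bound as a predicate, because in `Blocked` the sink of the first
-- chord is not a point but only a gap `p`.
data Start {A : Set} (_≪_ : A → A → Set) (α : A → A) (Lo Past Before : A → Set) : A → Set where
  end  : ∀ {e} → Past (α e) → Start _≪_ α Lo Past Before e
  step : ∀ {e} f → Before (α e) → Lo f → f ≪ α e → α e ≪ α f → Chain _≪_ α Past Before (α e) f → Start _≪_ α Lo Past Before e

-- In the top cycle of size `m` the chord of `c` is (1, 4), that of `d` is the long chord (2, 2m -
-- 1) and that of `e` is (3, 6); `rest` consists of the remaining short chords. For size 3 it is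
-- empty, and the sink of `e` is already past that of `d`.
record HasTopCycle {A : Set} (_≪_ : A → A → Set) (α : A → A) : Set where
  constructor topCycle
  field
    c d e : A
    c≪d   : c ≪ d
    d≪e   : d ≪ e
    e≪αc  : e ≪ α c
    αc≪αd : α c ≪ α d
    rest  : Start _≪_ α (α c ≪_) (α d ≪_) (_≪ α d) e

module _ {A B : Set} {_≪_ : A → A → Set} {α : A → A} {_≪′_ : B → B → Set} {β : B → B}
  (g : A → B) (mono : ∀ {x y} → x ≪ y → g x ≪′ g y) (hom : ∀ x → g (α x) ≡ β (g x)) where

  chain-map : ∀ {P Q : A → Set} {P′ Q′ : B → Set} → (∀ {x} → P x → P′ (g x)) → (∀ {x} → Q x → Q′ (g x)) →
    ∀ {lo e} → Chain _≪_ α P Q lo e → Chain _≪′_ β P′ Q′ (g lo) (g e)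
  chain-map {P′ = P′} p q {e = e} (end x) = end (subst P′ (hom e) (p x))
  chain-map {Q′ = Q′} p q {e = e} (step f b l u v r) = step (g f) (subst Q′ (hom e) (q b)) (mono l) (subst (g f ≪′_) (hom e) (mono u))
    (subst₂ _≪′_ (hom e) (hom f) (mono v)) (subst (λ z → Chain _≪′_ β _ _ z (g f)) (hom e) (chain-map p q r))

  start-map : ∀ {L P Q : A → Set} {L′ P′ Q′ : B → Set} → (∀ {x} → L x → L′ (g x)) → (∀ {x} → P x → P′ (g x)) → (∀ {x} → Q x → Q′ (g x)) →
    ∀ {e} → Start _≪_ α L P Q e → Start _≪′_ β L′ P′ Q′ (g e)
  start-map {P′ = P′} k p q {e} (end x) = end (subst P′ (hom e) (p x))
  start-map {Q′ = Q′} k p q {e} (step f b l u v r) = step (g f) (subst Q′ (hom e) (q b)) (k l) (subst (g f ≪′_) (hom e) (mono u))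
    (subst₂ _≪′_ (hom e) (hom f) (mono v)) (subst (λ z → Chain _≪′_ β _ _ z (g f)) (hom e) (chain-map p q r))

  topCycle-map : HasTopCycle _≪_ α → HasTopCycle _≪′_ β
  topCycle-map (topCycle c d e p q r s t) = topCycle (g c) (g d) (g e) (mono p) (mono q) (subst (g e ≪′_) (hom c) (mono r)) (subst₂ _≪′_ (hom c) (hom d) (mono s))
    (start-map (λ {x} l → subst (_≪′ g x) (hom c) (mono l)) (λ {x} l → subst (_≪′ g x) (hom d) (mono l)) (λ {x} l → subst (g x ≪′_) (hom d) (mono l)) t)

module _ {A : Set} {_≪_ : A → A → Set} {α : A → A} {P Q : A → Set} where
  chain-end : ∀ {lo e} → Chain _≪_ α P Q lo e → Σ[ f ∈ A ] P f
  chain-end {e = e} (end x)    = α e , x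
  chain-end (step _ _ _ _ _ r) = chain-end r

  start-end : ∀ {L e} → Start _≪_ α L P Q e → Σ[ f ∈ A ] P f
  start-end {e = e} (end x)    = α e , x
  start-end (step _ _ _ _ _ r) = chain-end r

-- The cycle through a root chord whose sink is inserted at p.
record Blocked t (p : ℕ) : Set where
  constructor blocked
  field
    d e  : Point t
    d◁e  : d ◁ e
    e<p  : place e < p
    p≤αd : p ≤ place (other d)
    rest : Start _◁_ other (λ f → p ≤ place f) (other d ◁_) (_◁ other d) e

blocked-beyond : ∀ {t p} {P Q : Point t → Set} {e} → (∀ {x} → P x → p ≤ place x) →
  Start _◁_ other (λ f → p ≤ place f) P Q e → p ≤ place (other e)
blocked-beyond k (end x) = k x
blocked-beyond k (step f _ l u _ _) = ≤-trans l (<⇒≤ (places u))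

rootSink>0 : ∀ t → 0 < place (other (root t))
rootSink>0 t = ℕP.n≢0⇒n>0 (λ d → other-≢ (root t) (place-injective (trans d (sym (place-root t)))))

-- In `unblocked-inner` this keeps the root chord of `t₂`, the only chord of `t₂` that crosses
-- chords of `t₁`, from serving as the long chord.
rootSink-below : ∀ t {n} → suc n < weight t → place (other (root t)) < slot t n
rootSink-below leaf (s≤s ())
rootSink-below (node t₁ j t₂) {n} lt with slotView {t₁} {j} {t₂} n (<-trans (n<1+n n) lt)
... | first d _ = contradiction d (<⇒≢ lt)
... | outer le e = subst₂ _<_ (sym (right-inside {t₁} {j} {t₂} b (rootSink>0 t₂))) (sym e) (+-mono-≤-< (slot-anti t₁ le (toℕ<n j)) (place-bound b))
  where b = other (root t₂)
... | inner k d lt′ e = subst₂ _<_ (sym (right-inside {t₁} {j} {t₂} b (rootSink>0 t₂))) (sym e) (+-monoʳ-< (slotOf t₁ j) (rootSink-below t₂ lt′))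
  where b = other (root t₂)

module _ {t₁ : Tree} {j : Fin (weight t₁)} {t₂ : Tree} where
  private
    N : Set
    N = Point (node t₁ j t₂)
    c = slotOf t₁ j
    l : Point t₁ → N
    l = left
    r : Point t₂ → N
    r = right

  -- Apart from its first point, the second diagram lies in a single gap of the first one, so the
  -- two cannot alternate; in `rlr⁻` only that first point can begin an alternation.
  lrl⁻ : ∀ {x y x′ y′} → l x ◁ r y → r y ◁ l x′ → ¬ (l x′ ◁ r y′)
  lrl⁻ p q s with see p | see q | see s
  ... | lr _ y>0 | root-l y≡0 | _ = <⇒≢ y>0 (sym y≡0)
  ... | lr _ _   | rl c≤ | lr x< _ = <⇒≱ x< c≤

  rlr⁻ : ∀ {y x y′ x′} → r y ◁ l x → l x ◁ r y′ → r y′ ◁ l x′ → place y ≡ 0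
  rlr⁻ p q s with see p | see q
  ... | root-l e | _ = e
  ... | rl c≤    | lr x< _ = contradiction c≤ (<⇒≱ x<)

  -- A link in the other part would start between two points of `t₁` and end behind them, an
  -- alternation that `lrl⁻` forbids.
  left-chain : ∀ {P Q : N → Set} {lo e} → Chain _◁_ other P Q (l lo) (l e) → Chain _◁_ other (P ∘ l) (Q ∘ l) lo e
  left-chain (end x) = end x
  left-chain (step (left f) b p u v k)  = step f b (ll⁻ p) (ll⁻ u) (ll⁻ v) (left-chain k)
  left-chain (step (right f) b p u v k) = contradiction v (lrl⁻ p u)

  left-start : ∀ {L P Q : N → Set} {e} → (∀ {y} → L (r y) → 0 < place y) → Start _◁_ other L P Q (l e) → Start _◁_ other (L ∘ l) (P ∘ l) (Q ∘ l) e
  left-start h (end x) = end x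
  left-start h (step (left f) b p u v k)  = step f b p (ll⁻ u) (ll⁻ v) (left-chain k)
  left-start h (step (right f) b p u v k) with see u | see v
  ... | root-l e | _ = contradiction e (>⇒≢ (h p))
  ... | rl c≤    | lr x< _ = contradiction c≤ (<⇒≱ x<)

  right-chain : ∀ {P Q : N → Set} {lo e} → 0 < place lo → Chain _◁_ other P Q (r lo) (r e) → Chain _◁_ other (P ∘ r) (Q ∘ r) lo e
  right-chain h (end x) = end x
  right-chain h (step (right f) b p u v k) = step f b (rr⁻ p) (rr⁻ u) (rr⁻ v) (right-chain (≤-<-trans z≤n (places (rr⁻ u))) k)
  right-chain h (step (left f) b p u v k)  = contradiction (rlr⁻ p u v) (>⇒≢ h)

  right-start : ∀ {L P Q : N → Set} {e} → (∀ {x} → L (l x) → c ≤ place x) → Start _◁_ other L P Q (r e) → Start _◁_ other (L ∘ r) (P ∘ r) (Q ∘ r) e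
  right-start h (end x) = end x
  right-start h (step (right f) b p u v k) = step f b p (rr⁻ u) (rr⁻ v) (right-chain (≤-<-trans z≤n (places (rr⁻ u))) k)
  right-start h (step (left f) b p u v k) with see u
  ... | lr x< _ = contradiction (h p) (<⇒≱ x<)

  left-place-< : ∀ {s} x → c ≤ s → place (l x) < s + size t₂ → place x < s
  left-place-< {s} x c≤s lt with <-≤-connex (place x) c
  ... | inj₁ p = <-≤-trans p c≤s
  ... | inj₂ p = +-cancelʳ-< (size t₂) _ _ (subst (_< s + size t₂) (left-above {t₁} {j} {t₂} x p) lt)

  left-place-≥ : ∀ {s} x → c ≤ s → s + size t₂ ≤ place (l x) → s ≤ place x
  left-place-≥ {s} x c≤s le with <-≤-connex (place x) c
  ... | inj₁ p = contradiction (≤-trans le (≤-reflexive (left-below {t₁} {j} {t₂} x p))) (<⇒≱ (≤-<-trans p (≤-<-trans c≤s (m<m+n s (<-trans (n<1+n 0) (size>0 t₂))))))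
  ... | inj₂ p = ℕP.+-cancelʳ-≤ (size t₂) _ _ (subst (s + size t₂ ≤_) (left-above {t₁} {j} {t₂} x p) le)

  right-≤ : ∀ y → place (r y) ≤ c + place y
  right-≤ y with place y
  ... | zero  = z≤n
  ... | suc _ = ≤-refl

  right-place-≱ : ∀ {s} y → c ≤ s → ¬ (s + size t₂ ≤ place (r y))
  right-place-≱ {s} y c≤s le = <⇒≱ (+-mono-≤-< c≤s (place-bound y)) (≤-trans le (right-≤ y))

  inner-left-< : ∀ {s} x → s ≤ size t₂ → place (l x) < c + s → place x < c
  inner-left-< {s} x le lt = ≰⇒> λ p → <⇒≱ lt (subst (c + s ≤_) (sym (left-above {t₁} {j} {t₂} x p)) (ℕP.+-mono-≤ p le))

  inner-left-≥ : ∀ {s} x → 0 < s → c + s ≤ place (l x) → c ≤ place x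
  inner-left-≥ {s} x s>0 le = ≮⇒≥ λ p → <⇒≱ (≤-<-trans p (m<m+n c s>0)) (subst (c + s ≤_) (left-below {t₁} {j} {t₂} x p) le)

  inner-right-< : ∀ {s} y → 0 < s → place (r y) < c + s → place y < s
  inner-right-< {s} y s>0 lt with place y
  ... | zero  = s>0
  ... | suc n = +-cancelˡ-< c _ _ lt

  inner-right-≥ : ∀ {s} y → c + s ≤ place (r y) → s ≤ place y
  inner-right-≥ {s} y le = ℕP.+-cancelˡ-≤ c _ _ (≤-trans le (right-≤ y))

  unblocked-outer : ∀ {s} → c ≤ s → ¬ Blocked t₁ s → ¬ Blocked (node t₁ j t₂) (s + size t₂)
  unblocked-outer c≤s h (blocked (right d) e d◁e e<p p≤αd rest) = right-place-≱ (other d) c≤s p≤αd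
  unblocked-outer c≤s h (blocked (left d) (right e) d◁e e<p p≤αd rest) =
    right-place-≱ (other e) c≤s (blocked-beyond (λ q → ≤-trans p≤αd (<⇒≤ (places q))) rest)
  unblocked-outer {s} c≤s h (blocked (left d) (left e) d◁e e<p p≤αd rest) = h (blocked d e (ll⁻ d◁e) (left-place-< e c≤s e<p) (left-place-≥ (other d) c≤s p≤αd)
    (start-map id id (λ _ → refl) (λ {x} → left-place-≥ x c≤s) ll⁻ ll⁻ (left-start (λ {y} p → contradiction p (right-place-≱ y c≤s)) rest)))

  unblocked-inner : ∀ {s} → 0 < s → s ≤ size t₂ → place (other (root t₂)) < s → ¬ Blocked t₁ c → ¬ Blocked t₂ s → ¬ Blocked (node t₁ j t₂) (c + s)
  unblocked-inner {s} s>0 s≤ b<s h₁ h₂ (blocked (left d) (left e) d◁e e<p p≤αd rest) = h₁ (blocked d e (ll⁻ d◁e) (inner-left-< e s≤ e<p) (inner-left-≥ (other d) s>0 p≤αd)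
    (start-map id id (λ _ → refl) (λ {x} → inner-left-≥ x s>0) ll⁻ ll⁻ (left-start (λ {y} p → <-≤-trans s>0 (inner-right-≥ y p)) rest)))
  unblocked-inner {s} s>0 s≤ b<s h₁ h₂ (blocked (left d) (right e) d◁e e<p p≤αd rest) with start-end (right-start (λ {x} → inner-left-≥ x s>0) rest)
  ... | f , lt with see lt
  ...   | lr x< _ = <⇒≱ x< (inner-left-≥ (other d) s>0 p≤αd)
  unblocked-inner {s} s>0 s≤ b<s h₁ h₂ (blocked (right d) (left e) d◁e e<p p≤αd rest) with see d◁e
  ... | root-l e₀ = <⇒≱ b<s (inner-right-≥ (other (root t₂)) (subst (λ y → c + s ≤ place (r (other y))) (place-injective {x = d} {root t₂} (trans e₀ (sym (place-root t₂)))) p≤αd))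
  ... | rl c≤     = <⇒≱ (inner-left-< e s≤ e<p) c≤
  unblocked-inner {s} s>0 s≤ b<s h₁ h₂ (blocked (right d) (right e) d◁e e<p p≤αd rest) = h₂ (blocked d e (rr⁻ d◁e) (inner-right-< e s>0 e<p) (inner-right-≥ (other d) p≤αd)
    (start-map id id (λ _ → refl) (λ {y} → inner-right-≥ y) rr⁻ rr⁻ (right-start (λ {x} → inner-left-≥ x s>0) rest)))

  -- If a top cycle uses both parts, alternation forces its first chord to be the root chord and all
  -- others to belong to `t₁`. They then block the slot that contains the sink of the root chord.
  topCycle-node : ¬ Blocked t₁ c → ¬ HasTopCycle (_◁_ {t₁}) other → ¬ HasTopCycle (_◁_ {t₂}) other → ¬ HasTopCycle (_◁_ {node t₁ j t₂}) other
  topCycle-node h h₁ h₂ (topCycle (left c) (right d) e p q u v s) = lrl⁻ p (◁-trans q u) v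
  topCycle-node h h₁ h₂ (topCycle (left c) (left d) (right e) p q u v s) = lrl⁻ (◁-trans p q) u (beyond s)
    where
    beyond : Start _◁_ other (l (other c) ◁_) (l (other d) ◁_) (_◁ l (other d)) (r e) → l (other c) ◁ r (other e)
    beyond (end x) = ◁-trans v x
    beyond (step _ _ a b _ _) = ◁-trans a b
  topCycle-node h h₁ h₂ (topCycle (left c) (left d) (left e) p q u v s) = h₁ (topCycle c d e (ll⁻ p) (ll⁻ q) (ll⁻ u) (ll⁻ v)
    (start-map id id (λ _ → refl) ll⁻ ll⁻ ll⁻ (left-start (λ a → case see a of λ { (lr _ y>0) → y>0 }) s)))
  topCycle-node h h₁ h₂ (topCycle (right c) (right d) (right e) p q u v s) = h₂ (topCycle c d e (rr⁻ p) (rr⁻ q) (rr⁻ u) (rr⁻ v)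
    (start-map id id (λ _ → refl) rr⁻ rr⁻ rr⁻ (right-start (λ a → case see a of λ
      { (rl c≤) → c≤ ; (root-l e₀) → contradiction e₀ (>⇒≢ (≤-<-trans z≤n (places (rr⁻ u)))) }) s)))
  topCycle-node h h₁ h₂ (topCycle (right c) (right d) (left e) p q u v s) with see q | see u
  ... | root-l e₀ | _ = <⇒≢ (≤-<-trans z≤n (places (rr⁻ p))) (sym e₀)
  ... | rl c≤     | lr x< _ = <⇒≱ x< c≤
  topCycle-node h h₁ h₂ (topCycle (right c) (left d) (right e) p q u v s) with see p | see q | see v
  ... | rl c≤    | lr x< _ | _ = <⇒≱ x< c≤
  ... | _ | _ | root-l e₀ = <⇒≢ (≤-<-trans z≤n (places (rr⁻ u))) (sym e₀)
  ... | root-l _ | _ | rl c≤ with start-end (right-start (λ a → case see a of λ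
      { (rl c≤) → c≤ ; (root-l e₀) → contradiction e₀ (>⇒≢ (≤-<-trans z≤n (places (rr⁻ u)))) }) s)
  ...   | f , lt with see lt
  ...     | lr x< _ = <⇒≱ x< c≤
  topCycle-node h h₁ h₂ (topCycle (right c) (left d) (left e) p q u v s) with see u | see v
  ... | lr _ b>0  | root-l e₀ = <⇒≢ b>0 (sym e₀)
  ... | lr e< b>0 | rl c≤     = h (blocked d e (ll⁻ q) e< c≤ (start-map id id (λ _ → refl)
      (λ a → case see a of λ { (rl c≤) → c≤ ; (root-l e₀) → contradiction e₀ (>⇒≢ b>0) }) ll⁻ ll⁻
      (left-start (λ a → ≤-<-trans z≤n (places (rr⁻ a))) s)))

unblocked : ∀ t {n} → n < weight t → ¬ Blocked t (slot t n)
unblocked leaf lt (blocked source source d◁e e<p p≤αd rest) = ◁-irrefl d◁e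
unblocked leaf lt (blocked d target d◁e (s≤s ()) p≤αd rest)
unblocked leaf lt (blocked target source d◁e e<p p≤αd rest) = contradiction p≤αd λ ()
unblocked (node t₁ j t₂) {n} lt with slotView {t₁} {j} {t₂} n lt
... | outer le e = subst (λ p → ¬ Blocked (node t₁ j t₂) p) (sym e) (unblocked-outer (slot-anti t₁ le (toℕ<n j)) (unblocked t₁ (≤-<-trans le (toℕ<n j))))
-- Before the first slot there is only one point, but a blocking pattern needs two.
... | first _ e = λ { (blocked d x d◁e e<p p≤αd rest) → <⇒≱ (≤-<-trans z≤n (places d◁e)) (≤-pred (subst (place x <_) e e<p)) }
... | inner k _ lt′ e = subst (λ p → ¬ Blocked (node t₁ j t₂) p) (sym e) (unblocked-inner (proj₁ range) (<⇒≤ (proj₂ range)) (rootSink-below t₂ lt′) (unblocked t₁ (toℕ<n j)) (unblocked t₂ k<w))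
  where
  k<w = <-trans (n<1+n k) lt′
  range = slot-range t₂ k<w

no-topCycle : ∀ t → ¬ HasTopCycle (_◁_ {t}) other
no-topCycle leaf (topCycle source target source p q u v s) = ◁-asym p q
no-topCycle leaf (topCycle source target target p q u v s) = ◁-irrefl q
no-topCycle leaf (topCycle source source e p q u v s) = ◁-irrefl p
no-topCycle leaf (topCycle target target e p q u v s) = ◁-irrefl p
no-topCycle leaf (topCycle target source e ⟪ () ⟫ q u v s)
no-topCycle (node t₁ j t₂) = topCycle-node (unblocked t₁ (toℕ<n j)) (no-topCycle t₁) (no-topCycle t₂)

-- Completeness of the slots

module _ {t₁ : Tree} {j : Fin (weight t₁)} {t₂ : Tree} where
  private
    c = slotOf t₁ j
    N = Point (node t₁ j t₂)
    l : Point t₁ → N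
    l = left
    r : Point t₂ → N
    r = right

  outer-< : ∀ {s} x → c ≤ s → place x < s → place (l x) < s + size t₂
  outer-< {s} x c≤s lt with <-≤-connex (place x) c
  ... | inj₁ p = subst (_< s + size t₂) (sym (left-below {t₁} {j} {t₂} x p)) (≤-<-trans lt (m<m+n s (<-trans (n<1+n 0) (size>0 t₂))))
  ... | inj₂ p = subst (_< s + size t₂) (sym (left-above {t₁} {j} {t₂} x p)) (+-monoˡ-< (size t₂) lt)

  outer-≥ : ∀ {s} x → c ≤ s → s ≤ place x → s + size t₂ ≤ place (l x)
  outer-≥ {s} x c≤s le = subst (s + size t₂ ≤_) (sym (left-above {t₁} {j} {t₂} x (≤-trans c≤s le))) (+-monoˡ-≤ (size t₂) le)

  inner-< : ∀ {s} y → place y < s → place (r y) < c + s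
  inner-< y lt = ≤-<-trans (right-≤ {t₁} {j} {t₂} y) (+-monoʳ-< c lt)

  inner-≥ : ∀ {s} y → 0 < s → s ≤ place y → c + s ≤ place (r y)
  inner-≥ {s} y s>0 le = subst (c + s ≤_) (sym (right-inside {t₁} {j} {t₂} y (<-≤-trans s>0 le))) (+-monoʳ-≤ c le)

-- The gaps in front of, inside and behind the inserted block. `front` includes the gap just before
-- the block, which was the first slot of `t₂`: it becomes blocked, and the first gap of the node
-- takes its place in `slot`.
data Region (t₁ : Tree) (j : Fin (weight t₁)) (t₂ : Tree) (p : ℕ) : Set where
  front  : p ≤ suc (slotOf t₁ j) → Region t₁ j t₂ p
  inside : ∀ s → p ≡ slotOf t₁ j + s → 1 < s → s < size t₂ → Region t₁ j t₂ p
  back   : ∀ s → p ≡ s + size t₂ → slotOf t₁ j ≤ s → s < size t₁ → Region t₁ j t₂ p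

region : ∀ t₁ (j : Fin (weight t₁)) t₂ p → p < size t₁ + size t₂ → Region t₁ j t₂ p
region t₁ j t₂ p p< with <-≤-connex (suc (slotOf t₁ j)) p | <-≤-connex p (slotOf t₁ j + size t₂)
... | inj₂ le | _ = front le
... | inj₁ lt | inj₁ lt′ = inside (p ∸ c) (sym p≡) (+-cancelˡ-< c _ _ (subst₂ _<_ (sym (ℕP.+-comm c 1)) (sym p≡) lt)) (+-cancelˡ-< c _ _ (subst (_< c + size t₂) (sym p≡) lt′))
  where
  c = slotOf t₁ j
  p≡ : c + (p ∸ c) ≡ p
  p≡ = m+[n∸m]≡n (≤-trans (n≤1+n c) (<⇒≤ lt))
... | inj₁ lt | inj₂ le  = back (p ∸ size t₂) (sym p≡) (ℕP.+-cancelʳ-≤ (size t₂) _ _ (subst (slotOf t₁ j + size t₂ ≤_) (sym p≡) le)) (+-cancelʳ-< (size t₂) _ _ (subst (_< size t₁ + size t₂) (sym p≡) p<))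
  where
  p≡ : p ∸ size t₂ + size t₂ ≡ p
  p≡ = m∸n+n≡m (≤-trans (m≤n+m (size t₂) (slotOf t₁ j)) le)

module _ {t₁ : Tree} {j : Fin (weight t₁)} {t₂ : Tree} where
  rootSink-place : suc (slotOf t₁ j) ≤ place (right {t₁} {j} (other (root t₂)))
  rootSink-place = subst (suc (slotOf t₁ j) ≤_) (sym (right-inside {t₁} {j} {t₂} (other (root t₂)) (rootSink>0 t₂))) (m<m+n (slotOf t₁ j) (rootSink>0 t₂))

same-other : ∀ {t} (x y : Point t) → place x ≡ place y → place (other x) ≡ place (other y)
same-other x y e = cong (place ∘ other) (place-injective {x = x} {y} e)

-- Connectedness in the form needed here: no gap separates the diagram. In front of the block the
-- root chord spans the gap, elsewhere a chord of the part to which the gap belongs.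
spanned : ∀ t p → 0 < p → p < size t → Σ[ x ∈ Point t ] place x < p × p ≤ place (other x)
spanned leaf p p>0 p< = source , p>0 , ≤-pred p<
spanned (node t₁ j t₂) p p>0 p< with region t₁ j t₂ p p<
... | front le = right (root t₂) , subst (_< p) (sym (right-root {t₁} {j} (root t₂) (place-root t₂))) p>0 , ≤-trans le (rootSink-place {t₁} {j} {t₂})
... | inside s refl s>1 s< = let (y , a , b) = spanned t₂ s (<-trans (n<1+n 0) s>1) s< in
  right y , inner-< {t₁} {j} {t₂} y a , inner-≥ {t₁} {j} {t₂} (other y) (<-trans (n<1+n 0) s>1) b
... | back s refl c≤s s< = let (x , a , b) = spanned t₁ s (<-≤-trans (proj₁ (slotOf-range t₁ j)) c≤s) s< in left x , outer-< {t₁} {j} {t₂} x c≤s a , outer-≥ {t₁} {j} {t₂} (other x) c≤s b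

Dominates : ∀ {t} → ℕ → Point t → Set
Dominates {t} p x = ∀ (y : Point t) → place y < p → place (other y) ≤ place (other x)

dominating : ∀ t {p} → 0 < p → p ≤ size t → Σ[ x ∈ Point t ] place x < p × Dominates p x
dominating t {suc zero} _ p≤ = root t , subst (_< 1) (sym (place-root t)) (s≤s z≤n) ,
  λ y lt → ≤-reflexive (same-other y (root t) (trans (ℕP.n<1⇒n≡0 lt) (sym (place-root t))))
dominating t {suc (suc p)} _ p≤ with dominating t {suc p} (s≤s z≤n) (<⇒≤ p≤) | at {t} (suc p) p≤
... | x , lt , dom | z , e with ℕP.≤-total (place (other x)) (place (other z))
...   | inj₁ le = z , ≤-reflexive (cong suc e) , λ y y< → [ (λ l → ≤-trans (dom y l) le) , (λ d → ≤-reflexive (same-other y z (trans d (sym e)))) ]′ (m≤n⇒m<n∨m≡n (≤-pred y<))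
...   | inj₂ le = x , ℕP.m<n⇒m<1+n lt , λ y y< → [ dom y , (λ d → ≤-trans (≤-reflexive (same-other y z (trans d (sym e)))) le) ]′ (m≤n⇒m<n∨m≡n (≤-pred y<))

dominating-spans : ∀ t {p} {x : Point t} → 0 < p → p < size t → Dominates p x → p ≤ place (other x)
dominating-spans t {p} p>0 p< dom = let (y , a , b) = spanned t p p>0 p< in ≤-trans b (dom y a)

-- Following the chords with the farthest sinks.
module Greedy t {q} (q< : q < size t) where
  Continuation : ℕ → Point t → Set
  Continuation p e = Σ[ f ∈ Point t ] p ≤ place f × f ◁ other e × other e ◁ other f × Dominates (suc (place (other e))) f

  continue : ∀ {p e} → p ≤ size t → place e < p → Dominates p e → place (other e) < q → Continuation p e
  continue {p} {e} p≤ e<p dom lt with dominating t {suc (place (other e))} (s≤s z≤n) (<-trans lt q<)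
  ... | f , f≤ , domf = f , p≤f , ⟪ ≤∧≢⇒< (≤-pred f≤) f≢ ⟫ , ⟪ further ⟫ , domf
    where
    further : place (other e) < place (other f)
    further = dominating-spans t {x = f} (s≤s z≤n) (≤-<-trans lt q<) domf
    -- A chord starting before `p` would not reach beyond the sink of `e`, by the choice of `e` as
    -- farthest.
    p≤f : p ≤ place f
    p≤f = ≮⇒≥ (λ f<p → <⇒≱ further (dom f f<p))
    f≢ : place f ≢ place (other e)
    f≢ d = <-asym (<-≤-trans e<p (subst (p ≤_) d p≤f))
      (subst (place (other e) <_) (trans (same-other f (other e) d) (cong place (other-inv e))) further)

  go : ∀ n {lo e} → q ≤ n + place (other e) → place e ≤ place lo → Dominates (suc (place lo)) e → Chain _◁_ other (λ z → q ≤ place z) (λ z → place z < q) lo e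
  go n {lo} {e} le e≤ dom with <-≤-connex (place (other e)) q
  go n le e≤ dom | inj₂ past = end past
  go zero    le e≤ dom | inj₁ lt   = contradiction le (<⇒≱ lt)
  go (suc n) {lo} {e} le e≤ dom | inj₁ lt with continue {suc (place lo)} (place-bound lo) (s≤s e≤) dom lt
  ... | f , p , u , v , domf = step f lt ⟪ p ⟫ u v (go n (≤-trans le (subst (_≤ n + place (other f)) (+-suc n _) (+-monoʳ-≤ n (places v)))) (<⇒≤ (places u)) domf)

  chain : ∀ {p} → 0 < p → p ≤ q → Σ[ e ∈ Point t ] place e < p × Start _◁_ other (λ f → p ≤ place f) (λ z → q ≤ place z) (λ z → place z < q) e
  chain {p} p>0 p≤q with dominating t p>0 (≤-trans p≤q (<⇒≤ q<))
  ... | e , e<p , dom = e , e<p , start (<-≤-connex (place (other e)) q)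
    where
    start : place (other e) < q ⊎ q ≤ place (other e) → Start _◁_ other (λ f → p ≤ place f) (λ z → q ≤ place z) (λ z → place z < q) e
    start (inj₂ past) = end past
    start (inj₁ lt) with continue (≤-trans p≤q (<⇒≤ q<)) e<p dom lt
    ... | f , le , u , v , domf = step f lt le u v (go q (m≤m+n q _) (<⇒≤ (places u)) domf)

module _ {t₁ : Tree} {j : Fin (weight t₁)} {t₂ : Tree} where
  private
    c = slotOf t₁ j
    N = Point (node t₁ j t₂)
    l : Point t₁ → N
    l = left
    r : Point t₂ → N
    r = right

  -- The long chord `d` is the root chord of `t₂`, whose sink lies in the block behind the slot `c`.
  -- The short chords are the greedy ones of `t₁`, leading from before the gap past `c`.
  blocked-front : ∀ {p} → 1 < p → p ≤ suc c → Blocked (node t₁ j t₂) p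
  blocked-front {suc p} (s≤s p>0) (s≤s p≤c) with Greedy.chain t₁ (proj₂ (slotOf-range t₁ j)) p>0 p≤c
  ... | e , e<p , s = blocked (r (root t₂)) (l e) (unsee (root-l (place-root t₂)))
      (subst (_< suc p) (sym (left-below {t₁} {j} {t₂} e (<-≤-trans e<p p≤c))) (s≤s e<p)) (≤-trans (s≤s p≤c) (rootSink-place {t₁} {j} {t₂}))
      (start-map l (λ q → unsee (ll q)) (λ _ → refl) (λ {x} → low x) (λ q → unsee (rl q)) (λ q → unsee (lr q (rootSink>0 t₂))) s)
    where
    low : ∀ x → p ≤ place x → suc p ≤ place (l x)
    low x le with <-≤-connex (place x) c
    ... | inj₁ lt  = subst (suc p ≤_) (sym (left-below {t₁} {j} {t₂} x lt)) (s≤s le)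
    ... | inj₂ c≤ = subst (suc p ≤_) (sym (left-above {t₁} {j} {t₂} x c≤)) (subst (suc p ≤_) (ℕP.+-comm (size t₂) (place x)) (ℕP.+-mono-≤ (<⇒≤ (size>0 t₂)) le))

  blocked-inside : ∀ {s} → 0 < s → Blocked t₂ s → Blocked (node t₁ j t₂) (c + s)
  blocked-inside s>0 (blocked d e p q u s) = blocked (r d) (r e) (unsee (rr p)) (inner-< {t₁} {j} {t₂} e q) (inner-≥ {t₁} {j} {t₂} (other d) s>0 u)
    (start-map r (λ q → unsee (rr q)) (λ _ → refl) (λ {x} → inner-≥ {t₁} {j} {t₂} x s>0) (λ q → unsee (rr q)) (λ q → unsee (rr q)) s)

  blocked-back : ∀ {s} → c ≤ s → Blocked t₁ s → Blocked (node t₁ j t₂) (s + size t₂)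
  blocked-back c≤s (blocked d e p q u s) = blocked (l d) (l e) (unsee (ll p)) (outer-< {t₁} {j} {t₂} e c≤s q) (outer-≥ {t₁} {j} {t₂} (other d) c≤s u)
    (start-map l (λ q → unsee (ll q)) (λ _ → refl) (λ {x} → outer-≥ {t₁} {j} {t₂} x c≤s) (λ q → unsee (ll q)) (λ q → unsee (ll q)) s)

-- The converse of `unblocked`. In the encoding it turns the gap in which the sink of the root chord
-- lies into a place of the tree.
slot-complete : ∀ t p → 0 < p → p < size t → ¬ Blocked t p → Σ[ n ∈ ℕ ] n < weight t × slot t n ≡ p
slot-complete leaf p p>0 p< _ = 0 , s≤s z≤n , ≤-antisym p>0 (≤-pred p<)
slot-complete (node t₁ j t₂) p p>0 p< free with region t₁ j t₂ p p<
... | front le with m≤n⇒m<n∨m≡n p>0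
...   | inj₁ p>1  = contradiction (blocked-front p>1 le) free
...   | inj₂ refl = let (n , e) = last-place (node t₁ j t₂) in n , ≤-reflexive e , slot-first (node t₁ j t₂) e
slot-complete (node t₁ j t₂) p p>0 p< free | inside s refl s>1 s<
  with slot-complete t₂ s (<-trans (n<1+n 0) s>1) s< (λ b → free (blocked-inside (<-trans (n<1+n 0) s>1) b))
... | k , k< , e = suc (toℕ j) + k , +-monoʳ-< (suc (toℕ j)) k< ,
    trans (slot-inner {t₁} {j} {t₂} (≤∧≢⇒< k< (λ d → <⇒≢ s>1 (trans (sym (slot-first t₂ d)) e)))) (cong (_+_ (slotOf t₁ j)) e)
slot-complete (node t₁ j t₂) p p>0 p< free | back s refl c≤s s<
  with slot-complete t₁ s (<-≤-trans (proj₁ (slotOf-range t₁ j)) c≤s) s< (λ b → free (blocked-back c≤s b))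
... | n , n< , e = n , ≤-trans (s≤s n≤j) (m≤m+n _ (weight t₂)) , trans (slot-outer {t₁} {j} {t₂} n≤j) (cong (λ m → m + size t₂) e)
  where
  n≤j : n ≤ toℕ j
  n≤j = slot-anti⁻ t₁ n< (subst (slotOf t₁ j ≤_) (sym e) c≤s)

-- Connectedness and uniqueness of the tree of a diagram

data Linked {t} : Point t → Point t → Set where
  chord    : ∀ {x} → Linked x (other x)
  crossing : ∀ {x y} → x ◁ y → y ◁ other x → other x ◁ other y → Linked x y

linked-left : ∀ {t₁ j t₂} {x y : Point t₁} → Linked x y → Linked (left {t₁} {j} {t₂} x) (left y)
linked-left chord = chord
linked-left (crossing p q r) = crossing (unsee (ll p)) (unsee (ll q)) (unsee (ll r))

linked-right : ∀ {t₁ j t₂} {x y : Point t₂} → Linked x y → Linked (right {t₁} {j} {t₂} x) (right y)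
linked-right chord = chord
linked-right (crossing p q r) = crossing (unsee (rr p)) (unsee (rr q)) (unsee (rr r))

connected : ∀ t x → EqClosure (Linked {t}) (root t) x
connected leaf source = ε
connected leaf target = fwd chord ◅ ε
connected (node t₁ j t₂) (right y) = Eq.gmap right linked-right (connected t₂ y)
connected (node t₁ j t₂) (left x) with spanned t₁ (slotOf t₁ j) (proj₁ (slotOf-range t₁ j)) (proj₂ (slotOf-range t₁ j))
-- The root chord of the node crosses any chord of `t₁` that spans the slot.
... | z , z< , ≤αz = fwd (crossing (unsee (root-l (place-root t₂))) (unsee (lr z< (rootSink>0 t₂))) (unsee (rl ≤αz)))
  ◅ Eq.gmap left linked-left (Eq.symmetric _ (connected t₁ z) ◅◅ connected t₁ x)

point-predecessor : ∀ {t n} (x : Point t) → place x ≡ suc n → Σ[ y ∈ Point t ] place y ≡ n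
point-predecessor {t} {n} x e = at {t} n (<-trans (≤-reflexive (sym e)) (place-bound x))

open OrderIsomorphism Point _◁_ other place places ⟪_⟫ place-injective point-predecessor public
  using () renaming (Iso to PointIso; iso-sym to pointIso-sym; iso-index to pointIso-place; module Restrict to RestrictPoints; module Iso to PointIso)

module IsoNode {t₁ j t₂ t₁′ j′ t₂′} (S : PointIso (node t₁ j t₂) (node t₁′ j′ t₂′)) where
  open PointIso S

  φ-root : φ (right (root t₂)) ≡ right (root t₂′)
  φ-root = place-injective (trans (pointIso-place S _) (trans (place-root (node t₁ j t₂)) (sym (place-root (node t₁′ j′ t₂′)))))

  φ-rootSink : φ (right (other (root t₂))) ≡ right (other (root t₂′))
  φ-rootSink = trans (mates (right (root t₂))) (cong other φ-root)

  φ-second : φ (left (root t₁)) ≡ left (root t₁′)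
  φ-second = place-injective (trans (pointIso-place S _) (trans (second t₁ j t₂) (sym (second t₁′ j′ t₂′))))
    where
    second : ∀ t₁ (j : Fin (weight t₁)) t₂ → place (left {t₁} {j} {t₂} (root t₁)) ≡ 1
    second t₁ j t₂ = trans (left-below {t₁} {j} {t₂} (root t₁) (subst (_< slotOf t₁ j) (sym (place-root t₁)) (proj₁ (slotOf-range t₁ j)))) (cong suc (place-root t₁))

NonRoot : ∀ {t} → Point t → Point t → Set
NonRoot {t} x y = Linked x y × x ≢ root t × y ≢ root t

IsLeft : ∀ {t₁ j t₂} → Point (node t₁ j t₂) → Set
IsLeft {t₁} u = Σ[ x ∈ Point t₁ ] u ≡ left x

-- Only the root chord connects the two parts of a node.
nonRoot-left : ∀ {t₁ j t₂} {x y : Point (node t₁ j t₂)} → NonRoot x y → IsLeft x ⇔ IsLeft y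
nonRoot-left {x = left x}  (chord , _) = mk⇔ (λ _ → other x , refl) (λ _ → x , refl)
nonRoot-left {x = right y} (chord , _) = mk⇔ (λ { (_ , ()) }) (λ { (_ , ()) })
nonRoot-left {x = left x}  {left y}  (crossing p q r , _) = mk⇔ (λ _ → y , refl) (λ _ → x , refl)
nonRoot-left {x = right x} {right y} (crossing p q r , _) = mk⇔ (λ { (_ , ()) }) (λ { (_ , ()) })
nonRoot-left {x = left x}  {right y} (crossing p q r , _) = contradiction r (lrl⁻ p q)
nonRoot-left {t₁} {j} {t₂} {right y} {left x} (crossing p q r , ne , _) = contradiction (cong right (place-injective (trans (rlr⁻ p q r) (sym (place-root t₂))))) ne

module IsoLeft {t₁ j t₂ t₁′ j′ t₂′} (S : PointIso (node t₁ j t₂) (node t₁′ j′ t₂′)) where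
  open PointIso S
  open IsoNode S

  φ-linked : ∀ {x y} → NonRoot x y → NonRoot (φ x) (φ y)
  φ-linked (k , ne , ne′) = go k , moved ne , moved ne′
    where
    moved : ∀ {x} → x ≢ root _ → φ x ≢ root _
    moved {x} ne e = ne (trans (sym (ψφ x)) (trans (cong ψ (trans e (sym φ-root))) (ψφ _)))
    go : ∀ {x y} → Linked x y → Linked (φ x) (φ y)
    go {x} chord = subst (Linked (φ x)) (sym (mates x)) chord
    go {x} {y} (crossing p q r) = crossing (mono p) (subst (φ y ◁_) (mates x) (mono q)) (subst₂ _◁_ (mates x) (mates y) (mono r))

  -- The first subdiagram is recovered as what is connected to the second point of the diagram
  -- without using the first point. Both points are determined by the order.
  φ-left : ∀ x → IsLeft (φ (left x))
  φ-left x = closure-invariant IsLeft nonRoot-left (Eq.gmap φ φ-linked (Eq.gmap left (λ k → linked-left k , (λ ()) , (λ ())) (connected t₁ x))) (root t₁′ , φ-second)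

module _ {t₁ j t₂ t₁′ j′ t₂′} (S : PointIso (node t₁ j t₂) (node t₁′ j′ t₂′)) where
  open PointIso S
  private
    φ-right : ∀ {t₁ j t₂ t₁′ j′ t₂′} (S : PointIso (node t₁ j t₂) (node t₁′ j′ t₂′)) y → Σ[ y′ ∈ Point t₂′ ] PointIso.φ S (right y) ≡ right y′
    φ-right S y with PointIso.φ S (right y) in e
    ... | right y′ = y′ , refl
    ... | left x   = case trans (sym (PointIso.ψφ S (right y))) (trans (cong (PointIso.ψ S) e) (proj₂ (IsoLeft.φ-left (pointIso-sym S) x))) of λ ()

  left-iso : PointIso t₁ t₁′
  left-iso = RestrictPoints.restrict S left left (λ p → unsee (ll p)) ll⁻ (λ { refl → refl }) (λ { refl → refl }) (λ _ → refl) (λ _ → refl)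
    (IsoLeft.φ-left S) (IsoLeft.φ-left (pointIso-sym S))

  right-iso : PointIso t₂ t₂′
  right-iso = RestrictPoints.restrict S right right (λ p → unsee (rr p)) rr⁻ (λ { refl → refl }) (λ { refl → refl }) (λ _ → refl) (λ _ → refl)
    (φ-right S) (φ-right (pointIso-sym S))

  iso-slot : ∀ x → place x < slotOf t₁ j → place x < slotOf t₁′ j′
  iso-slot x lt = case see (subst₂ _◁_ (proj₂ (IsoLeft.φ-left S x)) (IsoNode.φ-rootSink S) (mono {left x} {right (other (root t₂))} (unsee (lr lt (rootSink>0 t₂))))) of λ
    { (lr p _) → subst (_< slotOf t₁′ j′) (pointIso-place left-iso x) p }

leaf≄node : ∀ {t₁ j t₂} → ¬ PointIso (node t₁ j t₂) leaf
leaf≄node {t₁} {j} {t₂} S = let (x , e) = at {node t₁ j t₂} 2 (+-mono-< (size>0 t₁) (size>0 t₂)) in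
  <-irrefl (trans (pointIso-place S x) e) (place-bound (PointIso.φ S x))

pointIso-≡ : ∀ t t′ → PointIso t t′ → t ≡ t′
pointIso-≡ leaf leaf S = refl
pointIso-≡ leaf (node t₁ j t₂)    S = ⊥-elim (leaf≄node (pointIso-sym S))
pointIso-≡ (node t₁ j t₂) leaf S = ⊥-elim (leaf≄node S)
pointIso-≡ (node t₁ j t₂) (node t₁′ j′ t₂′) S with pointIso-≡ t₁ t₁′ (left-iso S) | pointIso-≡ t₂ t₂′ (right-iso S)
... | refl | refl = cong (λ i → node t₁ i t₂) (slotOf-injective t₁ (≤-antisym (slot-≤ S) (slot-≤ (pointIso-sym S))))
  where
  slot-≤ : ∀ {j j′} → PointIso (node t₁ j t₂) (node t₁ j′ t₂) → slotOf t₁ j ≤ slotOf t₁ j′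
  slot-≤ {j} {j′} S = ≮⇒≥ λ lt → let (x , e) = at {t₁} (slotOf t₁ j′) (proj₂ (slotOf-range t₁ j′)) in
    <-irrefl e (iso-slot S x (subst (_< slotOf t₁ j) (sym e) lt))

-- Top cycle diagrams as subdiagrams

data Parity : ℕ → Set where
  even : ∀ i → Parity (i + i)
  odd  : ∀ i → Parity (suc (i + i))

parity : ∀ p → Parity p
parity zero = even 0
parity (suc p) with parity p
... | even i = odd i
... | odd i  = subst Parity (cong suc (+-suc i i)) (even (suc i))

module _ {A : Set} where
  interleave : (ℕ → A) → (ℕ → A) → ℕ → A
  interleave u v zero = u 0
  interleave u v (suc zero)    = v 0
  interleave u v (suc (suc p)) = interleave (u ∘ suc) (v ∘ suc) p

  interleave-even : ∀ u v i → interleave u v (i + i) ≡ u i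
  interleave-even u v zero = refl
  interleave-even u v (suc i) rewrite +-suc i i = interleave-even (u ∘ suc) (v ∘ suc) i

  interleave-odd : ∀ u v i → interleave u v (suc (i + i)) ≡ v i
  interleave-odd u v zero = refl
  interleave-odd u v (suc i) rewrite +-suc i i = interleave-odd (u ∘ suc) (v ∘ suc) i

double-≤ : ∀ {i k} → i ≤ k → i + i ≤ k + k
double-≤ le = ℕP.+-mono-≤ le le

-- The top cycle of size 2 + n, with points numbered from 0.
module Cycle (n : ℕ) where
  m : ℕ
  m = 2 + n

  size≡ : 2 * m ≡ 4 + (n + n)
  size≡ = trans (cong (_+_ m) (ℕP.+-identityʳ m)) (cong (λ k → suc (suc k)) (trans (+-suc n (suc n)) (cong suc (+-suc n n))))

  -- Partners of the even and the odd points. For `i ≤ n` a short chord joins `2 i` to `2 i + 3`;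
  -- the long chord joins 1 to `2 n + 2`, the one even point that is not a source.
  up down : ℕ → ℕ
  up i = choose (i ≤? n) (3 + (i + i)) 1
  down zero    = 2 + (n + n)
  down (suc i) = i + i

  π : ℕ → ℕ
  π = interleave up down

  data Place : ℕ → Set where
    short : ∀ i → i ≤ n → Place (i + i)
    close : Place (2 + (n + n))
    long  : Place 1
    sinkOf  : ∀ i → i ≤ n → Place (3 + (i + i))

  half-< : ∀ {i} → i + i < 2 * m → i ≤ suc n
  half-< {i} lt = ≤-pred (≰⇒> λ big → <⇒≱ lt (subst (_≤ i + i) (cong (_+_ m) (sym (ℕP.+-identityʳ m))) (double-≤ big)))

  placed : ∀ p → p < 2 * m → Place p
  placed p lt with parity p
  placed _ lt | odd zero    = long
  placed _ lt | odd (suc i) = subst Place (cong (λ k → suc (suc k)) (sym (+-suc i i))) (sinkOf i (≤-pred (half-< (<-trans (n<1+n _) lt))))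
  placed _ lt | even i with m≤n⇒m<n∨m≡n (half-< lt)
  ... | inj₁ le   = short i (≤-pred le)
  ... | inj₂ refl = subst Place (cong suc (sym (+-suc n n))) close

  π-short : ∀ i → i ≤ n → π (i + i) ≡ 3 + (i + i)
  π-short i le = trans (interleave-even up down i) (choose-yes (i ≤? n) le)

  π-close : π (2 + (n + n)) ≡ 1
  π-close = trans (interleave-even (up ∘ suc) (down ∘ suc) n) (choose-no (suc n ≤? n) (<-irrefl refl))

  π-sink : ∀ i → π (3 + (i + i)) ≡ i + i
  π-sink i = interleave-odd (up ∘ suc) (down ∘ suc) i

  π-< : ∀ {p} → Place p → π p < 2 * m
  π-< {p} v = subst (π p <_) (sym size≡) (go v)
    where
    go : ∀ {p} → Place p → π p < 4 + (n + n)
    go (short i le) = subst (_< 4 + (n + n)) (sym (π-short i le)) (+-monoʳ-≤ 4 (double-≤ le))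
    go close = subst (_< 4 + (n + n)) (sym π-close) (s≤s (s≤s z≤n))
    go long = n≤1+n _
    go (sinkOf i le)  = subst (_< 4 + (n + n)) (sym (π-sink i)) (≤-trans (s≤s (double-≤ le)) (m≤n+m _ 3))

  π-inv : ∀ {p} → Place p → π (π p) ≡ p
  π-inv (short i le) = trans (cong π (π-short i le)) (π-sink i)
  π-inv close = cong π π-close
  π-inv long = π-close
  π-inv (sinkOf i le)  = trans (cong π (π-sink i)) (π-short i le)

  π-≢ : ∀ {p} → Place p → π p ≢ p
  π-≢ (short i le) e = <⇒≢ (m≤n+m (suc (i + i)) 2) (sym (trans (sym (π-short i le)) e))
  π-≢ close e = case trans (sym π-close) e of λ ()
  π-≢ (sinkOf i le)  e = <⇒≢ (m≤n+m (suc (i + i)) 2) (trans (sym (π-sink i)) e)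

  diagram : ChordDiagram m
  diagram = record { partner = λ x → fromℕ< (π-< (pl x)) ; involutive = λ x → toℕ-injective (trans (toℕ-fromℕ< _) (trans (cong π (toℕ-fromℕ< (π-< (pl x)))) (π-inv (pl x))))
    ; matched = λ x e → π-≢ (pl x) (trans (sym (toℕ-fromℕ< _)) (cong toℕ e)) }
    where
    pl : ∀ (x : Fin (2 * m)) → Place (toℕ x)
    pl x = placed (toℕ x) (toℕ<n x)

  toℕ-partner : ∀ x → toℕ (partner diagram x) ≡ π (toℕ x)
  toℕ-partner x = toℕ-fromℕ< _

  private
    from≡ : ∀ i → 2 * suc i ∸ 1 ≡ suc (i + i)
    from≡ i = trans (+-suc i (i + 0)) (cong (λ k → suc (i + k)) (ℕP.+-identityʳ i))

    to≡ : ∀ i → i ≤ n → 2 * suc i + 2 ≡ suc (π (i + i))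
    to≡ i le = trans (cong (λ k → suc i + k + 2) (ℕP.+-identityʳ (suc i))) (trans (ℕP.+-comm (suc i + suc i) 2) (trans (cong (_+_ 3) (+-suc i i)) (cong suc (sym (π-short i le)))))

  topChord : ∀ {p} → Place p → p < π p → TopCycle m (suc p) (suc (π p))
  topChord (short i le) _ = subst₂ (TopCycle m) (from≡ i) (to≡ i le) (short (suc i) (s≤s z≤n) (s≤s le))
  topChord close lt = contradiction (subst (2 + (n + n) <_) π-close lt) λ { (s≤s ()) }
  topChord long _ = subst (TopCycle m 2) (cong (_∸ 1) size≡) long
  topChord (sinkOf i le) lt = contradiction (subst (3 + (i + i) <_) (π-sink i) lt) (≤⇒≯ (m≤n+m (i + i) 3))

  topChord⁻ : ∀ {a b} → TopCycle m a b → Σ[ p ∈ ℕ ] p < 2 * m × p < π p × a ≡ suc p × b ≡ suc (π p)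
  topChord⁻ long = 1 , subst (1 <_) (sym size≡) (s≤s (s≤s z≤n)) , s≤s (s≤s z≤n) , refl , cong (_∸ 1) size≡
  topChord⁻ (short (suc i) _ (s≤s le)) = i + i , subst (i + i <_) (sym size≡) (≤-trans (s≤s (double-≤ le)) (m≤n+m _ 3)) ,
    subst (i + i <_) (sym (π-short i le)) (m≤n+m _ 2) , from≡ i , to≡ i le

  isTopCycle : ∀ a b → HasChord diagram a b ⇔ TopCycle m a b
  isTopCycle a b = mk⇔ (λ { (x , lt , refl , refl) → subst (λ k → TopCycle m (suc (toℕ x)) (suc k)) (sym (toℕ-partner x))
        (topChord (placed (toℕ x) (toℕ<n x)) (subst (toℕ x <_) (toℕ-partner x) lt)) })
    λ t → let (p , p< , lt , a≡ , b≡) = topChord⁻ t ; e = toℕ-fromℕ< p< ; e′ = trans (toℕ-partner (fromℕ< p<)) (cong π e) in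
      fromℕ< p< , subst₂ _<_ (sym e) (sym e′) lt , trans a≡ (cong suc (sym e)) , trans b≡ (cong suc (sym e′))

module _ {A : Set} (_≪_ : A → A → Set) (α : A → A) (d : A) where
  -- The short chords of a top cycle, from p on.
  record Ladder (p e : A) : Set where
    field
      n : ℕ
      s : ℕ → A
      n>0    : 0 < n
      s₀     : s 0 ≡ p
      s₁     : s 1 ≡ e
      near   : ∀ {i} → i < n → s (suc i) ≪ α (s i)
      gap    : ∀ {i} → suc i < n → α (s i) ≪ s (2 + i)
      under : ∀ {i} → suc i ≡ n → α (s i) ≪ α d
      past   : α d ≪ α (s n)

  ladder : ∀ {p e} → e ≪ α p → α p ≪ α d → Chain _≪_ α (α d ≪_) (_≪ α d) (α p) e → Ladder p e
  ladder {p} {e} u v (end x) = record { n = 1 ; s = λ { zero → p ; (suc _) → e } ; n>0 = s≤s z≤n ; s₀ = refl ; s₁ = refl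
    ; near = λ { (s≤s z≤n) → u } ; gap = λ { (s≤s ()) } ; under = λ { refl → v } ; past = x }
  ladder {p} {e} u v (step f b l u′ v′ r) = record { n = suc n ; s = s′ ; n>0 = s≤s z≤n ; s₀ = refl ; s₁ = s₀
    ; near = λ { {zero} _ → subst (_≪ α p) (sym s₀) u ; {suc i} (s≤s lt) → near lt }
    ; gap = λ { {zero} _ → subst (α p ≪_) (sym s₁) l ; {suc i} (s≤s lt) → gap lt }
    ; under = λ { {zero} d → contradiction (suc-injective d) (<⇒≢ n>0) ; {suc i} d → under (suc-injective d) } ; past = past }
    where
    open Ladder (ladder u′ b r)
    s′ : ℕ → A
    s′ zero    = p
    s′ (suc i) = s i

module _ {N} (E : ChordDiagram N) where
  private
    α = partner E
    α-inv = ChordDiagram.involutive E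

  -- Even points go to the sources of the short chords and at last to the sink of `d`; odd points go
  -- to `d` and then to the sinks of the short chords.
  module Embed {c d e} (c≺d : c ≺ d) (d≺e : d ≺ e) (L : Ladder _≺_ α d c e) where
    open Ladder L
    open Cycle n

    ev od F : ℕ → Fin (2 * N)
    ev i = choose (i ≤? n) (s i) (α d)
    od zero    = d
    od (suc i) = α (s i)
    F = interleave ev od

    ev-≤ : ∀ {i} → i ≤ n → ev i ≡ s i
    ev-≤ {i} le = choose-yes (i ≤? n) le

    ev-end : ev (suc n) ≡ α d
    ev-end = choose-no (suc n ≤? n) (<-irrefl refl)

    F-short : ∀ i → i ≤ n → F (i + i) ≡ s i
    F-short i le = trans (interleave-even ev od i) (ev-≤ le)

    F-close : F (2 + (n + n)) ≡ α d
    F-close = trans (interleave-even (ev ∘ suc) (od ∘ suc) n) ev-end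

    F-sink : ∀ i → F (3 + (i + i)) ≡ α (s i)
    F-sink i = interleave-odd (ev ∘ suc) (od ∘ suc) i

    F-hom : ∀ {p} → Place p → α (F p) ≡ F (π p)
    F-hom (short i le) = trans (cong α (F-short i le)) (trans (sym (F-sink i)) (cong F (sym (π-short i le))))
    F-hom close = trans (cong α F-close) (trans (α-inv d) (cong F (sym π-close)))
    F-hom long = sym F-close
    F-hom (sinkOf i le)  = trans (cong α (F-sink i)) (trans (α-inv (s i)) (trans (sym (F-short i le)) (cong F (sym (π-sink i)))))

    F-suc : ∀ {p} → Place p → suc p < 2 * m → F p ≺ F (suc p)
    F-suc (short zero le) _ = subst (_≺ d) (sym (trans (ev-≤ z≤n) s₀)) c≺d
    F-suc (short (suc i) le) _ = subst₂ _≺_ (sym (F-short (suc i) le)) (sym (interleave-odd ev od (suc i))) (near le)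
    F-suc close _ = subst₂ _≺_ (sym F-close) (sym (F-sink n)) past
    F-suc long _ = subst (d ≺_) (sym (trans (ev-≤ n>0) s₁)) d≺e
    F-suc (sinkOf i le) lt with m≤n⇒m<n∨m≡n le
    ... | inj₂ refl = contradiction size≡ (>⇒≢ lt)
    ... | inj₁ i<n with m≤n⇒m<n∨m≡n i<n
    ...   | inj₁ i+1<n = subst₂ _≺_ (sym (F-sink i)) (sym (trans (interleave-even (λ k → ev (2 + k)) (λ k → od (2 + k)) i) (ev-≤ i+1<n))) (gap i+1<n)
    ...   | inj₂ e     = subst₂ _≺_ (sym (F-sink i)) (sym (trans (interleave-even (λ k → ev (2 + k)) (λ k → od (2 + k)) i) (trans (cong (ev ∘ suc) e) ev-end))) (under e)

    F-mono : ∀ k {p} → suc (k + p) < 2 * m → F p ≺ F (suc (k + p))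
    F-mono zero    {p} lt = F-suc (placed p (<-trans (n<1+n p) lt)) lt
    F-mono (suc k) {p} lt = <-trans (F-mono k (<-trans (n<1+n _) lt)) (F-suc (placed (suc (k + p)) (<-trans (n<1+n _) lt)) lt)

    embedded : diagram IsSubdiagramOf E
    embedded = (λ x → F (toℕ x)) , (λ x y lt → subst (λ q → F (toℕ x) ≺ F q) (above lt) (F-mono (toℕ y ∸ suc (toℕ x)) (subst (_< 2 * m) (sym (above lt)) (toℕ<n y)))) ,
      λ x → trans (F-hom (placed (toℕ x) (toℕ<n x))) (cong F (sym (toℕ-partner x)))
      where
      above : ∀ {p q} → p < q → suc (q ∸ suc p + p) ≡ q
      above {p} {q} lt = trans (sym (+-suc (q ∸ suc p) p)) (m∸n+n≡m lt)

  free⇒no-cycle : TopCycleFree E → ¬ HasTopCycle _≺_ α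
  free⇒no-cycle free (topCycle c d e p q u v rest) = free (2 + Ladder.n L) (s≤s (s≤s (Ladder.n>0 L))) (Cycle.diagram (Ladder.n L)) (Embed.embedded p q L) (Cycle.isTopCycle (Ladder.n L))
    where
    chain : ∀ {lo} → Start _≺_ α (lo ≺_) (α d ≺_) (_≺ α d) e → Chain _≺_ α (α d ≺_) (_≺ α d) lo e
    chain (end x) = end x
    chain (step f b l u v r) = step f b l u v r
    L : Ladder _≺_ α d c e
    L = ladder _≺_ α d u v (chain rest)

  no-cycle⇒free : ¬ HasTopCycle _≺_ α → TopCycleFree E
  no-cycle⇒free none (suc (suc n)) (s≤s (s≤s n>0)) D (f , f-mono , f-hom) isTop = none (topCycle-map f (λ {x} {y} → f-mono x y) (λ x → sym (f-hom x)) cycle)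
    where
    open Cycle n hiding (diagram; isTopCycle)
    δ : Fin (2 * m) → Fin (2 * m)
    δ = partner D

    Src : ℕ → Fin (2 * m) → Set
    Src i x = toℕ x ≡ i + i × toℕ (δ x) ≡ 3 + (i + i)

    srcAt : ∀ i → i ≤ n → Σ[ x ∈ Fin (2 * m) ] Src i x
    srcAt i le with Equivalence.from (isTop _ _) (topChord (short i le) (subst (i + i <_) (sym (π-short i le)) (m≤n+m _ 2)))
    ... | x , _ , p , q = x , sym (suc-injective p) , trans (sym (suc-injective q)) (π-short i le)

    -- `k` is the number of short chords that follow the one of `x`.
    chain : ∀ k {d lo i x} → k + i ≡ n → toℕ (δ d) ≡ 2 + (n + n) → toℕ lo ≡ suc (i + i) → Src i x → Chain _≺_ δ (δ d ≺_) (_≺ δ d) lo x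
    chain zero    refl dd l (_ , e) = end (subst₂ _<_ (sym dd) (sym e) ≤-refl)
    chain (suc k) {i = i} refl dd l (e , e′) with srcAt (suc i) (s≤s (m≤n+m i k))
    ... | f , g , g′ = step f (subst₂ _<_ (sym e′) (sym dd) (+-monoʳ-≤ 2 (≤-trans (≤-reflexive (cong suc (sym (+-suc i i)))) (double-≤ (s≤s (m≤n+m i k))))))
      (subst₂ _<_ (sym l) (sym g≡) ≤-refl) (subst₂ _<_ (sym g≡) (sym e′) ≤-refl) (subst₂ _<_ (sym e′) (sym (trans g′ (cong (_+_ 4) (+-suc i i)))) (n≤1+n _))
      (chain k (+-suc k i) dd (trans e′ (cong (λ k → suc (suc k)) (sym (+-suc i i)))) (g , g′))
      where
      g≡ : toℕ f ≡ 2 + (i + i)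
      g≡ = trans g (cong suc (+-suc i i))

    cycle : HasTopCycle _≺_ δ
    cycle with srcAt 0 z≤n | srcAt 1 n>0 | Equivalence.from (isTop _ _) (topChord long (s≤s (s≤s z≤n)))
    ... | c , c₁ , c₂ | e , e₁ , e₂ | d , _ , d₁ , d₂ = topCycle c d e (subst₂ _<_ (sym c₁) (suc-injective d₁) ≤-refl) (subst₂ _<_ (suc-injective d₁) (sym e₁) ≤-refl)
      (subst₂ _<_ (sym e₁) (sym c₂) ≤-refl) (subst₂ _<_ (sym c₂) (suc-injective d₂) (s≤s (s≤s (ℕP.+-mono-≤ n>0 n>0))))
      (start (chain (n ∸ 1) {d} (m∸n+n≡m n>0) (sym (suc-injective d₂)) c₂ (e₁ , e₂)))
      where
      start : ∀ {lo P Q x} → Chain _≺_ δ P Q lo x → Start _≺_ δ (lo ≺_) P Q x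
      start (end x) = end x
      start (step f b l u v r) = step f b l u v r

-- The tree of a chord diagram

module _ {m : ℕ} where
  open DecMembership (≡-dec (FinP._≟_ {m}) (FinP._≟_ {m})) public using () renaming (_∈?_ to _∈chords?_)

  crosses-sym : ∀ {c d : Chord m} → Crosses c d → Crosses d c
  crosses-sym (inj₁ p) = inj₂ p
  crosses-sym (inj₂ p) = inj₁ p

  Step : List (Chord m) → Chord m → Chord m → Set
  Step K c d = c ∈ K × d ∈ K × Crosses c d

  ConnectedIn : List (Chord m) → Set
  ConnectedIn K = ∀ {c d} → c ∈ K → d ∈ K → EqClosure (Step K) c d

  via : ∀ {K c} → (∀ {d} → d ∈ K → EqClosure (Step K) d c) → ConnectedIn K
  via to-c p q = to-c p ◅◅ Eq.symmetric _ (to-c q)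

  widen : ∀ {K K′ : List (Chord m)} {c d} → (∀ {x} → x ∈ K → x ∈ K′) → EqClosure (Step K) c d → EqClosure (Step K′) c d
  widen sub = Eq.map (λ (p , q , r) → sub p , sub q , r)

  record Component (cs K : List (Chord m)) : Set where
    field
      linked : ConnectedIn K
      closed : ∀ {x y} → x ∈ K → y ∈ cs → Crosses x y → y ∈ K
      subset : ∀ {x} → x ∈ K → x ∈ cs

  record Components (cs : List (Chord m)) (Ks : List (List (Chord m))) : Set where
    field
      component : ∀ {K} → K ∈ Ks → Component cs K
      cover     : ∀ {x} → x ∈ cs → Σ[ K ∈ List (Chord m) ] K ∈ Ks × x ∈ K

  -- A component of the later chords either touches `c` and is merged with it, or remains closed
  -- under crossing. A chord of the merged piece reaches `c` through the crossing that made its old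
  -- component touch.
  components-spec : ∀ cs → Components cs (components cs)
  components-spec [] = record { component = λ () ; cover = λ () }
  components-spec (c ∷ cs) rewrite partition-defn (any? (crosses? c)) (components cs) = record
    { component = λ { (here refl) → first-component ; (there p) → rest-component (proj₁ (other∈ p)) (proj₂ (other∈ p)) }
    ; cover = λ { (here refl) → _ , here refl , here refl ; (there x∈) → covers x∈ } }
    where
    open Components (components-spec cs)
    touches? = any? (crosses? c)
    touching = filter touches? (components cs)
    others   = filter (∁? touches?) (components cs)
    K₀ = c ∷ filter (_∈chords? concat touching) cs

    touching∈ : ∀ {K} → K ∈ touching → K ∈ components cs × Any (Crosses c) K
    touching∈ = ∈-filter⁻ touches? {xs = components cs}

    other∈ : ∀ {K} → K ∈ others → K ∈ components cs × ¬ Any (Crosses c) K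
    other∈ = ∈-filter⁻ (∁? touches?) {xs = components cs}

    rest-component : ∀ {K} → K ∈ components cs → ¬ Any (Crosses c) K → Component (c ∷ cs) K
    rest-component K∈ free = record { linked = linked ; closed = λ { x∈ (here refl) p → contradiction (lose x∈ (crosses-sym p)) free ; x∈ (there y∈) p → closed x∈ y∈ p } ; subset = there ∘ subset }
      where open Component (component K∈)

    in-K₀ : ∀ {K x} → K ∈ touching → x ∈ K → x ∈ K₀
    in-K₀ K∈ x∈ = there (∈-filter⁺ (_∈chords? concat touching) (Component.subset (component (proj₁ (touching∈ K∈))) x∈) (∈-concat⁺′ x∈ K∈))

    K₀-in : ∀ {x} → x ∈ K₀ → x ≡ c ⊎ Σ[ K ∈ List (Chord m) ] x ∈ K × K ∈ touching
    K₀-in (here e)  = inj₁ e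
    K₀-in (there p) = inj₂ (∈-concat⁻′ touching (proj₂ (∈-filter⁻ (_∈chords? concat touching) {xs = cs} p)))

    covers : ∀ {x} → x ∈ cs → Σ[ K ∈ List (Chord m) ] K ∈ K₀ ∷ others × x ∈ K
    covers x∈ with cover x∈
    ... | K , K∈ , x∈K with touches? K
    ...   | yes t = K₀ , here refl , in-K₀ (∈-filter⁺ touches? K∈ t) x∈K
    ...   | no ¬t = K , there (∈-filter⁺ (∁? touches?) K∈ ¬t) , x∈K

    first-component : Component (c ∷ cs) K₀
    first-component = record { linked = via to-c ; closed = close ; subset = λ { (here e) → here e ; (there p) → there (proj₁ (∈-filter⁻ (_∈chords? concat touching) {xs = cs} p)) } }
      where
      to-c : ∀ {d} → d ∈ K₀ → EqClosure (Step K₀) d c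
      to-c d∈ with K₀-in d∈
      ... | inj₁ refl = ε
      ... | inj₂ (K , d∈K , K∈) with touching∈ K∈
      ...   | K∈′ , t with find t
      ...     | z , z∈ , p = widen (in-K₀ K∈) (Component.linked (component K∈′) d∈K z∈) ◅◅ bwd (here refl , in-K₀ K∈ z∈ , p) ◅ ε

      close : ∀ {x y} → x ∈ K₀ → y ∈ c ∷ cs → Crosses x y → y ∈ K₀
      close x∈ (here refl) p = here refl
      close x∈ (there y∈) p with K₀-in x∈
      ... | inj₂ (K , x∈K , K∈) = in-K₀ K∈ (Component.closed (component (proj₁ (touching∈ K∈))) x∈K y∈ p)
      ... | inj₁ refl with cover y∈
      ...   | K , K∈ , y∈K = in-K₀ (∈-filter⁺ touches? K∈ (lose y∈K p)) y∈K

module _ {n} (E : ChordDiagram n) where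
  private
    α = partner E
    α-inv = ChordDiagram.involutive E

  abstract
    chordOf : Fin (2 * n) → Chord (2 * n)
    chordOf x = choose (x FinP.<? α x) (x , α x) (α x , x)

    chordOf-source : ∀ {x} → x ≺ α x → chordOf x ≡ (x , α x)
    chordOf-source {x} lt = choose-yes (x FinP.<? α x) lt

    chordOf-sink : ∀ {x} → α x ≺ x → chordOf x ≡ (α x , x)
    chordOf-sink {x} lt = choose-no (x FinP.<? α x) (<-asym lt)

  source-or-sink : ∀ x → x ≺ α x ⊎ α x ≺ x
  source-or-sink x with <-cmp (toℕ x) (toℕ (α x))
  ... | tri< p _ _ = inj₁ p
  ... | tri≈ _ e _ = contradiction (toℕ-injective (sym e)) (ChordDiagram.matched E x)
  ... | tri> _ _ p = inj₂ p

  chordOf-partner : ∀ x → chordOf (α x) ≡ chordOf x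
  chordOf-partner x with source-or-sink x
  ... | inj₁ p = trans (chordOf-sink (subst (_≺ α x) (sym (α-inv x)) p)) (trans (cong (_, α x) (α-inv x)) (sym (chordOf-source p)))
  ... | inj₂ p = trans (chordOf-source (subst (α x ≺_) (sym (α-inv x)) p)) (trans (cong (α x ,_) (α-inv x)) (sym (chordOf-sink p)))

  IsChord : Chord (2 * n) → Set
  IsChord (a , b) = a ≺ b × b ≡ α a

  chordOf-isChord : ∀ x → IsChord (chordOf x)
  chordOf-isChord x with source-or-sink x
  ... | inj₁ p = subst IsChord (sym (chordOf-source p)) (p , refl)
  ... | inj₂ p = subst IsChord (sym (chordOf-sink p)) (p , sym (α-inv x))

  isChord-of : ∀ {c} → IsChord c → chordOf (proj₁ c) ≡ c × chordOf (proj₂ c) ≡ c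
  isChord-of {a , _} (lt , refl) = chordOf-source lt , trans (chordOf-partner a) (chordOf-source lt)

  endpoint : ∀ {x c} → chordOf x ≡ c → x ≡ proj₁ c ⊎ x ≡ proj₂ c
  endpoint {x} refl with source-or-sink x
  ... | inj₁ p = inj₁ (cong proj₁ (sym (chordOf-source p)))
  ... | inj₂ p = inj₂ (cong proj₂ (sym (chordOf-sink p)))

  ∈-chords : ∀ {c} → IsChord c → c ∈ chords E
  ∈-chords {a , _} (lt , refl) = ∈-map⁺ (λ a → a , α a) (∈-filter⁺ (λ a → a FinP.<? α a) (∈-allFin a) lt)

  chords-∈ : ∀ {c} → c ∈ chords E → IsChord c
  chords-∈ c∈ with ∈-map⁻ (λ a → a , α a) c∈
  ... | a , a∈ , refl = chosen (λ a → a FinP.<? α a) a∈ , refl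

threshold : ∀ t {n} (g : Point t → Fin n) (b : Fin n) → (∀ {x y} → x ◁ y → g x ≺ g y) →
  Σ[ p ∈ ℕ ] (∀ x → place x < p → g x ≺ b) × (∀ x → p ≤ place x → b ⪯ g x)
threshold t g b mono = go (size t) 0 (ℕP.+-identityʳ (size t)) λ _ ()
  where
  go : ∀ k p → k + p ≡ size t → (∀ x → place x < p → g x ≺ b) → Σ[ p ∈ ℕ ] (∀ x → place x < p → g x ≺ b) × (∀ x → p ≤ place x → b ⪯ g x)
  go zero    p e below = p , below , λ x le → contradiction (place-bound x) (≤⇒≯ (subst (_≤ place x) e le))
  go (suc k) p e below with at {t} p (subst (p <_) e (s≤s (m≤n+m p k)))
  ... | z , z≡ with toℕ (g z) <? toℕ b
  ...   | yes lt = go k (suc p) (trans (+-suc k p) e) λ x x< → [ below x , (λ d → subst (λ x → g x ≺ b) (place-injective (trans z≡ (sym d))) lt) ]′ (m≤n⇒m<n∨m≡n (≤-pred x<))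
  ...   | no ge  = p , below , λ x le → ≤-trans (≮⇒≥ ge) ([ (λ lt → <⇒≤ (mono ⟪ subst (_< place x) (sym z≡) lt ⟫)) , (λ d → ≤-reflexive (cong (toℕ ∘ g) (place-injective (trans z≡ d)))) ]′ (m≤n⇒m<n∨m≡n le))

module EncodeDiagram {n} (E : ChordDiagram n) (none : ¬ HasTopCycle _≺_ (partner E)) where
  α : Fin (2 * n) → Fin (2 * n)
  α = partner E

  Ch : Set
  Ch = Chord (2 * n)

  On : List Ch → Fin (2 * n) → Set
  On L x = chordOf E x ∈ L

  -- Makes terminality a matter of `L` alone, though `Terminal` refers to the whole diagram. The
  -- chords after the root inherit it by components.
  RightClosed : List Ch → Set
  RightClosed L = ∀ {c d} → c ∈ L → d ∈ chords E → RightNeighbor c d → d ∈ L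

  nonterminal? : Decidable (λ c → ¬ Terminal E c)
  nonterminal? c = ¬? (terminal? E c)

  -- Stated for every continuation `ds`, because in the intersection order of a larger set the first
  -- component is followed by the others.
  FirstTerminal : List Ch → ℕ → Set
  FirstTerminal cs k = ∀ ds → suc (length (takeWhile nonterminal? (cs ++ ds))) ≡ k

  record Code (L : List Ch) : Set where
    field
      t     : Tree
      g     : Point t → Fin (2 * n)
      mono  : ∀ {x y} → x ◁ y → g x ≺ g y
      hom   : ∀ x → g (other x) ≡ α (g x)
      on    : ∀ x → On L (g x)
      onto  : ∀ {y} → On L y → Σ[ x ∈ Point t ] g x ≡ y
      first-terminal : RightClosed L → ∀ k → depth t ≤ k → FirstTerminal (intersectionOrder k L) (depth t)

  record Valid (L : List Ch) : Set where
    field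
      sorted : AllPairs (λ c d → proj₁ c ≺ proj₁ d) L
      chordal  : ∀ {c} → c ∈ L → IsChord E c
      linked : ConnectedIn L

  take-nonterminal : ∀ {c cs} → ¬ Terminal E c → takeWhile nonterminal? (c ∷ cs) ≡ c ∷ takeWhile nonterminal? cs
  take-nonterminal {c} ¬t with terminal? E c
  ... | yes t = contradiction t ¬t
  ... | no _  = refl

  take-terminal : ∀ {c cs} → Terminal E c → takeWhile nonterminal? (c ∷ cs) ≡ []
  take-terminal {c} t with terminal? E c
  ... | yes _ = refl
  ... | no ¬t = contradiction t ¬t

  single : ∀ {c} → Valid (c ∷ []) → Code (c ∷ [])
  single {c@(a , b)} V = record
    { t = leaf ; g = g′
    ; mono = λ { {source} {source} ⟪ () ⟫ ; {source} {target} _ → a≺b ; {target} {source} ⟪ () ⟫ ; {target} {target} ⟪ s≤s () ⟫ }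
    ; hom = λ { source → b≡ ; target → trans (sym (ChordDiagram.involutive E a)) (cong α (sym b≡)) }
    ; on = λ { source → here (proj₁ (isChord-of E is)) ; target → here (proj₂ (isChord-of E is)) }
    ; onto = λ { (here e) → [ (λ d → source , sym d) , (λ d → target , sym d) ]′ (endpoint E e) }
    ; first-terminal = λ { rc (suc k) _ ds → cong (suc ∘ length) (take-terminal {cs = ds} (All.tabulate λ d∈ r → case rc (here refl) d∈ r of λ { (here refl) → <-irrefl refl (proj₁ r) })) } }
    where
    is = Valid.chordal V (here refl)
    a≺b = proj₁ is
    b≡ = proj₂ is
    g′ : Point leaf → Fin (2 * n)
    g′ source = a
    g′ target = b

  -- c is the root chord, K the first component of the other chords C, and R
  -- consists of the other components.
  record Splitting (c : Ch) (C K R : List Ch) : Set where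
    field
      component-K : Component C K
      R∈ : ∀ {d} → d ∈ R → d ∈ C × d ∉ K
      part : ∀ {d} → d ∈ C → d ∈ K ⊎ d ∈ R
      sorted-K    : AllPairs (λ c d → proj₁ c ≺ proj₁ d) K
      sorted-D    : AllPairs (λ c d → proj₁ c ≺ proj₁ d) (c ∷ R)
      order : ∀ k → Σ[ ds ∈ List Ch ] intersectionOrder (suc k) (c ∷ C) ≡ c ∷ intersectionOrder k K ++ ds

  module Split {c c₂ cs} (V : Valid (c ∷ c₂ ∷ cs)) {K R : List Ch} (c₂∈K : c₂ ∈ K) (splitting : Splitting c (c₂ ∷ cs) K R) where
    open Valid V
    open Splitting splitting
    a = proj₁ c
    b = proj₂ c
    L C D : List Ch
    L = c ∷ c₂ ∷ cs
    C = c₂ ∷ cs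
    D = c ∷ R

    open Component component-K renaming (linked to K-linked; closed to K-closed; subset to K⊆C)

    R-closed : ∀ {x y} → x ∈ R → y ∈ C → Crosses x y → y ∈ R
    R-closed x∈ y∈ p with part y∈
    ... | inj₁ q = contradiction (K-closed q (proj₁ (R∈ x∈)) (crosses-sym p)) (proj₂ (R∈ x∈))
    ... | inj₂ q = q

    a< : ∀ {d} → d ∈ C → a ≺ proj₁ d
    a< d∈ = All.lookup (AllPairs.head sorted) d∈

    c₂≤ : ∀ {d} → d ∈ C → proj₁ c₂ ⪯ proj₁ d
    c₂≤ (here refl) = ≤-refl
    c₂≤ (there d∈)  = <⇒≤ (All.lookup (AllPairs.head (AllPairs.tail sorted)) d∈)

    neighbor : ∀ {z} → z ∈ C → Crosses z c → RightNeighbor c z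
    neighbor z∈ (inj₁ (p , _)) = contradiction p (<-asym (a< z∈))
    neighbor z∈ (inj₂ p) = p

    -- A path from `S` to the root chord stays in `S` until it steps onto `c`. So a property can be
    -- proved for the chords of `S` crossing `c` and then carried backwards along crossings.
    module Along {S : List Ch} (S⊆C : ∀ {x} → x ∈ S → x ∈ C) (S-closed : ∀ {x y} → x ∈ S → y ∈ C → Crosses x y → y ∈ S) (P : Ch → Set)
      (base : ∀ {z} → z ∈ S → RightNeighbor c z → P z) (step : ∀ {y y′} → y ∈ S → y′ ∈ S → Crosses y y′ → P y′ → P y) where
      go : ∀ {y} → EqClosure (Step L) y c → y ∈ S → P y
      onward : ∀ {y y′} → y′ ∈ L → Crosses y y′ → EqClosure (Step L) y′ c → y ∈ S → P y
      go ε y∈ = contradiction (a< (S⊆C y∈)) (<-irrefl refl)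
      go (fwd (_ , q , r) ◅ rest) y∈ = onward q r rest y∈
      go (bwd (p , _ , r) ◅ rest) y∈ = onward p (crosses-sym r) rest y∈
      onward (here refl) r rest y∈ = base y∈ (neighbor (S⊆C y∈) r)
      onward (there q)   r rest y∈ = let y′∈ = S-closed y∈ q r in step y∈ y′∈ r (go rest y′∈)

      along : ∀ {y} → y ∈ S → P y
      along y∈ = go (linked (there (S⊆C y∈)) (here refl)) y∈

    touch : Σ[ z ∈ Ch ] z ∈ K × RightNeighbor c z
    touch = Along.along K⊆C K-closed (λ _ → Σ[ z ∈ Ch ] z ∈ K × RightNeighbor c z) (λ z∈ r → _ , z∈ , r) (λ _ _ _ p → p) c₂∈K

    isChord : ∀ {d} → d ∈ C → IsChord E d
    isChord d∈ = chordal (there d∈)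

    Inside : Ch → Ch → Set
    Inside y k = proj₁ y ≺ proj₁ k × proj₂ k ≺ proj₂ y

    -- No endpoint of `K` lies under a chord `y` of another component: nothing in `K` crosses `y`,
    -- so with one endpoint all of the connected `K` would lie under `y`, including `c₂`, which
    -- starts before `y`.
    module Separate {y} (y∈ : y ∈ R) where
      y₁ = proj₁ y
      y₂ = proj₂ y
      yC = proj₁ (R∈ y∈)

      apart : ∀ {x z} → On K x → chordOf E z ≡ y → x ≢ z
      apart x∈ e refl = proj₂ (R∈ y∈) (subst (_∈ K) e x∈)

      on₁ = proj₁ (isChord-of E (isChord yC))
      on₂ = proj₂ (isChord-of E (isChord yC))

      uncrossed : ∀ {k} → k ∈ K → ¬ Crosses k y
      uncrossed k∈ r = proj₂ (R∈ y∈) (K-closed k∈ yC r)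

      nest : ∀ {k x} → k ∈ K → x ≡ proj₁ k ⊎ x ≡ proj₂ k → y₁ ≺ x → x ≺ y₂ → Inside y k
      nest {k} k∈ (inj₁ refl) p q with <-cmp (toℕ (proj₂ k)) (toℕ y₂)
      ... | tri< r _ _ = p , r
      ... | tri≈ _ e _ = contradiction (toℕ-injective e) (apart (subst (_∈ K) (sym (proj₂ (isChord-of E (isChord (K⊆C k∈))))) k∈) on₂)
      ... | tri> _ _ r = contradiction (inj₂ (p , q , r)) (uncrossed k∈)
      nest {k} k∈ (inj₂ refl) p q with <-cmp (toℕ (proj₁ k)) (toℕ y₁)
      ... | tri< r _ _ = contradiction (inj₁ (r , p , q)) (uncrossed k∈)
      ... | tri≈ _ e _ = contradiction (toℕ-injective e) (apart (subst (_∈ K) (sym (proj₁ (isChord-of E (isChord (K⊆C k∈))))) k∈) on₁)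
      ... | tri> _ _ r = r , q

      inside-step : ∀ {k k′} → Step K k k′ → Inside y k → Inside y k′
      inside-step (_ , k′∈ , inj₁ (p , q , _)) (u , v) = nest k′∈ (inj₁ refl) (<-trans u p) (<-trans q v)
      inside-step (_ , k′∈ , inj₂ (p , q , r)) (u , v) = nest k′∈ (inj₂ refl) (<-trans u q) (<-trans r v)

      inside-c₂ : ∀ {k} → EqClosure (Step K) k c₂ → ¬ Inside y k
      inside-c₂ ε (u , _) = <⇒≱ u (c₂≤ yC)
      inside-c₂ (fwd s ◅ rest) i = inside-c₂ rest (inside-step s i)
      inside-c₂ (bwd (p , q , r) ◅ rest) i = inside-c₂ rest (inside-step (q , p , crosses-sym r) i)

      separate : ∀ {x} → On K x → x ≺ y₁ ⊎ y₂ ≺ x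
      separate {x} x∈ with <-cmp (toℕ x) (toℕ y₁) | <-cmp (toℕ x) (toℕ y₂)
      ... | tri< p _ _ | _ = inj₁ p
      ... | tri≈ _ e _ | _ = contradiction (toℕ-injective e) (apart x∈ on₁)
      ... | tri> _ _ p | tri< q _ _ = contradiction (nest x∈ (endpoint E refl) p q) (inside-c₂ (K-linked x∈ c₂∈K))
      ... | tri> _ _ _ | tri≈ _ e _ = contradiction (toℕ-injective e) (apart x∈ on₂)
      ... | tri> _ _ _ | tri> _ _ q = inj₂ q

    -- The chord `y` lies in the same gap of `K` as the sink `b` of the root chord. Chords crossing
    -- the root chord do, and crossing chords share their gap.
    Gap : Ch → Set
    Gap y = ∀ {x} → On K x → (x ≺ b → x ≺ proj₁ y) × (b ≺ x → proj₂ y ≺ x)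

    gap : ∀ {y} → y ∈ R → Gap y
    gap = Along.along (proj₁ ∘ R∈) R-closed Gap
      (λ z∈ (_ , z<b , b<z) x∈ → [ (λ p → (λ _ → p) , λ b<x → contradiction (<-trans p z<b) (<-asym b<x)) , (λ p → (λ x<b → contradiction (<-trans b<z p) (<-asym x<b)) , λ _ → p) ]′ (Separate.separate z∈ x∈))
      (λ y∈ y′∈ r h x∈ → let (h₁ , h₂) = h x∈ in
        (λ x<b → [ id , (λ p → contradiction (<-trans p (h₁ x<b)) (<-asym (proj₁ (meet y∈ y′∈ r)))) ]′ (Separate.separate y∈ x∈)) ,
        (λ b<x → [ (λ p → contradiction (<-trans (h₂ b<x) p) (<-asym (proj₂ (meet y∈ y′∈ r)))) , id ]′ (Separate.separate y∈ x∈)))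
      where
      meet : ∀ {y y′} → y ∈ R → y′ ∈ R → Crosses y y′ → proj₁ y′ ≺ proj₂ y × proj₁ y ≺ proj₂ y′
      meet y∈ y′∈ (inj₁ (p , q , r)) = q , <-trans (<-trans p q) r
      meet y∈ y′∈ (inj₂ (p , q , r)) = <-trans (<-trans p q) r , q

    valid-K : Valid K
    valid-K = record { sorted = sorted-K ; chordal = λ c∈ → isChord (K⊆C c∈) ; linked = K-linked }

    valid-D : Valid D
    valid-D = record { sorted = sorted-D
      ; chordal = λ { (here e) → chordal (here e) ; (there p) → isChord (proj₁ (R∈ p)) }
      ; linked = via λ { (here refl) → ε ; (there p) → Along.along (proj₁ ∘ R∈) R-closed (λ y → EqClosure (Step D) y c)
          (λ z∈ r → fwd (there z∈ , here refl , inj₂ r) ◅ ε) (λ y∈ y′∈ r q → fwd (there y∈ , there y′∈ , r) ◅ q) p } }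

    module Join (C₁ : Code K) (C₂ : Code D) where
      module C₁ = Code C₁
      module C₂ = Code C₂

      p : ℕ
      p = proj₁ (threshold C₁.t C₁.g b C₁.mono)

      below : ∀ x → place x < p → C₁.g x ≺ b
      below = proj₁ (proj₂ (threshold C₁.t C₁.g b C₁.mono))

      c-is = chordal (here refl)

      c∉K : ∀ {d} → d ∈ K → d ≢ c
      c∉K d∈ refl = <-irrefl refl (a< (K⊆C d∈))

      above : ∀ x → p ≤ place x → b ≺ C₁.g x
      above x le = ≤∧≢⇒< (proj₂ (proj₂ (threshold C₁.t C₁.g b C₁.mono)) x le)
        (λ e → c∉K (C₁.on x) (subst (λ z → chordOf E z ≡ c) (toℕ-injective e) (proj₂ (isChord-of E c-is))))

      a<g : ∀ x → a ≺ C₁.g x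
      a<g x with endpoint E {C₁.g x} refl | isChord (K⊆C (C₁.on x)) | a< (K⊆C (C₁.on x))
      ... | inj₁ e | _ | lt = subst (a ≺_) (sym e) lt
      ... | inj₂ e | (lt′ , _) | lt = subst (a ≺_) (sym e) (<-trans lt lt′)

      -- A pattern blocking the gap of `b` would form a top cycle with the root chord as its first
      -- chord.
      ¬blocked : ¬ Blocked C₁.t p
      ¬blocked (blocked d e d◁e e<p p≤αd rest) = none (topCycle a (C₁.g d) (C₁.g e) (a<g d) (C₁.mono d◁e)
        (subst (C₁.g e ≺_) (proj₂ c-is) (below e e<p)) (subst₂ _≺_ (proj₂ c-is) (C₁.hom d) (above (other d) p≤αd))
        (start-map C₁.g C₁.mono C₁.hom (λ {f} le → subst (_≺ C₁.g f) (proj₂ c-is) (above f le))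
          (λ {x} q → subst (_≺ C₁.g x) (C₁.hom d) (C₁.mono q)) (λ {x} q → subst (C₁.g x ≺_) (C₁.hom d) (C₁.mono q)) rest))

      -- A chord of `K` that crosses the root chord has its two endpoints on different sides of `b`.
      p-range : 0 < p × p < size C₁.t
      p-range with touch
      ... | z , z∈ , _ , z<b , b<z with isChord-of E (isChord (K⊆C z∈))
      ...   | o₁ , o₂ with C₁.onto (subst (_∈ K) (sym o₁) z∈) | C₁.onto (subst (_∈ K) (sym o₂) z∈)
      ...     | x , refl | x′ , refl = ≤-<-trans z≤n (≰⇒> {p} {place x} λ le → <-asym z<b (above x le)) ,
                  ≤-<-trans (≮⇒≥ {place x′} {p} λ lt → <-asym b<z (below x′ lt)) (place-bound x′)

      index-p : Σ[ m ∈ ℕ ] m < weight C₁.t × slot C₁.t m ≡ p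
      index-p = slot-complete C₁.t p (proj₁ p-range) (proj₂ p-range) ¬blocked

      j : Fin (weight C₁.t)
      j = fromℕ< (proj₁ (proj₂ index-p))

      slot≡ : slotOf C₁.t j ≡ p
      slot≡ = trans (cong (slot C₁.t) (toℕ-fromℕ< _)) (proj₂ (proj₂ index-p))

      g : Point (node C₁.t j C₂.t) → Fin (2 * n)
      g (left x)  = C₁.g x
      g (right y) = C₂.g y

      on-a : On D a
      on-a = here (proj₁ (isChord-of E c-is))

      a≤ : ∀ y → a ⪯ C₂.g y
      a≤ y with C₂.on y
      ... | here e = [ (λ d → ≤-reflexive (cong toℕ (sym d))) , (λ d → <⇒≤ (subst (a ≺_) (sym d) (proj₁ c-is))) ]′ (endpoint E e)
      ... | there y∈ = <⇒≤ ([ (λ d → subst (a ≺_) (sym d) lt) , (λ d → subst (a ≺_) (sym d) (<-trans lt (proj₁ (isChord (proj₁ (R∈ y∈)))))) ]′ (endpoint E refl))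
        where lt = a< (proj₁ (R∈ y∈))

      root-a : ∀ y → place y ≡ 0 → C₂.g y ≡ a
      root-a y e with C₂.onto on-a
      ... | y₀ , e₀ = toℕ-injective (≤-antisym (subst (C₂.g y ⪯_) e₀ ([ (λ lt → <⇒≤ (C₂.mono ⟪ subst (_< place y₀) (sym e) lt ⟫)) ,
              (λ d → ≤-reflexive (cong (toℕ ∘ C₂.g) (place-injective (trans e d)))) ]′ (m≤n⇒m<n∨m≡n (z≤n {place y₀})))) (a≤ y))

      nonroot-a : ∀ y → 0 < place y → C₂.g y ≢ a
      nonroot-a y lt e = <⇒≱ (C₂.mono {root C₂.t} ⟪ subst (_< place y) (sym (place-root C₂.t)) lt ⟫) (subst (_⪯ C₂.g (root C₂.t)) (sym e) (a≤ (root C₂.t)))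

      before-y : ∀ x y → C₁.g x ≺ b → 0 < place y → C₁.g x ≺ C₂.g y
      before-y x y lt y>0 with C₂.on y
      ... | here e   = [ (λ d → contradiction d (nonroot-a y y>0)) , (λ d → subst (C₁.g x ≺_) (sym d) lt) ]′ (endpoint E e)
      ... | there y∈ = let lt′ = proj₁ (gap y∈ (C₁.on x)) lt in
              [ (λ d → subst (C₁.g x ≺_) (sym d) lt′) , (λ d → subst (C₁.g x ≺_) (sym d) (<-trans lt′ (proj₁ (isChord (proj₁ (R∈ y∈)))))) ]′ (endpoint E refl)

      after-y : ∀ x y → b ≺ C₁.g x → C₂.g y ≺ C₁.g x
      after-y x y lt with C₂.on y
      ... | here e   = [ (λ d → subst (_≺ C₁.g x) (sym d) (a<g x)) , (λ d → subst (_≺ C₁.g x) (sym d) lt) ]′ (endpoint E e)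
      ... | there y∈ = let lt′ = proj₂ (gap y∈ (C₁.on x)) lt in
              [ (λ d → subst (_≺ C₁.g x) (sym d) (<-trans (proj₁ (isChord (proj₁ (R∈ y∈)))) lt′)) , (λ d → subst (_≺ C₁.g x) (sym d) lt′) ]′ (endpoint E refl)

      mono-g : ∀ {u v} → Seen u v → g u ≺ g v
      mono-g (ll q) = C₁.mono q
      mono-g (rr q) = C₂.mono q
      mono-g (lr {x} {y} q y>0)  = before-y x y (below x (subst (place x <_) slot≡ q)) y>0
      mono-g (root-l {x} {y} e)  = subst (_≺ C₁.g x) (sym (root-a y e)) (a<g x)
      mono-g (rl {x} {y} q) = after-y x y (above x (subst (_≤ place x) slot≡ q))

      -- The root chord has a right neighbor in `K`, so it is not terminal, and after it the
      -- intersection order continues with that of `K`. This adds one, as the depth does.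
      firsts : RightClosed L → ∀ k → suc (depth C₁.t) ≤ k → FirstTerminal (intersectionOrder k L) (suc (depth C₁.t))
      firsts rc (suc k) (s≤s le) ds with order k
      ... | ds′ , e = trans (cong (λ xs → suc (length (takeWhile nonterminal? (xs ++ ds)))) e) (cong suc (trans (cong length (take-nonterminal nonterm))
          (trans (cong (suc ∘ length ∘ takeWhile nonterminal?) (++-assoc (intersectionOrder k K) ds′ ds)) (C₁.first-terminal rc′ k le (ds′ ++ ds)))))
        where
        nonterm : ¬ Terminal E c
        nonterm t = let (z , z∈ , r) = touch in All.lookup t (∈-chords E (isChord (K⊆C z∈))) r
        rc′ : RightClosed K
        rc′ k∈ d∈ r with rc (there (K⊆C k∈)) d∈ r
        ... | here refl = contradiction (proj₁ r) (<-asym (a< (K⊆C k∈)))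
        ... | there d∈C = K-closed k∈ d∈C (inj₁ r)

      code : Code L
      code = record
        { t = node C₁.t j C₂.t ; g = g ; mono = λ q → mono-g (see q)
        ; hom = λ { (left x) → C₁.hom x ; (right y) → C₂.hom y }
        ; on = λ { (left x) → there (K⊆C (C₁.on x)) ; (right y) → case C₂.on y of λ { (here e) → here e ; (there y∈) → there (proj₁ (R∈ y∈)) } }
        ; onto = λ { (here e) → let (y , d) = C₂.onto (here e) in right y , d
                   ; (there z∈) → [ (λ q → let (x , d) = C₁.onto q in left x , d) , (λ q → let (y , d) = C₂.onto (there q) in right y , d) ]′ (part z∈) }
        ; first-terminal = firsts }

  module FirstComponent {c c₂ cs} (V : Valid (c ∷ c₂ ∷ cs)) where
    open Valid V
    touching K R : List Ch
    touching = concat (proj₁ (partition (any? (crosses? c₂)) (components cs)))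
    K = c₂ ∷ filter (_∈chords? touching) cs
    outside? : Decidable (_∉ K)
    outside? d = ¬? (d ∈chords? K)
    R = filter outside? (c₂ ∷ cs)

    splitting : Splitting c (c₂ ∷ cs) K R
    splitting = record
      { component-K = Components.component (components-spec (c₂ ∷ cs)) {K} (here refl)
      ; R∈ = ∈-filter⁻ outside? {xs = c₂ ∷ cs}
      ; part = λ {d} d∈ → case d ∈chords? K of λ { (yes p) → inj₁ p ; (no ¬p) → inj₂ (∈-filter⁺ outside? d∈ ¬p) }
      ; sorted-K = AllP.filter⁺ (_∈chords? touching) (AllPairs.head (AllPairs.tail sorted)) ∷ AllPairsP.filter⁺ (_∈chords? touching) (AllPairs.tail (AllPairs.tail sorted))
      ; sorted-D = AllP.filter⁺ outside? (AllPairs.head sorted) ∷ AllPairsP.filter⁺ outside? (AllPairs.tail sorted)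
      ; order = λ k → _ , refl }

    shorter-K : length (filter (_∈chords? touching) cs) ≤ length cs
    shorter-K = length-filter (_∈chords? touching) cs

    shorter-R : length R ≤ length cs
    shorter-R = ≤-pred (filter-notAll outside? (c₂ ∷ cs) (here (λ ¬p → ¬p (here refl))))

  encode : ∀ k c cs → length cs ≤ k → Valid (c ∷ cs) → Code (c ∷ cs)
  encode k c [] _ V = single V
  encode (suc k) c (c₂ ∷ cs) (s≤s le) V = Split.Join.code V (here refl) F.splitting
      (encode k c₂ _ (≤-trans F.shorter-K le) (Split.valid-K V (here refl) F.splitting))
      (encode k c F.R (≤-trans F.shorter-R le) (Split.valid-D V (here refl) F.splitting))
    where module F = FirstComponent V

-- Decoding trees to diagrams and the inverse coding

size-leaves : ∀ t → size t ≡ 2 * leaves t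
size-leaves leaf = refl
size-leaves (node t₁ j t₂) = trans (cong₂ _+_ (size-leaves t₁) (size-leaves t₂)) (sym (ℕP.*-distribˡ-+ 2 (leaves t₁) (leaves t₂)))

module DecodeDiagram (t : Tree) where
  n : ℕ
  n = leaves t

  point : Fin (2 * n) → Point t
  point x = proj₁ (at {t} (toℕ x) (subst (toℕ x <_) (sym (size-leaves t)) (toℕ<n x)))

  place-point : ∀ x → place (point x) ≡ toℕ x
  place-point x = proj₂ (at {t} (toℕ x) (subst (toℕ x <_) (sym (size-leaves t)) (toℕ<n x)))

  number : Point t → Fin (2 * n)
  number p = fromℕ< (subst (place p <_) (size-leaves t) (place-bound p))

  toℕ-number : ∀ p → toℕ (number p) ≡ place p
  toℕ-number p = toℕ-fromℕ< _

  point-number : ∀ p → point (number p) ≡ p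
  point-number p = place-injective (trans (place-point (number p)) (toℕ-number p))

  number-point : ∀ x → number (point x) ≡ x
  number-point x = toℕ-injective (trans (toℕ-number (point x)) (place-point x))

  diagram : ChordDiagram n
  diagram = record
    { partner = λ x → number (other (point x))
    ; involutive = λ x → trans (cong (number ∘ other) (point-number (other (point x)))) (trans (cong number (other-inv (point x))) (number-point x))
    ; matched = λ x e → other-≢ (point x) (trans (sym (point-number _)) (cong point e)) }

  partner-number : ∀ p → partner diagram (number p) ≡ number (other p)
  partner-number p = cong (number ∘ other) (point-number p)

  number-mono : ∀ {p q} → p ◁ q → number p ≺ number q
  number-mono {p} {q} lt = subst₂ _<_ (sym (toℕ-number p)) (sym (toℕ-number q)) (places lt)

  topCycleFree : TopCycleFree diagram
  topCycleFree = no-cycle⇒free diagram λ c → no-topCycle t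
    (topCycle-map point (λ {x} {y} lt → ⟪ subst₂ _<_ (sym (place-point x)) (sym (place-point y)) lt ⟫) (λ x → point-number (other (point x))) c)

  private
    chordAt : Point t → Chord (2 * n)
    chordAt p = chordOf diagram (number p)

    chordAt-∈ : ∀ p → chordAt p ∈ chords diagram
    chordAt-∈ p = ∈-chords diagram (chordOf-isChord diagram (number p))

    sourceAt : ∀ {p} → p ◁ other p → chordAt p ≡ (number p , number (other p))
    sourceAt {p} lt = trans (chordOf-source diagram (subst (number p ≺_) (sym (partner-number p)) (number-mono lt))) (cong (number p ,_) (partner-number p))

    linked-chords : ∀ {p q} → Linked p q → EqClosure (Step (chords diagram)) (chordAt p) (chordAt q)
    linked-chords {p} chord = subst (EqClosure _ _) (sym (trans (cong (chordOf diagram) (sym (partner-number p))) (chordOf-partner diagram (number p)))) ε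
    linked-chords {p} {q} (crossing u v w) = fwd (chordAt-∈ p , chordAt-∈ q ,
      subst₂ Crosses (sym (sourceAt (◁-trans u v))) (sym (sourceAt (◁-trans v w))) (inj₁ (number-mono u , number-mono v , number-mono w))) ◅ ε

    walk : ∀ {p q} → EqClosure Linked p q → EqClosure (Step (chords diagram)) (chordAt p) (chordAt q)
    walk ε = ε
    walk (fwd k ◅ r) = linked-chords k ◅◅ walk r
    walk (bwd k ◅ r) = Eq.symmetric _ (linked-chords k) ◅◅ walk r

  isConnected : Connected diagram
  isConnected = via {K = chords diagram} {chordAt (root t)} λ {d} d∈ →
    subst (λ c → EqClosure (Step (chords diagram)) c (chordAt (root t))) (trans (cong (chordOf diagram) (number-point (proj₁ d))) (proj₁ (isChord-of diagram (chords-∈ diagram d∈))))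
      (Eq.symmetric _ (walk (connected t (point (proj₁ d)))))

depth≤leaves : ∀ t → depth t ≤ leaves t
depth≤leaves leaf = ≤-refl
depth≤leaves (node t₁ j t₂) = subst (_≤ leaves t₁ + leaves t₂) (ℕP.+-comm (depth t₁) 1) (ℕP.+-mono-≤ (depth≤leaves t₁) (leaves>0 t₂))

-- A monotone bijection between finite orders is unique, so `g` must be the numbering by `place`.
-- Hence the tree determines the diagram (`represents-≈`), and the diagram determines the tree
-- (`represents-unique`).
record Represents {n} (E : ChordDiagram n) (t : Tree) : Set where
  field
    g     : Point t → Fin (2 * n)
    mono  : ∀ {x y} → x ◁ y → g x ≺ g y
    hom   : ∀ x → g (other x) ≡ partner E (g x)
    onto  : ∀ y → Σ[ x ∈ Point t ] g x ≡ y

  mono⁻ : ∀ {x y} → g x ≺ g y → x ◁ y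
  mono⁻ {x} {y} lt with compare x y
  ... | before p  = p
  ... | same refl = contradiction lt (<-irrefl refl)
  ... | after p   = contradiction lt (<-asym (mono p))

  g-injective : ∀ {x y} → g x ≡ g y → x ≡ y
  g-injective {x} {y} e with compare x y
  ... | before p = contradiction (cong toℕ e) (<⇒≢ (mono p))
  ... | same d   = d
  ... | after p  = contradiction (cong toℕ (sym e)) (<⇒≢ (mono p))

  private
    module D = DecodeDiagram t

    up : ∀ i → i ⪯ g (D.point i)
    up = monotone-≥ (λ i → g (D.point i)) λ {i} {j} lt → mono ⟪ subst₂ _<_ (sym (D.place-point i)) (sym (D.place-point j)) lt ⟫

    down : ∀ y → y ⪯ D.number (proj₁ (onto y))
    down = monotone-≥ (λ y → D.number (proj₁ (onto y))) λ {y} {z} lt → D.number-mono (mono⁻ (subst₂ _≺_ (sym (proj₂ (onto y))) (sym (proj₂ (onto z))) lt))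

  toℕ-g : ∀ x → toℕ (g x) ≡ place x
  toℕ-g x = ≤-antisym (subst (toℕ (g x) ≤_) (trans (D.toℕ-number (proj₁ (onto (g x)))) (cong place (g-injective (proj₂ (onto (g x)))))) (down (g x)))
    (subst₂ _≤_ (D.toℕ-number x) (cong (toℕ ∘ g) (D.point-number x)) (up (D.number x)))

  leaves≡ : leaves t ≡ n
  leaves≡ = ℕP.*-cancelˡ-≡ _ _ 2 (≤-antisym
    (injective⇒≤ {f = λ i → g (D.point i)} λ {i} {j} e → trans (sym (D.number-point i)) (trans (cong D.number (g-injective e)) (D.number-point j)))
    (injective⇒≤ {f = λ y → D.number (proj₁ (onto y))} λ {y} {z} e → trans (sym (proj₂ (onto y))) (trans (cong g (trans (sym (D.point-number _)) (trans (cong D.point e) (D.point-number _)))) (proj₂ (onto z)))))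

module _ {n} {E E′ : ChordDiagram n} where
  represents-cong : ∀ {t} → (∀ x → partner E x ≡ partner E′ x) → Represents E t → Represents E′ t
  represents-cong e R = record { Represents R ; hom = λ x → trans (Represents.hom R x) (e _) }

  represents-≈ : ∀ {t} → Represents E t → Represents E′ t → ∀ y → partner E y ≡ partner E′ y
  represents-≈ R R′ y with Represents.onto R y
  ... | x , refl = trans (sym (R.hom x)) (trans (g≡ (other x)) (trans (R′.hom x) (cong (partner E′) (sym (g≡ x)))))
    where
    module R = Represents R
    module R′ = Represents R′
    g≡ : ∀ x → R.g x ≡ R′.g x
    g≡ x = toℕ-injective (trans (R.toℕ-g x) (sym (R′.toℕ-g x)))

represents-unique : ∀ {n} {E : ChordDiagram n} {t t′} → Represents E t → Represents E t′ → t ≡ t′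
represents-unique {E = E} {t} {t′} R R′ = pointIso-≡ t t′ record
  { φ = λ x → proj₁ (R′.onto (R.g x)) ; ψ = λ x → proj₁ (R.onto (R′.g x))
  ; φψ = λ x → R′.g-injective (trans (proj₂ (R′.onto _)) (proj₂ (R.onto (R′.g x))))
  ; ψφ = λ x → R.g-injective (trans (proj₂ (R.onto _)) (proj₂ (R′.onto (R.g x))))
  ; mono = λ {x} {y} lt → R′.mono⁻ (subst₂ _≺_ (sym (proj₂ (R′.onto (R.g x)))) (sym (proj₂ (R′.onto (R.g y)))) (R.mono lt))
  ; mates = λ x → R′.g-injective (trans (proj₂ (R′.onto _)) (trans (R.hom x) (trans (cong (partner E) (sym (proj₂ (R′.onto (R.g x))))) (sym (R′.hom _))))) }
  where
  module R = Represents R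
  module R′ = Represents R′

represents-decode : ∀ t → Represents (DecodeDiagram.diagram t) t
represents-decode t = record { g = number ; mono = number-mono ; hom = λ x → sym (partner-number x) ; onto = λ y → point y , number-point y }
  where open DecodeDiagram t

-- The point `x₀` excludes the empty diagram, which has no root chord.
module EncodeWhole {n} (E : ChordDiagram n) (x₀ : Fin (2 * n)) (conn : Connected E) (free : TopCycleFree E) where
  open EncodeDiagram E (free⇒no-cycle E free)

  private
    valid : Valid (chords E)
    valid = record
      { sorted = AllPairsP.map⁺ (AllPairsP.filter⁺ (λ a → a FinP.<? partner E a) (AllPairsP.tabulate⁺-< id))
      ; chordal = chords-∈ E ; linked = conn }

    code : Code (chords E)
    code = go (chords E) valid (∈-chords E (chordOf-isChord E x₀))
      where
      go : ∀ L → Valid L → chordOf E x₀ ∈ L → Code L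
      go (c ∷ cs) V _ = encode _ c cs ≤-refl V

  open Code code public using (t)

  represents : Represents E t
  represents = record { g = Code.g code ; mono = Code.mono code ; hom = Code.hom code ; onto = λ y → Code.onto code (∈-chords E (chordOf-isChord E y)) }

  depth≡t₁ : depth t ≡ t₁ E
  depth≡t₁ = trans (sym (Code.first-terminal code (λ _ d∈ _ → d∈) n (subst (depth t ≤_) (Represents.leaves≡ represents) (depth≤leaves t)) []))
    (cong (suc ∘ length ∘ takeWhile nonterminal?) (++-identityʳ (intersectionOrder n (chords E))))

Diagram : ℕ → ℕ → Set
Diagram n i = Setoid.Carrier (connectedTopCycleFreeDiagrams n i)

-- The intersection order of a decoded diagram is never computed: encoding the diagram again gives
-- back `t`, and the encoding has been shown to turn `t₁` into the depth.
t₁-decode : ∀ t → t₁ (DecodeDiagram.diagram t) ≡ depth t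
t₁-decode t = trans (sym depth≡t₁) (cong depth (represents-unique represents (represents-decode t)))
  where
  open DecodeDiagram t hiding (n)
  open EncodeWhole diagram (number (root t)) isConnected topCycleFree hiding (t)

private
  resize : ∀ {m n i} (D : ChordDiagram m) → Connected D × TopCycleFree D × t₁ D ≡ i → m ≡ n → Diagram n i
  resize D good refl = D , good

  represents-resize : ∀ {m n i t} {D : ChordDiagram m} {good : Connected D × TopCycleFree D × t₁ D ≡ i} (d : m ≡ n) → Represents D t → Represents (proj₁ (resize D good d)) t
  represents-resize refl R = R

  decodeDiagram : ∀ n i t → leaves t ≡ n → depth t ≡ i → Diagram n i
  decodeDiagram n i t p q = resize diagram (isConnected , topCycleFree , trans (t₁-decode t) q) p
    where open DecodeDiagram t hiding (n)

  decode-represents : ∀ n i t p q → Represents (proj₁ (decodeDiagram n i t p q)) t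
  decode-represents n i t p q = represents-resize p (represents-decode t)

diagrams-cardinality : ∀ n i → HasCardinality (connectedTopCycleFreeDiagrams (suc n) i) (countTrees depth n i)
diagrams-cardinality n i = cardinality (connectedTopCycleFreeDiagrams (suc n) i) n i depth (decodeDiagram (suc n) i)
  (λ { (E , c , f , e) → let open EncodeWhole E fzero c f in
    t , Represents.leaves≡ represents , trans depth≡t₁ e , λ p q → represents-≈ (decode-represents (suc n) i t p q) represents })
  (λ {t} {t′} {p} {q} {p′} {q′} e → represents-unique (decode-represents (suc n) i t p q)
    (represents-cong (λ x → sym (e x)) (decode-represents (suc n) i t′ p′ q′)))

-- The two formulas

cancel-∸ : ∀ {a} b {c} → a ≡ b + c → a ∸ b ≡ c
cancel-∸ b {c} refl = m+n∸m≡n b c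

module Formulas (m e : ℕ) where
  open +-*-Solver

  n i : ℕ
  n = suc (m + suc e)
  i = suc (suc e)

  top-i : 2 * i ∸ 1 ≡ e + e + 3
  top-i = cancel-∸ 1 (solve 1 (λ e → con 2 :* (con 2 :+ e) := con 1 :+ (e :+ e :+ con 3)) refl e)

  gap-4n : 4 * n ∸ 2 * i ≡ 4 * m + (e + e + 4)
  gap-4n = cancel-∸ (2 * i) (solve 2 (λ m e → con 4 :* (con 1 :+ (m :+ (con 1 :+ e))) := con 2 :* (con 2 :+ e) :+ (con 4 :* m :+ (e :+ e :+ con 4))) refl m e)

  top-n : 4 * n ∸ 2 * i ∸ 3 ≡ 4 * m + (e + e + 1)
  top-n = trans (cong (_∸ 3) gap-4n) (cancel-∸ 3 (solve 2 (λ m e → con 4 :* m :+ (e :+ e :+ con 4) := con 3 :+ (con 4 :* m :+ (e :+ e :+ con 1))) refl m e))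

  low-n : 3 * n ∸ i ∸ 1 ≡ 3 * m + (e + e + 3)
  low-n = trans (cong (_∸ 1) (cancel-∸ i {suc (3 * m + (e + e + 3))} (solve 2 (λ m e → con 3 :* (con 1 :+ (m :+ (con 1 :+ e))) := (con 2 :+ e) :+ (con 1 :+ (con 3 :* m :+ (e :+ e :+ con 3)))) refl m e))) refl

  low-m : n ∸ i ≡ m
  low-m = cancel-∸ i (solve 2 (λ m e → con 1 :+ (m :+ (con 1 :+ e)) := (con 2 :+ e) :+ m) refl m e)

  A B P Q U R den : ℕ
  A = 4 * n ∸ 2 * i ∸ 1
  B = 2 * n ∸ i ∸ 1
  P = (2 * i ∸ 1) !
  Q = (4 * n ∸ 2 * i ∸ 3) !
  U = i !
  R = (3 * n ∸ i ∸ 1) !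
  den = e ! * U * (n ∸ i) ! * R

  A≡ : A ≡ 4 * m + (e + e + 3)
  A≡ = trans (cong (_∸ 1) gap-4n) (cancel-∸ 1 (solve 2 (λ m e → con 4 :* m :+ (e :+ e :+ con 4) := con 1 :+ (con 4 :* m :+ (e :+ e :+ con 3))) refl m e))

  B≡ : B ≡ 2 * m + (e + 1)
  B≡ = cong (_∸ 1) (cancel-∸ i {suc (2 * m + (e + 1))} (solve 2 (λ m e → con 2 :* (con 1 :+ (m :+ (con 1 :+ e))) := (con 2 :+ e) :+ (con 1 :+ (con 2 :* m :+ (e :+ con 1)))) refl m e))

  count-formula : countTrees weight (m + suc e) i * den ≡ 2 * P * Q
  count-formula = begin
    N * (e ! * U * (n ∸ i) ! * R) ≡⟨ cong₂ (λ a b → N * (e ! * U * a ! * b !)) low-m low-n ⟩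
    N * (e ! * U * m ! * (3 * m + (e + e + 3)) !) ≡⟨ count-weight m e ⟩
    2 * ((e + e + 3) ! * (4 * m + (e + e + 1)) !) ≡⟨ ℕP.*-assoc 2 ((e + e + 3) !) ((4 * m + (e + e + 1)) !) ⟨
    2 * (e + e + 3) ! * (4 * m + (e + e + 1)) ! ≡⟨ cong₂ (λ a b → 2 * a ! * b !) top-i top-n ⟨
    2 * P * Q ∎
    where
    open ≡-Reasoning
    N = countTrees weight (m + suc e) i

  binomial : ∀ {a k} → k ≤ a → (a choosing k) * (k ! * (a ∸ k) !) ≡ a !
  binomial {a} {k} le = trans (cong (_* (k ! * (a ∸ k) !)) (nCk≡n!/k![n-k]! le)) (m/n*n≡m {{k ℕP.!* (a ∸ k) !≢0}} (k![n∸k]!∣n! le))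

  first-binomial : ((2 * i ∸ 1) choosing i) * (U * (suc e * e !)) ≡ P
  first-binomial = trans (cong (λ k → ((2 * i ∸ 1) choosing i) * (U * k !)) (sym (trans (cong (_∸ i) top-i) (cancel-∸ i (i+ e)))))
    (binomial (subst (i ≤_) (sym (trans top-i (i+ e))) (m≤m+n i (suc e))))
    where
    i+ : ∀ e → e + e + 3 ≡ suc (suc e) + suc e
    i+ = solve 1 (λ e → e :+ e :+ con 3 := (con 2 :+ e) :+ (con 1 :+ e)) refl

  -- Since `A - (n - i)` is `3 n - i - 1`, the left side is `A !`, that is `A * (A - 1) * (A - 2) !`
  -- with `A - 1 = 2 B`. This is where the denominator `A * B` of the binomial formula comes from.
  second-binomial : (A choosing (n ∸ i)) * ((n ∸ i) ! * R) ≡ A * ((B + B) * Q)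
  second-binomial = trans (cong (λ k → (A choosing (n ∸ i)) * ((n ∸ i) ! * k !)) (trans low-n (sym (trans (cong₂ _∸_ A≡ low-m) (cancel-∸ m split)))))
    (trans (binomial (subst₂ _≤_ (sym low-m) (sym (trans A≡ split)) (m≤m+n m _))) (trans (cong _! A≡₂) (cong₂ (λ a b → a * (b * Q)) (sym A≡₂) B≡₂)))
    where
    split : 4 * m + (e + e + 3) ≡ m + (3 * m + (e + e + 3))
    split = solve 2 (λ m e → con 4 :* m :+ (e :+ e :+ con 3) := m :+ (con 3 :* m :+ (e :+ e :+ con 3))) refl m e
    q = 4 * n ∸ 2 * i ∸ 3
    A≡₂ : A ≡ suc (suc q)
    A≡₂ = trans A≡ (trans (solve 2 (λ m e → con 4 :* m :+ (e :+ e :+ con 3) := con 2 :+ (con 4 :* m :+ (e :+ e :+ con 1))) refl m e) (cong (λ k → suc (suc k)) (sym top-n)))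
    B≡₂ : suc q ≡ B + B
    B≡₂ = trans (cong suc top-n) (trans (solve 2 (λ m e → con 1 :+ (con 4 :* m :+ (e :+ e :+ con 1)) := (con 2 :* m :+ (e :+ con 1)) :+ (con 2 :* m :+ (e :+ con 1))) refl m e) (sym (cong₂ _+_ B≡ B≡)))

  formulas-agree : 2 * P * Q * (A * B) ≡ suc e * ((2 * i ∸ 1) choosing i) * (A choosing (n ∸ i)) * den
  formulas-agree = begin
    2 * P * Q * (A * B) ≡⟨ solve 4 (λ P Q A B → con 2 :* P :* Q :* (A :* B) := P :* (A :* ((B :+ B) :* Q))) refl P Q A B ⟩
    P * (A * ((B + B) * Q)) ≡⟨ cong₂ _*_ first-binomial second-binomial ⟨
    X * (U * (suc e * e !)) * (Y * (M * R)) ≡⟨ solve 7 (λ X U s f Y M R → X :* (U :* (s :* f)) :* (Y :* (M :* R)) := s :* X :* Y :* (f :* U :* M :* R)) refl X U (suc e) (e !) Y M R ⟩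
    suc e * X * Y * den ∎
    where
    open ≡-Reasoning
    X = (2 * i ∸ 1) choosing i
    Y = A choosing (n ∸ i)
    M = (n ∸ i) !

integer-≃ : ∀ a b d .{{_ : NonZero d}} → a * d ≡ b → (+ a) / 1 ≃ (+ b) / d
integer-≃ a b (suc d) e = *≡* (trans (sym (ℤP.pos-* a (suc d))) (trans (cong +_ (trans e (sym (ℕP.*-identityʳ b)))) (ℤP.pos-* b 1)))

product-≃ : ∀ a f x d y z .{{_ : NonZero d}} .{{_ : NonZero f}} → a * d ≡ x * y * z * f →
  (+ a) / f ≃ ((+ x) / d) ℚᵘ.* ((+ y) / 1) ℚᵘ.* ((+ z) / 1)
product-≃ a (suc f) x (suc d) y z e = *≡* (begin
  + a ℤ.* + (suc d * 1 * 1) ≡⟨ cong (λ k → + a ℤ.* + k) (trans (ℕP.*-identityʳ (suc d * 1)) (ℕP.*-identityʳ (suc d))) ⟩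
  + a ℤ.* + suc d ≡⟨ ℤP.pos-* a (suc d) ⟨
  + (a * suc d) ≡⟨ cong +_ e ⟩
  + (x * y * z * suc f) ≡⟨ ℤP.pos-* (x * y * z) (suc f) ⟩
  + (x * y * z) ℤ.* + suc f ≡⟨ cong (ℤ._* + suc f) (trans (ℤP.pos-* (x * y) z) (cong (ℤ._* + z) (ℤP.pos-* x y))) ⟩
  + x ℤ.* + y ℤ.* + z ℤ.* + suc f ∎)
  where open ≡-Reasoning

corollary7p4 : ∀ (n i : ℕ) (2≤i : 2 ≤ i) (i≤n : i ≤ n) →
  Σ[ N ∈ ℕ ]
    HasCardinality (connectedTopCycleFreeDiagrams n i) N ×
    HasCardinality (planarBridgelessMaps n i) N ×
    (+ N) / 1 ≃ factorialFormula n i ×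
    factorialFormula n i ≃ binomialFormula n i 2≤i i≤n
corollary7p4 n (suc (suc e)) 2≤i i≤n = go (n ∸ suc (suc e)) (sym (trans (sym (+-suc m (suc e))) (m∸n+n≡m i≤n))) 2≤i i≤n
  where
  m = n ∸ suc (suc e)
  go : ∀ {n} m → n ≡ suc (m + suc e) → (2≤i : 2 ≤ suc (suc e)) (i≤n : suc (suc e) ≤ n) →
    Σ[ N ∈ ℕ ] HasCardinality (connectedTopCycleFreeDiagrams n (suc (suc e))) N × HasCardinality (planarBridgelessMaps n (suc (suc e))) N ×
      (+ N) / 1 ≃ factorialFormula n (suc (suc e)) × factorialFormula n (suc (suc e)) ≃ binomialFormula n (suc (suc e)) 2≤i i≤n
  go m refl 2≤i i≤n = countTrees weight k i′ ,
    -- The diagrams are counted by depth; equidistribution replaces this by the count by weight,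
    -- which the maps have already.
    subst (HasCardinality (connectedTopCycleFreeDiagrams (suc k) i′)) (countTrees-depth k i′) (diagrams-cardinality k i′) ,
    maps-cardinality k i′ ,
    integer-≃ _ _ _ {{den≢0}} (Formulas.count-formula m e) ,
    product-≃ _ _ _ _ _ _ {{denominator≢0 (suc k) i′ 2≤i i≤n}} {{den≢0}} (Formulas.formulas-agree m e)
    where
    k i′ : ℕ
    k = m + suc e
    i′ = suc (suc e)
    den≢0 : NonZero (Formulas.den m e)
    den≢0 = ℕP.m*n≢0 _ _ {{ℕP.m*n≢0 _ _ {{ℕP.m*n≢0 _ _ {{e ℕP.!≢0}} {{i′ ℕP.!≢0}}}} {{(suc k ∸ i′) ℕP.!≢0}}}} {{(3 * suc k ∸ i′ ∸ 1) ℕP.!≢0}}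
corollary7p4 n 1 (s≤s ()) i≤n
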